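{- For every integer $m\ge 2$ and every real $\mu>0$ there exist $\epsilon>0$ and a sequence of $n$-vertex graphs $G_\epsilon=G_\epsilon(n)$ with $\delta(G_\epsilon)\ge(\tfrac12+\epsilon)n$ such that for every $p=p(n)\le n^{ -1/f_m(\ell_m)-\mu}$ $$\lim_{n\to\infty}\Pr\big(G_\epsilon\cup G(n,p)\in\mathcal{C}^m_n\big)=0.$$
   Context: For integers $m\ge1$ and $n\ge m+2$, $\mathcal{C}^m_n$ is the family of all $n$-vertex graphs containing the $m$-th power of a Hamiltonian cycle; the $m$-th power $F^m$ of a graph $F$ is the graph on $V(F)$ whose edges join distinct vertices at distance at most $m$ in $F$. $G(n,p)$ is the binomial random graph on the same vertex set as $G_\epsilon$ (each pair is an edge independently with probability $p$), and $G_\epsilon\cup G(n,p)$ is the union of the edge sets. For integers $m\ge2$ and real $\ell\in(0,m]$, $f_m(\ell)=\frac1{\ell}\left(\binom{\ell}{2}+\binom{m-\ell+1}{2}\right)=\ell+\frac{m^2+m}{2\ell}-m-1$. Let $\lambda_m=\frac{\sqrt{2m^2+2m}}{2}$, and let $\ell_m\in\{\lfloor\lambda_m\rfloor,\lceil\lambda_m\rceil\}$ be such that $f_m(\ell_m)=\min\{f_m(\lfloor\lambda_m\rfloor),f_m(\lceil\lambda_m\rceil)\}$, with the convention that if $\lfloor\lambda_m\rfloor\ne\lceil\lambda_m\rceil$ and $f_m(\lfloor\lambda_m\rfloor)=f_m(\lceil\lambda_m\rceil)$, then $\ell_m=\lfloor\lambda_m\rfloor$. -}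

module Defs where

open import Data.Fin.Base using (Fin; toℕ)
open import Data.Fin.Properties using (nonZeroIndex) renaming (_≟_ to _≟ᶠ_; _<?_ to _<ᶠ?_; any? to anyᶠ?; all? to allᶠ?)
open import Data.Integer.Base as ℤ using (ℤ; +_; -[1+_])
import Data.Integer.Properties as ℤₚ
import Data.Integer.Tactic.RingSolver as ℤSolver
open import Data.List.Base as List using (List; []; _∷_; _++_; length; allFin; cartesianProduct)
open import Data.List.Extrema.Nat using (min)
open import Data.List.Membership.Propositional using (_∈_)
import Data.List.Membership.DecPropositional as DecMembership
open import Data.Nat.Base as ℕ using (ℕ; zero; suc; z≤n; s≤s; NonZero)
open import Data.Nat.Combinatorics using (_C_; nC1≡n; nCk+nC[k+1]≡[n+1]C[k+1])
open import Data.Nat.Coprimality using (Coprime)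
open import Data.Nat.DivMod using (_mod_)
import Data.Nat.Properties as ℕₚ
import Data.Nat.Tactic.RingSolver as ℕSolver
open import Data.Product.Base using (∃; _×_; _,_)
open import Data.Product.Properties using (≡-dec)
open import Data.Rational.Base as ℚ using (ℚ; 0ℚ; 1ℚ; ½; ↥_; ↧_; ↧ₙ_; mkℚ; toℚᵘ)
import Data.Rational.Properties as ℚₚ
open import Data.Rational.Unnormalised.Base as ℚᵘ using (ℚᵘ; mkℚᵘ)
import Data.Rational.Unnormalised.Properties as ℚᵘₚ
import Data.Rational.Solver as ℚSolver
open import Data.Sum.Base as Sum using (_⊎_; inj₁; inj₂; [_,_]′)
open import Data.Vec.Base as Vec using (Vec; lookup)
open import Function.Base using (_∘_; _$_)
open import Function.Definitions using (Injective)
open import Level using (0ℓ)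
open import Relation.Binary.Core using (Rel)
open import Relation.Binary.Definitions using (Symmetric; Irreflexive; Decidable)
open import Relation.Binary.PropositionalEquality
  using (_≡_; _≢_; refl; sym; trans; cong; cong₂; subst; subst₂)
open import Relation.Nullary.Decidable using (Dec; yes; no; ¬?; map′; _×-dec_; _⊎-dec_; _→-dec_)
open import Relation.Nullary.Negation using (¬_)
open import Relation.Unary using (Pred) renaming (Decidable to Decidable₁)

------------------------------------------------------------------------
-- Real numbers: Cauchy sequences of rationals, taken up to the order
-- relations below (two reals are equal when each is ≤ the other).

record ℝ : Set where
  constructor mkℝ
  field
    seq    : ℕ → ℚ
    cauchy : ∀ ε → 0ℚ ℚ.< ε →
             ∃ λ N → ∀ i j → N ℕ.≤ i → N ℕ.≤ j → ℚ.∣ seq i ℚ.- seq j ∣ ℚ.≤ ε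

open ℝ public

infix 4 _<_ _≤_

_<_ : Rel ℝ 0ℓ
x < y = ∃ λ ε → 0ℚ ℚ.< ε × ∃ λ N → ∀ i → N ℕ.≤ i → seq x i ℚ.+ ε ℚ.≤ seq y i

_≤_ : Rel ℝ 0ℓ
x ≤ y = ∀ ε → 0ℚ ℚ.< ε → ∃ λ N → ∀ i → N ℕ.≤ i → seq x i ℚ.≤ seq y i ℚ.+ ε

fromℚ : ℚ → ℝ
fromℚ q = mkℝ (λ _ → q) λ ε 0<ε → 0 , λ _ _ _ _ →
  subst (λ z → ℚ.∣ z ∣ ℚ.≤ ε) (sym (ℚₚ.+-inverseʳ q)) (ℚₚ.<⇒≤ 0<ε)

fromℕ : ℕ → ℝ
fromℕ k = fromℚ (+ k ℚ./ 1)

0ℝ 1ℝ : ℝ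
0ℝ = fromℚ 0ℚ
1ℝ = fromℚ 1ℚ

half-pos : ∀ {ε} → 0ℚ ℚ.< ε → 0ℚ ℚ.< ½ ℚ.* ε
half-pos {ε} 0<ε = subst (ℚ._< ½ ℚ.* ε) (ℚₚ.*-zeroʳ ½) (ℚₚ.*-monoʳ-<-pos ½ 0<ε)

half+half : ∀ ε → ½ ℚ.* ε ℚ.+ ½ ℚ.* ε ≡ ε
half+half ε = trans (sym (ℚₚ.*-distribʳ-+ ε ½ ½)) (ℚₚ.*-identityˡ ε)

∣-∣-comm : ∀ p q → ℚ.∣ p ℚ.- q ∣ ≡ ℚ.∣ q ℚ.- p ∣
∣-∣-comm p q = trans (sym (ℚₚ.∣-p∣≡∣p∣ (p ℚ.- q))) (cong ℚ.∣_∣ eq)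
  where
  open ℚSolver.+-*-Solver
  eq : ℚ.- (p ℚ.- q) ≡ q ℚ.- p
  eq = solve 2 (λ p q → :- (p :- q) := q :- p) refl p q

-- A Cauchy sequence is bounded from some index on.
tail-bound : (x : ℝ) → ∃ λ B → 0ℚ ℚ.< B × ∃ λ N → ∀ i → N ℕ.≤ i → ℚ.∣ seq x i ∣ ℚ.≤ B
tail-bound x with cauchy x 1ℚ (ℚ.*<* (ℤ.+<+ (s≤s z≤n)))
... | N , c = ℚ.∣ seq x N ∣ ℚ.+ 1ℚ
            , ℚₚ.+-mono-≤-< {0ℚ} {ℚ.∣ seq x N ∣} {0ℚ} {1ℚ} (ℚₚ.0≤∣p∣ (seq x N)) (ℚ.*<* (ℤ.+<+ (s≤s z≤n)))
            , N , λ i N≤i → begin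
    ℚ.∣ seq x i ∣                                       ≡⟨ cong ℚ.∣_∣ (eq (seq x i) (seq x N)) ⟩
    ℚ.∣ seq x N ℚ.+ (seq x i ℚ.- seq x N) ∣             ≤⟨ ℚₚ.∣p+q∣≤∣p∣+∣q∣ (seq x N) _ ⟩
    ℚ.∣ seq x N ∣ ℚ.+ ℚ.∣ seq x i ℚ.- seq x N ∣         ≤⟨ ℚₚ.+-monoʳ-≤ ℚ.∣ seq x N ∣ (c i N N≤i ℕₚ.≤-refl) ⟩
    ℚ.∣ seq x N ∣ ℚ.+ 1ℚ                                ∎
  where
  open ℚₚ.≤-Reasoning
  eq : ∀ a b → a ≡ b ℚ.+ (a ℚ.- b)
  eq = solve 2 (λ a b → a := b :+ (a :- b)) refl
    where open ℚSolver.+-*-Solver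

infix  8 -_
infixl 6 _+_ _-_
infixl 7 _*_
infixr 8 _^_

_+_ : ℝ → ℝ → ℝ
x + y = mkℝ (λ i → seq x i ℚ.+ seq y i) λ ε 0<ε →
  let N , cx = cauchy x (½ ℚ.* ε) (half-pos 0<ε)
      M , cy = cauchy y (½ ℚ.* ε) (half-pos 0<ε)
  in N ℕ.⊔ M , λ i j ≤i ≤j → begin
       ℚ.∣ seq x i ℚ.+ seq y i ℚ.- (seq x j ℚ.+ seq y j) ∣
         ≡⟨ cong ℚ.∣_∣ (eq (seq x i) (seq y i) (seq x j) (seq y j)) ⟩
       ℚ.∣ (seq x i ℚ.- seq x j) ℚ.+ (seq y i ℚ.- seq y j) ∣
         ≤⟨ ℚₚ.∣p+q∣≤∣p∣+∣q∣ (seq x i ℚ.- seq x j) _ ⟩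
       ℚ.∣ seq x i ℚ.- seq x j ∣ ℚ.+ ℚ.∣ seq y i ℚ.- seq y j ∣
         ≤⟨ ℚₚ.+-mono-≤
              (cx i j (ℕₚ.≤-trans (ℕₚ.m≤m⊔n N M) ≤i) (ℕₚ.≤-trans (ℕₚ.m≤m⊔n N M) ≤j))
              (cy i j (ℕₚ.≤-trans (ℕₚ.m≤n⊔m N M) ≤i) (ℕₚ.≤-trans (ℕₚ.m≤n⊔m N M) ≤j)) ⟩
       ½ ℚ.* ε ℚ.+ ½ ℚ.* ε
         ≡⟨ half+half ε ⟩
       ε ∎
  where
  open ℚₚ.≤-Reasoning
  eq : ∀ a b c d → a ℚ.+ b ℚ.- (c ℚ.+ d) ≡ (a ℚ.- c) ℚ.+ (b ℚ.- d)
  eq = solve 4 (λ a b c d → a :+ b :- (c :+ d) := (a :- c) :+ (b :- d)) refl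
    where open ℚSolver.+-*-Solver

-_ : ℝ → ℝ
- x = mkℝ (λ i → ℚ.- seq x i) λ ε 0<ε →
  let N , cx = cauchy x ε 0<ε
  in N , λ i j ≤i ≤j →
       subst (ℚ._≤ ε) (cong ℚ.∣_∣ (eq (seq x j) (seq x i))) (cx j i ≤j ≤i)
  where
  eq : ∀ a b → a ℚ.- b ≡ ℚ.- b ℚ.- (ℚ.- a)
  eq = solve 2 (λ a b → a :- b := :- b :- (:- a)) refl
    where open ℚSolver.+-*-Solver

_-_ : ℝ → ℝ → ℝ
x - y = x + (- y)

_*_ : ℝ → ℝ → ℝ
x * y = mkℝ (λ i → seq x i ℚ.* seq y i) λ ε 0<ε →
  let B , 0<B , Nx , bx = tail-bound x
      D , 0<D , Ny , by = tail-bound y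
      N , cx = cauchy x (δ ε D 0<D) (δ-pos 0<ε 0<D)
      M , cy = cauchy y (δ ε B 0<B) (δ-pos 0<ε 0<B)
      L = (Nx ℕ.⊔ Ny) ℕ.⊔ (N ℕ.⊔ M)
      Nx≤L = ℕₚ.≤-trans (ℕₚ.m≤m⊔n Nx Ny) (ℕₚ.m≤m⊔n (Nx ℕ.⊔ Ny) (N ℕ.⊔ M))
      Ny≤L = ℕₚ.≤-trans (ℕₚ.m≤n⊔m Nx Ny) (ℕₚ.m≤m⊔n (Nx ℕ.⊔ Ny) (N ℕ.⊔ M))
      N≤L  = ℕₚ.≤-trans (ℕₚ.m≤m⊔n N M) (ℕₚ.m≤n⊔m (Nx ℕ.⊔ Ny) (N ℕ.⊔ M))
      M≤L  = ℕₚ.≤-trans (ℕₚ.m≤n⊔m N M) (ℕₚ.m≤n⊔m (Nx ℕ.⊔ Ny) (N ℕ.⊔ M))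
  in L , λ i j ≤i ≤j →
       let xi = seq x i; yi = seq y i; xj = seq x j; yj = seq y j in begin
       ℚ.∣ xi ℚ.* yi ℚ.- xj ℚ.* yj ∣
         ≡⟨ cong ℚ.∣_∣ (eq xi yi xj yj) ⟩
       ℚ.∣ xi ℚ.* (yi ℚ.- yj) ℚ.+ yj ℚ.* (xi ℚ.- xj) ∣
         ≤⟨ ℚₚ.∣p+q∣≤∣p∣+∣q∣ (xi ℚ.* (yi ℚ.- yj)) _ ⟩
       ℚ.∣ xi ℚ.* (yi ℚ.- yj) ∣ ℚ.+ ℚ.∣ yj ℚ.* (xi ℚ.- xj) ∣
         ≤⟨ ℚₚ.+-mono-≤
              (prod-bound 0<ε 0<B (bx i (ℕₚ.≤-trans Nx≤L ≤i)) (cy i j (ℕₚ.≤-trans M≤L ≤i) (ℕₚ.≤-trans M≤L ≤j)))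
              (prod-bound 0<ε 0<D (by j (ℕₚ.≤-trans Ny≤L ≤j)) (cx i j (ℕₚ.≤-trans N≤L ≤i) (ℕₚ.≤-trans N≤L ≤j))) ⟩
       ½ ℚ.* ε ℚ.+ ½ ℚ.* ε
         ≡⟨ half+half ε ⟩
       ε ∎
  where
  open ℚₚ.≤-Reasoning
  δ : ∀ ε B → 0ℚ ℚ.< B → ℚ
  δ ε B 0<B = (½ ℚ.* ε) ℚ.* (ℚ.1/ B) {{ℚ.>-nonZero 0<B}}
  δ-pos : ∀ {ε B} (0<ε : 0ℚ ℚ.< ε) (0<B : 0ℚ ℚ.< B) → 0ℚ ℚ.< δ ε B 0<B
  δ-pos {ε} {B} 0<ε 0<B = ℚₚ.positive⁻¹ _
    {{ℚₚ.pos*pos⇒pos (½ ℚ.* ε) {{ℚ.positive (half-pos 0<ε)}} _ {{ℚₚ.1/pos⇒pos B {{ℚ.positive 0<B}}}}}}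
  prod-bound : ∀ {ε B a b} (0<ε : 0ℚ ℚ.< ε) (0<B : 0ℚ ℚ.< B) →
               ℚ.∣ a ∣ ℚ.≤ B → ℚ.∣ b ∣ ℚ.≤ δ ε B 0<B → ℚ.∣ a ℚ.* b ∣ ℚ.≤ ½ ℚ.* ε
  prod-bound {ε} {B} {a} {b} 0<ε 0<B a≤ b≤ = begin
    ℚ.∣ a ℚ.* b ∣              ≡⟨ ℚₚ.∣p*q∣≡∣p∣*∣q∣ a b ⟩
    ℚ.∣ a ∣ ℚ.* ℚ.∣ b ∣        ≤⟨ ℚₚ.*-monoʳ-≤-nonNeg ℚ.∣ b ∣ {{ℚₚ.∣-∣-nonNeg b}} a≤ ⟩
    B ℚ.* ℚ.∣ b ∣              ≤⟨ ℚₚ.*-monoˡ-≤-nonNeg B {{ℚ.nonNegative (ℚₚ.<⇒≤ 0<B)}} b≤ ⟩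
    B ℚ.* δ ε B 0<B            ≡⟨ ℚₚ.*-comm B _ ⟩
    (½ ℚ.* ε) ℚ.* B⁻¹ ℚ.* B    ≡⟨ ℚₚ.*-assoc (½ ℚ.* ε) B⁻¹ B ⟩
    (½ ℚ.* ε) ℚ.* (B⁻¹ ℚ.* B)  ≡⟨ cong ((½ ℚ.* ε) ℚ.*_) (ℚₚ.*-inverseˡ B {{ℚ.>-nonZero 0<B}}) ⟩
    (½ ℚ.* ε) ℚ.* 1ℚ           ≡⟨ ℚₚ.*-identityʳ _ ⟩
    ½ ℚ.* ε                    ∎
    where B⁻¹ = (ℚ.1/ B) {{ℚ.>-nonZero 0<B}}
  eq : ∀ a b c d → a ℚ.* b ℚ.- c ℚ.* d ≡ a ℚ.* (b ℚ.- d) ℚ.+ d ℚ.* (a ℚ.- c)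
  eq = solve 4 (λ a b c d → a :* b :- c :* d := a :* (b :- d) :+ d :* (a :- c)) refl
    where open ℚSolver.+-*-Solver

_^_ : ℝ → ℕ → ℝ
x ^ zero  = 1ℝ
x ^ suc k = x * x ^ k

sumℝ : List ℝ → ℝ
sumℝ = List.foldr _+_ 0ℝ

-- L is the limit of the sequence a.
_⟶_ : (ℕ → ℝ) → ℝ → Set
a ⟶ L = ∀ ε → 0ℝ < ε → ∃ λ N → ∀ n → N ℕ.≤ n → L - ε < a n × a n < L + ε

------------------------------------------------------------------------
-- Powers with real exponents

^-distribʳ-* : ∀ k a b → (a ℕ.* b) ℕ.^ k ≡ a ℕ.^ k ℕ.* b ℕ.^ k
^-distribʳ-* zero    a b = refl
^-distribʳ-* (suc k) a b = trans (cong (a ℕ.* b ℕ.*_) (^-distribʳ-* k a b)) (eq a b (a ℕ.^ k) (b ℕ.^ k))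
  where
  eq : ∀ a b c d → a ℕ.* b ℕ.* (c ℕ.* d) ≡ a ℕ.* c ℕ.* (b ℕ.* d)
  eq = ℕSolver.solve-∀

^-of-product : ∀ x b y r c → (x ℕ.^ b ℕ.* y ℕ.^ r) ℕ.^ c ≡ x ℕ.^ (b ℕ.* c) ℕ.* y ℕ.^ (r ℕ.* c)
^-of-product x b y r c =
  trans (^-distribʳ-* c (x ℕ.^ b) (y ℕ.^ r)) (cong₂ ℕ._*_ (ℕₚ.^-*-assoc x b c) (ℕₚ.^-*-assoc y r c))

^-cancel-≤ : ∀ k .{{_ : NonZero k}} {a b} → a ℕ.^ k ℕ.≤ b ℕ.^ k → a ℕ.≤ b
^-cancel-≤ k h = ℕₚ.≮⇒≥ λ b<a → ℕₚ.<-irrefl refl (ℕₚ.<-≤-trans (ℕₚ.^-monoˡ-< k b<a) h)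

bernoulli : ∀ M n k → M ℕ.^ k ℕ.* (M ℕ.+ k ℕ.* n) ℕ.≤ (M ℕ.+ n) ℕ.^ k ℕ.* M
bernoulli M n zero    = ℕₚ.≤-reflexive (cong (1 ℕ.*_) (ℕₚ.+-identityʳ M))
bernoulli M n (suc k) = begin
  M ℕ.* M ℕ.^ k ℕ.* (M ℕ.+ (n ℕ.+ k ℕ.* n))
    ≤⟨ ℕₚ.m≤m+n _ (M ℕ.^ k ℕ.* k ℕ.* n ℕ.* n) ⟩
  M ℕ.* M ℕ.^ k ℕ.* (M ℕ.+ (n ℕ.+ k ℕ.* n)) ℕ.+ M ℕ.^ k ℕ.* k ℕ.* n ℕ.* n
    ≡⟨ eq₁ M (M ℕ.^ k) n k ⟩
  (M ℕ.+ n) ℕ.* (M ℕ.^ k ℕ.* (M ℕ.+ k ℕ.* n))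
    ≤⟨ ℕₚ.*-monoʳ-≤ (M ℕ.+ n) (bernoulli M n k) ⟩
  (M ℕ.+ n) ℕ.* ((M ℕ.+ n) ℕ.^ k ℕ.* M)
    ≡⟨ ℕₚ.*-assoc (M ℕ.+ n) _ M ⟨
  (M ℕ.+ n) ℕ.* (M ℕ.+ n) ℕ.^ k ℕ.* M ∎
  where
  open ℕₚ.≤-Reasoning
  eq₁ : ∀ M P n k → M ℕ.* P ℕ.* (M ℕ.+ (n ℕ.+ k ℕ.* n)) ℕ.+ P ℕ.* k ℕ.* n ℕ.* n
                  ≡ (M ℕ.+ n) ℕ.* (P ℕ.* (M ℕ.+ k ℕ.* n))
  eq₁ = ℕSolver.solve-∀

bernoulli-diag : ∀ M n .{{_ : NonZero M}} → M ℕ.^ M ℕ.* n ℕ.≤ (M ℕ.+ n) ℕ.^ M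
bernoulli-diag M n = ℕₚ.*-cancelʳ-≤ _ _ M (begin
  M ℕ.^ M ℕ.* n ℕ.* M                    ≡⟨ eq (M ℕ.^ M) n M ⟩
  M ℕ.^ M ℕ.* (M ℕ.* n)                  ≤⟨ ℕₚ.*-monoʳ-≤ (M ℕ.^ M) (ℕₚ.m≤n+m (M ℕ.* n) M) ⟩
  M ℕ.^ M ℕ.* (M ℕ.+ M ℕ.* n)            ≤⟨ bernoulli M n M ⟩
  (M ℕ.+ n) ℕ.^ M ℕ.* M                  ∎)
  where
  open ℕₚ.≤-Reasoning
  eq : ∀ a b c → a ℕ.* b ℕ.* c ≡ a ℕ.* (c ℕ.* b)
  eq = ℕSolver.solve-∀

pos neg : ℤ → ℕ
pos (+ k)    = k
pos -[1+ k ] = 0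
neg (+ k)    = 0
neg -[1+ k ] = suc k

-- U/K ≤ n^q, with denominators cleared: for q = a/b this says
-- Uᵇ · n^(-a) ≤ Kᵇ when a ≤ 0, and Uᵇ ≤ nᵃ · Kᵇ when a ≥ 0.
Below : ℕ → ℚ → ℕ → ℕ → Set
Below n q K U = U ℕ.^ ↧ₙ q ℕ.* n ℕ.^ neg (↥ q) ℕ.≤ n ℕ.^ pos (↥ q) ℕ.* K ℕ.^ ↧ₙ q

below? : ∀ n q K → Decidable₁ (Below n q K)
below? n q K U = _ ℕₚ.≤? _

greatest : {P : Pred ℕ 0ℓ} → Decidable₁ P → ℕ → ℕ
greatest P? zero    = 0
greatest P? (suc b) with P? (suc b)
... | yes _ = suc b
... | no  _ = greatest P? b

-- The numerator U of the largest fraction U/K with U/K ≤ n^q.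
rootNum : ℕ → ℚ → ℕ → ℕ
rootNum n q K = greatest (below? n q K) (n ℕ.^ pos (↥ q) ℕ.* K)

greatest-sat : {P : Pred ℕ 0ℓ} (P? : Decidable₁ P) (b : ℕ) → P 0 → P (greatest P? b)
greatest-sat P? zero    P0 = P0
greatest-sat P? (suc b) P0 with P? (suc b)
... | yes p = p
... | no  _ = greatest-sat P? b P0

greatest-max : {P : Pred ℕ 0ℓ} (P? : Decidable₁ P) (b : ℕ) →
               ¬ P (suc b) → ¬ P (suc (greatest P? b))
greatest-max P? zero    ¬P = ¬P
greatest-max P? (suc b) ¬P with P? (suc b)
... | yes _ = ¬P
... | no ¬p = greatest-max P? b ¬p

module _ (n : ℕ) .{{_ : NonZero n}} where

  root-below : ∀ q K → Below n q K (rootNum n q K)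
  root-below q@(mkℚ _ _ _) K = greatest-sat (below? n q K) (n ℕ.^ pos (↥ q) ℕ.* K) z≤n

  root-above : ∀ q K .{{_ : NonZero K}} → ¬ Below n q K (suc (rootNum n q K))
  root-above q@(mkℚ a d _) K = greatest-max (below? n q K) bound λ h →
    ℕₚ.<-irrefl refl $ ℕₚ.<-≤-trans (ℕₚ.^-monoˡ-< (suc d) (ℕₚ.n<1+n bound)) $ begin
      suc bound ℕ.^ suc d                         ≤⟨ ℕₚ.m≤m*n _ (n ℕ.^ neg a) {{ℕₚ.m^n≢0 n (neg a)}} ⟩
      suc bound ℕ.^ suc d ℕ.* n ℕ.^ neg a         ≤⟨ h ⟩
      np ℕ.* K ℕ.^ suc d                          ≤⟨ ℕₚ.*-monoˡ-≤ (K ℕ.^ suc d) (ℕₚ.m≤m*n np (np ℕ.^ d) {{ℕₚ.m^n≢0 np d {{ℕₚ.m^n≢0 n (pos a)}}}}) ⟩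
      np ℕ.^ suc d ℕ.* K ℕ.^ suc d                ≡⟨ ^-distribʳ-* (suc d) np K ⟨
      bound ℕ.^ suc d                             ∎
    where
    open ℕₚ.≤-Reasoning
    np = n ℕ.^ pos a
    bound = np ℕ.* K

  -- n^q ≤ n^q′ · (1 + n/M) whenever q ≤ q′ + 1/M, from Bernoulli's inequality.
  root-compare : ∀ q q′ K K′ U W M .{{_ : NonZero M}} →
    let b = ↧ₙ q; b′ = ↧ₙ q′ in
    pos (↥ q) ℕ.* (b′ ℕ.* M) ℕ.+ neg (↥ q′) ℕ.* (b ℕ.* M)
      ℕ.≤ (pos (↥ q′) ℕ.* (b ℕ.* M) ℕ.+ neg (↥ q) ℕ.* (b′ ℕ.* M)) ℕ.+ b ℕ.* b′ →
    Below n q K U → ¬ Below n q′ K′ W → U ℕ.* K′ ℕ.* M ℕ.≤ W ℕ.* K ℕ.* (M ℕ.+ n)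
  root-compare q@(mkℚ a d _) q′@(mkℚ a′ d′ _) K K′ U W M exps below ¬below =
    ^-cancel-≤ e {{e≢0}} (ℕₚ.*-cancelˡ-≤ (n ℕ.^ s) {{ℕₚ.m^n≢0 n s}} main)
    where
    open ℕₚ.≤-Reasoning
    b b′ c c′ e s : ℕ
    b = suc d
    b′ = suc d′
    c = b′ ℕ.* M
    c′ = b ℕ.* M
    e = b ℕ.* c
    s = pos a′ ℕ.* c′ ℕ.+ neg a ℕ.* c
    e≢0 : NonZero e
    e≢0 = ℕₚ.m*n≢0 b c {{_}} {{ℕₚ.m*n≢0 b′ M}}
    e≡ : b′ ℕ.* c′ ≡ e
    e≡ = eq b′ b M
      where
      eq : ∀ x y z → x ℕ.* (y ℕ.* z) ≡ y ℕ.* (x ℕ.* z)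
      eq = ℕSolver.solve-∀
    h₁ : U ℕ.^ e ℕ.* n ℕ.^ (neg a ℕ.* c) ℕ.≤ n ℕ.^ (pos a ℕ.* c) ℕ.* K ℕ.^ e
    h₁ = subst₂ ℕ._≤_ (^-of-product U b n (neg a) c) (^-of-product n (pos a) K b c) (ℕₚ.^-monoˡ-≤ c below)
    h₂ : n ℕ.^ (pos a′ ℕ.* c′) ℕ.* K′ ℕ.^ e ℕ.≤ W ℕ.^ e ℕ.* n ℕ.^ (neg a′ ℕ.* c′)
    h₂ = subst (λ e → n ℕ.^ (pos a′ ℕ.* c′) ℕ.* K′ ℕ.^ e ℕ.≤ W ℕ.^ e ℕ.* n ℕ.^ (neg a′ ℕ.* c′)) e≡
           (subst₂ ℕ._≤_ (^-of-product n (pos a′) K′ b′ c′) (^-of-product W b′ n (neg a′) c′)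
             (ℕₚ.^-monoˡ-≤ c′ (ℕₚ.<⇒≤ (ℕₚ.≰⇒> ¬below))))
    h₃ : M ℕ.^ e ℕ.* n ℕ.^ (b ℕ.* b′) ℕ.≤ (M ℕ.+ n) ℕ.^ e
    h₃ = subst₂ ℕ._≤_
           (trans (^-distribʳ-* (b ℕ.* b′) (M ℕ.^ M) n)
             (cong (ℕ._* n ℕ.^ (b ℕ.* b′)) (trans (ℕₚ.^-*-assoc M M (b ℕ.* b′)) (cong (M ℕ.^_) eq))))
           (trans (ℕₚ.^-*-assoc (M ℕ.+ n) M (b ℕ.* b′)) (cong ((M ℕ.+ n) ℕ.^_) eq))
           (ℕₚ.^-monoˡ-≤ (b ℕ.* b′) (bernoulli-diag M n))
      where
      eq : M ℕ.* (b ℕ.* b′) ≡ e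
      eq = eq′ M b b′
        where
        eq′ : ∀ x y z → x ℕ.* (y ℕ.* z) ≡ y ℕ.* (z ℕ.* x)
        eq′ = ℕSolver.solve-∀
    split₃ : ∀ x y z → (x ℕ.* y ℕ.* z) ℕ.^ e ≡ x ℕ.^ e ℕ.* y ℕ.^ e ℕ.* z ℕ.^ e
    split₃ x y z = trans (^-distribʳ-* e (x ℕ.* y) z) (cong (ℕ._* z ℕ.^ e) (^-distribʳ-* e x y))
    eq₁ : ∀ N₁ N₂ u k m → N₁ ℕ.* N₂ ℕ.* (u ℕ.* k ℕ.* m) ≡ (u ℕ.* N₂) ℕ.* (N₁ ℕ.* k) ℕ.* m
    eq₁ = ℕSolver.solve-∀
    eq₂ : ∀ N₁ N₂ u k m → (N₁ ℕ.* u) ℕ.* (k ℕ.* N₂) ℕ.* m ≡ N₁ ℕ.* N₂ ℕ.* (u ℕ.* k ℕ.* m)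
    eq₂ = ℕSolver.solve-∀
    eq₃ : ∀ N B u k m → N ℕ.* B ℕ.* (u ℕ.* k ℕ.* m) ≡ N ℕ.* (k ℕ.* u ℕ.* (m ℕ.* B))
    eq₃ = ℕSolver.solve-∀
    main : n ℕ.^ s ℕ.* (U ℕ.* K′ ℕ.* M) ℕ.^ e ℕ.≤ n ℕ.^ s ℕ.* (W ℕ.* K ℕ.* (M ℕ.+ n)) ℕ.^ e
    main = begin
      n ℕ.^ s ℕ.* (U ℕ.* K′ ℕ.* M) ℕ.^ e
        ≡⟨ cong₂ ℕ._*_ (ℕₚ.^-distribˡ-+-* n (pos a′ ℕ.* c′) (neg a ℕ.* c)) (split₃ U K′ M) ⟩
      n ℕ.^ (pos a′ ℕ.* c′) ℕ.* n ℕ.^ (neg a ℕ.* c) ℕ.* (U ℕ.^ e ℕ.* K′ ℕ.^ e ℕ.* M ℕ.^ e)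
        ≡⟨ eq₁ (n ℕ.^ (pos a′ ℕ.* c′)) (n ℕ.^ (neg a ℕ.* c)) (U ℕ.^ e) (K′ ℕ.^ e) (M ℕ.^ e) ⟩
      (U ℕ.^ e ℕ.* n ℕ.^ (neg a ℕ.* c)) ℕ.* (n ℕ.^ (pos a′ ℕ.* c′) ℕ.* K′ ℕ.^ e) ℕ.* M ℕ.^ e
        ≤⟨ ℕₚ.*-monoˡ-≤ (M ℕ.^ e) (ℕₚ.*-mono-≤ h₁ h₂) ⟩
      (n ℕ.^ (pos a ℕ.* c) ℕ.* K ℕ.^ e) ℕ.* (W ℕ.^ e ℕ.* n ℕ.^ (neg a′ ℕ.* c′)) ℕ.* M ℕ.^ e
        ≡⟨ eq₂ (n ℕ.^ (pos a ℕ.* c)) (n ℕ.^ (neg a′ ℕ.* c′)) (K ℕ.^ e) (W ℕ.^ e) (M ℕ.^ e) ⟩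
      n ℕ.^ (pos a ℕ.* c) ℕ.* n ℕ.^ (neg a′ ℕ.* c′) ℕ.* (K ℕ.^ e ℕ.* W ℕ.^ e ℕ.* M ℕ.^ e)
        ≡⟨ cong (ℕ._* (K ℕ.^ e ℕ.* W ℕ.^ e ℕ.* M ℕ.^ e)) (ℕₚ.^-distribˡ-+-* n (pos a ℕ.* c) (neg a′ ℕ.* c′)) ⟨
      n ℕ.^ (pos a ℕ.* c ℕ.+ neg a′ ℕ.* c′) ℕ.* (K ℕ.^ e ℕ.* W ℕ.^ e ℕ.* M ℕ.^ e)
        ≤⟨ ℕₚ.*-monoˡ-≤ (K ℕ.^ e ℕ.* W ℕ.^ e ℕ.* M ℕ.^ e) (ℕₚ.^-monoʳ-≤ n exps) ⟩
      n ℕ.^ (s ℕ.+ b ℕ.* b′) ℕ.* (K ℕ.^ e ℕ.* W ℕ.^ e ℕ.* M ℕ.^ e)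
        ≡⟨ cong (ℕ._* (K ℕ.^ e ℕ.* W ℕ.^ e ℕ.* M ℕ.^ e)) (ℕₚ.^-distribˡ-+-* n s (b ℕ.* b′)) ⟩
      n ℕ.^ s ℕ.* n ℕ.^ (b ℕ.* b′) ℕ.* (K ℕ.^ e ℕ.* W ℕ.^ e ℕ.* M ℕ.^ e)
        ≡⟨ eq₃ (n ℕ.^ s) (n ℕ.^ (b ℕ.* b′)) (K ℕ.^ e) (W ℕ.^ e) (M ℕ.^ e) ⟩
      n ℕ.^ s ℕ.* (W ℕ.^ e ℕ.* K ℕ.^ e ℕ.* (M ℕ.^ e ℕ.* n ℕ.^ (b ℕ.* b′)))
        ≤⟨ ℕₚ.*-monoʳ-≤ (n ℕ.^ s) (ℕₚ.*-monoʳ-≤ (W ℕ.^ e ℕ.* K ℕ.^ e) h₃) ⟩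
      n ℕ.^ s ℕ.* (W ℕ.^ e ℕ.* K ℕ.^ e ℕ.* (M ℕ.+ n) ℕ.^ e)
        ≡⟨ cong (n ℕ.^ s ℕ.*_) (split₃ W K (M ℕ.+ n)) ⟨
      n ℕ.^ s ℕ.* (W ℕ.* K ℕ.* (M ℕ.+ n)) ℕ.^ e ∎

pos-neg : ∀ i → i ≡ + pos i ℤ.- + neg i
pos-neg (+ k)    = sym (ℤₚ.+-identityʳ (+ k))
pos-neg -[1+ k ] = refl

fromℚᵘ-≤ : ∀ x y r → x ℚᵘ.≤ y ℚᵘ.+ toℚᵘ r → ℚ.fromℚᵘ x ℚ.≤ ℚ.fromℚᵘ y ℚ.+ r
fromℚᵘ-≤ x y r h = ℚₚ.toℚᵘ-cancel-≤ (ℚᵘₚ.≤-respˡ-≃ (ℚᵘₚ.≃-sym (ℚₚ.toℚᵘ-fromℚᵘ x))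
  (ℚᵘₚ.≤-respʳ-≃ (ℚᵘₚ.≃-sym (ℚᵘₚ.≃-trans (ℚₚ.toℚᵘ-homo-+ (ℚ.fromℚᵘ y) r)
    (ℚᵘₚ.+-congˡ (toℚᵘ r) (ℚₚ.toℚᵘ-fromℚᵘ y)))) h))

-- q ≤ q′ + 1/M with denominators cleared.
exponents : ∀ q q′ M .{{_ : NonZero M}} → q ℚ.≤ q′ ℚ.+ + 1 ℚ./ M →
  let b = ↧ₙ q; b′ = ↧ₙ q′ in
  pos (↥ q) ℕ.* (b′ ℕ.* M) ℕ.+ neg (↥ q′) ℕ.* (b ℕ.* M)
    ℕ.≤ (pos (↥ q′) ℕ.* (b ℕ.* M) ℕ.+ neg (↥ q) ℕ.* (b′ ℕ.* M)) ℕ.+ b ℕ.* b′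
exponents q@(mkℚ a d _) q′@(mkℚ a′ d′ _) M@(suc M-1) h = ℤₚ.drop‿+≤+ (subst₂ ℤ._≤_ lhs rhs step)
  where
  b = suc d
  b′ = suc d′
  hᵘ : mkℚᵘ a d ℚᵘ.≤ mkℚᵘ a′ d′ ℚᵘ.+ mkℚᵘ (+ 1) M-1
  hᵘ = ℚᵘₚ.≤-respʳ-≃
         (ℚᵘₚ.≃-trans (ℚₚ.toℚᵘ-homo-+ q′ (+ 1 ℚ./ M))
           (ℚᵘₚ.+-congʳ (mkℚᵘ a′ d′) (ℚₚ.toℚᵘ-fromℚᵘ (mkℚᵘ (+ 1) M-1))))
         (ℚₚ.toℚᵘ-mono-≤ h)
  hℤ : a ℤ.* (+ b′ ℤ.* + M) ℤ.≤ (a′ ℤ.* + M ℤ.+ + 1 ℤ.* + b′) ℤ.* + b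
  hℤ = subst (λ z → a ℤ.* z ℤ.≤ (a′ ℤ.* + M ℤ.+ + 1 ℤ.* + b′) ℤ.* + b) (ℤₚ.pos-* b′ M) (ℚᵘₚ.drop-*≤* hᵘ)
  extra : ℤ
  extra = + neg a ℤ.* (+ b′ ℤ.* + M) ℤ.+ + neg a′ ℤ.* (+ b ℤ.* + M)
  step : a ℤ.* (+ b′ ℤ.* + M) ℤ.+ extra ℤ.≤ (a′ ℤ.* + M ℤ.+ + 1 ℤ.* + b′) ℤ.* + b ℤ.+ extra
  step = ℤₚ.+-monoˡ-≤ extra hℤ
  eq₁ : ∀ p r r′ b b′ M → (p ℤ.- r) ℤ.* (b′ ℤ.* M) ℤ.+ (r ℤ.* (b′ ℤ.* M) ℤ.+ r′ ℤ.* (b ℤ.* M))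
                        ≡ p ℤ.* (b′ ℤ.* M) ℤ.+ r′ ℤ.* (b ℤ.* M)
  eq₁ = ℤSolver.solve-∀
  eq₂ : ∀ p′ r r′ b b′ M → ((p′ ℤ.- r′) ℤ.* M ℤ.+ + 1 ℤ.* b′) ℤ.* b ℤ.+ (r ℤ.* (b′ ℤ.* M) ℤ.+ r′ ℤ.* (b ℤ.* M))
                         ≡ (p′ ℤ.* (b ℤ.* M) ℤ.+ r ℤ.* (b′ ℤ.* M)) ℤ.+ b ℤ.* b′
  eq₂ = ℤSolver.solve-∀
  cast₃ : ∀ x y z → + x ℤ.* (+ y ℤ.* + z) ≡ + (x ℕ.* (y ℕ.* z))
  cast₃ x y z = trans (cong (+ x ℤ.*_) (sym (ℤₚ.pos-* y z))) (sym (ℤₚ.pos-* x (y ℕ.* z)))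
  lhs : a ℤ.* (+ b′ ℤ.* + M) ℤ.+ extra ≡ + (pos a ℕ.* (b′ ℕ.* M) ℕ.+ neg a′ ℕ.* (b ℕ.* M))
  lhs = trans (cong (λ z → z ℤ.* (+ b′ ℤ.* + M) ℤ.+ extra) (pos-neg a))
       (trans (eq₁ (+ pos a) (+ neg a) (+ neg a′) (+ b) (+ b′) (+ M))
              (cong₂ ℤ._+_ (cast₃ (pos a) b′ M) (cast₃ (neg a′) b M)))
  rhs : (a′ ℤ.* + M ℤ.+ + 1 ℤ.* + b′) ℤ.* + b ℤ.+ extra
      ≡ + ((pos a′ ℕ.* (b ℕ.* M) ℕ.+ neg a ℕ.* (b′ ℕ.* M)) ℕ.+ b ℕ.* b′)
  rhs = trans (cong (λ z → (z ℤ.* + M ℤ.+ + 1 ℤ.* + b′) ℤ.* + b ℤ.+ extra) (pos-neg a′))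
       (trans (eq₂ (+ pos a′) (+ neg a) (+ neg a′) (+ b) (+ b′) (+ M))
              (cong₂ ℤ._+_ (cong₂ ℤ._+_ (cast₃ (pos a′) b M) (cast₃ (neg a) b′ M)) (sym (ℤₚ.pos-* b b′))))

fraction-≤ : ∀ U U′ k k′ e d .(cop : Coprime e (suc d)) →
  U ℕ.* suc k′ ℕ.* suc d ℕ.≤ U′ ℕ.* suc k ℕ.* suc d ℕ.+ suc k ℕ.* suc k′ ℕ.* e →
  + U ℚ./ suc k ℚ.≤ + U′ ℚ./ suc k′ ℚ.+ mkℚ (+ e) d cop
fraction-≤ U U′ k k′ e d cop h =
  fromℚᵘ-≤ (mkℚᵘ (+ U) k) (mkℚᵘ (+ U′) k′) (mkℚ (+ e) d cop) (ℚᵘ.*≤* (subst₂ ℤ._≤_ lhs rhs (ℤ.+≤+ h)))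
  where
  eq₁ : ∀ u k d → u ℕ.* k ℕ.* d ≡ u ℕ.* (k ℕ.* d)
  eq₁ = ℕSolver.solve-∀
  eq₂ : ∀ u k k′ d e → u ℕ.* k ℕ.* d ℕ.+ k ℕ.* k′ ℕ.* e ≡ (u ℕ.* d ℕ.+ e ℕ.* k′) ℕ.* k
  eq₂ = ℕSolver.solve-∀
  lhs : + (U ℕ.* suc k′ ℕ.* suc d) ≡ + U ℤ.* + (suc k′ ℕ.* suc d)
  lhs = trans (cong +_ (eq₁ U (suc k′) (suc d))) (ℤₚ.pos-* U (suc k′ ℕ.* suc d))
  rhs : + (U′ ℕ.* suc k ℕ.* suc d ℕ.+ suc k ℕ.* suc k′ ℕ.* e) ≡ (+ U′ ℤ.* + suc d ℤ.+ + e ℤ.* + suc k′) ℤ.* + suc k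
  rhs = trans (cong +_ (eq₂ U′ (suc k) (suc k′) (suc d) e))
       (trans (ℤₚ.pos-* (U′ ℕ.* suc d ℕ.+ e ℕ.* suc k′) (suc k))
              (cong (ℤ._* + suc k) (cong₂ ℤ._+_ (ℤₚ.pos-* U′ (suc d)) (ℤₚ.pos-* e (suc k′)))))

∣-∣-≤⇒≤ : ∀ {p q ε} → ℚ.∣ p ℚ.- q ∣ ℚ.≤ ε → p ℚ.≤ q ℚ.+ ε
∣-∣-≤⇒≤ {p} {q} {ε} h = begin
  p                        ≡⟨ eq p q ⟩
  q ℚ.+ (p ℚ.- q)          ≤⟨ ℚₚ.+-monoʳ-≤ q (p≤∣p∣ (p ℚ.- q)) ⟩
  q ℚ.+ ℚ.∣ p ℚ.- q ∣      ≤⟨ ℚₚ.+-monoʳ-≤ q h ⟩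
  q ℚ.+ ε                  ∎
  where
  open ℚₚ.≤-Reasoning
  open ℚSolver.+-*-Solver
  eq : ∀ p q → p ≡ q ℚ.+ (p ℚ.- q)
  eq = solve 2 (λ p q → p := q :+ (p :- q)) refl
  p≤∣p∣ : ∀ p → p ℚ.≤ ℚ.∣ p ∣
  p≤∣p∣ p with ℚₚ.≤-total 0ℚ p
  ... | inj₁ 0≤p = ℚₚ.≤-reflexive (sym (ℚₚ.0≤p⇒∣p∣≡p 0≤p))
  ... | inj₂ p≤0 = ℚₚ.≤-trans p≤0 (ℚₚ.0≤∣p∣ p)

≤⇒∣-∣-≤ : ∀ {p q ε} → p ℚ.≤ q ℚ.+ ε → q ℚ.≤ p ℚ.+ ε → ℚ.∣ p ℚ.- q ∣ ℚ.≤ ε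
≤⇒∣-∣-≤ {p} {q} {ε} h₁ h₂ with ℚₚ.∣p∣≡p∨∣p∣≡-p (p ℚ.- q)
... | inj₁ e = subst (ℚ._≤ ε) (sym e) (subst (p ℚ.- q ℚ.≤_) (eq q ε) (ℚₚ.+-monoˡ-≤ (ℚ.- q) h₁))
  where
  open ℚSolver.+-*-Solver
  eq : ∀ q ε → q ℚ.+ ε ℚ.- q ≡ ε
  eq = solve 2 (λ q ε → q :+ ε :- q := ε) refl
... | inj₂ e = subst (ℚ._≤ ε) (sym e) (subst₂ ℚ._≤_ (eq₁ p q) (eq₂ p ε) (ℚₚ.+-monoˡ-≤ (ℚ.- p) h₂))
  where
  open ℚSolver.+-*-Solver
  eq₁ : ∀ p q → q ℚ.- p ≡ ℚ.- (p ℚ.- q)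
  eq₁ = solve 2 (λ p q → q :- p := :- (p :- q)) refl
  eq₂ : ∀ p ε → p ℚ.+ ε ℚ.- p ≡ ε
  eq₂ = solve 2 (λ p ε → p :+ ε :- p := ε) refl

coarse-bound : ∀ u N w K n .{{_ : NonZero N}} →
  u ℕ.* N ℕ.* 1 ℕ.≤ w ℕ.* K ℕ.* (1 ℕ.+ n) → u ℕ.≤ w ℕ.* (1 ℕ.+ n) ℕ.* K
coarse-bound u N w K n h = begin
  u                          ≤⟨ ℕₚ.m≤m*n u N ⟩
  u ℕ.* N                    ≡⟨ ℕₚ.*-identityʳ _ ⟨
  u ℕ.* N ℕ.* 1              ≤⟨ h ⟩
  w ℕ.* K ℕ.* (1 ℕ.+ n)      ≡⟨ eq w K (1 ℕ.+ n) ⟩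
  w ℕ.* (1 ℕ.+ n) ℕ.* K      ∎
  where
  open ℕₚ.≤-Reasoning
  eq : ∀ a b c → a ℕ.* b ℕ.* c ≡ a ℕ.* c ℕ.* b
  eq = ℕSolver.solve-∀

error-bound : ∀ u v L K B n d e → 1 ℕ.≤ K → 1 ℕ.≤ e →
  (1 ℕ.+ (1 ℕ.+ B) ℕ.* n) ℕ.* d ℕ.≤ K → v ℕ.≤ B ℕ.* K →
  u ℕ.* K ℕ.* ((1 ℕ.+ (1 ℕ.+ B) ℕ.* n) ℕ.* d)
    ℕ.≤ suc v ℕ.* L ℕ.* ((1 ℕ.+ (1 ℕ.+ B) ℕ.* n) ℕ.* d ℕ.+ n) →
  u ℕ.* K ℕ.* d ℕ.≤ v ℕ.* L ℕ.* d ℕ.+ L ℕ.* K ℕ.* e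
error-bound u v L K B n d e 1≤K 1≤e M≤K v≤BK h = ℕₚ.*-cancelʳ-≤ _ _ (1 ℕ.+ (1 ℕ.+ B) ℕ.* n) (begin
  u ℕ.* K ℕ.* d ℕ.* Z
    ≡⟨ eq₁ u K d Z ⟩
  u ℕ.* K ℕ.* (Z ℕ.* d)
    ≤⟨ h ⟩
  suc v ℕ.* L ℕ.* (Z ℕ.* d ℕ.+ n)
    ≡⟨ eq₂ (suc v) v L (Z ℕ.* d) n refl ⟩
  v ℕ.* L ℕ.* (Z ℕ.* d) ℕ.+ L ℕ.* (Z ℕ.* d ℕ.+ suc v ℕ.* n)
    ≤⟨ ℕₚ.+-monoʳ-≤ (v ℕ.* L ℕ.* (Z ℕ.* d)) (ℕₚ.*-monoʳ-≤ L (ℕₚ.+-mono-≤ M≤K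
         (ℕₚ.*-monoˡ-≤ n (ℕₚ.+-mono-≤ 1≤K v≤BK)))) ⟩
  v ℕ.* L ℕ.* (Z ℕ.* d) ℕ.+ L ℕ.* (K ℕ.+ (K ℕ.+ B ℕ.* K) ℕ.* n)
    ≡⟨ eq₃ v L K d B n ⟩
  (v ℕ.* L ℕ.* d ℕ.+ L ℕ.* K ℕ.* 1) ℕ.* Z
    ≤⟨ ℕₚ.*-monoˡ-≤ Z (ℕₚ.+-monoʳ-≤ (v ℕ.* L ℕ.* d) (ℕₚ.*-monoʳ-≤ (L ℕ.* K) 1≤e)) ⟩
  (v ℕ.* L ℕ.* d ℕ.+ L ℕ.* K ℕ.* e) ℕ.* Z ∎)
  where
  open ℕₚ.≤-Reasoning
  Z : ℕ
  Z = 1 ℕ.+ (1 ℕ.+ B) ℕ.* n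
  eq₁ : ∀ u k d c → u ℕ.* k ℕ.* d ℕ.* c ≡ u ℕ.* k ℕ.* (c ℕ.* d)
  eq₁ = ℕSolver.solve-∀
  eq₂′ : ∀ u l M n → (1 ℕ.+ u) ℕ.* l ℕ.* (M ℕ.+ n) ≡ u ℕ.* l ℕ.* M ℕ.+ l ℕ.* (M ℕ.+ (1 ℕ.+ u) ℕ.* n)
  eq₂′ = ℕSolver.solve-∀
  eq₂ : ∀ w u l M n → w ≡ 1 ℕ.+ u → w ℕ.* l ℕ.* (M ℕ.+ n) ≡ u ℕ.* l ℕ.* M ℕ.+ l ℕ.* (M ℕ.+ w ℕ.* n)
  eq₂ _ u l M n refl = eq₂′ u l M n
  eq₃ : ∀ u l k d B n → u ℕ.* l ℕ.* ((1 ℕ.+ (1 ℕ.+ B) ℕ.* n) ℕ.* d) ℕ.+ l ℕ.* (k ℕ.+ (k ℕ.+ B ℕ.* k) ℕ.* n)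
                      ≡ (u ℕ.* l ℕ.* d ℕ.+ l ℕ.* k ℕ.* 1) ℕ.* (1 ℕ.+ (1 ℕ.+ B) ℕ.* n)
  eq₃ = ℕSolver.solve-∀

module _ (n : ℕ) (U : ℕ → ℕ)
  (close : ∀ M .{{_ : NonZero M}} → ∃ λ N → ∀ l k → N ℕ.≤ l → N ℕ.≤ k →
           U l ℕ.* suc k ℕ.* M ℕ.≤ suc (U k) ℕ.* suc l ℕ.* (M ℕ.+ n)) where

  bounded : ∃ λ B → ∃ λ N → ∀ k → N ℕ.≤ k → U k ℕ.≤ B ℕ.* suc k
  bounded with close 1
  ... | N , c = suc (U N) ℕ.* (1 ℕ.+ n) , N , λ k ≤k →
    coarse-bound (U k) (suc N) (suc (U N)) (suc k) n (c k N ≤k ℕₚ.≤-refl)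

  one-sided : ∀ ε → 0ℚ ℚ.< ε → ∃ λ N → ∀ l k → N ℕ.≤ l → N ℕ.≤ k →
              + U l ℚ./ suc l ℚ.≤ + U k ℚ./ suc k ℚ.+ ε
  one-sided (mkℚ (+ zero) d _) (ℚ.*<* (ℤ.+<+ ()))
  one-sided (mkℚ -[1+ _ ] d _) (ℚ.*<* ())
  one-sided (mkℚ (+ suc e) d cop) _ with bounded
  ... | B , N₀ , bd with close ((1 ℕ.+ (1 ℕ.+ B) ℕ.* n) ℕ.* suc d)
  ...   | N₁ , cl = (N₀ ℕ.⊔ N₁) ℕ.⊔ M , λ l k ≤l ≤k →
      fraction-≤ (U l) (U k) l k (suc e) d cop
        (error-bound (U l) (U k) (suc l) (suc k) B n (suc d) (suc e) (s≤s z≤n) (s≤s z≤n)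
          (ℕₚ.≤-trans (ℕₚ.m⊔n≤o⇒n≤o (N₀ ℕ.⊔ N₁) M ≤k) (ℕₚ.n≤1+n k))
          (bd k (ℕₚ.m⊔n≤o⇒m≤o N₀ N₁ (ℕₚ.m⊔n≤o⇒m≤o _ M ≤k)))
          (cl l k (ℕₚ.m⊔n≤o⇒n≤o N₀ N₁ (ℕₚ.m⊔n≤o⇒m≤o _ M ≤l)) (ℕₚ.m⊔n≤o⇒n≤o N₀ N₁ (ℕₚ.m⊔n≤o⇒m≤o _ M ≤k))))
    where
    M : ℕ
    M = (1 ℕ.+ (1 ℕ.+ B) ℕ.* n) ℕ.* suc d

  fractions-cauchy : ∀ ε → 0ℚ ℚ.< ε → ∃ λ N → ∀ i j → N ℕ.≤ i → N ℕ.≤ j →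
                     ℚ.∣ + U i ℚ./ suc i ℚ.- + U j ℚ./ suc j ∣ ℚ.≤ ε
  fractions-cauchy ε 0<ε with one-sided ε 0<ε
  ... | N , c = N , λ i j ≤i ≤j → ≤⇒∣-∣-≤ (c i j ≤i ≤j) (c j i ≤j ≤i)

roots-close : ∀ n .{{_ : NonZero n}} (s : ℝ) M .{{_ : NonZero M}} →
  let U = λ k → rootNum n (seq s k) (suc k) in
  ∃ λ N → ∀ l k → N ℕ.≤ l → N ℕ.≤ k →
  U l ℕ.* suc k ℕ.* M ℕ.≤ suc (U k) ℕ.* suc l ℕ.* (M ℕ.+ n)
roots-close n s M =
  let N , c = cauchy s (+ 1 ℚ./ M) (ℚₚ.positive⁻¹ _ {{ℚₚ.normalize-pos 1 M}})
  in N , λ l k ≤l ≤k →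
    root-compare n (seq s l) (seq s k) (suc l) (suc k) (rootNum n (seq s l) (suc l)) (suc (rootNum n (seq s k) (suc k))) M
      (exponents (seq s l) (seq s k) M (∣-∣-≤⇒≤ {seq s l} (c l k ≤l ≤k)))
      (root-below n (seq s l) (suc l))
      (root-above n (seq s k) (suc k))

infixr 8 _^ᵣ_

-- n^s for a real exponent s: the k-th approximation is the largest multiple
-- of 1/(k+1) not exceeding n^(s k), where s k is the k-th approximation of s.
_^ᵣ_ : (n : ℕ) .{{_ : NonZero n}} → ℝ → ℝ
n ^ᵣ s = mkℝ (λ k → + rootNum n (seq s k) (suc k) ℚ./ suc k)
  (fractions-cauchy n (λ k → rootNum n (seq s k) (suc k)) (roots-close n s))

√_ : ℕ → ℝ
√ zero  = 0ℝ
√ suc k = suc k ^ᵣ fromℚ ½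

infix 9 √_

------------------------------------------------------------------------
-- The exponent

-- Only the values at integers 1 ≤ ℓ ≤ m are needed; there the truncated
-- subtraction is exact.
f : (m ℓ : ℕ) .{{_ : NonZero ℓ}} → ℚ
f m ℓ = + (ℓ C 2 ℕ.+ (m ℕ.∸ ℓ ℕ.+ 1) C 2) ℚ./ ℓ

C2-nonZero : ∀ k → 2 ℕ.≤ k → NonZero (k C 2)
C2-nonZero (suc zero)    (s≤s ())
C2-nonZero (suc (suc k)) _ = subst NonZero {x = suc k ℕ.+ suc k C 2}
  (trans (cong (ℕ._+ suc k C 2) (sym (nC1≡n (suc k)))) (nCk+nC[k+1]≡[n+1]C[k+1] (suc k) 1)) _

f-nonZero : ∀ {m} → 2 ℕ.≤ m → ∀ ℓ .{{_ : NonZero ℓ}} → ℚ.NonZero (f m ℓ)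
f-nonZero {m} 2≤m ℓ {{ℓ≢0}} = ℚₚ.pos⇒nonZero (f m ℓ) {{ℚₚ.normalize-pos _ ℓ {{ℓ≢0}} {{sum-nonZero ℓ}}}}
  where
  sum-nonZero : ∀ ℓ .{{_ : NonZero ℓ}} → NonZero (ℓ C 2 ℕ.+ (m ℕ.∸ ℓ ℕ.+ 1) C 2)
  sum-nonZero (suc zero) = ℕ.>-nonZero (ℕₚ.<-≤-trans
    (ℕ.>-nonZero⁻¹ _ {{C2-nonZero (m ℕ.∸ 1 ℕ.+ 1) (ℕₚ.≤-trans 2≤m (ℕₚ.≤-reflexive (sym (ℕₚ.m∸n+n≡m (ℕₚ.<⇒≤ 2≤m)))))}})
    (ℕₚ.m≤n+m _ (1 C 2)))
  sum-nonZero ℓ@(suc (suc _)) = ℕ.>-nonZero (ℕₚ.<-≤-trans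
    (ℕ.>-nonZero⁻¹ _ {{C2-nonZero ℓ (s≤s (s≤s z≤n))}}) (ℕₚ.m≤m+n (ℓ C 2) _))

λₘ : ℕ → ℝ
λₘ m = √ (2 ℕ.* m ℕ.^ 2 ℕ.+ 2 ℕ.* m) * fromℚ ½

IsFloor IsCeiling : ℝ → ℕ → Set
IsFloor   x k = fromℕ k ≤ x × x < fromℕ k + 1ℝ
IsCeiling x k = fromℕ k - 1ℝ < x × x ≤ fromℕ k

-- ℓ is the integer ℓₘ. Floors of reals cannot be computed constructively,
-- so ⌊λₘ⌋ and ⌈λₘ⌉ are given by their defining inequalities.
record Isℓₘ (m ℓ : ℕ) .{{_ : NonZero ℓ}} : Set where
  field
    ⌊λ⌋ ⌈λ⌉     : ℕ
    .{{⌊λ⌋≢0}}  : NonZero ⌊λ⌋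
    .{{⌈λ⌉≢0}}  : NonZero ⌈λ⌉
    isFloor     : IsFloor (λₘ m) ⌊λ⌋
    isCeiling   : IsCeiling (λₘ m) ⌈λ⌉
    candidate   : ℓ ≡ ⌊λ⌋ ⊎ ℓ ≡ ⌈λ⌉
    minimises   : f m ℓ ≡ f m ⌊λ⌋ ℚ.⊓ f m ⌈λ⌉
    tie         : ⌊λ⌋ ≢ ⌈λ⌉ → f m ⌊λ⌋ ≡ f m ⌈λ⌉ → ℓ ≡ ⌊λ⌋

------------------------------------------------------------------------
-- Finite simple graphs on the vertex set Fin n

record Graph (n : ℕ) : Set₁ where
  field
    Adj    : Rel (Fin n) 0ℓ
    adj?   : Decidable Adj
    symm   : Symmetric Adj
    irrefl : Irreflexive _≡_ Adj

open Graph public using (Adj; adj?)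

infixr 6 _∪_
infix 4 _⊆_

_∪_ : ∀ {n} → Graph n → Graph n → Graph n
G ∪ H = record
  { Adj    = λ u v → Adj G u v ⊎ Adj H u v
  ; adj?   = λ u v → adj? G u v ⊎-dec adj? H u v
  ; symm   = Sum.map (Graph.symm G) (Graph.symm H)
  ; irrefl = λ u≡v → [ Graph.irrefl G u≡v , Graph.irrefl H u≡v ]′
  }

_⊆_ : ∀ {n} → Graph n → Graph n → Set
G ⊆ H = ∀ u v → Adj G u v → Adj H u v

-- Forgets directions and loops.
fromRel : ∀ {n} {R : Rel (Fin n) 0ℓ} → Decidable R → Graph n
fromRel {R = R} R? = record
  { Adj    = λ u v → u ≢ v × (R u v ⊎ R v u)
  ; adj?   = λ u v → ¬? (u ≟ᶠ v) ×-dec (R? u v ⊎-dec R? v u)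
  ; symm   = λ (u≢v , r) → (u≢v ∘ sym) , Sum.swap r
  ; irrefl = λ u≡v (u≢v , _) → u≢v u≡v
  }

degree : ∀ {n} → Graph n → Fin n → ℕ
degree {n} G v = length (List.filter (adj? G v) (allFin n))

-- The default value n exceeds every degree, so this is the minimum as soon
-- as n ≥ 1.
δ : ∀ {n} → Graph n → ℕ
δ {n} G = min n (List.map (degree G) (allFin n))

Walk : ∀ {n} → Graph n → ℕ → Rel (Fin n) 0ℓ
Walk F zero    u v = u ≡ v
Walk F (suc k) u v = ∃ λ w → Adj F u w × Walk F k w v

walk? : ∀ {n} (F : Graph n) k → Decidable (Walk F k)
walk? F zero    u v = u ≟ᶠ v
walk? F (suc k) u v = anyᶠ? λ w → adj? F u w ×-dec walk? F k w v

walk-snoc : ∀ {n} (F : Graph n) k {u v w} → Walk F k u v → Adj F v w → Walk F (suc k) u w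
walk-snoc F zero    refl          a  = _ , a , refl
walk-snoc F (suc k) (x , b , wlk) a  = x , b , walk-snoc F k wlk a

walk-sym : ∀ {n} (F : Graph n) k → Symmetric (Walk F k)
walk-sym F zero    eq            = sym eq
walk-sym F (suc k) (x , a , wlk) = walk-snoc F k (walk-sym F k wlk) (Graph.symm F a)

-- The distance in F is the length of a shortest walk.
Distance≤ : ∀ {n} → Graph n → ℕ → Rel (Fin n) 0ℓ
Distance≤ F m u v = ∃ λ k → k ℕ.≤ m × Walk F k u v

distance≤? : ∀ {n} (F : Graph n) m → Decidable (Distance≤ F m)
distance≤? F m u v = map′
  (λ (k , k<1+m , wlk) → k , ℕ.s≤s⁻¹ k<1+m , wlk)
  (λ (k , k≤m   , wlk) → k , s≤s k≤m       , wlk)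
  (ℕₚ.anyUpTo? (λ k → walk? F k u v) (suc m))

power : ∀ {n} → Graph n → ℕ → Graph n
power F m = record
  { Adj    = λ u v → u ≢ v × Distance≤ F m u v
  ; adj?   = λ u v → ¬? (u ≟ᶠ v) ×-dec distance≤? F m u v
  ; symm   = λ (u≢v , k , k≤m , wlk) → (u≢v ∘ sym) , k , k≤m , walk-sym F k wlk
  ; irrefl = λ u≡v (u≢v , _) → u≢v u≡v
  }

next : ∀ {n} → Fin n → Fin n
next {n} i = _mod_ (suc (toℕ i)) n {{nonZeroIndex i}}

-- The closed walk σ₀ σ₁ … σₙ₋₁ σ₀; for n ≥ 3 and distinct entries this is a
-- Hamiltonian cycle, and every Hamiltonian cycle on Fin n is of this form.
cycle : ∀ {n} → Vec (Fin n) n → Graph n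
cycle {n} σ = fromRel {R = λ u v → ∃ λ i → lookup σ i ≡ u × lookup σ (next i) ≡ v}
  λ u v → anyᶠ? λ i → (lookup σ i ≟ᶠ u) ×-dec (lookup σ (next i) ≟ᶠ v)

𝒞 : (m n : ℕ) → Graph n → Set
𝒞 m n G = ∃ λ (σ : Vec (Fin n) n) → Injective _≡_ _≡_ (lookup σ) × power (cycle σ) m ⊆ G

anyVec? : ∀ {n} k {P : Vec (Fin n) k → Set} → (∀ v → Dec (P v)) → Dec (∃ P)
anyVec? zero    P? = map′ (Vec.[] ,_) (λ { (Vec.[] , p) → p }) (P? Vec.[])
anyVec? (suc k) P? = map′ (λ (i , v , p) → i Vec.∷ v , p) (λ { (i Vec.∷ v , p) → i , v , p })
  (anyᶠ? λ i → anyVec? k λ v → P? (i Vec.∷ v))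

𝒞? : ∀ m n (G : Graph n) → Dec (𝒞 m n G)
𝒞? m n G = anyVec? n λ σ → injective? σ ×-dec
  (allᶠ? λ u → allᶠ? λ v → adj? (power (cycle σ) m) u v →-dec adj? G u v)
  where
  injective? : ∀ σ → Dec (Injective _≡_ _≡_ (lookup σ))
  injective? σ = map′ (λ inj {i} {j} → inj i j) (λ inj i j → inj)
    (allᶠ? λ i → allᶠ? λ j → (lookup σ i ≟ᶠ lookup σ j) →-dec (i ≟ᶠ j))

------------------------------------------------------------------------
-- The binomial random graph

pairs : (n : ℕ) → List (Fin n × Fin n)
pairs n = List.filter (λ (i , j) → i <ᶠ? j) (cartesianProduct (allFin n) (allFin n))

-- All sublists; for a list without repetitions, each subset exactly once.
subsets : ∀ {A : Set} → List A → List (List A)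
subsets []       = [] ∷ []
subsets (x ∷ xs) = subsets xs ++ List.map (x ∷_) (subsets xs)

edgeGraph : ∀ {n} → List (Fin n × Fin n) → Graph n
edgeGraph E = fromRel {R = λ u v → (u , v) ∈ E} λ u v → (u , v) ∈? E
  where open DecMembership (≡-dec _≟ᶠ_ _≟ᶠ_) using (_∈?_)

-- The probability that G(n,p) has the property P.
ℙ[G_,_∈_] : ∀ n → ℝ → {P : Graph n → Set} → (∀ H → Dec (P H)) → ℝ
ℙ[G n , p ∈ P? ] = sumℝ (List.map weight (List.filter (P? ∘ edgeGraph) (subsets (pairs n))))
  where
  weight : List (Fin n × Fin n) → ℝ
  weight E = p ^ length E * (1ℝ - p) ^ (length (pairs n) ℕ.∸ length E)

module Submission where

-- G is a complete bipartite graph together with a few hubs joined to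
-- everything. An m-th power of a Hamiltonian cycle in G ∪ G(n,p) 2-colours the
-- cycle by the sides of G, and every monochromatic pair at distance at most m
-- that avoids the hubs must be an edge of G(n,p).  So the probability is at
-- most nⁿ pᵏ, where k is the least number of such pairs, and it tends to 0 once
-- k ≥ f(ℓₘ) n up to the pairs that meet hubs.
--
-- For this bound let z(t) be half the excess of opposite over equal colours
-- within distance m of t. Flips of single vertices that do not increase the
-- number of monochromatic pairs lead to a colouring in which z ≥ 0 and z varies
-- slowly along each run of equal colours. The claim is then that z is at most
-- Y/ℓ on average, where Y = ℓm − 2(C(ℓ,2) + C(m−ℓ+1,2)). It is proved run by
-- run, from the peak of z on the run; a run may exceed its budget, and
-- neighbouring runs then settle the difference by a payment κ at their common
-- boundary, which telescopes.

-- Colourings whose runs all have length ℓ attain the average Y/ℓ: there z sums to exactly Y on each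
-- run. Every estimate must therefore be sharp near this configuration, whose peak is m + 1 - ℓ. The
-- obstacle is that runs cannot be treated alone: at a colour change only z t + z (t + 1) ≤ 2 is
-- known, so a run may begin with z = 2 next to a vertex with z = 0. Moving that zero vertex into
-- the run restores a profile that rises from at most 1 at both ends. For a peak P above Y/ℓ and no
-- moved vertices the excess over the budget is at most `I P`, a quadratic that the optimality of ℓ,
-- in the form 2ℓ(ℓ - 1) ≤ m(m + 1) ≤ 2ℓ(ℓ + 1), keeps nonpositive at integers. κ is the price of
-- one moved vertex for which half of `I P` balances the receiver as well as the giver, whatever
-- their peaks. Two complications remain. A giver with a small peak can afford κ only from the area
-- missing at its ends, so it must be long. A short giver pays nothing; its receiver, if its peak is
-- well above Y/ℓ, sees across it to the next run of its own colour.

-- The quadratic inequalities that express optimality of ℓ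

module IntegerInequalities where

  open import Data.Integer.Base using (ℤ; +_; 0ℤ; 1ℤ; _+_; _*_; _-_; -_; _≤_; -[1+_]; +≤+; nonNegative; Positive)
  open import Data.Integer.Properties using (≤-refl; ≤-total; +-mono-≤; i≤j⇒0≤j-i; 0≤i-j⇒j≤i; *-monoˡ-≤-nonNeg; *-cancelˡ-≤-pos; *-zeroʳ)
  open import Data.Integer.Tactic.RingSolver using (solve-∀)
  open import Data.Nat.Base using (suc; z≤n)
  open import Data.Product.Base using (_,_; ∃)
  open import Data.Sum.Base using (_⊎_; inj₁; inj₂)
  open import Relation.Binary.PropositionalEquality

  ≤-by : ∀ {i j k} → 0ℤ ≤ k → k ≡ j - i → i ≤ j
  ≤-by 0≤k e = 0≤i-j⇒j≤i (subst (0ℤ ≤_) e 0≤k)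

  0≤+ : ∀ {i j} → 0ℤ ≤ i → 0ℤ ≤ j → 0ℤ ≤ i + j
  0≤+ = +-mono-≤

  0≤* : ∀ {i j} → 0ℤ ≤ i → 0ℤ ≤ j → 0ℤ ≤ i * j
  0≤* {i} {j} p q = subst (_≤ i * j) (*-zeroʳ i) (*-monoˡ-≤-nonNeg i {{nonNegative p}} q)

  0≤pos : ∀ {n} → 0ℤ ≤ + n
  0≤pos = +≤+ z≤n

  0≤*⇒0≤ : ∀ k {i} .{{_ : Positive k}} → 0ℤ ≤ k * i → 0ℤ ≤ i
  0≤*⇒0≤ k {i} p = *-cancelˡ-≤-pos 0ℤ i k (subst (_≤ k * i) (sym (*-zeroʳ k)) p)

  0≤v[v-1] : ∀ v → 0ℤ ≤ v * (v - 1ℤ)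
  0≤v[v-1] (+ 0)     = ≤-refl
  0≤v[v-1] (+ suc n) = 0≤* {+ suc n} {+ n} 0≤pos 0≤pos
  0≤v[v-1] -[1+ n ]  = 0≤pos

  0≤v² : ∀ v → 0ℤ ≤ v * v
  0≤v² (+ n)     = 0≤* {+ n} {+ n} 0≤pos 0≤pos
  0≤v² -[1+ n ]  = 0≤pos

  0≤∨0≤- : ∀ v → 0ℤ ≤ v ⊎ 0ℤ ≤ - v
  0≤∨0≤- (+ n)    = inj₁ 0≤pos
  0≤∨0≤- -[1+ n ] = inj₂ 0≤pos

  module Constants (L M : ℤ) (0≤L : 0ℤ ≤ L)
    (lower : + 2 * L * (L - 1ℤ) ≤ M * (M + 1ℤ)) (upper : M * (M + 1ℤ) ≤ + 2 * L * (L + 1ℤ)) where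

    -- Factored form of LM - 2(C(L,2) + C(M+1-L,2)).
    Y : ℤ
    Y = (M + 1ℤ - L) * (+ 2 * L - M)

    -- The excess L S - Y b of a block of length b = M + 1 - P whose profile has peak P and slope
    -- one at both ends, so that S = bP - P(P - 1). In terms of v = M + 1 - L - P it equals -(2L v²
    -- + (2L² - M(M + 1)) v), which vanishes at P = M + 1 - L.
    I : ℤ → ℤ
    I P = (M + 1ℤ - P) * (L * P - Y) - L * P * (P - 1ℤ)

    -- The price κ = L c - Y has two roles. Receiving a vertex adds L P - Y - L to the bound on the
    -- excess, giving one away removes L P - Y, and half of `I P` must bring these down to κ and -κ
    -- for every peak P. Doubled, the two conditions are `I-gain` and `I-loss`.
    record Slope (c : ℤ) : Set where
      field
        I≤0    : ∀ P → 0ℤ ≤ - I P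
        I-gain : ∀ P → 0ℤ ≤ - (I P + + 2 * L * (P - 1ℤ - c))
        I-loss : ∀ P → 0ℤ ≤ - (I P + + 2 * L * (c - P))
        c≤     : c ≤ M + 1ℤ - L
        ≤c     : M - L ≤ c
        c-cases : M * (M + 1ℤ) ≤ + 2 * L * L ⊎ c ≤ M - L

    private
      2L : 0ℤ ≤ + 2 * L
      2L = 0≤* {+ 2} 0≤pos 0≤L

      pos-v : ∀ {a b v} → 0ℤ ≤ a → 0ℤ ≤ b → 0ℤ ≤ v → 0ℤ ≤ + 2 * L * a + b * v
      pos-v p q r = 0≤+ (0≤* 2L p) (0≤* q r)

    -- The hypotheses place the linear coefficient 2L² - M(M + 1) of -I, as a polynomial in v,
    -- between -2L and 2L. Each claim then reduces to v² ≥ 0 or v(v - 1) ≥ 0 for integers v, once 2L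
    -- v is shifted between the two terms for negative v. The sign of the coefficient tells on which
    -- side of M + 1 - L the real maximiser of I lies, hence which c works.
    slope : ∃ Slope
    slope with ≤-total (M * (M + 1ℤ)) (+ 2 * L * L)
    ... | inj₁ h = M + 1ℤ - L , record
      { I≤0 = i
      ; I-gain = g
      ; I-loss = l
      ; c≤ = ≤-refl
      ; ≤c = ≤-by (0≤pos {1}) (e L M)
      ; c-cases = inj₁ h }
      where
      p = i≤j⇒0≤j-i h
      q = i≤j⇒0≤j-i lower
      e : ∀ L M → 1ℤ ≡ M + 1ℤ - L - (M - L)
      e = solve-∀
      i : ∀ P → 0ℤ ≤ - I P
      i P with 0≤∨0≤- (M + 1ℤ - P - L)
      ... | inj₁ r = subst (0ℤ ≤_) (eq L M P) (pos-v {(M + 1ℤ - P - L) * (M + 1ℤ - P - L)} (0≤v² (M + 1ℤ - P - L)) p r)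
        where
        eq : ∀ L M P → + 2 * L * ((M + 1ℤ - P - L) * (M + 1ℤ - P - L)) + (+ 2 * L * L - M * (M + 1ℤ)) * (M + 1ℤ - P - L) ≡ - ((M + 1ℤ - P) * (L * P - (M + 1ℤ - L) * (+ 2 * L - M)) - L * P * (P - 1ℤ))
        eq = solve-∀
      ... | inj₂ r = subst (0ℤ ≤_) (eq L M P) (pos-v {(- (M + 1ℤ - P - L)) * ((- (M + 1ℤ - P - L)) - 1ℤ)} (0≤v[v-1] (- (M + 1ℤ - P - L))) q r)
        where
        eq : ∀ L M P → + 2 * L * ((- (M + 1ℤ - P - L)) * ((- (M + 1ℤ - P - L)) - 1ℤ)) + (M * (M + 1ℤ) - + 2 * L * (L - 1ℤ)) * (- (M + 1ℤ - P - L)) ≡ - ((M + 1ℤ - P) * (L * P - (M + 1ℤ - L) * (+ 2 * L - M)) - L * P * (P - 1ℤ))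
        eq = solve-∀
      g : ∀ P → 0ℤ ≤ - (I P + + 2 * L * (P - 1ℤ - (M + 1ℤ - L)))
      g P with 0≤∨0≤- (M + 1ℤ - P - L)
      ... | inj₁ r = subst (0ℤ ≤_) (eq L M P) (pos-v {((M + 1ℤ - P - L) * (M + 1ℤ - P - L) + (M + 1ℤ - P - L) + 1ℤ)} (0≤+ (0≤+ (0≤v² (M + 1ℤ - P - L)) r) (0≤pos {1})) p r)
        where
        eq : ∀ L M P → + 2 * L * (((M + 1ℤ - P - L) * (M + 1ℤ - P - L) + (M + 1ℤ - P - L) + 1ℤ)) + (+ 2 * L * L - M * (M + 1ℤ)) * (M + 1ℤ - P - L) ≡ - (((M + 1ℤ - P) * (L * P - (M + 1ℤ - L) * (+ 2 * L - M)) - L * P * (P - 1ℤ)) + + 2 * L * (P - 1ℤ - (M + 1ℤ - L)))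
        eq = solve-∀
      ... | inj₂ r = subst (0ℤ ≤_) (eq L M P) (pos-v {((- (M + 1ℤ - P - L)) - 1ℤ) * ((- (M + 1ℤ - P - L)) - 1ℤ)} (0≤v² ((- (M + 1ℤ - P - L)) - 1ℤ)) q r)
        where
        eq : ∀ L M P → + 2 * L * (((- (M + 1ℤ - P - L)) - 1ℤ) * ((- (M + 1ℤ - P - L)) - 1ℤ)) + (M * (M + 1ℤ) - + 2 * L * (L - 1ℤ)) * (- (M + 1ℤ - P - L)) ≡ - (((M + 1ℤ - P) * (L * P - (M + 1ℤ - L) * (+ 2 * L - M)) - L * P * (P - 1ℤ)) + + 2 * L * (P - 1ℤ - (M + 1ℤ - L)))
        eq = solve-∀
      l : ∀ P → 0ℤ ≤ - (I P + + 2 * L * ((M + 1ℤ - L) - P))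
      l P with 0≤∨0≤- (M + 1ℤ - P - L)
      ... | inj₁ r = subst (0ℤ ≤_) (eq L M P) (pos-v {(M + 1ℤ - P - L) * ((M + 1ℤ - P - L) - 1ℤ)} (0≤v[v-1] (M + 1ℤ - P - L)) p r)
        where
        eq : ∀ L M P → + 2 * L * ((M + 1ℤ - P - L) * ((M + 1ℤ - P - L) - 1ℤ)) + (+ 2 * L * L - M * (M + 1ℤ)) * (M + 1ℤ - P - L) ≡ - (((M + 1ℤ - P) * (L * P - (M + 1ℤ - L) * (+ 2 * L - M)) - L * P * (P - 1ℤ)) + + 2 * L * ((M + 1ℤ - L) - P))
        eq = solve-∀
      ... | inj₂ r = subst (0ℤ ≤_) (eq L M P) (pos-v {(- (M + 1ℤ - P - L)) * (- (M + 1ℤ - P - L))} (0≤v² (- (M + 1ℤ - P - L))) q r)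
        where
        eq : ∀ L M P → + 2 * L * ((- (M + 1ℤ - P - L)) * (- (M + 1ℤ - P - L))) + (M * (M + 1ℤ) - + 2 * L * (L - 1ℤ)) * (- (M + 1ℤ - P - L)) ≡ - (((M + 1ℤ - P) * (L * P - (M + 1ℤ - L) * (+ 2 * L - M)) - L * P * (P - 1ℤ)) + + 2 * L * ((M + 1ℤ - L) - P))
        eq = solve-∀
    ... | inj₂ h = M - L , record
      { I≤0 = i
      ; I-gain = g
      ; I-loss = l
      ; c≤ = ≤-by (0≤pos {1}) (e L M)
      ; ≤c = ≤-refl
      ; c-cases = inj₂ ≤-refl }
      where
      p = i≤j⇒0≤j-i h
      q = i≤j⇒0≤j-i upper
      e : ∀ L M → 1ℤ ≡ M + 1ℤ - L - (M - L)
      e = solve-∀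
      i : ∀ P → 0ℤ ≤ - I P
      i P with 0≤∨0≤- (M + 1ℤ - P - L)
      ... | inj₁ r = subst (0ℤ ≤_) (eq L M P) (pos-v {(M + 1ℤ - P - L) * ((M + 1ℤ - P - L) - 1ℤ)} (0≤v[v-1] (M + 1ℤ - P - L)) q r)
        where
        eq : ∀ L M P → + 2 * L * ((M + 1ℤ - P - L) * ((M + 1ℤ - P - L) - 1ℤ)) + (+ 2 * L * (L + 1ℤ) - M * (M + 1ℤ)) * (M + 1ℤ - P - L) ≡ - ((M + 1ℤ - P) * (L * P - (M + 1ℤ - L) * (+ 2 * L - M)) - L * P * (P - 1ℤ))
        eq = solve-∀
      ... | inj₂ r = subst (0ℤ ≤_) (eq L M P) (pos-v {(- (M + 1ℤ - P - L)) * (- (M + 1ℤ - P - L))} (0≤v² (- (M + 1ℤ - P - L))) p r)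
        where
        eq : ∀ L M P → + 2 * L * ((- (M + 1ℤ - P - L)) * (- (M + 1ℤ - P - L))) + (M * (M + 1ℤ) - + 2 * L * L) * (- (M + 1ℤ - P - L)) ≡ - ((M + 1ℤ - P) * (L * P - (M + 1ℤ - L) * (+ 2 * L - M)) - L * P * (P - 1ℤ))
        eq = solve-∀
      g : ∀ P → 0ℤ ≤ - (I P + + 2 * L * (P - 1ℤ - (M - L)))
      g P with 0≤∨0≤- (M + 1ℤ - P - L)
      ... | inj₁ r = subst (0ℤ ≤_) (eq L M P) (pos-v {(M + 1ℤ - P - L) * (M + 1ℤ - P - L)} (0≤v² (M + 1ℤ - P - L)) q r)
        where
        eq : ∀ L M P → + 2 * L * ((M + 1ℤ - P - L) * (M + 1ℤ - P - L)) + (+ 2 * L * (L + 1ℤ) - M * (M + 1ℤ)) * (M + 1ℤ - P - L) ≡ - (((M + 1ℤ - P) * (L * P - (M + 1ℤ - L) * (+ 2 * L - M)) - L * P * (P - 1ℤ)) + + 2 * L * (P - 1ℤ - (M - L)))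
        eq = solve-∀
      ... | inj₂ r = subst (0ℤ ≤_) (eq L M P) (pos-v {(- (M + 1ℤ - P - L)) * ((- (M + 1ℤ - P - L)) - 1ℤ)} (0≤v[v-1] (- (M + 1ℤ - P - L))) p r)
        where
        eq : ∀ L M P → + 2 * L * ((- (M + 1ℤ - P - L)) * ((- (M + 1ℤ - P - L)) - 1ℤ)) + (M * (M + 1ℤ) - + 2 * L * L) * (- (M + 1ℤ - P - L)) ≡ - (((M + 1ℤ - P) * (L * P - (M + 1ℤ - L) * (+ 2 * L - M)) - L * P * (P - 1ℤ)) + + 2 * L * (P - 1ℤ - (M - L)))
        eq = solve-∀
      l : ∀ P → 0ℤ ≤ - (I P + + 2 * L * ((M - L) - P))
      l P with 0≤∨0≤- (M + 1ℤ - P - L)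
      ... | inj₁ r = subst (0ℤ ≤_) (eq L M P) (pos-v {((M + 1ℤ - P - L) - 1ℤ) * ((M + 1ℤ - P - L) - 1ℤ)} (0≤v² ((M + 1ℤ - P - L) - 1ℤ)) q r)
        where
        eq : ∀ L M P → + 2 * L * (((M + 1ℤ - P - L) - 1ℤ) * ((M + 1ℤ - P - L) - 1ℤ)) + (+ 2 * L * (L + 1ℤ) - M * (M + 1ℤ)) * (M + 1ℤ - P - L) ≡ - (((M + 1ℤ - P) * (L * P - (M + 1ℤ - L) * (+ 2 * L - M)) - L * P * (P - 1ℤ)) + + 2 * L * ((M - L) - P))
        eq = solve-∀
      ... | inj₂ r = subst (0ℤ ≤_) (eq L M P) (pos-v {((- (M + 1ℤ - P - L)) * (- (M + 1ℤ - P - L)) + (- (M + 1ℤ - P - L)) + 1ℤ)} (0≤+ (0≤+ (0≤v² (- (M + 1ℤ - P - L))) r) (0≤pos {1})) p r)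
        where
        eq : ∀ L M P → + 2 * L * (((- (M + 1ℤ - P - L)) * (- (M + 1ℤ - P - L)) + (- (M + 1ℤ - P - L)) + 1ℤ)) + (M * (M + 1ℤ) - + 2 * L * L) * (- (M + 1ℤ - P - L)) ≡ - (((M + 1ℤ - P) * (L * P - (M + 1ℤ - L) * (+ 2 * L - M)) - L * P * (P - 1ℤ)) + + 2 * L * ((M - L) - P))
        eq = solve-∀

-- A long low run can pay twice

module Surplus where

  open IntegerInequalities
  open import Data.Integer.Base using (ℤ; +_; 0ℤ; 1ℤ; _+_; _*_; _-_; -_; _≤_; +≤+)
  open import Data.Integer.Properties as ℤₚ using (i≤j⇒0≤j-i)
  open import Data.Integer.Tactic.RingSolver using (solve-∀)
  open import Data.Nat.Base using (ℕ; suc; NonZero) renaming (_+_ to _+ₙ_; _*_ to _*ₙ_; _≤_ to _≤ₙ_)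
  open import Data.Nat.DivMod using (_/_; _%_; m≡m%n+[m/n]*n; m%n<n)
  import Data.Nat.Properties as ℕₚ
  import Data.Nat.Tactic.RingSolver as ℕSolver
  open import Data.Empty using (⊥-elim)
  open import Data.Sum.Base using (_⊎_; inj₁; inj₂)
  open import Relation.Nullary.Negation using (¬_)
  open import Relation.Nullary.Decidable using (yes; no)
  open import Relation.Binary.PropositionalEquality

  -- The difference factor (H - 1)(G - H) is 2 H (G + 1) - (H + G)(H + 1).
  surplus-identity : ∀ L H G P φ → L ≡ H + G → H * (G + 1ℤ) ≡ L * P + φ →
    + 4 * L * ((P + 1ℤ) * (L * P + + 2 * φ) - + 2 * L * H)
    ≡ + 4 * (φ * (L - φ)) + L * L * ((H - 1ℤ) * (H - + 3))
      + (H - 1ℤ) * (G - H) * (L * (+ 2 * H + + 4) + (H - 1ℤ) * (G - H))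
  surplus-identity _ H G P φ refl e = trans (eq₁ H G P φ) (trans (cong (λ y → + 4 * (φ * (H + G - φ)) + + 4 * (y * (y + (H + G))) - + 8 * (H + G) * (H + G) * H) (sym e)) (eq₂ H G φ))
    where
    eq₁ : ∀ H G P φ → + 4 * (H + G) * ((P + 1ℤ) * ((H + G) * P + + 2 * φ) - + 2 * (H + G) * H)
        ≡ + 4 * (φ * (H + G - φ)) + + 4 * (((H + G) * P + φ) * (((H + G) * P + φ) + (H + G))) - + 8 * (H + G) * (H + G) * H
    eq₁ = solve-∀
    eq₂ : ∀ H G φ → + 4 * (φ * (H + G - φ)) + + 4 * (H * (G + 1ℤ) * (H * (G + 1ℤ) + (H + G))) - + 8 * (H + G) * (H + G) * H
        ≡ + 4 * (φ * (H + G - φ)) + (H + G) * (H + G) * ((H - 1ℤ) * (H - + 3))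
      + (H - 1ℤ) * (G - H) * ((H + G) * (+ 2 * H + + 4) + (H - 1ℤ) * (G - H))
    eq₂ = solve-∀

  -- With Y = L P + φ and κ = L c - Y this is 2κ ≤ L P (P - 1) + 2Pφ: the area missing at the ends
  -- of a block of height P, together with the distance of 2P vertices from the budget, covers two
  -- payments.
  SurplusBound : (L P φ c : ℤ) → Set
  SurplusBound L P φ c = 0ℤ ≤ (P + 1ℤ) * (L * P + + 2 * φ) - + 2 * L * c

  Division : ℕ → ℕ → ℕ → ℕ → Set
  Division h g P φ = h *ₙ suc g ≡ (h +ₙ g) *ₙ P +ₙ φ

  division-ℤ : ∀ h g P φ → Division h g P φ → + h * (+ g + 1ℤ) ≡ + (h +ₙ g) * + P + + φ
  division-ℤ h g P φ e = begin
    + h * (+ g + 1ℤ)              ≡⟨ cong (λ k → + h * + k) (ℕₚ.+-comm g 1) ⟩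
    + h * + suc g                 ≡⟨ ℤₚ.pos-* h (suc g) ⟨
    + (h *ₙ suc g)                ≡⟨ cong +_ e ⟩
    + ((h +ₙ g) *ₙ P) + + φ       ≡⟨ cong (_+ + φ) (ℤₚ.pos-* (h +ₙ g) P) ⟩
    + (h +ₙ g) * + P + + φ        ∎
    where open ≡-Reasoning

  surplus-antitone : ∀ {L P φ c c′} → 0ℤ ≤ L → c ≤ c′ → SurplusBound L P φ c′ → SurplusBound L P φ c
  surplus-antitone {L} {P} {φ} {c} {c′} 0≤L q p =
    subst (0ℤ ≤_) (eq ((P + 1ℤ) * (L * P + + 2 * φ)) L c c′) (0≤+ p (0≤* (0≤* {+ 2} 0≤pos 0≤L) (i≤j⇒0≤j-i q)))
    where
    eq : ∀ A L c c′ → A - + 2 * L * c′ + + 2 * L * (c′ - c) ≡ A - + 2 * L * c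
    eq = solve-∀

  0≤cast- : ∀ {a b} → a ≤ₙ b → 0ℤ ≤ + b - + a
  0≤cast- p = i≤j⇒0≤j-i (+≤+ p)

  -- For H = 2 the factor (H - 1)(H - 3) of the identity is -1, so a direct argument is needed. The
  -- division with P = 1 forces φ = g; from P = 2 on the term L P (P + 1) suffices by itself.
  surplus-h=2 : ∀ g P φ → 2 ≤ₙ g → 1 ≤ₙ P → Division 2 g P φ → SurplusBound (+ (2 +ₙ g)) (+ P) (+ φ) (+ 2)
  surplus-h=2 g 1 φ h≤g _ e =
    subst (λ f → SurplusBound (+ (2 +ₙ g)) 1ℤ (+ f) (+ 2)) g≡φ
      (subst (0ℤ ≤_) (eq (+ g)) (0≤* {+ 2} 0≤pos (0≤cast- h≤g)))
    where
    eq′ : ∀ g → (2 +ₙ g) +ₙ g ≡ 2 *ₙ suc g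
    eq′ = ℕSolver.solve-∀
    g≡φ : g ≡ φ
    g≡φ = ℕₚ.+-cancelˡ-≡ (2 +ₙ g) g φ (trans (eq′ g) (trans e (cong (_+ₙ φ) (ℕₚ.*-identityʳ (2 +ₙ g)))))
    eq : ∀ G → + 2 * (G - + 2) ≡ (1ℤ + 1ℤ) * ((+ 2 + G) * 1ℤ + + 2 * G) - + 2 * (+ 2 + G) * + 2
    eq = solve-∀
  surplus-h=2 g (suc (suc p)) φ h≤g _ e =
    subst (0ℤ ≤_) (eq (+ (2 +ₙ g)) (+ p) (+ φ))
      (0≤+ (0≤* (0≤pos {2 +ₙ g}) (0≤+ (0≤+ (0≤* (0≤pos {p}) (0≤pos {p})) (0≤* (0≤pos {5}) (0≤pos {p}))) (0≤pos {2})))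
           (0≤* (0≤pos {2}) (0≤* (0≤+ (0≤pos {p}) (0≤pos {3})) (0≤pos {φ}))))
    where
    eq : ∀ L p φ → L * (p * p + + 5 * p + + 2) + + 2 * ((p + + 3) * φ)
                ≡ (+ 2 + p + 1ℤ) * (L * (+ 2 + p) + + 2 * φ) - + 2 * L * + 2
    eq = solve-∀

  surplus-h≢2 : ∀ h g P φ .{{_ : NonZero (h +ₙ g)}} → 0ℤ ≤ (+ h - 1ℤ) * (+ h - + 3) → 0ℤ ≤ (+ h - 1ℤ) * (+ g - + h) →
    φ ≤ₙ h +ₙ g → Division h g P φ → SurplusBound (+ (h +ₙ g)) (+ P) (+ φ) (+ h)
  surplus-h≢2 h g P φ q f φ≤L e with h +ₙ g in eq
  ... | suc l = 0≤*⇒0≤ (+ 4 * + suc l)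
      (subst (0ℤ ≤_) (sym (surplus-identity (+ suc l) (+ h) (+ g) (+ P) (+ φ) (cong +_ (sym eq)) (trans (division-ℤ h g P φ e′) (cong (λ l → + l * + P + + φ) eq))))
      (0≤+ (0≤+ (0≤* (0≤pos {4}) (0≤* (0≤pos {φ}) (0≤cast- φ≤L))) (0≤* (0≤pos {suc l *ₙ suc l}) q))
           (0≤* f (0≤+ (0≤* (0≤pos {suc l}) (0≤+ (0≤* (0≤pos {2}) (0≤pos {h})) (0≤pos {4}))) f))))
    where
    e′ : Division h g P φ
    e′ = trans e (cong (λ l → l *ₙ P +ₙ φ) (sym eq))

  surplus-wide : ∀ h g P φ → 1 ≤ₙ h → h ≤ₙ g → 1 ≤ₙ P → φ ≤ₙ h +ₙ g → Division h g P φ →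
                 SurplusBound (+ (h +ₙ g)) (+ P) (+ φ) (+ h)
  surplus-wide 1 g P φ _ h≤g 1≤P φ≤L e = surplus-h≢2 1 g P φ 0≤pos 0≤pos φ≤L e
  surplus-wide 2 g P φ _ h≤g 1≤P φ≤L e = surplus-h=2 g P φ h≤g 1≤P e
  surplus-wide (suc (suc (suc h))) g P φ _ h≤g 1≤P φ≤L e =
    surplus-h≢2 (3 +ₙ h) g P φ (0≤* (0≤pos {2 +ₙ h}) (0≤pos {h})) (0≤* (0≤pos {2 +ₙ h}) (0≤cast- h≤g)) φ≤L e

  exceeds : ∀ {a b} d → a ≡ b +ₙ suc d → ¬ a ≤ₙ b
  exceeds d refl = ℕₚ.m+1+n≰m _

  -- The pairs with g < h that satisfy 2h² ≤ g² + 3g + 4h, the upper optimality condition.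
  data Narrow : ℕ → ℕ → Set where
    n10 : Narrow 1 0
    n20 : Narrow 2 0
    n21 : Narrow 2 1
    n32 : Narrow 3 2
    n43 : Narrow 4 3

  narrow : ∀ g k → 2 *ₙ (suc g +ₙ k) *ₙ (suc g +ₙ k) ≤ₙ g *ₙ g +ₙ 3 *ₙ g +ₙ 4 *ₙ (suc g +ₙ k) → Narrow (suc g +ₙ k) g
  narrow 0 0 _ = n10
  narrow 1 0 _ = n21
  narrow 2 0 _ = n32
  narrow 3 0 _ = n43
  narrow (suc (suc (suc (suc g)))) 0 le = ⊥-elim (exceeds _ (eq g) le)
    where
    eq : ∀ g → 2 *ₙ (suc (4 +ₙ g) +ₙ 0) *ₙ (suc (4 +ₙ g) +ₙ 0)
             ≡ ((4 +ₙ g) *ₙ (4 +ₙ g) +ₙ 3 *ₙ (4 +ₙ g) +ₙ 4 *ₙ (suc (4 +ₙ g) +ₙ 0)) +ₙ suc (1 +ₙ 5 *ₙ g +ₙ g *ₙ g)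
    eq = ℕSolver.solve-∀
  narrow 0 1 _ = n20
  narrow (suc g) 1 le = ⊥-elim (exceeds _ (eq g) le)
    where
    eq : ∀ g → 2 *ₙ (suc (1 +ₙ g) +ₙ 1) *ₙ (suc (1 +ₙ g) +ₙ 1)
             ≡ ((1 +ₙ g) *ₙ (1 +ₙ g) +ₙ 3 *ₙ (1 +ₙ g) +ₙ 4 *ₙ (suc (1 +ₙ g) +ₙ 1)) +ₙ suc (1 +ₙ 3 *ₙ g +ₙ g *ₙ g)
    eq = ℕSolver.solve-∀
  narrow g (suc (suc k)) le = ⊥-elim (exceeds _ (eq g k) le)
    where
    eq : ∀ g k → 2 *ₙ (suc g +ₙ (2 +ₙ k)) *ₙ (suc g +ₙ (2 +ₙ k))
             ≡ (g *ₙ g +ₙ 3 *ₙ g +ₙ 4 *ₙ (suc g +ₙ (2 +ₙ k))) +ₙ suc (5 +ₙ 5 *ₙ g +ₙ g *ₙ g +ₙ 4 *ₙ g *ₙ k +ₙ 2 *ₙ k *ₙ k +ₙ 8 *ₙ k)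
    eq = ℕSolver.solve-∀

  -- For h > g the admissible pairs are few and the bound is checked by
  -- evaluation; all but (1, 0) need c < h.
  surplus-narrow : ∀ h g .{{_ : NonZero (h +ₙ g)}} c → Narrow h g → c ≤ + h →
    2 *ₙ h *ₙ h ≤ₙ g *ₙ g +ₙ g +ₙ 2 *ₙ h ⊎ c ≤ + h - 1ℤ →
    SurplusBound (+ (h +ₙ g)) (+ (h *ₙ suc g / (h +ₙ g))) (+ (h *ₙ suc g % (h +ₙ g))) c
  surplus-narrow 1 0 c n10 c≤ _        = surplus-antitone {+ 1} {+ 1} {+ 0} 0≤pos c≤ 0≤pos
  surplus-narrow 2 0 c n20 _ (inj₂ c≤) = surplus-antitone {+ 2} {+ 1} {+ 0} 0≤pos c≤ 0≤pos
  surplus-narrow 2 1 c n21 _ (inj₂ c≤) = surplus-antitone {+ 3} {+ 1} {+ 1} 0≤pos c≤ 0≤pos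
  surplus-narrow 3 2 c n32 _ (inj₂ c≤) = surplus-antitone {+ 5} {+ 1} {+ 4} 0≤pos c≤ 0≤pos
  surplus-narrow 4 3 c n43 _ (inj₂ c≤) = surplus-antitone {+ 7} {+ 2} {+ 2} 0≤pos c≤ 0≤pos
  surplus-narrow 2 0 c n20 _ (inj₁ le) = ⊥-elim (ℕₚ.m+1+n≰m 4 {3} le)
  surplus-narrow 2 1 c n21 _ (inj₁ le) = ⊥-elim (ℕₚ.m+1+n≰m 6 {1} le)
  surplus-narrow 3 2 c n32 _ (inj₁ le) = ⊥-elim (ℕₚ.m+1+n≰m 12 {5} le)
  surplus-narrow 4 3 c n43 _ (inj₁ le) = ⊥-elim (ℕₚ.m+1+n≰m 20 {11} le)

  surplus : ∀ h g .{{_ : NonZero (h +ₙ g)}} c → 1 ≤ₙ h → 1 ≤ₙ h *ₙ suc g / (h +ₙ g) →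
    2 *ₙ h *ₙ h ≤ₙ g *ₙ g +ₙ 3 *ₙ g +ₙ 4 *ₙ h → c ≤ + h →
    2 *ₙ h *ₙ h ≤ₙ g *ₙ g +ₙ g +ₙ 2 *ₙ h ⊎ c ≤ + h - 1ℤ →
    SurplusBound (+ (h +ₙ g)) (+ (h *ₙ suc g / (h +ₙ g))) (+ (h *ₙ suc g % (h +ₙ g))) c
  surplus h g c 1≤h 1≤P opt c≤h cases with h ℕₚ.≤? g
  ... | yes h≤g = surplus-antitone {+ (h +ₙ g)} {+ P} {+ φ} 0≤pos c≤h
    (surplus-wide h g P φ 1≤h h≤g 1≤P (ℕₚ.<⇒≤ (m%n<n Y (h +ₙ g))) division)
    where
    Y = h *ₙ suc g
    P = Y / (h +ₙ g)
    φ = Y % (h +ₙ g)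
    division : Division h g P φ
    division = trans (m≡m%n+[m/n]*n Y (h +ₙ g)) (trans (ℕₚ.+-comm φ _) (cong (_+ₙ φ) (ℕₚ.*-comm P (h +ₙ g))))
  ... | no h≰g = surplus-narrow h g c (subst (λ h → Narrow h g) h≡ (narrow g k (subst (λ h → 2 *ₙ h *ₙ h ≤ₙ g *ₙ g +ₙ 3 *ₙ g +ₙ 4 *ₙ h) (sym h≡) opt))) c≤h cases
    where
    k = h Data.Nat.Base.∸ suc g
    h≡ : suc g +ₙ k ≡ h
    h≡ = ℕₚ.m+[n∸m]≡n (ℕₚ.≰⇒> h≰g)

-- Arithmetic of the payments of one block

module BlockPayments where

  open IntegerInequalities
  open import Data.Integer.Base using (ℤ; +_; 0ℤ; 1ℤ; _+_; _*_; _-_; -_; _≤_)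
  open import Data.Integer.Properties as ℤₚ using (i≤j⇒0≤j-i; ≤-refl)
  open import Data.Integer.Tactic.RingSolver using (solve-∀)
  open import Data.Sum.Base using (_⊎_; inj₁; inj₂)
  open import Relation.Binary.PropositionalEquality

  -- S is the sum of z over a block of length b with peak value P; g counts the
  -- vertices the block receives and g′ those its run gives away, and gᶜ, gᵈ the
  -- parts of g, g′ for which κ is paid.
  module BlockArithmetic (L M : ℤ) (0≤L : 0ℤ ≤ L)
    (lower : + 2 * L * (L - 1ℤ) ≤ M * (M + 1ℤ)) (upper : M * (M + 1ℤ) ≤ + 2 * L * (L + 1ℤ))
    (c : ℤ) (slope : Constants.Slope L M 0≤L lower upper c)
    (S b g gᶜ g′ gᵈ : ℤ) (0≤g : 0ℤ ≤ g) (0≤gᶜ : 0ℤ ≤ gᶜ) (gᶜ≤g : gᶜ ≤ g) (0≤g′ : 0ℤ ≤ g′) (gᶜ+g′≤2 : gᶜ + g′ ≤ + 2) where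

    open Constants L M 0≤L lower upper hiding (slope)
    open Slope slope

    -- Here κ is `L * c - Y`, and `L * S - Y * b` is the excess of the block over its budget.
    Paid : Set
    Paid = 0ℤ ≤ (L * c - Y) * (gᶜ - gᵈ) - (L * S - Y * b)

    module _ (P : ℤ) (area : S + g + P * (P - 1ℤ) ≤ b * P) where

      -- Each of the two ends of the block is credited with half of `I P`, whence the factor 2. At
      -- an end with a paid received vertex L P - Y - L + I/2 ≤ κ by `I-gain`; at an end that gives
      -- one away -(L P - Y) + I/2 ≤ -κ by `I-loss`; elsewhere I/2 ≤ 0.
      high-long : 0ℤ ≤ L * P - Y → gᵈ ≡ g′ →
        0ℤ ≤ (M + 1ℤ - P) * (L * P - Y) + (gᶜ - g′) * (L * P - Y) - gᶜ * L - (b * (L * P - Y) - g * L) → Paid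
      high-long P≥ refl bound = 0≤*⇒0≤ (+ 2) (subst (0ℤ ≤_) (eq L Y c S b g gᶜ g′ P M)
        (0≤+ (0≤+ (0≤+ (0≤* (0≤pos {2}) bound) (0≤* (0≤* (0≤pos {2}) 0≤L) (i≤j⇒0≤j-i area)))
                  (0≤+ (0≤* 0≤gᶜ (I-gain P)) (0≤* 0≤g′ (I-loss P))))
             (0≤* (i≤j⇒0≤j-i gᶜ+g′≤2) (I≤0 P))))
        where
        eq : ∀ L Y c S b g gᶜ g′ P M → let I = (M + 1ℤ - P) * (L * P - Y) - L * P * (P - 1ℤ) in
          + 2 * ((M + 1ℤ - P) * (L * P - Y) + (gᶜ - g′) * (L * P - Y) - gᶜ * L - (b * (L * P - Y) - g * L))
            + + 2 * L * (b * P - (S + g + P * (P - 1ℤ)))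
            + (gᶜ * - (I + + 2 * L * (P - 1ℤ - c)) + g′ * - (I + + 2 * L * (c - P)))
            + (+ 2 - (gᶜ + g′)) * - I
          ≡ + 2 * ((L * c - Y) * (gᶜ - g′) - (L * S - Y * b))
        eq = solve-∀

      -- A gift without payment is harmless for a high block: it only takes L P - Y ≥ 0 off the
      -- bound on the excess.
      high-short : 0ℤ ≤ L * P - Y → gᵈ ≡ 0ℤ →
        0ℤ ≤ (M + 1ℤ - P) * (L * P - Y) + (gᶜ - g′) * (L * P - Y) - gᶜ * L - (b * (L * P - Y) - g * L) → Paid
      high-short P≥ refl bound = 0≤*⇒0≤ (+ 2) (subst (0ℤ ≤_) (eq L Y c S b g gᶜ g′ P M)
        (0≤+ (0≤+ (0≤+ (0≤* (0≤pos {2}) bound) (0≤* (0≤* (0≤pos {2}) 0≤L) (i≤j⇒0≤j-i area)))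
                  (0≤+ (0≤* 0≤gᶜ (I-gain P)) (0≤* (0≤* (0≤pos {2}) 0≤g′) P≥)))
             (0≤* (0≤+ (i≤j⇒0≤j-i gᶜ+g′≤2) 0≤g′) (I≤0 P))))
        where
        eq : ∀ L Y c S b g gᶜ g′ P M → let I = (M + 1ℤ - P) * (L * P - Y) - L * P * (P - 1ℤ) in
          + 2 * ((M + 1ℤ - P) * (L * P - Y) + (gᶜ - g′) * (L * P - Y) - gᶜ * L - (b * (L * P - Y) - g * L))
            + + 2 * L * (b * P - (S + g + P * (P - 1ℤ)))
            + (gᶜ * - (I + + 2 * L * (P - 1ℤ - c)) + + 2 * g′ * (L * P - Y))
            + (+ 2 - (gᶜ + g′) + g′) * - I
          ≡ + 2 * ((L * c - Y) * (gᶜ - 0ℤ) - (L * S - Y * b))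
        eq = solve-∀

      high : 0ℤ ≤ L * P - Y → gᵈ ≡ g′ ⊎ gᵈ ≡ 0ℤ →
        0ℤ ≤ (M + 1ℤ - P) * (L * P - Y) + (gᶜ - g′) * (L * P - Y) - gᶜ * L - (b * (L * P - Y) - g * L) → Paid
      high P≥ (inj₁ e) = high-long P≥ e
      high P≥ (inj₂ e) = high-short P≥ e

      -- All runs beyond short givers are visible from the peak.
      high-visible : 0ℤ ≤ L * P - Y → gᵈ ≡ g′ ⊎ gᵈ ≡ 0ℤ → b ≤ M + 1ℤ - P + gᶜ - g′ → Paid
      high-visible P≥ d b≤ = high P≥ d (subst (0ℤ ≤_) (eq L Y b g gᶜ g′ P M)
        (0≤+ (0≤* (i≤j⇒0≤j-i b≤) P≥) (0≤* (i≤j⇒0≤j-i gᶜ≤g) 0≤L)))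
        where
        eq : ∀ L Y b g gᶜ g′ P M → (M + 1ℤ - P + gᶜ - g′ - b) * (L * P - Y) + (g - gᶜ) * L
           ≡ (M + 1ℤ - P) * (L * P - Y) + (gᶜ - g′) * (L * P - Y) - gᶜ * L - (b * (L * P - Y) - g * L)
        eq = solve-∀

      -- Just above the budget level an unpaid received vertex pays for itself: it lengthens the
      -- block at the cost L P - Y, while having z = 0 saves L, which is at least as much.
      high-near : 0ℤ ≤ L * P - Y → 0ℤ ≤ L - (L * P - Y) → gᵈ ≡ g′ ⊎ gᵈ ≡ 0ℤ → b ≤ M + 1ℤ - P + g - g′ → Paid
      high-near P≥ P≤ d b≤ = high P≥ d (subst (0ℤ ≤_) (eq L Y b g gᶜ g′ P M)
        (0≤+ (0≤* (i≤j⇒0≤j-i b≤) P≥) (0≤* (i≤j⇒0≤j-i gᶜ≤g) P≤)))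
        where
        eq : ∀ L Y b g gᶜ g′ P M → (M + 1ℤ - P + g - g′ - b) * (L * P - Y) + (g - gᶜ) * (L - (L * P - Y))
           ≡ (M + 1ℤ - P) * (L * P - Y) + (gᶜ - g′) * (L * P - Y) - gᶜ * L - (b * (L * P - Y) - g * L)
        eq = solve-∀

    module _ (P : ℤ) (P≤ : 0ℤ ≤ Y - L * P) where

      -- κ may be negative, but the L saved by a received vertex always makes up for it.
      0≤κ+L : 0ℤ ≤ L * c - Y + L
      0≤κ+L = subst (0ℤ ≤_) (eq L M c) (0≤+ (0≤* 0≤L (i≤j⇒0≤j-i ≤c)) (0≤v[v-1] (M + 1ℤ - L)))
        where
        eq : ∀ L M c → L * (c - (M - L)) + (M + 1ℤ - L) * (M + 1ℤ - L - 1ℤ)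
           ≡ L * c - (M + 1ℤ - L) * (+ 2 * L - M) + L
        eq = solve-∀

      -- The bound by the constant P ≤ Y/L suffices here: each received vertex saves L, and whatever
      -- is paid at the price κ ≤ 0 is a gain.
      low-flat : S + g ≤ b * P → 0ℤ ≤ b → 0ℤ ≤ gᵈ → gᵈ ≡ 0ℤ ⊎ 0ℤ ≤ - (L * c - Y) → Paid
      low-flat area 0≤b 0≤gᵈ d = subst (0ℤ ≤_) (eq L Y c S b g gᶜ gᵈ P)
        (0≤+ (0≤+ (0≤+ (0≤* 0≤L (i≤j⇒0≤j-i area)) (0≤* 0≤b P≤))
                  (0≤+ (0≤* 0≤κ+L 0≤gᶜ) (0≤* 0≤L (i≤j⇒0≤j-i gᶜ≤g)))) (unpaid d))
        where
        unpaid : gᵈ ≡ 0ℤ ⊎ 0ℤ ≤ - (L * c - Y) → 0ℤ ≤ - (L * c - Y) * gᵈ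
        unpaid (inj₁ refl) = subst (0ℤ ≤_) (sym (ℤₚ.*-zeroʳ (- (L * c - Y)))) ≤-refl
        unpaid (inj₂ h)    = 0≤* h 0≤gᵈ
        eq : ∀ L Y c S b g gᶜ gᵈ P →
          L * (b * P - (S + g)) + b * (Y - L * P) + ((L * c - Y + L) * gᶜ + L * (g - gᶜ)) + - (L * c - Y) * gᵈ
          ≡ (L * c - Y) * (gᶜ - gᵈ) - (L * S - Y * b)
        eq = solve-∀

      -- The worst case is two payments; they come from the area P(P - 1) missing at the two ends
      -- and from 2P vertices, each Y - L P below the budget.
      low-long : S + P * (P - 1ℤ) ≤ b * P → + 2 * P ≤ b → gᵈ ≤ + 2 → 0ℤ ≤ L * c - Y →
        0ℤ ≤ L * P * (P - 1ℤ) + + 2 * P * (Y - L * P) - + 2 * (L * c - Y) → Paid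
      low-long area b≥ gᵈ≤2 0≤κ surplus = subst (0ℤ ≤_) (eq L Y c S b gᶜ gᵈ P)
        (0≤+ (0≤+ (0≤+ (0≤* 0≤L (i≤j⇒0≤j-i area)) (0≤* (i≤j⇒0≤j-i b≥) P≤)) surplus)
             (0≤+ (0≤* 0≤κ (i≤j⇒0≤j-i gᵈ≤2)) (0≤* 0≤κ 0≤gᶜ)))
        where
        eq : ∀ L Y c S b gᶜ gᵈ P →
          L * (b * P - (S + P * (P - 1ℤ))) + (b - + 2 * P) * (Y - L * P)
            + (L * P * (P - 1ℤ) + + 2 * P * (Y - L * P) - + 2 * (L * c - Y))
            + ((L * c - Y) * (+ 2 - gᵈ) + (L * c - Y) * gᶜ)
          ≡ (L * c - Y) * (gᶜ - gᵈ) - (L * S - Y * b)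
        eq = solve-∀

-- The constants attached to the optimal ℓ

module OptimumConstants where

  open IntegerInequalities
  open Surplus
  open import Data.Integer.Base using (ℤ; +_; 0ℤ; 1ℤ; _+_; _*_; _-_; -_; _≤_)
  open import Data.Integer.Properties as ℤₚ using (i≤j⇒0≤j-i)
  open import Data.Integer.Tactic.RingSolver using (solve-∀)
  open import Data.Nat.Base using (ℕ; suc; NonZero; >-nonZero) renaming (_+_ to _+ₙ_; _*_ to _*ₙ_; _≤_ to _≤ₙ_; _<_ to _<ₙ_)
  open import Data.Nat.DivMod using (_/_; _%_; m≡m%n+[m/n]*n; m%n<n; m≥n⇒m/n>0)
  import Data.Nat.Properties as ℕₚ
  open import Data.Product.Base using (proj₁; proj₂)
  import Data.Sum.Base as Sum
  open import Relation.Binary.PropositionalEquality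

  -- The substitution is h = m - ℓ + 1 and e = ℓ - h; in these terms `lower` and `upper` say 2ℓ(ℓ -
  -- 1) ≤ m(m + 1) ≤ 2ℓ(ℓ + 1).
  module Optimum (m h e : ℕ) (1≤h : 1 ≤ₙ h) (m≡ : suc m ≡ h +ₙ e +ₙ h)
    (lower : e *ₙ e ≤ₙ 2 *ₙ h *ₙ h +ₙ e) (upper : 2 *ₙ h *ₙ h ≤ₙ e *ₙ e +ₙ 3 *ₙ e +ₙ 4 *ₙ h) where

    ℓ : ℕ
    ℓ = h +ₙ e

    instance
      ℓ≢0 : NonZero ℓ
      ℓ≢0 = >-nonZero (ℕₚ.≤-trans 1≤h (ℕₚ.m≤m+n h e))

    Y : ℕ
    Y = h *ₙ suc e

    abstract
      -- Separates low from high peaks: if z ≤ `P̂` throughout a block, the block is within its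
      -- budget vertex by vertex.
      P̂ ρ : ℕ
      P̂ = Y / ℓ
      ρ = Y % ℓ

      Y≡ : Y ≡ ℓ *ₙ P̂ +ₙ ρ
      Y≡ = trans (m≡m%n+[m/n]*n Y ℓ) (trans (ℕₚ.+-comm ρ _) (cong (_+ₙ ρ) (ℕₚ.*-comm P̂ ℓ)))

      ρ<ℓ : ρ <ₙ ℓ
      ρ<ℓ = m%n<n Y ℓ

      1≤P̂ : 1 ≤ₙ P̂
      1≤P̂ = m≥n⇒m/n>0 (begin
        h +ₙ e          ≤⟨ ℕₚ.+-monoʳ-≤ h (ℕₚ.m≤n*m e h {{>-nonZero 1≤h}}) ⟩
        h +ₙ h *ₙ e     ≡⟨ ℕₚ.*-suc h e ⟨
        Y               ∎)
        where open ℕₚ.≤-Reasoning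

    private
      H E L M : ℤ
      H = + h
      E = + e
      L = + ℓ
      M = + m

      abstract

        M≡ : M ≡ H + E + H - 1ℤ
        M≡ = trans (sym (eq M)) (cong (_- 1ℤ) (trans (cong +_ (ℕₚ.+-comm m 1)) (cong +_ m≡)))
          where
          eq : ∀ M → M + 1ℤ - 1ℤ ≡ M
          eq = solve-∀

        pos-*₃ : ∀ k a b → + (k *ₙ a *ₙ b) ≡ + k * + a * + b
        pos-*₃ k a b = trans (ℤₚ.pos-* (k *ₙ a) b) (cong (_* + b) (ℤₚ.pos-* k a))

        lowerℤ : + 2 * L * (L - 1ℤ) ≤ M * (M + 1ℤ)
        lowerℤ = ≤-by (0≤cast- lower) (trans (cong₂ (λ a b → a + E - b) (pos-*₃ 2 h h) (ℤₚ.pos-* e e))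
          (trans (eq H E) (cong (λ M → M * (M + 1ℤ) - + 2 * L * (L - 1ℤ)) (sym M≡))))
          where
          eq : ∀ H E → + 2 * H * H + E - E * E
             ≡ (H + E + H - 1ℤ) * (H + E + H - 1ℤ + 1ℤ) - + 2 * (H + E) * (H + E - 1ℤ)
          eq = solve-∀

        upperℤ : M * (M + 1ℤ) ≤ + 2 * L * (L + 1ℤ)
        upperℤ = ≤-by (0≤cast- upper)
          (trans (cong₂ _-_ (cong₂ _+_ (cong₂ _+_ (ℤₚ.pos-* e e) (ℤₚ.pos-* 3 e)) (ℤₚ.pos-* 4 h)) (pos-*₃ 2 h h))
          (trans (eq H E) (cong (λ M → + 2 * L * (L + 1ℤ) - M * (M + 1ℤ)) (sym M≡))))
          where
          eq : ∀ H E → E * E + + 3 * E + + 4 * H - + 2 * H * H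
             ≡ + 2 * (H + E) * (H + E + 1ℤ) - (H + E + H - 1ℤ) * (H + E + H - 1ℤ + 1ℤ)
          eq = solve-∀

    open Constants (+ ℓ) (+ m) (0≤pos {ℓ}) lowerℤ upperℤ public renaming (Y to Yℤ)

    abstract
      s : ℤ
      s = proj₁ slope

      s-slope : Slope s
      s-slope = proj₂ slope

      Yℤ≡Y : Yℤ ≡ + Y
      Yℤ≡Y = trans (cong (λ M → (M + 1ℤ - L) * (+ 2 * L - M)) M≡)
        (trans (eq H E) (trans (cong (λ k → + h * + k) (ℕₚ.+-comm e 1)) (sym (ℤₚ.pos-* h (suc e)))))
        where
        eq : ∀ H E → (H + E + H - 1ℤ + 1ℤ - (H + E)) * (+ 2 * (H + E) - (H + E + H - 1ℤ)) ≡ H * (E + 1ℤ)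
        eq = solve-∀

      slope-bound : SurplusBound L (+ P̂) (+ ρ) s
      slope-bound = surplus h e s 1≤h 1≤P̂ upper s≤h (Sum.map flat steep (Slope.c-cases s-slope))
        where
        s≤h : s ≤ H
        s≤h = subst (s ≤_) (trans (cong (λ M → M + 1ℤ - L) M≡) (eq H E)) (Slope.c≤ s-slope)
          where
          eq : ∀ H E → H + E + H - 1ℤ + 1ℤ - (H + E) ≡ H
          eq = solve-∀
        steep : s ≤ M - L → s ≤ H - 1ℤ
        steep = subst (s ≤_) (trans (cong (λ M → M - L) M≡) (eq H E))
          where
          eq : ∀ H E → H + E + H - 1ℤ - (H + E) ≡ H - 1ℤ
          eq = solve-∀
        flat : M * (M + 1ℤ) ≤ + 2 * L * L → 2 *ₙ h *ₙ h ≤ₙ e *ₙ e +ₙ e +ₙ 2 *ₙ h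
        flat q = ℤₚ.drop‿+≤+ (≤-by (i≤j⇒0≤j-i q)
          (trans (cong (λ M → + 2 * L * L - M * (M + 1ℤ)) M≡)
          (trans (eq H E) (cong₂ _-_ (cong₂ _+_ (cong (_+ E) (sym (ℤₚ.pos-* e e))) (sym (ℤₚ.pos-* 2 h))) (sym (pos-*₃ 2 h h))))))
          where
          eq : ∀ H E → + 2 * (H + E) * (H + E) - (H + E + H - 1ℤ) * (H + E + H - 1ℤ + 1ℤ)
             ≡ E * E + E + + 2 * H - + 2 * H * H
          eq = solve-∀

      Yℤ≡LP̂+ρ : Yℤ ≡ L * + P̂ + + ρ
      Yℤ≡LP̂+ρ = trans Yℤ≡Y (trans (cong +_ Y≡) (cong (_+ + ρ) (ℤₚ.pos-* ℓ P̂)))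

    κ : ℤ
    κ = L * s - Yℤ

    abstract

      low-surplus : 0ℤ ≤ L * + P̂ * (+ P̂ - 1ℤ) + + 2 * + P̂ * (Yℤ - L * + P̂) - + 2 * (L * s - Yℤ)
      low-surplus = subst (0ℤ ≤_) (eq L (+ P̂) (+ ρ) s Yℤ Yℤ≡LP̂+ρ) slope-bound
        where
        eq′ : ∀ L P ρ c → (P + 1ℤ) * (L * P + + 2 * ρ) - + 2 * L * c
           ≡ L * P * (P - 1ℤ) + + 2 * P * (L * P + ρ - L * P) - + 2 * (L * c - (L * P + ρ))
        eq′ = solve-∀
        eq : ∀ L P ρ c Y → Y ≡ L * P + ρ → (P + 1ℤ) * (L * P + + 2 * ρ) - + 2 * L * c
           ≡ L * P * (P - 1ℤ) + + 2 * P * (Y - L * P) - + 2 * (L * c - Y)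
        eq L P ρ c _ refl = eq′ L P ρ c

      low-level : 0ℤ ≤ Yℤ - L * + P̂
      low-level = subst (0ℤ ≤_) (eq L (+ P̂) (+ ρ) Yℤ Yℤ≡LP̂+ρ) (0≤pos {ρ})
        where
        eq′ : ∀ L P ρ → ρ ≡ L * P + ρ - L * P
        eq′ = solve-∀
        eq : ∀ L P ρ Y → Y ≡ L * P + ρ → ρ ≡ Y - L * P
        eq L P ρ _ refl = eq′ L P ρ

      high-level : ∀ {P} → P̂ <ₙ P → 0ℤ ≤ L * + P - Yℤ
      high-level {P} P̂<P = subst (0ℤ ≤_) (eq L (+ P̂) (+ ρ) (+ P) Yℤ Yℤ≡LP̂+ρ)
        (0≤+ (0≤* (0≤pos {ℓ}) (0≤cast- P̂<P)) (0≤cast- (ℕₚ.<⇒≤ ρ<ℓ)))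
        where
        eq′ : ∀ L P̂ ρ P → L * (P - (1ℤ + P̂)) + (L - ρ) ≡ L * P - (L * P̂ + ρ)
        eq′ = solve-∀
        eq : ∀ L P̂ ρ P Y → Y ≡ L * P̂ + ρ → L * (P - (1ℤ + P̂)) + (L - ρ) ≡ L * P - Y
        eq L P̂ ρ P _ refl = eq′ L P̂ ρ P

      near-level : 0ℤ ≤ L - (L * + suc P̂ - Yℤ)
      near-level = subst (0ℤ ≤_) (eq L (+ P̂) (+ ρ) Yℤ Yℤ≡LP̂+ρ) (0≤pos {ρ})
        where
        eq′ : ∀ L P ρ → ρ ≡ L - (L * (1ℤ + P) - (L * P + ρ))
        eq′ = solve-∀
        eq : ∀ L P ρ Y → Y ≡ L * P + ρ → ρ ≡ L - (L * (1ℤ + P) - Y)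
        eq L P ρ _ refl = eq′ L P ρ

-- Finite sums and periodic sequences

module FiniteSums where

  open import Data.Nat.Base hiding (_/_; _%_)
  open import Data.Nat.DivMod using (_/_; _%_; m≡m%n+[m/n]*n)
  open import Data.Nat.Properties
  open import Data.Nat.Tactic.RingSolver using (solve-∀)
  open import Function.Base using (_∘_)
  open import Relation.Binary.PropositionalEquality

  ∑ : ℕ → (ℕ → ℕ) → ℕ
  ∑ zero    f = 0
  ∑ (suc n) f = f 0 + ∑ n (f ∘ suc)

  ∑-cong : ∀ n {f g} → (∀ k → k < n → f k ≡ g k) → ∑ n f ≡ ∑ n g
  ∑-cong zero    h = refl
  ∑-cong (suc n) h = cong₂ _+_ (h 0 z<s) (∑-cong n λ k k<n → h (suc k) (s<s k<n))

  ∑-mono : ∀ n {f g} → (∀ k → k < n → f k ≤ g k) → ∑ n f ≤ ∑ n g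
  ∑-mono zero    h = z≤n
  ∑-mono (suc n) h = +-mono-≤ (h 0 z<s) (∑-mono n λ k k<n → h (suc k) (s<s k<n))

  ∑-++ : ∀ m n f → ∑ (m + n) f ≡ ∑ m f + ∑ n (f ∘ (m +_))
  ∑-++ zero    n f = refl
  ∑-++ (suc m) n f = trans (cong (f 0 +_) (∑-++ m n (f ∘ suc))) (sym (+-assoc (f 0) _ _))

  ∑-last : ∀ n f → ∑ (suc n) f ≡ ∑ n f + f n
  ∑-last zero    f = +-identityʳ (f 0)
  ∑-last (suc n) f = trans (cong (f 0 +_) (∑-last n (f ∘ suc))) (sym (+-assoc (f 0) _ _))

  ∑-const : ∀ n c → ∑ n (λ _ → c) ≡ n * c
  ∑-const zero    c = refl
  ∑-const (suc n) c = cong (c +_) (∑-const n c)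

  ∑-distrib-+ : ∀ n f g → ∑ n (λ k → f k + g k) ≡ ∑ n f + ∑ n g
  ∑-distrib-+ zero    f g = refl
  ∑-distrib-+ (suc n) f g = trans (cong (f 0 + g 0 +_) (∑-distrib-+ n (f ∘ suc) (g ∘ suc))) (eq (f 0) (g 0) _ _)
    where
    eq : ∀ a b c d → a + b + (c + d) ≡ a + c + (b + d)
    eq = solve-∀

  *-distribˡ-∑ : ∀ n c f → c * ∑ n f ≡ ∑ n (λ k → c * f k)
  *-distribˡ-∑ zero    c f = *-zeroʳ c
  *-distribˡ-∑ (suc n) c f = trans (*-distribˡ-+ c (f 0) _) (cong (c * f 0 +_) (*-distribˡ-∑ n c (f ∘ suc)))

  ∑-comm : ∀ m n (f : ℕ → ℕ → ℕ) → ∑ m (λ i → ∑ n (f i)) ≡ ∑ n (λ j → ∑ m (λ i → f i j))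
  ∑-comm zero    n f = sym (trans (∑-const n 0) (*-zeroʳ n))
  ∑-comm (suc m) n f = trans (cong (∑ n (f 0) +_) (∑-comm m n (f ∘ suc))) (sym (∑-distrib-+ n (f 0) _))

  ∑-reverse : ∀ n f → ∑ n (λ k → f (n ∸ suc k)) ≡ ∑ n f
  ∑-reverse zero    f = refl
  ∑-reverse (suc n) f = trans (cong (f n +_) (∑-reverse n f)) (trans (+-comm (f n) _) (sym (∑-last n f)))

  Periodic : {A : Set} → ℕ → (ℕ → A) → Set
  Periodic N f = ∀ t → f (t + N) ≡ f t

  periodic-* : ∀ {A N} {f : ℕ → A} → Periodic N f → ∀ q t → f (t + q * N) ≡ f t
  periodic-* {f = f} p zero t = cong f (+-identityʳ t)
  periodic-* {N = N} {f} p (suc q) t = trans (cong f (trans (cong (t +_) (+-comm N (q * N))) (sym (+-assoc t (q * N) N))))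
    (trans (p (t + q * N)) (periodic-* p q t))

  periodic-% : ∀ {A N} .{{_ : NonZero N}} {f : ℕ → A} → Periodic N f → ∀ t → f t ≡ f (t % N)
  periodic-% {N = N} {f} p t = trans (cong f (m≡m%n+[m/n]*n t N)) (periodic-* p (t / N) (t % N))

  ∑-shift : ∀ {N f} → Periodic N f → ∀ u → ∑ N (f ∘ (u +_)) ≡ ∑ N f
  ∑-shift p zero = refl
  ∑-shift {N} {f} p (suc u) = trans (+-cancelˡ-≡ (f u) _ _ step) (∑-shift p u)
    where
    open ≡-Reasoning
    step : f u + ∑ N (f ∘ (suc u +_)) ≡ f u + ∑ N (f ∘ (u +_))
    step = begin
      f u + ∑ N (f ∘ (suc u +_))                ≡⟨ cong₂ _+_ (cong f (sym (+-identityʳ u))) (∑-cong N λ k _ → cong f (sym (+-suc u k))) ⟩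
      ∑ (suc N) (f ∘ (u +_))                    ≡⟨ ∑-last N (f ∘ (u +_)) ⟩
      ∑ N (f ∘ (u +_)) + f (u + N)              ≡⟨ cong (∑ N (f ∘ (u +_)) +_) (p u) ⟩
      ∑ N (f ∘ (u +_)) + f u                    ≡⟨ +-comm _ (f u) ⟩
      f u + ∑ N (f ∘ (u +_))                    ∎

  triangle : ∀ p → ∑ p suc + ∑ p suc ≡ p * suc p
  triangle zero    = refl
  triangle (suc p) = trans (cong₂ _+_ (∑-last p suc) (∑-last p suc))
    (trans (eq₁ (∑ p suc) (suc p)) (trans (cong (_+ (suc p + suc p)) (triangle p)) (eq₂ p)))
    where
    eq₁ : ∀ a b → a + b + (a + b) ≡ a + a + (b + b)
    eq₁ = solve-∀
    eq₂ : ∀ p → p * suc p + (suc p + suc p) ≡ suc p * suc (suc p)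
    eq₂ = solve-∀

  -- Against the constant p + 1 a profile of slope one loses 1 + ... + p at each end of the
  -- interval.
  trapezoid : ∀ p r (y : ℕ → ℕ) → let b = p + (r + p) in
    (∀ k → k < b → y k ≤ suc k) → (∀ k → k < b → y k + k ≤ b) → (∀ k → k < b → y k ≤ suc p) →
    ∑ b y ≤ p * suc p + r * suc p
  trapezoid p r y rise fall flat = begin
    ∑ (p + (r + p)) y                                                      ≡⟨ ∑-++ p (r + p) y ⟩
    ∑ p y + ∑ (r + p) (y ∘ (p +_))                                         ≡⟨ cong (∑ p y +_) (∑-++ r p _) ⟩
    ∑ p y + (∑ r (y ∘ (p +_)) + ∑ p (y ∘ (p +_) ∘ (r +_)))                 ≤⟨ +-mono-≤ left (+-mono-≤ middle right) ⟩
    ∑ p suc + (r * suc p + ∑ p suc)                                        ≡⟨ eq (∑ p suc) (r * suc p) ⟩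
    ∑ p suc + ∑ p suc + r * suc p                                          ≡⟨ cong (_+ r * suc p) (triangle p) ⟩
    p * suc p + r * suc p                                                  ∎
    where
    open ≤-Reasoning
    b = p + (r + p)
    eq : ∀ a c → a + (c + a) ≡ a + a + c
    eq = solve-∀
    left : ∑ p y ≤ ∑ p suc
    left = ∑-mono p λ k k<p → rise k (<-≤-trans k<p (m≤m+n p _))
    middle : ∑ r (y ∘ (p +_)) ≤ r * suc p
    middle = ≤-trans (∑-mono r λ k k<r → flat (p + k) (+-monoʳ-< p (<-≤-trans k<r (m≤m+n r p)))) (≤-reflexive (∑-const r (suc p)))
    right : ∑ p (y ∘ (p +_) ∘ (r +_)) ≤ ∑ p suc
    right = ≤-trans (∑-mono p bound) (≤-reflexive (∑-reverse p suc))
      where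
      bound : ∀ k → k < p → y (p + (r + k)) ≤ suc (p ∸ suc k)
      bound k k<p = +-cancelʳ-≤ (p + (r + k)) _ _ (≤-trans (fall (p + (r + k)) (+-monoʳ-< p (+-monoʳ-< r k<p)))
        (≤-reflexive (trans (cong (λ q → p + (r + q)) (sym (m∸n+n≡m k<p))) (eq′ p r (p ∸ suc k) k))))
        where
        eq′ : ∀ p r d k → p + (r + (d + suc k)) ≡ suc d + (p + (r + k))
        eq′ = solve-∀

-- Runs of equal colours and their blocks

module Runs where

  open FiniteSums
  open import Data.Bool.Base using (Bool; true; false)
  open import Data.Bool.Properties using () renaming (_≟_ to _≟ᵇ_)
  open import Data.Empty using (⊥)
  open import Data.Nat.Base
  open import Data.Nat.Properties
  open import Data.Nat.Tactic.RingSolver using (solve-∀)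
  open import Data.Product.Base using (_×_; _,_; ∃-syntax; proj₁; proj₂)
  open import Data.Sum.Base using (_⊎_; inj₁; inj₂)
  open import Function.Base using (_∘_)
  open import Relation.Binary.PropositionalEquality
  open import Relation.Nullary.Decidable using (Dec; yes; no)
  open import Relation.Nullary.Negation using (¬_; contradiction)

  𝟙 : {P : Set} → Dec P → ℕ
  𝟙 (yes _) = 1
  𝟙 (no  _) = 0

  𝟙-yes : ∀ {P : Set} (P? : Dec P) → P → 𝟙 P? ≡ 1
  𝟙-yes (yes _) _ = refl
  𝟙-yes (no ¬p) p = contradiction p ¬p

  𝟙-no : ∀ {P : Set} (P? : Dec P) → ¬ P → 𝟙 P? ≡ 0
  𝟙-no (yes p) ¬p = contradiction p ¬p
  𝟙-no (no _)  _  = refl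

  𝟙-cong : ∀ {P Q : Set} (P? : Dec P) (Q? : Dec Q) → (P → Q) → (Q → P) → 𝟙 P? ≡ 𝟙 Q?
  𝟙-cong (yes p) Q? f g = sym (𝟙-yes Q? (f p))
  𝟙-cong (no ¬p) Q? f g = sym (𝟙-no Q? (¬p ∘ g))

  𝟙≤1 : ∀ {P : Set} (P? : Dec P) → 𝟙 P? ≤ 1
  𝟙≤1 (yes _) = ≤-refl
  𝟙≤1 (no _)  = z≤n

  ≢-≢⇒≡ : ∀ {a b d : Bool} → a ≢ b → d ≢ b → a ≡ d
  ≢-≢⇒≡ {false} {false} {_}     p q = contradiction refl p
  ≢-≢⇒≡ {false} {true}  {false} p q = refl
  ≢-≢⇒≡ {false} {true}  {true}  p q = contradiction refl q
  ≢-≢⇒≡ {true}  {true}  {_}     p q = contradiction refl p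
  ≢-≢⇒≡ {true}  {false} {true}  p q = refl
  ≢-≢⇒≡ {true}  {false} {false} p q = contradiction refl q

  count : Bool → (ℕ → Bool) → ℕ → ℕ → ℕ
  count b c u n = ∑ n λ k → 𝟙 (c (u + k) ≟ᵇ b)

  count-++ : ∀ b c u n n′ → count b c u (n + n′) ≡ count b c u n + count b c (u + n) n′
  count-++ b c u n n′ = trans (∑-++ n n′ _) (cong (count b c u n +_)
    (∑-cong n′ λ k _ → cong (λ t → 𝟙 (c t ≟ᵇ b)) (sym (+-assoc u n k))))

  count-all : ∀ b c u n → (∀ k → k < n → c (u + k) ≡ b) → count b c u n ≡ n
  count-all b c u n h = trans (∑-cong n λ k k<n → 𝟙-yes (c (u + k) ≟ᵇ b) (h k k<n)) (trans (∑-const n 1) (*-identityʳ n))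

  -- The value z t is (number of opposite − number of equal colours)/2 among the
  -- 2m positions at distance at most m from t.
  record Tame (m : ℕ) (c : ℕ → Bool) (z : ℕ → ℕ) : Set where
    field
      climb    : ∀ t → c t ≡ c (suc t) → z (suc t) ≤ suc (z t)
      descend  : ∀ t → c t ≡ c (suc t) → z t ≤ suc (z (suc t))
      cross    : ∀ t → c t ≢ c (suc t) → z t + z (suc t) ≤ 2
      isolated : ∀ t → c t ≢ c (suc t) → c (suc t) ≢ c (suc (suc t)) → 1 ≤ z (suc t)
      visible  : ∀ t u n → t ≤ u + m → u + n ≤ suc (t + m) → count (c t) c u n + z t ≤ suc m

  -- The run occupies the positions r + 1, ..., r + a; its left boundary `r` is the last vertex of
  -- the preceding run.
  record Run (c : ℕ → Bool) (r a : ℕ) : Set where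
    field
      1≤a    : 1 ≤ a
      before : c r ≢ c (suc r)
      inside : ∀ j → j < a → c (suc r + j) ≡ c (suc r)
      after  : c (r + a) ≢ c (suc (r + a))

  peak : ∀ T (y : ℕ → ℕ) b → (∀ k → k < b → y k ≤ T) ⊎ (∃[ k ] k < b × T < y k × ∀ j → j < b → y j ≤ y k)
  peak T y zero = inj₁ λ _ ()
  peak T y (suc b) with peak T y b
  ... | inj₁ low with y b ≤? T
  ...   | yes yb≤T = inj₁ λ k k<1+b → lemma k k<1+b
    where
    lemma : ∀ k → k < suc b → y k ≤ T
    lemma k k<1+b with m<1+n⇒m<n∨m≡n k<1+b
    ... | inj₁ k<b  = low k k<b
    ... | inj₂ refl = yb≤T
  ...   | no yb≰T = inj₂ (b , ≤-refl , ≰⇒> yb≰T , lemma)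
    where
    lemma : ∀ k → k < suc b → y k ≤ y b
    lemma k k<1+b with m<1+n⇒m<n∨m≡n k<1+b
    ... | inj₁ k<b  = ≤-trans (low k k<b) (<⇒≤ (≰⇒> yb≰T))
    ... | inj₂ refl = ≤-refl
  peak T y (suc b) | inj₂ (k , k<b , T<yk , max) with y b ≤? y k
  ... | yes yb≤yk = inj₂ (k , m≤n⇒m≤1+n k<b , T<yk , lemma)
    where
    lemma : ∀ j → j < suc b → y j ≤ y k
    lemma j j<1+b with m<1+n⇒m<n∨m≡n j<1+b
    ... | inj₁ j<b  = max j j<b
    ... | inj₂ refl = yb≤yk
  ... | no yb≰yk = inj₂ (b , ≤-refl , <-trans T<yk (≰⇒> yb≰yk) , lemma)
    where
    lemma : ∀ j → j < suc b → y j ≤ y b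
    lemma j j<1+b with m<1+n⇒m<n∨m≡n j<1+b
    ... | inj₁ j<b  = ≤-trans (max j j<b) (<⇒≤ (≰⇒> yb≰yk))
    ... | inj₂ refl = ≤-refl

  -- The block of a run starts at r + z r: a vertex at the end of a run with
  -- z = 0 whose neighbour across the boundary has z = 2 changes sides.
  module RunBlock {m c z} (tame : Tame m c z) {r a : ℕ} (run : Run c r a) where
    open Tame tame
    open Run run

    zˡ zʳ : ℕ
    zˡ = z r
    zʳ = z (r + a)

    climb-run : ∀ j → j < a → z (suc r + j) ≤ z (suc r) + j
    climb-run zero    _   = ≤-reflexive (trans (cong z (+-identityʳ (suc r))) (sym (+-identityʳ _)))
    climb-run (suc j) j<a = begin
      z (suc r + suc j)         ≡⟨ cong z (+-suc (suc r) j) ⟩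
      z (suc (suc r + j))       ≤⟨ climb (suc r + j) (trans (inside j (<-trans (n<1+n j) j<a))
                                     (sym (trans (cong c (sym (+-suc (suc r) j))) (inside (suc j) j<a)))) ⟩
      suc (z (suc r + j))       ≤⟨ s≤s (climb-run j (<-trans (n<1+n j) j<a)) ⟩
      suc (z (suc r) + j)       ≡⟨ +-suc (z (suc r)) j ⟨
      z (suc r) + suc j         ∎
      where open ≤-Reasoning

    descend-run : ∀ i j → suc i + j ≡ a → z (suc r + j) ≤ zʳ + i
    descend-run zero    j refl = ≤-reflexive (trans (cong z (sym (+-suc r j))) (sym (+-identityʳ _)))
    descend-run (suc i) j e = begin
      z (suc r + j)             ≤⟨ descend (suc r + j) (trans (inside j (≤-trans (m≤n+m (suc j) (suc i)) (≤-reflexive e′)))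
                                     (sym (trans (cong c (sym (+-suc (suc r) j))) (inside (suc j) (≤-trans (m≤n+m (suc (suc j)) i) (≤-reflexive e″)))))) ⟩
      suc (z (suc (suc r + j))) ≡⟨ cong (suc ∘ z) (sym (+-suc (suc r) j)) ⟩
      suc (z (suc r + suc j))   ≤⟨ s≤s (descend-run i (suc j) e′) ⟩
      suc (zʳ + i)              ≡⟨ +-suc zʳ i ⟨
      zʳ + suc i                ∎
      where
      open ≤-Reasoning
      e′ : suc i + suc j ≡ a
      e′ = trans (cong suc (+-suc i j)) e
      e″ : i + suc (suc j) ≡ a
      e″ = trans (+-suc i (suc j)) e′

    module _ {b : ℕ} (b≡ : b + zˡ ≡ a + zʳ) where

      data Position (k : ℕ) : Set where
        received←  : z (r + zˡ + k) ≡ 0 → Position k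
        own        : ∀ j → j < a → r + zˡ + k ≡ suc r + j → Position k

      -- A block position outside the run is either `r`, when z r = 0, or `suc (r + a)`, when z (r +
      -- a) = 2; in the second case `cross` forces z = 0 there.
      position : ∀ k → k < b → Position k
      position k k<b with zˡ + k in eq
      ... | zero = received← (trans (cong z (trans (cong (λ x → r + x + k) zˡ≡0) (trans (cong (_+ k) (+-identityʳ r)) (trans (cong (r +_) k≡0) (+-identityʳ r))))) zˡ≡0)
        where
        zˡ≡0 = m+n≡0⇒m≡0 zˡ eq
        k≡0 = m+n≡0⇒n≡0 zˡ eq
      ... | suc j with j <? a
      ...   | yes j<a = own j j<a (trans (+-assoc r zˡ k) (trans (cong (r +_) eq) (+-suc r j)))
      ...   | no j≮a  = received← (trans (cong z at) last≡0)
        where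
        bound : suc (suc j) ≤ a + zʳ
        bound = begin
          suc (suc j)         ≡⟨ cong suc eq ⟨
          suc (zˡ + k)        ≡⟨ +-suc zˡ k ⟨
          zˡ + suc k          ≤⟨ +-monoʳ-≤ zˡ k<b ⟩
          zˡ + b              ≡⟨ trans (+-comm zˡ b) b≡ ⟩
          a + zʳ              ∎
          where open ≤-Reasoning
        2≤zʳ : 2 ≤ zʳ
        2≤zʳ = +-cancelˡ-≤ a 2 zʳ (≤-trans (≤-trans (≤-reflexive (+-comm a 2)) (s≤s (s≤s (≮⇒≥ j≮a)))) bound)
        zʳ≤2 : zʳ ≤ 2
        zʳ≤2 = ≤-trans (m≤m+n zʳ _) (cross (r + a) after)
        j≡a : j ≡ a
        j≡a = ≤-antisym (s≤s⁻¹ (s≤s⁻¹ (≤-trans bound (≤-trans (+-monoʳ-≤ a zʳ≤2) (≤-reflexive (+-comm a 2)))))) (≮⇒≥ j≮a)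
        at : r + zˡ + k ≡ suc (r + a)
        at = trans (+-assoc r zˡ k) (trans (cong (r +_) (trans eq (cong suc j≡a))) (+-suc r a))
        last≡0 : z (suc (r + a)) ≡ 0
        last≡0 = n≤0⇒n≡0 (+-cancelˡ-≤ 2 _ 0 (≤-trans (+-monoˡ-≤ _ 2≤zʳ) (cross (r + a) after)))

      -- This explains the start `r + z r`: by `cross` the run begins with z ≤ 2 - z r, and shifting
      -- the origin by z r - 1 turns this into a profile that begins with at most 1. The right end
      -- is symmetric.
      rise-fall : ∀ k → k < b → z (r + zˡ + k) ≤ suc k × z (r + zˡ + k) + k ≤ b
      rise-fall k k<b with position k k<b
      ... | received← e = ≤-trans (≤-reflexive e) z≤n , ≤-trans (+-monoˡ-≤ k (≤-reflexive e)) (<⇒≤ k<b)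
      ... | own j j<a e = +-cancelʳ-≤ zˡ _ _ up , +-cancelʳ-≤ zˡ _ _ down
        where
        open ≤-Reasoning
        zˡ+k≡ : zˡ + k ≡ suc j
        zˡ+k≡ = +-cancelˡ-≡ r _ _ (trans (sym (+-assoc r zˡ k)) (trans e (sym (+-suc r j))))
        eq₁ : ∀ x y w → x + y + w ≡ w + x + y
        eq₁ = solve-∀
        up : z (r + zˡ + k) + zˡ ≤ suc k + zˡ
        up = begin
          z (r + zˡ + k) + zˡ     ≡⟨ cong (λ t → z t + zˡ) e ⟩
          z (suc r + j) + zˡ      ≤⟨ +-monoˡ-≤ zˡ (climb-run j j<a) ⟩
          z (suc r) + j + zˡ      ≡⟨ eq₁ (z (suc r)) j zˡ ⟩
          zˡ + z (suc r) + j      ≤⟨ +-monoˡ-≤ j (cross r before) ⟩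
          suc (suc j)             ≡⟨ cong suc zˡ+k≡ ⟨
          suc (zˡ + k)            ≡⟨ +-comm (suc zˡ) k ⟩
          k + suc zˡ              ≡⟨ +-suc k zˡ ⟩
          suc k + zˡ              ∎
        eq₂ : ∀ x k w → x + k + w ≡ x + (w + k)
        eq₂ = solve-∀
        eq₃ : ∀ x i j → x + i + suc j ≡ suc i + j + x
        eq₃ = solve-∀
        down : z (r + zˡ + k) + k + zˡ ≤ b + zˡ
        down with i , i≡ ← m≤n⇒∃[o]m+o≡n j<a = begin
          z (r + zˡ + k) + k + zˡ   ≡⟨ eq₂ (z (r + zˡ + k)) k zˡ ⟩
          z (r + zˡ + k) + (zˡ + k) ≡⟨ cong₂ (λ t x → z t + x) e zˡ+k≡ ⟩
          z (suc r + j) + suc j     ≤⟨ +-monoˡ-≤ (suc j) (descend-run i j (trans (cong suc (+-comm i j)) i≡)) ⟩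
          zʳ + i + suc j            ≡⟨ eq₃ zʳ i j ⟩
          suc i + j + zʳ            ≡⟨ cong (_+ zʳ) (trans (cong suc (+-comm i j)) i≡) ⟩
          a + zʳ                    ≡⟨ b≡ ⟨
          b + zˡ                    ∎

      ≤⊔1 : ∀ x → x ⊔ 1 ≡ x + (1 ∸ x)
      ≤⊔1 zero    = refl
      ≤⊔1 (suc x) = cong suc (trans (⊔-identityʳ x) (trans (sym (+-identityʳ x)) (cong (x +_) (sym (0∸n≡0 x)))))

      -- Raising z to at least 1 respects the bounds from both ends and adds 1 at every received
      -- vertex, so that the area estimate improves by `g`.
      y : ℕ → ℕ
      y k = z (r + zˡ + k) ⊔ 1

      S g : ℕ
      S = ∑ b λ k → z (r + zˡ + k)
      g = 𝟙 (zˡ ≟ 0) + 𝟙 (zʳ ≟ 2)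

      zˡ≤2 : zˡ ≤ 2
      zˡ≤2 = ≤-trans (m≤m+n zˡ _) (cross r before)

      zʳ≤2 : zʳ ≤ 2
      zʳ≤2 = ≤-trans (m≤m+n zʳ _) (cross (r + a) after)

      w : ℕ → ℕ
      w k = 1 ∸ z (r + zˡ + k)

      first-received : zˡ ≡ 0 → w 0 ≡ 1
      first-received e = cong (1 ∸_) (trans (cong z (trans (+-identityʳ (r + zˡ)) (trans (cong (r +_) e) (+-identityʳ r)))) e)

      last-received : zʳ ≡ 2 → ∀ k → suc k ≡ b → w k ≡ 1
      last-received e k refl = cong (1 ∸_) (trans (cong z at) z≡0)
        where
        at : r + zˡ + k ≡ suc (r + a)
        at = suc-injective (begin
          suc (r + zˡ + k)       ≡⟨ eq r zˡ k ⟩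
          r + (suc k + zˡ)       ≡⟨ cong (r +_) (trans b≡ (cong (a +_) e)) ⟩
          r + (a + 2)            ≡⟨ eq′ r a ⟩
          suc (suc (r + a))      ∎)
          where
          open ≡-Reasoning
          eq : ∀ r x k → suc (r + x + k) ≡ r + (suc k + x)
          eq = solve-∀
          eq′ : ∀ r a → r + (a + 2) ≡ suc (suc (r + a))
          eq′ = solve-∀
        z≡0 : z (suc (r + a)) ≡ 0
        z≡0 = n≤0⇒n≡0 (+-cancelˡ-≤ 2 _ 0 (subst (λ x → x + z (suc (r + a)) ≤ 2) e (cross (r + a) after)))

      received≤ : g ≤ ∑ b w
      received≤ with zˡ ≟ 0 | zʳ ≟ 2
      ... | no _  | no _  = z≤n
      ... | yes p | no _  = go b refl
        where
        go : ∀ b′ → b′ ≡ b → 1 ≤ ∑ b′ w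
        go zero    e = contradiction (≤-trans 1≤a (≤-trans (m≤m+n a zʳ) (≤-reflexive (trans (sym b≡) (trans (cong (_+ zˡ) (sym e)) p))))) λ ()
        go (suc _) e = ≤-trans (≤-reflexive (sym (first-received p))) (m≤m+n (w 0) _)
      ... | no _  | yes q = go b refl
        where
        go : ∀ b′ → b′ ≡ b → 1 ≤ ∑ b′ w
        go zero e = contradiction (≤-trans (+-monoˡ-≤ 2 1≤a) (≤-trans (≤-reflexive (trans (cong (a +_) (sym q)) (trans (sym b≡) (cong (_+ zˡ) (sym e))))) zˡ≤2)) λ { (s≤s (s≤s ())) }
        go (suc k) e = ≤-trans (≤-reflexive (sym (last-received q k e))) (≤-trans (m≤n+m (w k) (∑ k w)) (≤-reflexive (sym (∑-last k w))))
      ... | yes p | yes q = go b refl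
        where
        b≡a+2 : b ≡ a + 2
        b≡a+2 = trans (sym (+-identityʳ b)) (trans (cong (b +_) (sym p)) (trans b≡ (cong (a +_) q)))
        go : ∀ b′ → b′ ≡ b → 2 ≤ ∑ b′ w
        go zero    e = contradiction (≤-trans (m≤n+m 2 a) (≤-reflexive (sym (trans e b≡a+2)))) λ ()
        go 1       e = contradiction (≤-trans (m≤n+m 2 a) (≤-reflexive (sym (trans e b≡a+2)))) λ { (s≤s ()) }
        go (suc (suc k)) e = +-mono-≤ (≤-reflexive (sym (first-received p)))
          (≤-trans (≤-reflexive (sym (last-received q (suc k) e))) (≤-trans (m≤n+m (w (suc k)) (∑ k (w ∘ suc))) (≤-reflexive (sym (∑-last k (w ∘ suc))))))

      sum-received : S + g ≤ ∑ b y
      sum-received = ≤-trans (+-monoʳ-≤ S received≤)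
        (≤-reflexive (sym (trans (∑-cong b λ k _ → ≤⊔1 (z (r + zˡ + k))) (∑-distrib-+ b (λ k → z (r + zˡ + k)) w))))

      y-rise : ∀ k → k < b → y k ≤ suc k
      y-rise k k<b = ⊔-lub (proj₁ (rise-fall k k<b)) (s≤s z≤n)

      y-fall : ∀ k → k < b → y k + k ≤ b
      y-fall k k<b = ≤-trans (≤-reflexive (+-distribʳ-⊔ k (z (r + zˡ + k)) 1)) (⊔-lub (proj₂ (rise-fall k k<b)) k<b)

      area-flat : ∀ P → (∀ k → k < b → y k ≤ P) → S + g ≤ b * P
      area-flat P flat = ≤-trans sum-received (≤-trans (∑-mono b flat) (≤-reflexive (∑-const b P)))

      area : ∀ p → p + p ≤ b → (∀ k → k < b → y k ≤ suc p) → S + g + suc p * p ≤ b * suc p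
      area p 2p≤b flat with o , o≡ ← m≤n⇒∃[o]m+o≡n 2p≤b = begin
        S + g + suc p * p               ≤⟨ +-monoˡ-≤ (suc p * p) (≤-trans sum-received
                                            (subst (λ b → ∑ b y ≤ p * suc p + o * suc p) b′≡ (trapezoid p o y
                                              (λ k k< → y-rise k (subst (k <_) b′≡ k<))
                                              (λ k k< → subst (y k + k ≤_) (sym b′≡) (y-fall k (subst (k <_) b′≡ k<)))
                                              (λ k k< → flat k (subst (k <_) b′≡ k<))))) ⟩
        p * suc p + o * suc p + suc p * p ≡⟨ eq p o ⟩
        (p + p + o) * suc p              ≡⟨ cong (_* suc p) o≡ ⟩
        b * suc p                        ∎
        where
        open ≤-Reasoning
        b′≡ : p + (o + p) ≡ b
        b′≡ = trans (eq″ p o) o≡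
          where
          eq″ : ∀ p o → p + (o + p) ≡ p + p + o
          eq″ = solve-∀
        eq : ∀ p o → p * suc p + o * suc p + suc p * p ≡ (p + p + o) * suc p
        eq = solve-∀

    module _ (j : ℕ) (j<a : j < a) (1≤z : 1 ≤ z (suc r + j)) where

      private
        t : ℕ
        t = suc r + j

      ct≡ : c t ≡ c (suc r)
      ct≡ = inside j j<a

      -- Otherwise m + 1 consecutive vertices of the run, all within distance m of `t`, would
      -- exhaust the m + 1 of `visible` and leave no room for z t ≥ 1.
      no-full-window : ∀ o → o + m < a → t ≤ suc r + o + m → suc r + o ≤ t → ⊥
      no-full-window o o<a t≤ ≤t = <-irrefl refl (begin-strict
        suc m                                  <⟨ m<m+n (suc m) 1≤z ⟩
        suc m + z t                            ≡⟨ cong (_+ z t) (count-all (c t) c (suc r + o) (suc m) all) ⟨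
        count (c t) c (suc r + o) (suc m) + z t  ≤⟨ visible t (suc r + o) (suc m) t≤ (≤-trans (≤-reflexive (+-suc (suc r + o) m)) (s≤s (+-monoˡ-≤ m ≤t))) ⟩
        suc m                                  ∎)
        where
        open ≤-Reasoning
        all : ∀ k → k < suc m → c (suc r + o + k) ≡ c t
        all k k≤m = trans (cong c (+-assoc (suc r) o k))
          (trans (inside (o + k) (≤-<-trans (+-monoʳ-≤ o (s≤s⁻¹ k≤m)) o<a)) (sym ct≡))

      j≤m : j ≤ m
      j≤m = ≮⇒≥ λ m<j → let o = j ∸ m; o+m≡j = m∸n+n≡m (<⇒≤ m<j) in
        no-full-window o (subst (_< a) (sym o+m≡j) j<a)
          (≤-reflexive (sym (trans (+-assoc (suc r) o m) (cong (suc r +_) o+m≡j))))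
          (+-monoʳ-≤ (suc r) (m∸n≤m j m))

      a≤1+j+m : a ≤ suc (j + m)
      a≤1+j+m = ≮⇒≥ λ lt → no-full-window j (<-trans (n<1+n _) lt) (m≤m+n t m) ≤-refl

      -- Vertices of the run's colour beyond the two neighbouring runs tighten the bound on the run;
      -- `eˡ` and `eʳ` count those that are known to be seen from `t`.
      visible-around : ∀ u nˡ eˡ nʳ eʳ → u + nˡ ≡ suc r → t ≤ u + m → eˡ ≤ count (c t) c u nˡ →
        suc r + a + nʳ ≤ suc (t + m) → eʳ ≤ count (c t) c (suc r + a) nʳ → eˡ + (a + eʳ) + z t ≤ suc m
      visible-around u nˡ eˡ nʳ eʳ u≡ t≤ ≤ˡ ≤t ≤ʳ = begin
        eˡ + (a + eʳ) + z t                     ≤⟨ +-monoˡ-≤ (z t) (+-mono-≤ ≤ˡ (+-monoʳ-≤ a ≤ʳ)) ⟩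
        count (c t) c u nˡ + (a + count (c t) c (suc r + a) nʳ) + z t
          ≡⟨ cong (_+ z t) (cong (count (c t) c u nˡ +_) (trans (cong (_+ count (c t) c (suc r + a) nʳ) (sym (count-all (c t) c (suc r) a λ k k<a → trans (inside k k<a) (sym ct≡))))
               (sym (count-++ (c t) c (suc r) a nʳ)))) ⟩
        count (c t) c u nˡ + count (c t) c (suc r) (a + nʳ) + z t
          ≡⟨ cong (λ v → count (c t) c u nˡ + count (c t) c v (a + nʳ) + z t) u≡ ⟨
        count (c t) c u nˡ + count (c t) c (u + nˡ) (a + nʳ) + z t
          ≡⟨ cong (_+ z t) (count-++ (c t) c u nˡ (a + nʳ)) ⟨
        count (c t) c u (nˡ + (a + nʳ)) + z t
          ≤⟨ visible t u (nˡ + (a + nʳ)) t≤ (≤-trans (≤-reflexive (trans (sym (+-assoc u nˡ (a + nʳ))) (trans (cong (_+ (a + nʳ)) u≡) (sym (+-assoc (suc r) a nʳ))))) ≤t) ⟩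
        suc m ∎
        where open ≤-Reasoning

      nothing-left : t ≤ suc r + m
      nothing-left = +-monoʳ-≤ (suc r) j≤m

      nothing-right : suc r + a + 0 ≤ suc (t + m)
      nothing-right = begin
        suc r + a + 0           ≡⟨ +-identityʳ (suc r + a) ⟩
        suc r + a               ≤⟨ +-monoʳ-≤ (suc r) a≤1+j+m ⟩
        suc r + suc (j + m)     ≡⟨ +-suc (suc r) (j + m) ⟩
        suc (suc r + (j + m))   ≡⟨ cong suc (+-assoc (suc r) j m) ⟨
        suc (t + m)             ∎
        where open ≤-Reasoning

      -- A vertex with z ≥ 1 sees its whole run, by `j≤m` and `a≤1+j+m`.
      plateau : a + z t ≤ suc m
      plateau = ≤-trans (≤-reflexive (cong (_+ z t) (sym (+-identityʳ a))))
        (visible-around (suc r) 0 0 0 0 (+-identityʳ (suc r)) nothing-left z≤n nothing-right z≤n)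

-- The excess of a block is bounded by the flow across its boundaries

module BlockBounds where

  open IntegerInequalities
  open Surplus using (0≤cast-)
  open BlockPayments
  open OptimumConstants
  open FiniteSums
  open Runs
  open import Data.Bool.Base using (Bool)
  open import Data.Bool.Properties using () renaming (_≟_ to _≟ᵇ_)
  open import Data.Integer.Base as ℤ using (ℤ; +_; 0ℤ; 1ℤ; +≤+)
  import Data.Integer.Properties as ℤₚ
  import Data.Integer.Tactic.RingSolver as ℤSolver
  open import Data.Nat.Base
  open import Data.Nat.Properties
  open import Data.Nat.Tactic.RingSolver using (solve-∀)
  open import Data.Product.Base using (_×_; _,_; ∃-syntax; proj₁; proj₂)
  open import Data.Sum.Base using (_⊎_; inj₁; inj₂)
  open import Function.Base using (_∘_)
  open import Relation.Binary.PropositionalEquality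
  open import Relation.Nullary.Decidable using (Dec; yes; no; ¬?)
  open import Relation.Nullary.Negation using (¬_; contradiction)

  module BlockBound (m h e : ℕ) (1≤h : 1 ≤ h) (m≡ : suc m ≡ h + e + h)
    (lower : e * e ≤ 2 * h * h + e) (upper : 2 * h * h ≤ e * e + 3 * e + 4 * h) where

    open Optimum m h e 1≤h m≡ lower upper

    -- A compromise: a run of length at least `τ` keeps 2P̂ vertices after giving away two, as
    -- `low-long` demands, while a run shorter than `τ` can be looked across from a peak of height
    -- at least P̂ + 2.
    τ : ℕ
    τ = 2 + (P̂ + P̂)

    module _ {c : ℕ → Bool} {z : ℕ → ℕ} where

      Short← Short→ : ℕ → Set
      Short← r = ∃[ j ] j < τ × c (r ∸ j) ≢ c r
      Short→ r = ∃[ j ] j < τ × c (suc r + j) ≢ c (suc r)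

      short←? : ∀ r → Dec (Short← r)
      short←? r = anyUpTo? (λ j → ¬? (c (r ∸ j) ≟ᵇ c r)) τ

      short→? : ∀ r → Dec (Short→ r)
      short→? r = anyUpTo? (λ j → ¬? (c (suc r + j) ≟ᵇ c (suc r))) τ

      pay← pay→ : ℕ → ℕ
      pay← r = 𝟙 (z r ≟ 2) * 𝟙 (¬? (short→? r))
      pay→ r = 𝟙 (z r ≟ 0) * 𝟙 (¬? (short←? r))

      -- A giver in a long run passes κ to the receiver of its end vertex.
      flow : ℕ → ℤ
      flow r = κ ℤ.* (+ pay← r ℤ.- + pay→ r)

      pay≤ : ∀ {P Q : Set} (P? : Dec P) (Q? : Dec Q) → 𝟙 P? * 𝟙 Q? ≤ 𝟙 P?
      pay≤ P? Q? = ≤-trans (*-monoʳ-≤ (𝟙 P?) (𝟙≤1 Q?)) (≤-reflexive (*-identityʳ (𝟙 P?)))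

      pay-all : ∀ {P Q : Set} (P? : Dec P) (Q? : Dec Q) → ¬ (P × Q) → 𝟙 P? ≡ 𝟙 P? * 𝟙 (¬? Q?) + 0
      pay-all (yes p) (yes q) ¬pq = contradiction (p , q) ¬pq
      pay-all (yes _) (no _)  _   = refl
      pay-all (no _)  _       _   = refl

      pay-none : ∀ {P Q : Set} (P? : Dec P) (Q? : Dec Q) → P → Q → 𝟙 P? ≡ 𝟙 P? * 𝟙 (¬? Q?) + 1
      pay-none (yes _) (yes _) _ _ = refl
      pay-none (yes _) (no ¬q) _ q = contradiction q ¬q
      pay-none (no ¬p) _       p _ = contradiction p ¬p

      shift-balance : ∀ x → x ≤ 2 → x + 𝟙 (x ≟ 0) ≡ 1 + 𝟙 (x ≟ 2)
      shift-balance 0 _ = refl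
      shift-balance 1 _ = refl
      shift-balance 2 _ = refl
      shift-balance (suc (suc (suc _))) (s≤s (s≤s ()))

      𝟙0+𝟙2≤1 : ∀ x → 𝟙 (x ≟ 0) + 𝟙 (x ≟ 2) ≤ 1
      𝟙0+𝟙2≤1 0 = ≤-refl
      𝟙0+𝟙2≤1 1 = z≤n
      𝟙0+𝟙2≤1 2 = ≤-refl
      𝟙0+𝟙2≤1 (suc (suc (suc _))) = z≤n

      module _ (tame : Tame m c z) {r a : ℕ} (run : Run c r a) (τ≤r : τ ≤ r)
               {b : ℕ} (b≡ : b + z r ≡ a + z (r + a)) where

        open RunBlock tame run
        open Run run
        open Tame tame

        private
          r₂ gᶜ g′ gᵈ G : ℕ
          r₂ = r + a
          gᶜ = pay← r₂ + pay→ r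
          g′ = 𝟙 (zˡ ≟ 2) + 𝟙 (zʳ ≟ 0)
          gᵈ = pay→ r₂ + pay← r
          G = g b≡

        b+g′≡a+g : b + g′ ≡ a + G
        b+g′≡a+g = +-cancelʳ-≡ (zˡ + zʳ + 1) _ _ (begin
          b + (𝟙 (zˡ ≟ 2) + 𝟙 (zʳ ≟ 0)) + (zˡ + zʳ + 1)   ≡⟨ eq₁ b (𝟙 (zˡ ≟ 2)) (𝟙 (zʳ ≟ 0)) zˡ zʳ ⟩
          (b + zˡ) + (1 + 𝟙 (zˡ ≟ 2)) + (zʳ + 𝟙 (zʳ ≟ 0)) ≡⟨ cong₂ _+_ (cong₂ _+_ b≡ (sym (shift-balance zˡ (zˡ≤2 b≡)))) (shift-balance zʳ (zʳ≤2 b≡)) ⟩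
          (a + zʳ) + (zˡ + 𝟙 (zˡ ≟ 0)) + (1 + 𝟙 (zʳ ≟ 2)) ≡⟨ eq₂ a zʳ zˡ (𝟙 (zˡ ≟ 0)) (𝟙 (zʳ ≟ 2)) ⟩
          a + (𝟙 (zˡ ≟ 0) + 𝟙 (zʳ ≟ 2)) + (zˡ + zʳ + 1)   ∎)
          where
          open ≡-Reasoning
          eq₁ : ∀ b x y u v → b + (x + y) + (u + v + 1) ≡ (b + u) + (1 + x) + (v + y)
          eq₁ = solve-∀
          eq₂ : ∀ a v u x y → (a + v) + (u + x) + (1 + y) ≡ a + (x + y) + (u + v + 1)
          eq₂ = solve-∀

        gᶜ≤g : gᶜ ≤ G
        gᶜ≤g = ≤-trans (+-mono-≤ (pay≤ (zʳ ≟ 2) (¬? (short→? r₂))) (pay≤ (zˡ ≟ 0) (¬? (short←? r))))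
                 (≤-reflexive (+-comm (𝟙 (zʳ ≟ 2)) _))

        g+g′≤2 : G + g′ ≤ 2
        g+g′≤2 = ≤-trans (≤-reflexive (eq (𝟙 (zˡ ≟ 0)) (𝟙 (zʳ ≟ 2)) (𝟙 (zˡ ≟ 2)) (𝟙 (zʳ ≟ 0)))) (+-mono-≤ (𝟙0+𝟙2≤1 zˡ) (𝟙0+𝟙2≤1 zʳ))
          where
          eq : ∀ x y u v → x + y + (u + v) ≡ (x + u) + (v + y)
          eq = solve-∀

        gᵈ≤2 : gᵈ ≤ 2
        gᵈ≤2 = +-mono-≤ (≤-trans (pay≤ (zʳ ≟ 0) (¬? (short←? r₂))) (𝟙≤1 (zʳ ≟ 0)))
                        (≤-trans (pay≤ (zˡ ≟ 2) (¬? (short→? r))) (𝟙≤1 (zˡ ≟ 2)))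

        last-colour : c r₂ ≡ c (suc r)
        last-colour with o , o≡ ← m≤n⇒∃[o]m+o≡n 1≤a =
          trans (cong c (trans (cong (λ x → r + x) (sym o≡)) (+-suc r o))) (inside o (≤-reflexive o≡))

        long : τ ≤ a → gᵈ ≡ g′
        long τ≤a = trans (cong₂ _+_ (trans (cong (𝟙 (zʳ ≟ 0) *_) (𝟙-yes (¬? (short←? r₂)) ¬short←)) (*-identityʳ (𝟙 (zʳ ≟ 0))))
                                    (trans (cong (𝟙 (zˡ ≟ 2) *_) (𝟙-yes (¬? (short→? r)) ¬short→)) (*-identityʳ (𝟙 (zˡ ≟ 2)))))
                         (+-comm (𝟙 (zʳ ≟ 0)) (𝟙 (zˡ ≟ 2)))
          where
          ¬short→ : ¬ Short→ r
          ¬short→ (j , j<τ , ≢ᵢ) = ≢ᵢ (inside j (<-≤-trans j<τ τ≤a))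
          ¬short← : ¬ Short← r₂
          ¬short← (j , j<τ , ≢ᵢ) with o , o≡ ← m≤n⇒∃[o]m+o≡n (<-≤-trans j<τ τ≤a) =
            ≢ᵢ (trans (trans (cong c at) (inside o (≤-trans (s≤s (m≤n+m o j)) (≤-reflexive o≡)))) (sym last-colour))
            where
            at : r + a ∸ j ≡ suc r + o
            at = trans (cong (_∸ j) (trans (cong (λ x → r + x) (sym o≡)) (eq r j o))) (m+n∸n≡m (suc r + o) j)
              where
              eq : ∀ r j o → r + (suc j + o) ≡ suc r + o + j
              eq = solve-∀

        short : ¬ τ ≤ a → gᵈ ≡ 0
        short τ≰a = cong₂ _+_ (trans (cong (𝟙 (zʳ ≟ 0) *_) (𝟙-no (¬? (short←? r₂)) λ ¬s → ¬s short←)) (*-zeroʳ (𝟙 (zʳ ≟ 0))))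
                              (trans (cong (𝟙 (zˡ ≟ 2) *_) (𝟙-no (¬? (short→? r)) λ ¬s → ¬s short→)) (*-zeroʳ (𝟙 (zˡ ≟ 2))))
          where
          short→ : Short→ r
          short→ = a , ≰⇒> τ≰a , λ eq → after (trans last-colour (sym eq))
          short← : Short← r₂
          short← = a , ≰⇒> τ≰a , λ eq → before (trans (sym (cong c (m+n∸n≡m r a))) (trans eq last-colour))

        open BlockArithmetic (+ ℓ) (+ m) 0≤pos _ _ s s-slope (+ S b≡) (+ b) (+ G) (+ gᶜ) (+ g′) (+ gᵈ)
          0≤pos 0≤pos (+≤+ gᶜ≤g) 0≤pos (+≤+ (≤-trans (+-monoˡ-≤ g′ gᶜ≤g) g+g′≤2))

        long∨short : + gᵈ ≡ + g′ ⊎ + gᵈ ≡ 0ℤ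
        long∨short with τ ≤? a
        ... | yes p = inj₁ (cong +_ (long p))
        ... | no ¬p = inj₂ (cong +_ (short ¬p))

        flatℤ : ∀ P → (∀ k → k < b → y b≡ k ≤ P) → + (S b≡ + G) ℤ.≤ + b ℤ.* + P
        flatℤ P flat = subst (λ x → + (S b≡ + G) ℤ.≤ x) (ℤₚ.pos-* b P) (+≤+ (area-flat b≡ P flat))

        areaℤ : ∀ p P → suc p ≡ P → p + p ≤ b → (∀ k → k < b → y b≡ k ≤ P) →
                + S b≡ ℤ.+ + G ℤ.+ + P ℤ.* (+ P ℤ.- 1ℤ) ℤ.≤ + b ℤ.* + P
        areaℤ p _ refl 2p≤b flat = subst₂ ℤ._≤_ (cong (λ x → + (S b≡ + G) ℤ.+ x) (ℤₚ.pos-* (suc p) p)) (ℤₚ.pos-* b (suc p)) (+≤+ (area b≡ p 2p≤b flat))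

        -- Only a payment at a nonnegative price can endanger a low block. Only long runs pay, and
        -- their length is what makes the estimate with two payments available.
        low : (∀ k → k < b → y b≡ k ≤ P̂) → Paid
        low flat with τ ≤? a | 0≤∨0≤- κ
        ... | no ¬p | _ = low-flat (+ P̂) low-level (flatℤ P̂ flat) 0≤pos 0≤pos (inj₁ (cong +_ (short ¬p)))
        ... | yes _ | inj₂ κ≤0 = low-flat (+ P̂) low-level (flatℤ P̂ flat) 0≤pos 0≤pos (inj₂ κ≤0)
        ... | yes τ≤a | inj₁ 0≤κ with p , p≡ ← m≤n⇒∃[o]m+o≡n 1≤P̂ = low-long (+ P̂) low-level
                (ℤₚ.≤-trans (≤-by (0≤pos {G}) (eq (+ S b≡) (+ G) (+ P̂ ℤ.* (+ P̂ ℤ.- 1ℤ))))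
                  (areaℤ p P̂ p≡ (≤-trans (+-mono-≤ (p≤P̂ p≡) (p≤P̂ p≡)) 2P̂≤b) flat))
                (subst (λ x → x ℤ.≤ + b) (trans (cong (λ x → + (P̂ + x)) (sym (+-identityʳ P̂))) (ℤₚ.pos-* 2 P̂)) (+≤+ 2P̂≤b))
                (+≤+ gᵈ≤2) 0≤κ low-surplus
          where
          p≤P̂ : ∀ {p} → suc p ≡ P̂ → p ≤ P̂
          p≤P̂ e = <⇒≤ (≤-reflexive e)
          eq : ∀ S G A → G ≡ S ℤ.+ G ℤ.+ A ℤ.- (S ℤ.+ A)
          eq = ℤSolver.solve-∀
          2P̂≤b : P̂ + P̂ ≤ b
          2P̂≤b = +-cancelʳ-≤ 2 _ _ (begin
            P̂ + P̂ + 2           ≡⟨ +-comm (P̂ + P̂) 2 ⟩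
            τ                   ≤⟨ τ≤a ⟩
            a                   ≤⟨ m≤m+n a zʳ ⟩
            a + zʳ              ≡⟨ b≡ ⟨
            b + zˡ              ≤⟨ +-monoʳ-≤ b (zˡ≤2 b≡) ⟩
            b + 2               ∎)
            where open ≤-Reasoning

        module _ (k : ℕ) (k<b : k < b) (P̂<yk : P̂ < y b≡ k) (max : ∀ i → i < b → y b≡ i ≤ y b≡ k)
                 (j : ℕ) (j<a : j < a) (at : r + zˡ + k ≡ suc r + j) where

          t P : ℕ
          t = suc r + j
          P = y b≡ k

          zˡ+k≡1+j : zˡ + k ≡ suc j
          zˡ+k≡1+j = +-cancelˡ-≡ r _ _ (trans (sym (+-assoc r zˡ k)) (trans at (sym (+-suc r j))))

          2≤P : 2 ≤ P
          2≤P = ≤-trans (s≤s 1≤P̂) P̂<yk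

          zt≡P : z t ≡ P
          zt≡P = trans (cong z (sym at)) (sym (m≥n⇒m⊔n≡m (≮⇒≥ λ z<1 → contradiction
            (≤-trans 2≤P (≤-reflexive (m≤n⇒m⊔n≡n (<⇒≤ z<1)))) λ { (s≤s ()) })))

          1≤zt : 1 ≤ z t
          1≤zt = ≤-trans (s≤s z≤n) (≤-trans 2≤P (≤-reflexive (sym zt≡P)))

          a+P≤1+m : a + P ≤ suc m
          a+P≤1+m = subst (λ x → a + x ≤ suc m) zt≡P (plateau j j<a 1≤zt)

          ct : c t ≡ c (suc r)
          ct = inside j j<a

          -- If the left neighbour is short and hands over its end vertex, κ is not paid (`unpaid` =
          -- 1); in exchange a vertex of the run's colour on the far side of that neighbour is seen
          -- from the peak.
          record Left : Set where
            field
              unpaid u n  : ℕ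
              balance     : 𝟙 (zˡ ≟ 0) ≡ pay→ r + unpaid
              end         : u + n ≡ suc r
              near        : t ≤ u + m
              seen        : unpaid ≤ count (c t) c u n

          record Right : Set where
            field
              unpaid n    : ℕ
              balance     : 𝟙 (zʳ ≟ 2) ≡ pay← r₂ + unpaid
              near        : suc r + a + n ≤ suc (t + m)
              seen        : unpaid ≤ count (c t) c (suc r + a) n

          module _ (2+P̂≤P : 2 + P̂ ≤ P) where

            near-short : ∀ {i} → i < τ → i + 3 ≤ P + P
            near-short {i} i<τ = begin
              i + 3                  ≡⟨ +-suc i 2 ⟩
              suc i + 2              ≤⟨ +-monoˡ-≤ 2 i<τ ⟩
              2 + (P̂ + P̂) + 2        ≡⟨ eq P̂ ⟩
              2 + P̂ + (2 + P̂)        ≤⟨ +-mono-≤ 2+P̂≤P 2+P̂≤P ⟩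
              P + P                  ∎
              where
              open ≤-Reasoning
              eq : ∀ p → 2 + (p + p) + 2 ≡ 2 + p + (2 + p)
              eq = solve-∀

            -- The far vertex is `r ∸ i`, at distance 1 + j + i from the peak. The shortness i < τ
            -- gives i + 3 ≤ 2P; with P + (1 + j) ≤ a + 2 from the falling profile and a + P ≤ m + 1
            -- from `plateau`, the distance is at most m.
            left : Left
            left with zˡ ≟ 0 | short←? r
            ... | no ¬p | _ = record { unpaid = 0 ; u = suc r ; n = 0 ; balance = pay-all (zˡ ≟ 0) (short←? r) (¬p ∘ proj₁) ; end = +-identityʳ (suc r)
                                    ; near = nothing-left j j<a 1≤zt ; seen = z≤n }
            ... | yes _ | no ¬q = record { unpaid = 0 ; u = suc r ; n = 0 ; balance = pay-all (zˡ ≟ 0) (short←? r) (¬q ∘ proj₂) ; end = +-identityʳ (suc r)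
                                        ; near = nothing-left j j<a 1≤zt ; seen = z≤n }
            ... | yes zˡ≡0 | yes (i , i<τ , ≢ᵢ) = record
              { unpaid = 1 ; u = r ∸ i ; n = suc i ; balance = pay-none (zˡ ≟ 0) (short←? r) zˡ≡0 (i , i<τ , ≢ᵢ)
              ; end = trans (+-suc (r ∸ i) i) (cong suc (m∸n+n≡m i≤r))
              ; near = +-cancelʳ-≤ i _ _ (begin
                  suc r + j + i          ≡⟨ eq₂ r j i ⟩
                  r + (suc j + i)        ≤⟨ +-monoʳ-≤ r 1+j+i≤m ⟩
                  r + m                  ≡⟨ cong (λ x → x + m) (sym (m∸n+n≡m i≤r)) ⟩
                  r ∸ i + i + m          ≡⟨ eq₃ (r ∸ i) i m ⟩
                  r ∸ i + m + i          ∎)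
              ; seen = ≤-trans (≤-reflexive (sym (𝟙-yes (c (r ∸ i + 0) ≟ᵇ c t) (trans (cong c (+-identityʳ (r ∸ i)))
                         (trans (≢-≢⇒≡ ≢ᵢ (before ∘ sym)) (sym ct)))))) (m≤m+n _ _) }
              where
              open ≤-Reasoning
              i≤r : i ≤ r
              i≤r = ≤-trans (<⇒≤ i<τ) τ≤r
              eq₂ : ∀ r j i → suc r + j + i ≡ r + (suc j + i)
              eq₂ = solve-∀
              eq₃ : ∀ x i m → x + i + m ≡ x + m + i
              eq₃ = solve-∀
              P+1+j≤a+2 : P + suc j ≤ a + 2
              P+1+j≤a+2 = begin
                P + suc j              ≡⟨ cong (λ x → P + x) (trans (sym zˡ+k≡1+j) (cong (λ x → x + k) zˡ≡0)) ⟩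
                P + k                  ≤⟨ y-fall b≡ k k<b ⟩
                b                      ≡⟨ trans (sym (+-identityʳ b)) (trans (cong (λ x → b + x) (sym zˡ≡0)) b≡) ⟩
                a + zʳ                 ≤⟨ +-monoʳ-≤ a (zʳ≤2 b≡) ⟩
                a + 2                  ∎
              1+j+i≤m : suc j + i ≤ m
              1+j+i≤m = +-cancelʳ-≤ (P + P + (a + 3)) _ _ (begin
                suc j + i + (P + P + (a + 3))          ≡⟨ eq₄ (suc j) i P a ⟩
                P + suc j + (i + 3) + (a + P)          ≤⟨ +-mono-≤ (+-mono-≤ P+1+j≤a+2 (near-short i<τ)) a+P≤1+m ⟩
                a + 2 + (P + P) + suc m                ≡⟨ eq₅ a P m ⟩
                m + (P + P + (a + 3))                  ∎)
                where
                eq₄ : ∀ j i P a → j + i + (P + P + (a + 3)) ≡ P + j + (i + 3) + (a + P)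
                eq₄ = solve-∀
                eq₅ : ∀ a P m → a + 2 + (P + P) + suc m ≡ m + (P + P + (a + 3))
                eq₅ = solve-∀

            right : Right
            right with zʳ ≟ 2 | short→? r₂
            ... | no ¬p | _ = record { unpaid = 0 ; n = 0 ; balance = pay-all (zʳ ≟ 2) (short→? r₂) (¬p ∘ proj₁) ; near = nothing-right j j<a 1≤zt ; seen = z≤n }
            ... | yes _ | no ¬q = record { unpaid = 0 ; n = 0 ; balance = pay-all (zʳ ≟ 2) (short→? r₂) (¬q ∘ proj₂) ; near = nothing-right j j<a 1≤zt ; seen = z≤n }
            ... | yes zʳ≡2 | yes (i , i<τ , ≢ᵢ) = record
              { unpaid = 1 ; n = suc i ; balance = pay-none (zʳ ≟ 2) (short→? r₂) zʳ≡2 (i , i<τ , ≢ᵢ)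
              ; near = begin
                  suc r + a + suc i      ≡⟨ eq₂ r a i ⟩
                  suc (suc r + (a + i))  ≤⟨ s≤s (+-monoʳ-≤ (suc r) a+i≤j+m) ⟩
                  suc (suc r + (j + m))  ≡⟨ cong suc (+-assoc (suc r) j m) ⟨
                  suc (t + m)            ∎
              ; seen = ≤-trans (≤-reflexive (sym (𝟙-yes (c (suc r + a + i) ≟ᵇ c t)
                         (trans (≢-≢⇒≡ ≢ᵢ after) (trans last-colour (sym ct))))))
                         (≤-trans (m≤n+m _ _) (≤-reflexive (sym (∑-last i λ k → 𝟙 (c (suc r + a + k) ≟ᵇ c t))))) }
              where
              open ≤-Reasoning
              eq₂ : ∀ r a i → suc r + a + suc i ≡ suc (suc r + (a + i))
              eq₂ = solve-∀
              P≤2+j : P ≤ 2 + j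
              P≤2+j = ≤-trans (y-rise b≡ k k<b) (s≤s (≤-trans (m≤n+m k zˡ) (≤-reflexive zˡ+k≡1+j)))
              a+i≤j+m : a + i ≤ j + m
              a+i≤j+m = +-cancelʳ-≤ (P + P + 3) _ _ (begin
                a + i + (P + P + 3)          ≡⟨ eq₄ a i P ⟩
                a + P + (i + 3) + P          ≤⟨ +-mono-≤ (+-mono-≤ a+P≤1+m (near-short i<τ)) P≤2+j ⟩
                suc m + (P + P) + (2 + j)    ≡⟨ eq₅ m P j ⟩
                j + m + (P + P + 3)          ∎)
                where
                eq₄ : ∀ a i P → a + i + (P + P + 3) ≡ a + P + (i + 3) + P
                eq₄ = solve-∀
                eq₅ : ∀ m P j → suc m + (P + P) + (2 + j) ≡ j + m + (P + P + 3)
                eq₅ = solve-∀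

            -- An unpaid received vertex lengthens the block by one, and the vertex seen beyond its
            -- giver shortens the admissible run by one; the two cancel.
            b-visible : b + P + g′ ≤ suc m + gᶜ
            b-visible = +-cancelʳ-≤ (eˡ + eʳ) _ _ (begin
              b + P + g′ + (eˡ + eʳ)                     ≡⟨ eq₁ b P g′ (eˡ + eʳ) ⟩
              (b + g′) + (P + (eˡ + eʳ))                 ≡⟨ cong (λ x → x + (P + (eˡ + eʳ))) b+g′≡a+g ⟩
              a + G + (P + (eˡ + eʳ))                    ≡⟨ cong (λ x → a + x + (P + (eˡ + eʳ))) (cong₂ _+_ (Left.balance left) (Right.balance right)) ⟩
              a + (pay→ r + eˡ + (pay← r₂ + eʳ)) + (P + (eˡ + eʳ)) ≡⟨ eq₂ a (pay→ r) eˡ (pay← r₂) eʳ P ⟩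
              (eˡ + (a + eʳ) + P) + gᶜ + (eˡ + eʳ)       ≤⟨ +-monoˡ-≤ (eˡ + eʳ) (+-monoˡ-≤ gᶜ seen) ⟩
              suc m + gᶜ + (eˡ + eʳ)                     ∎)
              where
              open ≤-Reasoning
              eˡ = Left.unpaid left
              eʳ = Right.unpaid right
              seen : eˡ + (a + eʳ) + P ≤ suc m
              seen = subst (λ x → eˡ + (a + eʳ) + x ≤ suc m) zt≡P (visible-around j j<a 1≤zt
                (Left.u left) (Left.n left) eˡ (Right.n right) eʳ (Left.end left) (Left.near left) (Left.seen left) (Right.near right) (Right.seen right))
              eq₁ : ∀ b P g e → b + P + g + e ≡ b + g + (P + e)
              eq₁ = solve-∀
              eq₂ : ∀ a x l y r P → a + (x + l + (y + r)) + (P + (l + r)) ≡ (l + (a + r) + P) + (y + x) + (l + r)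
              eq₂ = solve-∀

          b-near : b + P + g′ ≤ suc m + G
          b-near = begin
            b + P + g′       ≡⟨ eq b P g′ ⟩
            b + g′ + P       ≡⟨ cong (λ x → x + P) b+g′≡a+g ⟩
            a + G + P        ≡⟨ eq a G P ⟩
            a + P + G        ≤⟨ +-monoˡ-≤ G a+P≤1+m ⟩
            suc m + G        ∎
            where
            open ≤-Reasoning
            eq : ∀ b P g → b + P + g ≡ b + g + P
            eq = solve-∀

          bound-ℤ : ∀ x → b + P + g′ ≤ suc m + x → + b ℤ.≤ + m ℤ.+ 1ℤ ℤ.- + P ℤ.+ + x ℤ.- + g′
          bound-ℤ x le = ≤-by (0≤cast- le) (eq (+ m) (+ x) (+ b) (+ P) (+ g′))
            where
            eq : ∀ m x b P g → 1ℤ ℤ.+ m ℤ.+ x ℤ.- (b ℤ.+ P ℤ.+ g) ≡ m ℤ.+ 1ℤ ℤ.- P ℤ.+ x ℤ.- g ℤ.- b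
            eq = ℤSolver.solve-∀

          peak-area : + S b≡ ℤ.+ + G ℤ.+ + P ℤ.* (+ P ℤ.- 1ℤ) ℤ.≤ + b ℤ.* + P
          peak-area with p , p≡ ← m≤n⇒∃[o]m+o≡n (≤-trans (s≤s z≤n) 2≤P) = areaℤ p P p≡ (2p≤b p p≡) max
            where
            2p≤b : ∀ p → suc p ≡ P → p + p ≤ b
            2p≤b p p≡ = ≤-trans (+-mono-≤ (<⇒≤ (≤-reflexive p≡)) (s≤s⁻¹ (≤-trans (≤-reflexive p≡) (y-rise b≡ k k<b)))) (y-fall b≡ k k<b)

          -- From height P̂ + 2 on, short neighbours are looked across. At height P̂ + 1 this may
          -- fail, but there L P - Y ≤ L, so that unpaid received vertices carry their own cost.
          high-paid : Paid
          high-paid with m≤n⇒m<n∨m≡n P̂<yk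
          ... | inj₁ lt = high-visible (+ P) peak-area (high-level P̂<yk) long∨short (bound-ℤ gᶜ (b-visible lt))
          ... | inj₂ e  = high-near (+ P) peak-area (high-level P̂<yk)
                            (subst (λ P → 0ℤ ℤ.≤ + ℓ ℤ.- (+ ℓ ℤ.* + P ℤ.- Yℤ)) e near-level) long∨short (bound-ℤ G b-near)

        paid : Paid
        paid with peak P̂ (y b≡) b
        ... | inj₁ flat = low flat
        ... | inj₂ (k , k<b , P̂<yk , max) with position b≡ k k<b
        ...   | own j j<a at = high-paid k k<b P̂<yk max j j<a at
        ...   | received← e  = contradiction (≤-trans (s≤s 1≤P̂) (≤-trans P̂<yk (≤-reflexive (cong (λ x → x ⊔ 1) e)))) λ { (s≤s ()) }

        block-bound : + ℓ ℤ.* + S b≡ ℤ.- Yℤ ℤ.* + b ℤ.≤ flow r₂ ℤ.- flow r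
        block-bound = ≤-by paid (eq κ (+ pay← r₂) (+ pay→ r₂) (+ pay← r) (+ pay→ r) (+ ℓ ℤ.* + S b≡ ℤ.- Yℤ ℤ.* + b))
          where
          eq : ∀ κ x y u v w → κ ℤ.* (x ℤ.+ v ℤ.- (y ℤ.+ u)) ℤ.- w ≡ κ ℤ.* (x ℤ.- y) ℤ.- κ ℤ.* (u ℤ.- v) ℤ.- w
          eq = ℤSolver.solve-∀

-- Summation over the runs of one period

module TameColourings where

  open IntegerInequalities
  open OptimumConstants
  open FiniteSums
  open Runs
  open BlockBounds
  open import Data.Bool.Base using (Bool)
  open import Data.Bool.Properties using () renaming (_≟_ to _≟ᵇ_)
  open import Data.Integer.Base as ℤ using (ℤ; +_; 0ℤ)
  import Data.Integer.Properties as ℤₚ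
  import Data.Integer.Tactic.RingSolver as ℤSolver
  open import Data.Nat.Base hiding (_/_; _%_)
  open import Data.Nat.DivMod using (_%_; m%n<n)
  open import Data.Nat.Induction using (<-rec)
  open import Data.Nat.Properties
  open import Data.Nat.Tactic.RingSolver using (solve-∀)
  open import Data.Product.Base using (_×_; _,_; ∃-syntax)
  open import Data.Sum.Base using (inj₁; inj₂)
  open import Function.Base using (_∘_)
  open import Relation.Binary.PropositionalEquality
  open import Relation.Nullary.Decidable using (yes; no; ¬?; decidable-stable)
  open import Relation.Nullary.Negation using (¬_)
  open import Relation.Unary using (Decidable)

  least : ∀ {P : ℕ → Set} → Decidable P → ∀ n → P n → ∃[ k ] k ≤ n × P k × (∀ j → j < k → ¬ P j)
  least P? zero    p = 0 , z≤n , p , λ _ ()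
  least P? (suc n) p with P? 0
  ... | yes p₀ = 0 , z≤n , p₀ , λ _ ()
  ... | no ¬p₀ with k , k≤n , pk , min ← least (P? ∘ suc) n p = suc k , s≤s k≤n , pk , λ
    { zero    _         → ¬p₀
    ; (suc j) (s≤s j<k) → min j j<k }

  module TameBound (m h e : ℕ) (1≤h : 1 ≤ h) (m≡ : suc m ≡ h + e + h)
    (lower : e * e ≤ 2 * h * h + e) (upper : 2 * h * h ≤ e * e + 3 * e + 4 * h) where

    open Optimum m h e 1≤h m≡ lower upper
    open BlockBound m h e 1≤h m≡ lower upper using (τ; flow; short→?; short←?; block-bound)

    module _ {c : ℕ → Bool} {z : ℕ → ℕ} (tame : Tame m c z) where
      open Tame tame

      Boundary : ℕ → Set
      Boundary r = c r ≢ c (suc r)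

      boundary? : Decidable Boundary
      boundary? r = ¬? (c r ≟ᵇ c (suc r))

      next-run : ∀ r d → Boundary r → Boundary (r + suc d) → ∃[ a ] a ≤ suc d × Run c r a
      next-run r d br bd with k , k≤d , bk , min ← least (λ i → boundary? (r + suc i)) d bd =
        suc k , s≤s k≤d , record { 1≤a = s≤s z≤n ; before = br ; inside = inside ; after = bk }
        where
        inside : ∀ j → j < suc k → c (suc r + j) ≡ c (suc r)
        inside zero    _     = cong c (+-identityʳ (suc r))
        inside (suc j) j+1≤k = trans (sym (decidable-stable (_ ≟ᵇ _) (min j (s≤s⁻¹ j+1≤k))))
          (trans (cong c (+-suc r j)) (inside j (<-trans (n<1+n j) j+1≤k)))

      -- A negative length could occur only for a run of one vertex that would be given away on both
      -- sides, with z r = 2 and z (r + 1) = 0. This is what `isolated` rules out.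
      block-length : ∀ {r a} → Run c r a → ∃[ b ] b + z r ≡ a + z (r + a)
      block-length {r} {a} run = a + z (r + a) ∸ z r , m∸n+n≡m zˡ≤
        where
        open Run run
        zˡ≤ : z r ≤ a + z (r + a)
        zˡ≤ with m≤n⇒m<n∨m≡n 1≤a
        ... | inj₁ 2≤a = ≤-trans (≤-trans (m≤m+n (z r) _) (cross r before)) (≤-trans 2≤a (m≤m+n a _))
        ... | inj₂ refl = ≤-trans (+-cancelʳ-≤ 1 _ _ (≤-trans (+-monoʳ-≤ (z r) 1≤zʳ) (cross r before))) (s≤s z≤n)
          where
          1≤zʳ : 1 ≤ z (suc r)
          1≤zʳ = isolated r before (λ e → after (trans (cong c (+-comm r 1)) (trans e (cong c (cong suc (+-comm 1 r))))))

      -- Sums extend between the shifted cut points `r + z r`, so that consecutive blocks abut and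
      -- the flows telescope.
      Bounded : ℕ → ℕ → Set
      Bounded r r′ = ∃[ b ] b + (r + z r) ≡ r′ + z r′ ×
        + ℓ ℤ.* + ∑ b (λ k → z (r + z r + k)) ℤ.- Yℤ ℤ.* + b ℤ.≤ flow {c} {z} r′ ℤ.- flow {c} {z} r

      bounded-refl : ∀ r → Bounded r r
      bounded-refl r = 0 , refl , ℤₚ.≤-reflexive (eq (+ ℓ) Yℤ (flow {c} {z} r))
        where
        eq : ∀ L Y f → L ℤ.* 0ℤ ℤ.- Y ℤ.* 0ℤ ≡ f ℤ.- f
        eq = ℤSolver.solve-∀

      bounded-trans : ∀ {r r′ r″} → Bounded r r′ → Bounded r′ r″ → Bounded r r″
      bounded-trans {r} {r′} {r″} (b , e , le) (b′ , e′ , le′) = b + b′ , trans (cong (λ x → x + (r + z r)) (+-comm b b′))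
        (trans (+-assoc b′ b _) (trans (cong (λ x → b′ + x) e) e′)) ,
        subst₂ ℤ._≤_
          (trans (eq₁ (+ ℓ) Yℤ (+ ∑ b f) (+ b) (+ ∑ b′ f′) (+ b′)) (cong (λ S → + ℓ ℤ.* + S ℤ.- Yℤ ℤ.* + (b + b′)) (sym sum)))
          (eq₂ (flow {c} {z} r) (flow {c} {z} r′) (flow {c} {z} r″))
          (ℤₚ.+-mono-≤ le le′)
        where
        f f′ : ℕ → ℕ
        f k = z (r + z r + k)
        f′ k = z (r′ + z r′ + k)
        at : ∀ k → r′ + z r′ + k ≡ r + z r + (b + k)
        at k = trans (cong (λ x → x + k) (trans (sym e) (+-comm b (r + z r)))) (+-assoc (r + z r) b k)
        sum : ∑ (b + b′) f ≡ ∑ b f + ∑ b′ f′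
        sum = trans (∑-++ b b′ f) (cong (λ x → ∑ b f + x) (∑-cong b′ λ k _ → cong z (sym (at k))))
        eq₁ : ∀ L Y S b S′ b′ → L ℤ.* S ℤ.- Y ℤ.* b ℤ.+ (L ℤ.* S′ ℤ.- Y ℤ.* b′) ≡ L ℤ.* (S ℤ.+ S′) ℤ.- Y ℤ.* (b ℤ.+ b′)
        eq₁ = ℤSolver.solve-∀
        eq₂ : ∀ x y w → y ℤ.- x ℤ.+ (w ℤ.- y) ≡ w ℤ.- x
        eq₂ = ℤSolver.solve-∀

      one-block : ∀ {r a} → Run c r a → τ ≤ r → Bounded r (r + a)
      one-block {r} {a} run τ≤r with b , b≡ ← block-length run = b ,
        trans (eq b r (z r)) (trans (cong (λ x → r + x) b≡) (sym (+-assoc r a _))) , block-bound tame run τ≤r b≡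
        where
        eq : ∀ b r x → b + (r + x) ≡ r + (b + x)
        eq = solve-∀

      many-blocks : ∀ d r → τ ≤ r → Boundary r → Boundary (r + d) → Bounded r (r + d)
      many-blocks = <-rec (λ d → ∀ r → τ ≤ r → Boundary r → Boundary (r + d) → Bounded r (r + d)) step
        where
        step : ∀ d → (∀ {d′} → d′ < d → ∀ r → τ ≤ r → Boundary r → Boundary (r + d′) → Bounded r (r + d′)) →
               ∀ r → τ ≤ r → Boundary r → Boundary (r + d) → Bounded r (r + d)
        step zero    rec r τ≤r br bd = subst (Bounded r) (sym (+-identityʳ r)) (bounded-refl r)
        step (suc d) rec r τ≤r br bd with next-run r d br bd
        ... | a , a≤ , run with o , o≡ ← m≤n⇒∃[o]m+o≡n a≤ =
          bounded-trans (one-block run τ≤r)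
            (subst (Bounded (r + a)) end (rec (≤-trans (+-monoˡ-≤ o (Run.1≤a run)) (≤-reflexive o≡)) (r + a)
              (≤-trans τ≤r (m≤m+n r a)) (Run.after run) (subst Boundary (sym end) bd)))
          where
          end : r + a + o ≡ r + suc d
          end = trans (+-assoc r a o) (cong (λ x → r + x) o≡)

      module _ {N : ℕ} .{{_ : NonZero N}} (c-periodic : Periodic N c) (z-periodic : Periodic N z) where

        flow-periodic : ∀ r → τ ≤ r → flow {c} {z} (r + N) ≡ flow {c} {z} r
        flow-periodic r τ≤r = cong₂ (λ x y → κ ℤ.* (+ x ℤ.- + y))
          (cong₂ _*_ (cong (λ x → 𝟙 (x ≟ 2)) (z-periodic r))
            (𝟙-cong (¬? (short→? {c} {z} (r + N))) (¬? (short→? {c} {z} r)) (λ ¬s (j , j<τ , q) → ¬s (j , j<τ , λ e → q (trans (sym (right j)) (trans e right₀))))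
                     (λ ¬s (j , j<τ , q) → ¬s (j , j<τ , λ e → q (trans (right j) (trans e (sym right₀)))))))
          (cong₂ _*_ (cong (λ x → 𝟙 (x ≟ 0)) (z-periodic r))
            (𝟙-cong (¬? (short←? {c} {z} (r + N))) (¬? (short←? {c} {z} r)) (λ ¬s (j , j<τ , q) → ¬s (j , j<τ , λ e → q (trans (sym (left j j<τ)) (trans e (c-periodic r)))))
                     (λ ¬s (j , j<τ , q) → ¬s (j , j<τ , λ e → q (trans (left j j<τ) (trans e (sym (c-periodic r))))))))
          where
          right : ∀ j → c (suc (r + N) + j) ≡ c (suc r + j)
          right j = trans (cong c (eq r N j)) (c-periodic (suc r + j))
            where
            eq : ∀ r N j → suc (r + N) + j ≡ suc r + j + N
            eq = solve-∀
          right₀ : c (suc (r + N)) ≡ c (suc r)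
          right₀ = c-periodic (suc r)
          left : ∀ j → j < τ → c (r + N ∸ j) ≡ c (r ∸ j)
          left j j<τ = trans (cong c (trans (cong (λ x → x ∸ j) (+-comm r N)) (trans (+-∸-assoc N (≤-trans (<⇒≤ j<τ) τ≤r)) (+-comm N (r ∸ j))))) (c-periodic (r ∸ j))

        constant⇒z≡0 : (∀ t → c t ≡ c (suc t)) → ∀ t → z t ≡ 0
        constant⇒z≡0 con t = n≤0⇒n≡0 (+-cancelˡ-≤ (suc m) _ 0 (begin
          suc m + z t                     ≡⟨ cong (λ n → n + z t) (count-all (c t) c t (suc m) λ k _ → same k) ⟨
          count (c t) c t (suc m) + z t   ≤⟨ visible t t (suc m) (m≤m+n t m) (≤-reflexive (+-suc t m)) ⟩
          suc m                           ≡⟨ +-identityʳ (suc m) ⟨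
          suc m + 0                       ∎))
          where
          open ≤-Reasoning
          same : ∀ k → c (t + k) ≡ c t
          same zero    = cong c (+-identityʳ t)
          same (suc k) = trans (cong c (+-suc t k)) (trans (sym (con (t + k))) (same k))

        one-period : ∀ {r} → τ ≤ r → Bounded r (r + N) → + ℓ ℤ.* + ∑ N z ℤ.≤ Yℤ ℤ.* + N
        one-period {r} τ≤r (b , e , le) = ≤-by (ℤₚ.i≤j⇒0≤j-i (subst₂ ℤ._≤_
            (cong₂ (λ S b → + ℓ ℤ.* + S ℤ.- Yℤ ℤ.* + b) (trans (cong (λ b → ∑ b (λ k → z (r + z r + k))) b≡N) (∑-shift z-periodic (r + z r))) b≡N)
            (trans (cong (λ x → x ℤ.- flow {c} {z} r) (flow-periodic r τ≤r)) (ℤₚ.+-inverseʳ (flow {c} {z} r))) le))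
            (eq (+ ℓ ℤ.* + ∑ N z) (Yℤ ℤ.* + N))
          where
          eq : ∀ x y → 0ℤ ℤ.- (x ℤ.- y) ≡ y ℤ.- x
          eq = ℤSolver.solve-∀
          b≡N : b ≡ N
          b≡N = +-cancelʳ-≡ (r + z r) b N (trans e (trans (cong (λ x → r + N + x) (z-periodic r)) (eq′ r N (z r))))
            where
            eq′ : ∀ r N x → r + N + x ≡ N + (r + x)
            eq′ = solve-∀

        tame-bound : ℓ * ∑ N z ≤ Y * N
        tame-bound with anyUpTo? boundary? N
        ... | no none = ≤-trans (≤-reflexive (trans (cong (λ x → ℓ * x) (trans (∑-cong N λ k _ → constant⇒z≡0 con k) (trans (∑-const N 0) (*-zeroʳ N)))) (*-zeroʳ ℓ))) z≤n
          where
          con : ∀ t → c t ≡ c (suc t)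
          con t = trans (periodic-% c-periodic t) (trans (decidable-stable (_ ≟ᵇ _) (λ b → none (t % N , m%n<n t N , b)))
            (sym (periodic-% {f = c ∘ suc} (c-periodic ∘ suc) t)))
        ... | yes (k , _ , bk) = ℤₚ.drop‿+≤+ (subst₂ ℤ._≤_ (sym (ℤₚ.pos-* ℓ (∑ N z)))
            (trans (cong (λ x → x ℤ.* + N) Yℤ≡Y) (sym (ℤₚ.pos-* Y N)))
            (one-period τ≤r (many-blocks N r τ≤r br (λ e → br (trans (sym (c-periodic r)) (trans e (c-periodic (suc r))))))))
          where
          r : ℕ
          -- Moving the boundary up by `τ` periods ensures `τ ≤ r`, which keeps the truncated
          -- `r ∸ j` in the backward search of `Short←` exact.
          r = k + τ * N
          τ≤r : τ ≤ r
          τ≤r = ≤-trans (m≤m*n τ N) (m≤n+m (τ * N) k)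
          br : Boundary r
          br e = bk (trans (sym (periodic-* c-periodic τ k)) (trans e (periodic-* {f = c ∘ suc} (c-periodic ∘ suc) τ k)))

-- Flipping single vertices of a cyclic colouring

module Flips where

  open FiniteSums
  open Runs
  open TameColourings
  open import Data.Bool.Base using (Bool; true; false; not)
  open import Data.Bool.Properties using () renaming (_≟_ to _≟ᵇ_)
  open import Data.Nat.Base hiding (_/_; _%_)
  open import Data.Nat.DivMod using (_/_; _%_; m≡m%n+[m/n]*n; [m+n]%n≡m%n)
  open import Data.Nat.Properties
  open import Data.Nat.Tactic.RingSolver using (solve-∀)
  open import Data.Product.Base using (_,_)
  open import Function.Base using (_∘_)
  open import Relation.Binary.Definitions using (tri<; tri≈; tri>)
  open import Relation.Binary.PropositionalEquality
  open import Relation.Nullary.Decidable using (yes; no)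
  open import Relation.Nullary.Negation using (contradiction)

  ∑-select : ∀ n (f : ℕ → ℕ) j → j < n → ∑ n (λ k → f k * 𝟙 (k ≟ j)) ≡ f j
  ∑-select (suc n) f zero j<n = trans (cong₂ _+_ (*-identityʳ (f 0))
    (trans (∑-cong n λ k _ → *-zeroʳ (f (suc k))) (trans (∑-const n 0) (*-zeroʳ n)))) (+-identityʳ (f 0))
  ∑-select (suc n) f (suc j) j<n = trans (cong₂ _+_ (*-zeroʳ (f 0))
    (trans (∑-cong n λ k _ → cong (f (suc k) *_) (𝟙-cong (suc k ≟ suc j) (k ≟ j) suc-injective (cong suc))) (∑-select n (f ∘ suc) j (s≤s⁻¹ j<n)))) refl

  %-injective : ∀ {N} .{{_ : NonZero N}} v o → o < N → (v + o) % N ≡ v % N → o ≡ 0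
  %-injective {N} v o o<N e with (v + o) / N ≤? v / N
  ... | yes q′≤q = n≤0⇒n≡0 (+-cancelʳ-≤ (v / N * N) o 0 (≤-trans (≤-reflexive (trans (+-comm o _) (sym q′N≡))) (*-monoˡ-≤ N q′≤q)))
    where
    q′N≡ : (v + o) / N * N ≡ v / N * N + o
    q′N≡ = +-cancelˡ-≡ (v % N) _ _ (begin
      v % N + (v + o) / N * N          ≡⟨ cong (_+ (v + o) / N * N) e ⟨
      (v + o) % N + (v + o) / N * N    ≡⟨ m≡m%n+[m/n]*n (v + o) N ⟨
      v + o                            ≡⟨ cong (_+ o) (m≡m%n+[m/n]*n v N) ⟩
      v % N + v / N * N + o            ≡⟨ +-assoc (v % N) _ o ⟩
      v % N + (v / N * N + o)          ∎)
      where open ≡-Reasoning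
  ... | no q′≰q = contradiction (+-cancelˡ-≤ (v % N + v / N * N) N o (begin
      v % N + v / N * N + N            ≡⟨ eq (v % N) (v / N) N ⟩
      v % N + suc (v / N) * N          ≤⟨ +-monoʳ-≤ (v % N) (*-monoˡ-≤ N (≰⇒> q′≰q)) ⟩
      v % N + (v + o) / N * N          ≡⟨ cong (_+ (v + o) / N * N) e ⟨
      (v + o) % N + (v + o) / N * N    ≡⟨ m≡m%n+[m/n]*n (v + o) N ⟨
      v + o                            ≡⟨ cong (_+ o) (m≡m%n+[m/n]*n v N) ⟩
      v % N + v / N * N + o            ∎)) (<⇒≱ o<N)
    where
    open ≤-Reasoning
    eq : ∀ r q N → r + q * N + N ≡ r + suc q * N
    eq = solve-∀

  module Cyclic (m N : ℕ) .{{_ : NonZero N}} (m<N : m < N) where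

    same : (ℕ → Bool) → ℕ → ℕ → ℕ
    same x d t = 𝟙 (x t ≟ᵇ x (t + d))

    same-total : (ℕ → Bool) → ℕ → ℕ
    same-total x d = ∑ N (same x d)

    cost : (ℕ → Bool) → ℕ
    cost x = ∑ m λ i → same-total x (suc i)

    -- The centre is `t + m`, which keeps all positions natural, and it is counted itself. Half the
    -- excess of opposite over equal colours at the centre is m + 1 - `window x t`.
    window : (ℕ → Bool) → ℕ → ℕ
    window x t = count (x (t + m)) x t (suc (m + m))

    same-periodic : ∀ {x} → Periodic N x → ∀ d → Periodic N (same x d)
    same-periodic {x} p d t = cong₂ (λ a b → 𝟙 (a ≟ᵇ b)) (p t) (trans (cong x (eq t N d)) (p (t + d)))
      where
      eq : ∀ t N d → t + N + d ≡ t + d + N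
      eq = solve-∀

    back : ℕ → ℕ → ℕ
    back t i = t + (m ∸ suc i)

    back+ : ∀ t {i} → i < m → back t i + suc i ≡ t + m
    back+ t {i} i<m = trans (+-assoc t (m ∸ suc i) (suc i)) (cong (λ k → t + k) (m∸n+n≡m i<m))

    window-split : ∀ x t → window x t ≡ suc (∑ m λ i → same x (suc i) (back t i) + same x (suc i) (t + m))
    window-split x t = begin
      ∑ (suc (m + m)) f                                   ≡⟨ cong (λ n → ∑ n f) (+-suc m m) ⟨
      ∑ (m + suc m) f                                     ≡⟨ ∑-++ m (suc m) f ⟩
      ∑ m f + (f (m + 0) + ∑ m (λ i → f (m + suc i)))     ≡⟨ cong₂ _+_ left (cong₂ _+_ middle right) ⟩
      ∑ m L + (1 + ∑ m R)                                 ≡⟨ +-suc (∑ m L) (∑ m R) ⟩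
      suc (∑ m L + ∑ m R)                                 ≡⟨ cong suc (∑-distrib-+ m L R) ⟨
      suc (∑ m λ i → L i + R i)                           ∎
      where
      open ≡-Reasoning
      f L R : ℕ → ℕ
      f k = 𝟙 (x (t + k) ≟ᵇ x (t + m))
      L i = same x (suc i) (back t i)
      R i = same x (suc i) (t + m)
      left : ∑ m f ≡ ∑ m L
      left = trans (sym (∑-reverse m f)) (∑-cong m λ i i<m → cong (λ p → 𝟙 (x (back t i) ≟ᵇ x p)) (sym (back+ t i<m)))
      middle : f (m + 0) ≡ 1
      middle = 𝟙-yes (x (t + (m + 0)) ≟ᵇ x (t + m)) (cong (λ k → x (t + k)) (+-identityʳ m))
      right : ∑ m (λ i → f (m + suc i)) ≡ ∑ m R
      right = ∑-cong m λ i _ → trans (cong (λ p → 𝟙 (x p ≟ᵇ x (t + m))) (sym (+-assoc t m (suc i))))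
        (𝟙-cong (x (t + m + suc i) ≟ᵇ x (t + m)) (x (t + m) ≟ᵇ x (t + m + suc i)) sym sym)

    module Flip (x : ℕ → Bool) (periodic : Periodic N x) (p : ℕ) where

      x′ : ℕ → Bool
      x′ t with t % N ≟ p % N
      ... | yes _ = not (x t)
      ... | no  _ = x t

      x′-at : ∀ t → t % N ≡ p % N → x′ t ≡ not (x t)
      x′-at t e with t % N ≟ p % N
      ... | yes _ = refl
      ... | no ¬e = contradiction e ¬e

      x′-off : ∀ t → t % N ≢ p % N → x′ t ≡ x t
      x′-off t ¬e with t % N ≟ p % N
      ... | yes e = contradiction e ¬e
      ... | no  _ = refl

      x′-periodic : Periodic N x′
      x′-periodic t with t % N ≟ p % N
      ... | yes e = trans (x′-at (t + N) (trans ([m+n]%n≡m%n t N) e)) (cong not (periodic t))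
      ... | no ¬e = trans (x′-off (t + N) (λ e → ¬e (trans (sym ([m+n]%n≡m%n t N)) e))) (periodic t)

      𝟙-not : ∀ a b → 𝟙 (not a ≟ᵇ b) + 𝟙 (a ≟ᵇ b) ≡ 1
      𝟙-not false false = refl
      𝟙-not false true  = refl
      𝟙-not true  false = refl
      𝟙-not true  true  = refl

      𝟙-not′ : ∀ a b → 𝟙 (a ≟ᵇ not b) + 𝟙 (a ≟ᵇ b) ≡ 1
      𝟙-not′ false false = refl
      𝟙-not′ false true  = refl
      𝟙-not′ true  false = refl
      𝟙-not′ true  true  = refl

      -- Exactly two of the pairs (k, k + d) contain the flipped vertex, those with k = p - d = `u`
      -- and k = p, and both change their status. Starting the period at `u` puts them at the
      -- indices 0 and d.
      total-flip : ∀ u d → 0 < d → d < N → u + d ≡ p →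
        same-total x′ d + 2 * (same x d u + same x d p) ≡ same-total x d + 2
      total-flip u d 0<d d<N u+d≡p = begin
        same-total x′ d + 2 * (same x d u + same x d p)
          ≡⟨ cong₂ (λ a b → a + 2 * b) (sym (∑-shift (same-periodic x′-periodic d) u)) (cong₂ _+_ at₀ at-d) ⟩
        ∑ N f′ + 2 * (∑ N (λ k → f k * 𝟙 (k ≟ 0)) + ∑ N (λ k → f k * 𝟙 (k ≟ d)))
          ≡⟨ cong (λ b → ∑ N f′ + 2 * b) (sym (∑-distrib-+ N _ _)) ⟩
        ∑ N f′ + 2 * ∑ N (λ k → f k * 𝟙 (k ≟ 0) + f k * 𝟙 (k ≟ d))
          ≡⟨ cong (∑ N f′ +_) (*-distribˡ-∑ N 2 _) ⟩
        ∑ N f′ + ∑ N (λ k → 2 * (f k * 𝟙 (k ≟ 0) + f k * 𝟙 (k ≟ d)))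
          ≡⟨ ∑-distrib-+ N f′ _ ⟨
        ∑ N (λ k → f′ k + 2 * (f k * 𝟙 (k ≟ 0) + f k * 𝟙 (k ≟ d)))
          ≡⟨ ∑-cong N pointwise ⟩
        ∑ N (λ k → f k + (1 * 𝟙 (k ≟ 0) + 1 * 𝟙 (k ≟ d)))
          ≡⟨ ∑-distrib-+ N f _ ⟩
        ∑ N f + ∑ N (λ k → 1 * 𝟙 (k ≟ 0) + 1 * 𝟙 (k ≟ d))
          ≡⟨ cong₂ _+_ (∑-shift (same-periodic periodic d) u) (trans (∑-distrib-+ N _ _)
               (cong₂ _+_ (∑-select N (λ _ → 1) 0 0<N) (∑-select N (λ _ → 1) d d<N))) ⟩
        same-total x d + 2 ∎
        where
        open ≡-Reasoning
        f f′ : ℕ → ℕ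
        f k = same x d (u + k)
        f′ k = same x′ d (u + k)
        0<N : 0 < N
        0<N = <-trans 0<d d<N
        at₀ : same x d u ≡ ∑ N (λ k → f k * 𝟙 (k ≟ 0))
        at₀ = trans (cong (same x d) (sym (+-identityʳ u))) (sym (∑-select N f 0 0<N))
        at-d : same x d p ≡ ∑ N (λ k → f k * 𝟙 (k ≟ d))
        at-d = trans (cong (same x d) (sym u+d≡p)) (sym (∑-select N f d d<N))
        distinct : ∀ i j → i < j → j < N → ∀ v → (v + i) % N ≢ (v + j) % N
        distinct i j i<j j<N v e with o , o≡ ← m≤n⇒∃[o]m+o≡n i<j =
          1+n≢0 {o} (%-injective (v + i) (suc o) (≤-trans (s≤s (m≤n+m (suc o) i)) (≤-trans (≤-reflexive (cong suc (trans (+-suc i o) o≡))) j<N))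
            (trans (cong (_% N) (trans (+-assoc v i (suc o)) (cong (v +_) (trans (+-suc i o) o≡)))) (sym e)))
        not-p : ∀ k → k < N → k ≢ d → (u + k) % N ≢ p % N
        not-p k k<N k≢d e with <-cmp k d
        ... | tri< k<d _ _ = distinct k d k<d d<N u (trans e (cong (_% N) (sym u+d≡p)))
        ... | tri≈ _ k≡d _ = k≢d k≡d
        ... | tri> _ _ d<k = distinct d k d<k k<N u (trans (cong (_% N) u+d≡p) (sym e))
        not-p+d : ∀ k → k < N → k ≢ 0 → (u + k + d) % N ≢ p % N
        not-p+d zero    k<N k≢0 e = k≢0 refl
        not-p+d (suc k) k<N k≢0 e = distinct 0 (suc k) z<s k<N (u + d)
          (trans (cong (_% N) (trans (+-identityʳ (u + d)) u+d≡p)) (trans (sym e) (cong (_% N) (eq u k d))))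
          where
          eq : ∀ u k d → u + suc k + d ≡ u + d + suc k
          eq = solve-∀
        pointwise : ∀ k → k < N → f′ k + 2 * (f k * 𝟙 (k ≟ 0) + f k * 𝟙 (k ≟ d)) ≡ f k + (1 * 𝟙 (k ≟ 0) + 1 * 𝟙 (k ≟ d))
        pointwise k k<N with k ≟ 0 | k ≟ d
        ... | yes refl | yes refl = contradiction 0<d λ ()
        ... | yes refl | no k≢d = trans (eq (f′ 0) (f 0)) (trans (cong (_+ f 0) flipped) (+-comm 1 (f 0)))
          where
          flipped : f′ 0 + f 0 ≡ 1
          flipped = trans (cong₂ (λ a b → 𝟙 (a ≟ᵇ b) + f 0) (x′-off (u + 0) (not-p 0 k<N k≢d))
              (x′-at (u + 0 + d) (cong (_% N) (trans (cong (_+ d) (+-identityʳ u)) u+d≡p))))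
            (𝟙-not′ (x (u + 0)) (x (u + 0 + d)))
          eq : ∀ a b → a + 2 * (b * 1 + b * 0) ≡ a + b + b
          eq = solve-∀
        ... | no k≢0 | yes refl = trans (eq (f′ d) (f d)) (trans (cong (_+ f d) flipped) (+-comm 1 (f d)))
          where
          flipped : f′ d + f d ≡ 1
          flipped = trans (cong₂ (λ a b → 𝟙 (a ≟ᵇ b) + f d) (x′-at (u + d) (cong (_% N) u+d≡p))
              (x′-off (u + d + d) (not-p+d d k<N k≢0)))
            (𝟙-not (x (u + d)) (x (u + d + d)))
          eq : ∀ a b → a + 2 * (b * 0 + b * 1) ≡ a + b + b
          eq = solve-∀
        ... | no k≢0 | no k≢d = trans (eq (f′ k) (f k)) (trans (cong₂ (λ a b → 𝟙 (a ≟ᵇ b)) (x′-off (u + k) (not-p k k<N k≢d))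
              (x′-off (u + k + d) (not-p+d k k<N k≢0))) (sym (+-identityʳ (f k))))
          where
          eq : ∀ a b → a + 2 * (b * 0 + b * 0) ≡ a
          eq = solve-∀

      module _ (t : ℕ) (p≡ : t + m ≡ p) where

        private
          pairs : ℕ → ℕ
          pairs i = same x (suc i) (back t i) + same x (suc i) (t + m)

        step-total : ∀ i → i < m → same-total x′ (suc i) + 2 * pairs i ≡ same-total x (suc i) + 2
        step-total i i<m = subst (λ q → same-total x′ (suc i) + 2 * (same x (suc i) (back t i) + same x (suc i) q) ≡ same-total x (suc i) + 2)
          (sym p≡) (total-flip (back t i) (suc i) z<s (≤-<-trans i<m m<N) (trans (back+ t i<m) p≡))

        -- Of the 2m pairs at the flipped vertex, window - 1 are monochromatic, and after the flip
        -- the other 2m - (window - 1) are.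
        cost-flip : cost x′ + 2 * window x t ≡ cost x + 2 * suc m
        cost-flip = begin
          cost x′ + 2 * window x t                                   ≡⟨ cong (λ w → cost x′ + 2 * w) (window-split x t) ⟩
          cost x′ + 2 * suc (∑ m pairs)                              ≡⟨ eq (cost x′) (∑ m pairs) ⟩
          cost x′ + 2 * ∑ m pairs + 2                                ≡⟨ cong (λ s → cost x′ + s + 2) (*-distribˡ-∑ m 2 pairs) ⟩
          cost x′ + ∑ m (λ i → 2 * pairs i) + 2                      ≡⟨ cong (_+ 2) (∑-distrib-+ m (λ i → same-total x′ (suc i)) (λ i → 2 * pairs i)) ⟨
          ∑ m (λ i → same-total x′ (suc i) + 2 * pairs i) + 2        ≡⟨ cong (_+ 2) (∑-cong m step-total) ⟩
          ∑ m (λ i → same-total x (suc i) + 2) + 2                   ≡⟨ cong (_+ 2) (∑-distrib-+ m (λ i → same-total x (suc i)) (λ _ → 2)) ⟩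
          cost x + ∑ m (λ _ → 2) + 2                                 ≡⟨ cong (λ s → cost x + s + 2) (∑-const m 2) ⟩
          cost x + m * 2 + 2                                         ≡⟨ eq′ (cost x) m ⟩
          cost x + 2 * suc m                                         ∎
          where
          open ≡-Reasoning
          eq : ∀ c s → c + 2 * suc s ≡ c + 2 * s + 2
          eq = solve-∀
          eq′ : ∀ c m → c + m * 2 + 2 ≡ c + 2 * suc m
          eq′ = solve-∀

    same-total≤N : ∀ x d → same-total x d ≤ N
    same-total≤N x d = ≤-trans (∑-mono N λ k _ → 𝟙≤1 (x k ≟ᵇ x (k + d))) (≤-reflexive (trans (∑-const N 1) (*-identityʳ N)))

    -- Every vertex counts itself once, and every monochromatic pair is counted from both of its
    -- ends.
    window-total : ∀ {x} → Periodic N x → ∑ N (window x) ≡ N + 2 * cost x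
    window-total {x} periodic = begin
      ∑ N (window x)                                                      ≡⟨ ∑-cong N (λ t _ → window-split x t) ⟩
      ∑ N (λ t → 1 + ∑ m λ i → L i t + R i t)                             ≡⟨ ∑-distrib-+ N (λ _ → 1) _ ⟩
      ∑ N (λ _ → 1) + ∑ N (λ t → ∑ m λ i → L i t + R i t)                 ≡⟨ cong₂ _+_ (trans (∑-const N 1) (*-identityʳ N)) (∑-comm N m (λ t i → L i t + R i t)) ⟩
      N + ∑ m (λ i → ∑ N λ t → L i t + R i t)                             ≡⟨ cong (N +_) (∑-cong m λ i _ → trans (∑-distrib-+ N (L i) (R i))
                                                                               (cong₂ _+_ (shift i (m ∸ suc i)) (shift i m))) ⟩
      N + ∑ m (λ i → same-total x (suc i) + same-total x (suc i))         ≡⟨ cong (N +_) (trans (∑-distrib-+ m _ _) (cong (cost x +_) (sym (+-identityʳ (cost x))))) ⟩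
      N + 2 * cost x                                                      ∎
      where
      open ≡-Reasoning
      L R : ℕ → ℕ → ℕ
      L i t = same x (suc i) (back t i)
      R i t = same x (suc i) (t + m)
      shift : ∀ i k → ∑ N (λ t → same x (suc i) (t + k)) ≡ same-total x (suc i)
      shift i k = trans (∑-cong N λ t _ → cong (same x (suc i)) (+-comm t k)) (∑-shift (same-periodic periodic (suc i)) k)

    -- Local optimality: no flip lowers the cost, and no flip of equal cost joins a single-vertex
    -- run to its neighbours.
    record Stable (x : ℕ → Bool) : Set where
      field
        light    : ∀ t → window x t ≤ suc m
        isolated : ∀ t → x (t + m) ≢ x (suc t + m) → x (suc t + m) ≢ x (suc (suc t) + m) → window x (suc t) ≤ m

    count-not : ∀ b x u n → count b x u n + count (not b) x u n ≡ n
    count-not b x u n = trans (sym (∑-distrib-+ n _ _)) (trans (∑-cong n λ k _ → eq (x (u + k)) b) (trans (∑-const n 1) (*-identityʳ n)))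
      where
      eq : ∀ a b → 𝟙 (a ≟ᵇ b) + 𝟙 (a ≟ᵇ not b) ≡ 1
      eq false false = refl
      eq false true  = refl
      eq true  false = refl
      eq true  true  = refl

    count-slide : ∀ b x t n → 𝟙 (x t ≟ᵇ b) + count b x (suc t) n ≡ count b x t n + 𝟙 (x (t + n) ≟ᵇ b)
    count-slide b x t n = trans (cong₂ (λ p q → 𝟙 (x p ≟ᵇ b) + q) (sym (+-identityʳ t))
      (∑-cong n λ k _ → cong (λ p → 𝟙 (x p ≟ᵇ b)) (sym (+-suc t k)))) (∑-last n λ k → 𝟙 (x (t + k) ≟ᵇ b))

    count-slide-≤ : ∀ b x t n → count b x t n ≤ suc (count b x (suc t) n)
    count-slide-≤ b x t n = ≤-trans (m≤m+n _ _) (≤-trans (≤-reflexive (sym (count-slide b x t n))) (+-monoˡ-≤ _ (𝟙≤1 (x t ≟ᵇ b))))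

    count-slide-≥ : ∀ b x t n → count b x (suc t) n ≤ suc (count b x t n)
    count-slide-≥ b x t n = ≤-trans (m≤n+m _ _) (≤-trans (≤-reflexive (count-slide b x t n))
      (≤-trans (+-monoʳ-≤ _ (𝟙≤1 (x (t + n) ≟ᵇ b))) (≤-reflexive (+-comm _ 1))))

    height : (ℕ → Bool) → ℕ → ℕ
    height x t = suc m ∸ window x t

    module _ {x : ℕ → Bool} (stable : Stable x) where
      open Stable stable

      height+window : ∀ t → height x t + window x t ≡ suc m
      height+window t = m∸n+n≡m (light t)

      height-step : ∀ t t′ → window x t′ ≤ suc (window x t) → height x t ≤ suc (height x t′)
      height-step t t′ le = +-cancelʳ-≤ (window x t) _ _ (begin
        height x t + window x t            ≡⟨ trans (height+window t) (sym (height+window t′)) ⟩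
        height x t′ + window x t′          ≤⟨ +-monoʳ-≤ (height x t′) le ⟩
        height x t′ + suc (window x t)     ≡⟨ +-suc (height x t′) (window x t) ⟩
        suc (height x t′) + window x t     ∎)
        where open ≤-Reasoning

      stable⇒tame : Tame m (λ t → x (t + m)) (height x)
      stable⇒tame = record { climb = climb ; descend = descend ; cross = cross ; isolated = isolated′ ; visible = visible }
        where
        n = suc (m + m)
        climb : ∀ t → x (t + m) ≡ x (suc t + m) → height x (suc t) ≤ suc (height x t)
        climb t e = height-step (suc t) t (subst (λ b → count (x (t + m)) x t n ≤ suc (count b x (suc t) n)) e (count-slide-≤ (x (t + m)) x t n))
        descend : ∀ t → x (t + m) ≡ x (suc t + m) → height x t ≤ suc (height x (suc t))
        descend t e = height-step t (suc t) (subst (λ b → count b x (suc t) n ≤ suc (count (x (t + m)) x t n)) e (count-slide-≥ (x (t + m)) x t n))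
        -- `window x t` counts one colour and `window x (suc t)` the other. If both referred to the
        -- same 2m + 1 positions they would add up to 2m + 1; sliding one of them by a step costs at
        -- most 1.
        cross : ∀ t → x (t + m) ≢ x (suc t + m) → height x t + height x (suc t) ≤ 2
        cross t ≢ᵗ = +-cancelʳ-≤ (window x t + window x (suc t)) _ _ (begin
          height x t + height x (suc t) + (window x t + window x (suc t))    ≡⟨ eq (height x t) (height x (suc t)) (window x t) (window x (suc t)) ⟩
          (height x t + window x t) + (height x (suc t) + window x (suc t))  ≡⟨ cong₂ _+_ (height+window t) (height+window (suc t)) ⟩
          suc m + suc m                                                      ≡⟨ cong suc (+-suc m m) ⟩
          suc n                                                              ≡⟨ cong suc (count-not b x (suc t) n) ⟨
          suc (count b x (suc t) n + count (not b) x (suc t) n)              ≡⟨ cong (λ b′ → suc (count b x (suc t) n + count b′ x (suc t) n)) not-b ⟩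
          suc (count b x (suc t) n + window x (suc t))                       ≤⟨ s≤s (+-monoˡ-≤ (window x (suc t)) (count-slide-≥ b x t n)) ⟩
          2 + (window x t + window x (suc t))                                ∎)
          where
          open ≤-Reasoning
          b = x (t + m)
          not-b : not b ≡ x (suc t + m)
          not-b = flip-≢ b (x (suc t + m)) ≢ᵗ
            where
            flip-≢ : ∀ a b → a ≢ b → not a ≡ b
            flip-≢ false false q = contradiction refl q
            flip-≢ false true  q = refl
            flip-≢ true  false q = refl
            flip-≢ true  true  q = contradiction refl q
          eq : ∀ a b c d → a + b + (c + d) ≡ (a + c) + (b + d)
          eq = solve-∀
        isolated′ : ∀ t → x (t + m) ≢ x (suc t + m) → x (suc t + m) ≢ x (suc (suc t) + m) → 1 ≤ height x (suc t)
        isolated′ t p q = m<n⇒0<n∸m (s≤s (isolated t p q))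
        visible : ∀ t u k → t ≤ u + m → u + k ≤ suc (t + m) → count (x (t + m)) (λ s → x (s + m)) u k + height x t ≤ suc m
        visible t u k t≤ ≤t with i , i≡ ← m≤n⇒∃[o]m+o≡n t≤ with o , o≡ ← m≤n⇒∃[o]m+o≡n ≤t = begin
          count b (λ s → x (s + m)) u k + height x t      ≡⟨ cong (_+ height x t) (∑-cong k λ j _ → cong (λ p → 𝟙 (x p ≟ᵇ b)) (at j)) ⟩
          count b x (t + i) k + height x t                ≤⟨ +-monoˡ-≤ (height x t) (≤-trans (m≤n+m _ (count b x t i)) (m≤m+n _ (count b x (t + (i + k)) o))) ⟩
          count b x t i + count b x (t + i) k + count b x (t + (i + k)) o + height x t
            ≡⟨ cong (λ c → c + count b x (t + (i + k)) o + height x t) (count-++ b x t i k) ⟨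
          count b x t (i + k) + count b x (t + (i + k)) o + height x t   ≡⟨ cong (_+ height x t) (count-++ b x t (i + k) o) ⟨
          count b x t (i + k + o) + height x t            ≡⟨ cong (λ l → count b x t l + height x t) length ⟩
          window x t + height x t                         ≡⟨ +-comm (window x t) (height x t) ⟩
          height x t + window x t                         ≡⟨ height+window t ⟩
          suc m                                           ∎
          where
          open ≤-Reasoning
          b = x (t + m)
          at : ∀ j → u + j + m ≡ t + i + j
          at j = trans (eq u j m) (cong (_+ j) (sym i≡))
            where
            eq : ∀ u j m → u + j + m ≡ u + m + j
            eq = solve-∀
          length : i + k + o ≡ n
          length = +-cancelˡ-≡ t _ _ (trans (eq₁ t i k o) (trans (cong (λ s → s + k + o) i≡) (trans (eq₂ u m k o) (trans (cong (_+ m) o≡) (eq₃ t m)))))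
            where
            eq₁ : ∀ t i k o → t + (i + k + o) ≡ t + i + k + o
            eq₁ = solve-∀
            eq₂ : ∀ u m k o → u + m + k + o ≡ u + k + o + m
            eq₂ = solve-∀
            eq₃ : ∀ t m → suc (t + m) + m ≡ t + suc (m + m)
            eq₃ = solve-∀

-- The minimum number of monochromatic pairs in a cyclic colouring

module CyclicColourings where

  open FiniteSums
  open Runs
  open TameColourings
  open Flips
  open OptimumConstants
  open import Data.Bool.Base using (Bool)
  open import Data.Bool.Properties using () renaming (_≟_ to _≟ᵇ_)
  open import Data.Nat.Base hiding (_/_; _%_)
  open import Data.Nat.DivMod using (_%_; m%n<n)
  open import Data.Nat.Induction using (<-wellFounded)
  open import Data.Nat.Properties
  open import Data.Nat.Tactic.RingSolver using (solve-∀)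
  open import Data.Product.Base using (_×_; _,_; ∃-syntax)
  open import Data.Sum.Base using (_⊎_; inj₁; inj₂)
  open import Function.Base using (_∘_)
  open import Induction.WellFounded using (Acc; acc)
  open import Relation.Binary.PropositionalEquality
  open import Relation.Nullary.Decidable using (Dec; yes; no; ¬?; _×-dec_)
  open import Relation.Nullary.Negation using (¬_)

  module CyclicBound (m h e : ℕ) (1≤m : 1 ≤ m) (1≤h : 1 ≤ h) (m≡ : suc m ≡ h + e + h)
    (lower : e * e ≤ 2 * h * h + e) (upper : 2 * h * h ≤ e * e + 3 * e + 4 * h)
    (N : ℕ) .{{_ : NonZero N}} (m<N : m < N) where

    open Cyclic m N m<N
    open Optimum m h e 1≤h m≡ lower upper using (ℓ; Y)
    open TameBound m h e 1≤h m≡ lower upper using (tame-bound)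

    -- Flipping a heavy vertex lowers the cost by at least 2 but may destroy two equal neighbour
    -- pairs, hence the weight 2. Flipping an isolated vertex with z = 0 keeps the cost and creates
    -- two equal neighbour pairs.
    measure : (ℕ → Bool) → ℕ
    measure x = 2 * cost x + (N ∸ same-total x 1)

    Heavy Isolated : (ℕ → Bool) → ℕ → Set
    Heavy x t = suc m < window x t
    Isolated x t = x (t + m) ≢ x (suc t + m) × x (suc t + m) ≢ x (suc (suc t) + m) × m < window x (suc t)

    heavy? : ∀ x t → Dec (Heavy x t)
    heavy? x t = suc m <? window x t

    isolated? : ∀ x t → Dec (Isolated x t)
    isolated? x t = ¬? (x (t + m) ≟ᵇ x (suc t + m)) ×-dec (¬? (x (suc t + m) ≟ᵇ x (suc (suc t) + m)) ×-dec (m <? window x (suc t)))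

    window-periodic : ∀ {x} → Periodic N x → Periodic N (window x)
    window-periodic {x} p t = ∑-cong (suc (m + m)) λ k _ → cong₂ (λ a b → 𝟙 (a ≟ᵇ b)) (shift k) (shift m)
      where
      shift : ∀ k → x (t + N + k) ≡ x (t + k)
      shift k = trans (cong x (eq t N k)) (p (t + k))
        where
        eq : ∀ t N k → t + N + k ≡ t + k + N
        eq = solve-∀

    Improvement : (ℕ → Bool) → Set
    Improvement x = ∃[ x′ ] Periodic N x′ × measure x′ < measure x × cost x′ ≤ cost x

    heavy⇒improvement : ∀ {x} → Periodic N x → ∀ t → Heavy x t → Improvement x
    heavy⇒improvement {x} p t heavy = x′ , x′-periodic , smaller , ≤-trans (m≤m+n (cost x′) 2) cost+2≤
      where
      open Flip x p (t + m)
      cost+2≤ : cost x′ + 2 ≤ cost x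
      cost+2≤ = +-cancelʳ-≤ (2 * suc m) _ _ (begin
        cost x′ + 2 + 2 * suc m        ≡⟨ eq (cost x′) m ⟩
        cost x′ + 2 * suc (suc m)      ≤⟨ +-monoʳ-≤ (cost x′) (*-monoʳ-≤ 2 heavy) ⟩
        cost x′ + 2 * window x t       ≡⟨ cost-flip t refl ⟩
        cost x + 2 * suc m             ∎)
        where
        open ≤-Reasoning
        eq : ∀ c m → c + 2 + 2 * suc m ≡ c + 2 * suc (suc m)
        eq = solve-∀
      pairs = same x 1 (back t 0) + same x 1 (t + m)
      total : same-total x′ 1 + 2 * pairs ≡ same-total x 1 + 2
      total = step-total t refl 0 1≤m
      total≤ : same-total x 1 ≤ same-total x′ 1 + 2
      total≤ = +-cancelʳ-≤ 2 _ _ (begin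
        same-total x 1 + 2             ≡⟨ total ⟨
        same-total x′ 1 + 2 * pairs    ≤⟨ +-monoʳ-≤ _ (*-monoʳ-≤ 2 (+-mono-≤ (𝟙≤1 (x (back t 0) ≟ᵇ _)) (𝟙≤1 (x (t + m) ≟ᵇ _)))) ⟩
        same-total x′ 1 + 4            ≡⟨ +-assoc (same-total x′ 1) 2 2 ⟨
        same-total x′ 1 + 2 + 2        ∎)
        where open ≤-Reasoning
      smaller : measure x′ < measure x
      smaller = begin-strict
        2 * cost x′ + (N ∸ same-total x′ 1)              ≤⟨ +-monoʳ-≤ (2 * cost x′) (m≤n+o⇒m∸n≤o N (same-total x′ 1) (begin
          N                                                  ≡⟨ m∸n+n≡m (same-total≤N x 1) ⟨
          N ∸ same-total x 1 + same-total x 1                ≤⟨ +-monoʳ-≤ (N ∸ same-total x 1) total≤ ⟩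
          N ∸ same-total x 1 + (same-total x′ 1 + 2)         ≡⟨ eq (N ∸ same-total x 1) (same-total x′ 1) ⟩
          same-total x′ 1 + (2 + (N ∸ same-total x 1))       ∎)) ⟩
        2 * cost x′ + (2 + (N ∸ same-total x 1))         <⟨ +-monoʳ-< (2 * cost x′) (+-monoˡ-< (N ∸ same-total x 1) {2} {4} (s≤s (s≤s (s≤s z≤n)))) ⟩
        2 * cost x′ + (4 + (N ∸ same-total x 1))         ≡⟨ eq′ (cost x′) (N ∸ same-total x 1) ⟩
        2 * (cost x′ + 2) + (N ∸ same-total x 1)         ≤⟨ +-monoˡ-≤ _ (*-monoʳ-≤ 2 cost+2≤) ⟩
        2 * cost x + (N ∸ same-total x 1)                ∎
        where
        open ≤-Reasoning
        eq : ∀ a s → a + (s + 2) ≡ s + (2 + a)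
        eq = solve-∀
        eq′ : ∀ c a → 2 * c + (4 + a) ≡ 2 * (c + 2) + a
        eq′ = solve-∀

    isolated⇒improvement : ∀ {x} → Periodic N x → ∀ t → ¬ Heavy x (suc t) → Isolated x t → Improvement x
    isolated⇒improvement {x} p t light (≢ˡ , ≢ʳ , m<w) = x′ , x′-periodic , smaller , ≤-reflexive cost≡
      where
      open Flip x p (suc t + m)
      window≡ : window x (suc t) ≡ suc m
      window≡ = ≤-antisym (≮⇒≥ light) m<w
      cost≡ : cost x′ ≡ cost x
      cost≡ = +-cancelʳ-≡ (2 * suc m) _ _ (trans (cong (λ w → cost x′ + 2 * w) (sym window≡)) (cost-flip (suc t) refl))
      back≡ : back (suc t) 0 ≡ t + m
      back≡ = trans (sym (+-suc t (m ∸ 1))) (cong (t +_) (m+[n∸m]≡n 1≤m))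
      total : same-total x′ 1 ≡ same-total x 1 + 2
      total = trans (trans (sym (+-identityʳ _)) (cong (λ s → same-total x′ 1 + 2 * s) (sym (cong₂ _+_
        (𝟙-no (x (back (suc t) 0) ≟ᵇ x (back (suc t) 0 + 1)) λ e → ≢ˡ (trans (cong x (sym back≡)) (trans e (cong x (trans (+-comm _ 1) (cong suc back≡))))))
        (𝟙-no (x (suc t + m) ≟ᵇ x (suc t + m + 1)) λ e → ≢ʳ (trans e (cong x (+-comm (suc t + m) 1)))))))) (step-total (suc t) refl 0 1≤m)
      smaller : measure x′ < measure x
      smaller = begin-strict
        2 * cost x′ + (N ∸ same-total x′ 1)   ≡⟨ cong (λ c → 2 * c + (N ∸ same-total x′ 1)) cost≡ ⟩
        2 * cost x + (N ∸ same-total x′ 1)    <⟨ +-monoʳ-< (2 * cost x) (∸-monoʳ-< (≤-trans (m≤m+n _ 1) (≤-reflexive (trans (eq (same-total x 1)) (sym total)))) (same-total≤N x′ 1)) ⟩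
        2 * cost x + (N ∸ same-total x 1)     ∎
        where
        open ≤-Reasoning
        eq : ∀ a → suc a + 1 ≡ a + 2
        eq = solve-∀

    stable∨improvement : ∀ {x} → Periodic N x → Stable x ⊎ Improvement x
    stable∨improvement {x} p with anyUpTo? (heavy? x) N | anyUpTo? (isolated? x) N
    ... | yes (t , _ , heavy) | _ = inj₂ (heavy⇒improvement p t heavy)
    ... | no light | yes (t , _ , iso) = inj₂ (isolated⇒improvement p t (λ heavy → light′ (suc t) heavy) iso)
      where
      light′ : ∀ t → ¬ Heavy x t
      light′ t heavy = light (t % N , m%n<n t N , subst (suc m <_) (periodic-% (window-periodic p) t) heavy)
    ... | no light | no ¬iso = inj₁ record
      { light = λ t → ≮⇒≥ λ heavy → light (t % N , m%n<n t N , subst (suc m <_) (periodic-% (window-periodic p) t) heavy)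
      ; isolated = λ t ≢ˡ ≢ʳ → ≮⇒≥ λ heavy → ¬iso (t % N , m%n<n t N ,
          (λ e → ≢ˡ (trans (at 0 t) (trans e (sym (at 1 t))))) , (λ e → ≢ʳ (trans (at 1 t) (trans e (sym (at 2 t))))) ,
          subst (m <_) (periodic-% {f = window x ∘ suc} (window-periodic p ∘ suc) t) heavy) }
      where
      at : ∀ k t → x (k + t + m) ≡ x (k + t % N + m)
      at k t = periodic-% {f = λ t → x (k + t + m)} (λ t → trans (cong x (eq k t N m)) (p (k + t + m))) t
        where
        eq : ∀ k t N m → k + (t + N) + m ≡ k + t + m + N
        eq = solve-∀

    stable-bound : ∀ {x} → Periodic N x → Stable x → ℓ * (m * N) ≤ Y * N + 2 * (ℓ * cost x)
    stable-bound {x} p stable = +-cancelʳ-≤ (ℓ * N) _ _ (begin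
      ℓ * (m * N) + ℓ * N                            ≡⟨ eq ℓ m N ⟩
      ℓ * (N * suc m)                                ≡⟨ cong (ℓ *_) (trans (sym (∑-const N (suc m))) (trans (∑-cong N λ t _ → sym (height+window stable t)) (∑-distrib-+ N (height x) (window x)))) ⟩
      ℓ * (∑ N (height x) + ∑ N (window x))          ≡⟨ *-distribˡ-+ ℓ _ _ ⟩
      ℓ * ∑ N (height x) + ℓ * ∑ N (window x)        ≤⟨ +-mono-≤ (tame-bound (stable⇒tame stable) {N} colour-periodic height-periodic) (≤-reflexive (cong (ℓ *_) (window-total p))) ⟩
      Y * N + ℓ * (N + 2 * cost x)                   ≡⟨ eq′ (Y * N) ℓ N (cost x) ⟩
      Y * N + 2 * (ℓ * cost x) + ℓ * N               ∎)
      where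
      open ≤-Reasoning
      eq : ∀ ℓ m N → ℓ * (m * N) + ℓ * N ≡ ℓ * (N * suc m)
      eq = solve-∀
      eq′ : ∀ y ℓ N c → y + ℓ * (N + 2 * c) ≡ y + 2 * (ℓ * c) + ℓ * N
      eq′ = solve-∀
      colour-periodic : Periodic N (λ t → x (t + m))
      colour-periodic t = trans (cong x (eq″ t N m)) (p (t + m))
        where
        eq″ : ∀ t N m → t + N + m ≡ t + m + N
        eq″ = solve-∀
      height-periodic : Periodic N (height x)
      height-periodic t = cong (suc m ∸_) (window-periodic p t)

    -- As ℓm - Y is twice the numerator of f at ℓ, this is cost ≥ f(ℓ) N. Improvements never raise
    -- the cost, so it suffices to treat the stable colouring at which they end.
    cyclic-bound : ∀ x → Periodic N x → ℓ * (m * N) ≤ Y * N + 2 * (ℓ * cost x)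
    cyclic-bound x p = go x p (<-wellFounded (measure x))
      where
      go : ∀ x → Periodic N x → Acc _<_ (measure x) → ℓ * (m * N) ≤ Y * N + 2 * (ℓ * cost x)
      go x p (acc rec) with stable∨improvement p
      ... | inj₁ stable = stable-bound p stable
      ... | inj₂ (x′ , p′ , lt , cost≤) = ≤-trans (go x′ p′ (rec lt)) (+-monoʳ-≤ (Y * N) (*-monoʳ-≤ 2 (*-monoʳ-≤ ℓ cost≤)))

-- The graphs of large minimum degree

module HubGraphs where

  open import Data.Bool.Base using (Bool; true; false)
  open import Data.Bool.Properties using () renaming (_≟_ to _≟ᵇ_)
  open import Data.Fin.Base using (Fin; toℕ)
  open import Data.Fin.Properties using (toℕ<n; toℕ-injective) renaming (_≟_ to _≟ᶠ_)
  open import Data.List.Base using (List; []; _∷_; _++_; length; map; filter; allFin; applyUpTo; [_])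
  open import Data.List.Extrema.Nat using (argmin-all)
  open import Data.List.Membership.Propositional using (_∈_)
  open import Data.List.Membership.Propositional.Properties using (∈-∃++; ∈-++⁺ˡ; ∈-++⁺ʳ; ∈-++⁻; ∈-filter⁻; ∈-map⁻; ∈-applyUpTo⁺)
  open import Data.List.Properties using (length-++; length-map; length-applyUpTo; length-tabulate)
  open import Data.List.Relation.Unary.All as All using (All; []; _∷_)
  import Data.List.Relation.Unary.All.Properties as Allₚ
  open import Data.List.Relation.Unary.Any using (here; there)
  open import Data.List.Relation.Unary.AllPairs using ([]; _∷_)
  open import Data.List.Relation.Unary.Unique.Propositional using (Unique)
  open import Data.List.Relation.Unary.Unique.Propositional.Properties using (map⁺; filter⁺; allFin⁺)
  open import Data.Nat.Base hiding (_/_; _%_)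
  open import Data.Nat.DivMod using (_/_; m/n<m; m≡m%n+[m/n]*n; m%n<n)
  open import Data.Nat.Properties
  open import Data.Nat.Tactic.RingSolver using (solve-∀)
  open import Data.Product.Base using (_×_; _,_; proj₂)
  open import Data.Sum.Base using (_⊎_; inj₁; inj₂)
  open import Defs using (Graph; Adj; adj?; degree; δ)
  open import Function.Base using (_∘_; id)
  open import Relation.Binary.PropositionalEquality hiding ([_])
  open import Relation.Nullary.Decidable using (Dec; yes; no; does; ¬?; _×-dec_; _⊎-dec_; decidable-stable)
  open import Relation.Nullary.Negation using (¬_; contradiction)
  open import Relation.Unary using (Decidable)

  unique-⊆⇒length≤ : ∀ {A : Set} {xs : List A} → Unique xs → ∀ {ys} → (∀ {x} → x ∈ xs → x ∈ ys) → length xs ≤ length ys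
  unique-⊆⇒length≤ [] sub = z≤n
  unique-⊆⇒length≤ {xs = x ∷ xs} (x∉ ∷ u) {ys} sub with ps , qs , refl ← ∈-∃++ (sub (here refl)) = begin
    suc (length xs)                 ≤⟨ s≤s (unique-⊆⇒length≤ u sub′) ⟩
    suc (length (ps ++ qs))         ≡⟨ cong suc (length-++ ps) ⟩
    suc (length ps + length qs)     ≡⟨ +-suc (length ps) (length qs) ⟨
    length ps + suc (length qs)     ≡⟨ length-++ ps ⟨
    length (ps ++ [ x ] ++ qs)      ∎
    where
    open ≤-Reasoning
    sub′ : ∀ {y} → y ∈ xs → y ∈ ps ++ qs
    sub′ y∈xs with ∈-++⁻ ps (sub (there y∈xs))
    ... | inj₁ y∈ps            = ∈-++⁺ˡ y∈ps
    ... | inj₂ (here refl)     = contradiction refl (All.lookup x∉ y∈xs)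
    ... | inj₂ (there y∈qs)    = ∈-++⁺ʳ ps y∈qs

  length-filter-¬ : ∀ {A : Set} {P : A → Set} (P? : Decidable P) xs →
    length (filter P? xs) + length (filter (¬? ∘ P?) xs) ≡ length xs
  length-filter-¬ P? [] = refl
  length-filter-¬ P? (x ∷ xs) with P? x
  ... | yes _ = cong suc (length-filter-¬ P? xs)
  ... | no  _ = trans (+-suc _ _) (cong suc (length-filter-¬ P? xs))

  does-true : ∀ {P : Set} (P? : Dec P) → does P? ≡ true → P
  does-true (yes p) _ = p

  does-false : ∀ {P : Set} (P? : Dec P) → does P? ≡ false → ¬ P
  does-false (no ¬p) _ = ¬p

  length-interval : ∀ {n} {P : Fin n → Set} (P? : Decidable P) a k → (∀ u → P u → a ≤ toℕ u × toℕ u < a + k) →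
    length (filter P? (allFin n)) ≤ k
  length-interval {n} P? a k within = begin
    length (filter P? (allFin n))              ≡⟨ length-map toℕ (filter P? (allFin n)) ⟨
    length (map toℕ (filter P? (allFin n)))    ≤⟨ unique-⊆⇒length≤ (map⁺ toℕ-injective (filter⁺ P? (allFin⁺ n))) sub ⟩
    length (applyUpTo (λ i → a + i) k)         ≡⟨ length-applyUpTo _ k ⟩
    k                                          ∎
    where
    open ≤-Reasoning
    sub : ∀ {x} → x ∈ map toℕ (filter P? (allFin n)) → x ∈ applyUpTo (λ i → a + i) k
    sub x∈ with u , u∈ , refl ← ∈-map⁻ toℕ x∈ with a≤u , u<a+k ← within u (proj₂ (∈-filter⁻ P? {xs = allFin n} u∈)) =
      subst (_∈ applyUpTo (λ i → a + i) k) (m+[n∸m]≡n a≤u)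
        (∈-applyUpTo⁺ (λ i → a + i) (+-cancelˡ-< a _ _ (subst (_< a + k) (sym (m+[n∸m]≡n a≤u)) u<a+k)))

  -- A complete bipartite graph with n/D further vertices joined to everything;
  -- for n < 4D all vertices are of the latter kind.
  module HubGraph (D : ℕ) (2≤D : 2 ≤ D) where

    instance
      D≢0 : NonZero D
      D≢0 = >-nonZero (≤-trans (s≤s z≤n) 2≤D)

    hub : ℕ → ℕ
    hub n with n <? 4 * D
    ... | yes _ = n
    ... | no  _ = n / D

    hub-small : ∀ {n} → n < 4 * D → hub n ≡ n
    hub-small {n} p with n <? 4 * D
    ... | yes _ = refl
    ... | no ¬p = contradiction p ¬p

    hub-large : ∀ {n} → ¬ n < 4 * D → hub n ≡ n / D
    hub-large {n} ¬p with n <? 4 * D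
    ... | yes p = contradiction p ¬p
    ... | no _  = refl

    cut : ℕ → ℕ
    cut n = hub n + ⌊ n ∸ hub n /2⌋

    Hub : ∀ {n} → Fin n → Set
    Hub {n} v = toℕ v < hub n

    hub? : ∀ {n} → Decidable (Hub {n})
    hub? {n} v = toℕ v <? hub n

    side : ∀ {n} → Fin n → Bool
    side {n} v = does (toℕ v <? cut n)

    G : ∀ n → Graph n
    G n = record
      { Adj    = λ u v → u ≢ v × (Hub u ⊎ Hub v ⊎ side u ≢ side v)
      ; adj?   = λ u v → ¬? (u ≟ᶠ v) ×-dec (hub? u ⊎-dec (hub? v ⊎-dec ¬? (side u ≟ᵇ side v)))
      ; symm   = λ (u≢v , r) → u≢v ∘ sym , swap r
      ; irrefl = λ u≡v (u≢v , _) → u≢v u≡v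
      }
      where
      swap : ∀ {u v : Fin n} → Hub u ⊎ Hub v ⊎ side u ≢ side v → Hub v ⊎ Hub u ⊎ side v ≢ side u
      swap (inj₁ h)        = inj₂ (inj₁ h)
      swap (inj₂ (inj₁ h)) = inj₁ h
      swap (inj₂ (inj₂ s)) = inj₂ (inj₂ (s ∘ sym))

    module _ {n} (v : Fin n) where

      non-degree : ℕ
      non-degree = length (filter (¬? ∘ adj? (G n) v) (allFin n))

      degree+non-degree : degree (G n) v + non-degree ≡ n
      degree+non-degree = trans (length-filter-¬ (adj? (G n) v) (allFin n)) (length-tabulate {n = n} id)

      hub-non-degree : Hub v → non-degree ≤ 1
      hub-non-degree h = length-interval (¬? ∘ adj? (G n) v) (toℕ v) 1 λ u ¬a → subst (λ w → toℕ v ≤ toℕ w × toℕ w < toℕ v + 1)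
        (decidable-stable (v ≟ᶠ u) λ v≢u → ¬a (v≢u , inj₁ h)) (≤-refl , ≤-reflexive (+-comm 1 (toℕ v)))

      same-side : ¬ Hub v → ∀ u → ¬ Adj (G n) v u → ¬ Hub u × side u ≡ side v
      same-side ¬h u ¬a with v ≟ᶠ u
      ... | yes refl = ¬h , refl
      ... | no v≢u   = (λ h → ¬a (v≢u , inj₂ (inj₁ h))) , sym (decidable-stable (side v ≟ᵇ side u) λ s → ¬a (v≢u , inj₂ (inj₂ s)))

      side-true : ∀ u → side {n} u ≡ true → toℕ u < cut n
      side-true u = does-true (toℕ u <? cut n)

      side-false : ∀ u → side {n} u ≡ false → cut n ≤ toℕ u
      side-false u = ≮⇒≥ ∘ does-false (toℕ u <? cut n)

      rest : ℕ
      rest = n ∸ hub n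

      non-degree≤ : ¬ Hub v → non-degree ≤ ⌈ rest /2⌉
      non-degree≤ ¬h = go (side v) refl
        where
        hub≤n : hub n ≤ n
        hub≤n = <⇒≤ (≤-<-trans (≮⇒≥ ¬h) (toℕ<n v))
        cut+ : cut n + ⌈ rest /2⌉ ≡ n
        cut+ = trans (+-assoc (hub n) _ _) (trans (cong (λ k → hub n + k) (⌊n/2⌋+⌈n/2⌉≡n rest)) (m+[n∸m]≡n hub≤n))
        go : ∀ b → side v ≡ b → non-degree ≤ ⌈ rest /2⌉
        go true eq = ≤-trans (length-interval (¬? ∘ adj? (G n) v) (hub n) ⌊ rest /2⌋ λ u ¬a →
            let ¬hu , s = same-side ¬h u ¬a in ≮⇒≥ ¬hu , side-true u (trans s eq)) (⌊n/2⌋≤⌈n/2⌉ rest)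
        go false eq = length-interval (¬? ∘ adj? (G n) v) (cut n) ⌈ rest /2⌉ λ u ¬a →
            let _ , s = same-side ¬h u ¬a in side-false u (trans s eq) , <-≤-trans (toℕ<n u) (≤-reflexive (sym cut+))

      2*⌈/2⌉ : ∀ k → ⌈ k /2⌉ + ⌈ k /2⌉ ≤ suc k
      2*⌈/2⌉ k = ≤-trans (+-monoʳ-≤ ⌈ k /2⌉ (⌊n/2⌋≤⌈n/2⌉ (suc k))) (≤-reflexive (⌊n/2⌋+⌈n/2⌉≡n (suc k)))

      -- For n ≥ 4D a vertex outside the hubs misses, itself included, at most half of n - n/D,
      -- rounded up. The hubs thus gain about n/(2D) over n/2, and half of that gain pays for both
      -- roundings as soon as n ≥ 4D. This is the reason why smaller graphs are complete.
      degree-bound : 4 ≤ n → (2 * D + 1) * n ≤ 4 * D * degree (G n) v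
      degree-bound 4≤n = go (n <? 4 * D)
       where
       go : Dec (n < 4 * D) → (2 * D + 1) * n ≤ 4 * D * degree (G n) v
       go (yes n<4D) = +-cancelʳ-≤ (4 * D) _ _ (begin
        (2 * D + 1) * n + 4 * D          ≤⟨ complete D n 2≤D 4≤n ⟩
        4 * D * n                        ≡⟨ cong (4 * D *_) degree+non-degree ⟨
        4 * D * (deg + non-degree)       ≤⟨ *-monoʳ-≤ (4 * D) (+-monoʳ-≤ deg (hub-non-degree is-hub)) ⟩
        4 * D * (deg + 1)                ≡⟨ trans (*-distribˡ-+ (4 * D) deg 1) (cong (λ k → 4 * D * deg + k) (*-identityʳ (4 * D))) ⟩
        4 * D * deg + 4 * D              ∎)
        where
        open ≤-Reasoning
        deg = degree (G n) v
        is-hub : Hub v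
        is-hub = subst (toℕ v <_) (sym (hub-small n<4D)) (toℕ<n v)
        complete : ∀ D n → 2 ≤ D → 4 ≤ n → (2 * D + 1) * n + 4 * D ≤ 4 * D * n
        complete D n 2≤D 4≤n with k , refl ← m≤n⇒∃[o]m+o≡n 2≤D with j , refl ← m≤n⇒∃[o]m+o≡n 4≤n =
          ≤-trans (m≤m+n _ (4 + 3 * j + 4 * k + 2 * k * j)) (≤-reflexive (id′ k j))
          where
          id′ : ∀ k j → (2 * (2 + k) + 1) * (4 + j) + 4 * (2 + k) + (4 + 3 * j + 4 * k + 2 * k * j) ≡ 4 * (2 + k) * (4 + j)
          id′ = solve-∀
       go (no n≮4D) = +-cancelʳ-≤ (2 * D * (nd + nd)) _ _ (begin
        (2 * D + 1) * n + 2 * D * (nd + nd)                ≤⟨ +-monoʳ-≤ ((2 * D + 1) * n) (*-monoʳ-≤ (2 * D) 2nd≤) ⟩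
        (2 * D + 1) * n + 2 * D * suc r                    ≤⟨ +-cancelʳ-≤ (2 * (n / D * D) + 2 * D) _ _ slack ⟩
        4 * D * n                                          ≡⟨ cong (4 * D *_) degree+non-degree ⟨
        4 * D * (deg + nd)                                 ≡⟨ eq₀ D deg nd ⟩
        4 * D * deg + 2 * D * (nd + nd)                    ∎)
        where
        open ≤-Reasoning
        deg = degree (G n) v
        nd = non-degree
        r = n ∸ n / D
        eq₀ : ∀ D d k → 4 * D * (d + k) ≡ 4 * D * d + 2 * D * (k + k)
        eq₀ = solve-∀
        n/D<n : n / D < n
        n/D<n = m/n<m n D {{>-nonZero (≤-trans (s≤s z≤n) 4≤n)}} 2≤D
        2nd≤ : nd + nd ≤ suc r
        2nd≤ = by-kind (hub? v)
         where
         by-kind : Dec (Hub v) → nd + nd ≤ suc r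
         by-kind (yes h) = ≤-trans (+-mono-≤ (hub-non-degree h) (hub-non-degree h)) (s≤s (m<n⇒0<n∸m n/D<n))
         by-kind (no ¬h) = ≤-trans (+-mono-≤ (non-degree≤ ¬h) (non-degree≤ ¬h)) (subst (λ k → ⌈ k /2⌉ + ⌈ k /2⌉ ≤ suc r) (cong (λ k → n ∸ k) (sym (hub-large n≮4D))) (2*⌈/2⌉ r))
        n≤ : n ≤ n / D * D + D
        n≤ = ≤-trans (≤-reflexive (trans (m≡m%n+[m/n]*n n D) (+-comm _ (n / D * D)))) (+-monoʳ-≤ (n / D * D) (<⇒≤ (m%n<n n D)))
        slack : (2 * D + 1) * n + 2 * D * suc r + (2 * (n / D * D) + 2 * D) ≤ 4 * D * n + (2 * (n / D * D) + 2 * D)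
        slack = begin
          (2 * D + 1) * n + 2 * D * suc r + (2 * (n / D * D) + 2 * D)   ≡⟨ eq₁ D n r (n / D) ⟩
          2 * D * n + 2 * D * (n / D + r) + (n + 4 * D)                 ≤⟨ +-mono-≤ (≤-reflexive (cong (λ k → 2 * D * n + 2 * D * k) (m+[n∸m]≡n (<⇒≤ n/D<n)))) (+-monoʳ-≤ n (≮⇒≥ n≮4D)) ⟩
          2 * D * n + 2 * D * n + (n + n)                               ≤⟨ +-monoʳ-≤ (2 * D * n + 2 * D * n) (+-mono-≤ n≤ n≤) ⟩
          2 * D * n + 2 * D * n + ((n / D * D + D) + (n / D * D + D))   ≡⟨ eq₂ D n (n / D * D) ⟩
          4 * D * n + (2 * (n / D * D) + 2 * D)                         ∎
          where
          eq₁ : ∀ D n r s → (2 * D + 1) * n + 2 * D * suc r + (2 * (s * D) + 2 * D) ≡ 2 * D * n + 2 * D * (s + r) + (n + 4 * D)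
          eq₁ = solve-∀
          eq₂ : ∀ D n t → 2 * D * n + 2 * D * n + ((t + D) + (t + D)) ≡ 4 * D * n + (2 * t + 2 * D)
          eq₂ = solve-∀

    min-degree-bound : ∀ n → 4 ≤ n → (2 * D + 1) * n ≤ 4 * D * δ (G n)
    min-degree-bound n 4≤n = argmin-all id {P = λ k → (2 * D + 1) * n ≤ 4 * D * k}
      -- The default value `n` of the minimum has to satisfy the bound as well.
      (*-monoˡ-≤ n (≤-trans (+-monoʳ-≤ (2 * D) (≤-trans (≤-trans (s≤s z≤n) 2≤D) (m≤m+n D _))) (≤-reflexive (eq D))))
      (Allₚ.map⁺ (All.universal (λ v → degree-bound v 4≤n) (allFin n)))
      where
      eq : ∀ D → 2 * D + (D + 1 * D) ≡ 4 * D
      eq = solve-∀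

    hub≤ : ∀ n → 4 * D ≤ n → hub n * D ≤ n
    hub≤ n 4D≤n = ≤-trans (≤-reflexive (cong (λ k → k * D) (hub-large (≤⇒≯ 4D≤n))))
      (≤-trans (m≤n+m (n / D * D) _) (≤-reflexive (sym (m≡m%n+[m/n]*n n D))))

-- Probabilities in the binomial model at a rational parameter

module BinomialMass where

  open import Data.List.Base as List using (List; []; _∷_; _++_; length; map; filter; foldr)
  open import Data.List.Membership.Propositional using (_∈_; _∉_)
  open import Data.List.Membership.Propositional.Properties using (∈-++⁺ˡ; ∈-++⁺ʳ; ∈-++⁻; ∈-map⁻; ∈-map⁺)
  open import Data.List.Properties using (map-++; filter-++; filter-none)
  open import Data.List.Relation.Unary.All as All using (All; []; _∷_)
  open import Data.List.Relation.Unary.Any using (here; there)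
  open import Data.List.Relation.Unary.AllPairs using ([]; _∷_)
  open import Data.List.Relation.Unary.Unique.Propositional using (Unique)
  open import Data.Nat.Base as ℕ using (ℕ; zero; suc)
  import Data.Nat.Properties as ℕₚ
  open import Data.Product.Base using (_×_; _,_; ∃-syntax)
  open import Data.Rational.Base
  open import Data.Rational.Properties
  import Data.Rational.Solver as ℚSolver
  open import Data.Sum.Base using (inj₁; inj₂)
  open import Defs using (subsets)
  open import Function.Base using (_∘_)
  open import Relation.Binary.PropositionalEquality
  open import Relation.Nullary.Decidable using (yes; no)
  open import Relation.Nullary.Negation using (¬_; contradiction)
  open import Relation.Unary using (Decidable)

  infixr 8 _^_

  _^_ : ℚ → ℕ → ℚ
  q ^ zero  = 1ℚ
  q ^ suc k = q * q ^ k

  0≤+ : ∀ {p q} → 0ℚ ≤ p → 0ℚ ≤ q → 0ℚ ≤ p + q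
  0≤+ = +-mono-≤ {0ℚ} {_} {0ℚ} {_}

  0≤* : ∀ {p q} → 0ℚ ≤ p → 0ℚ ≤ q → 0ℚ ≤ p * q
  0≤* {p} {q} 0≤p 0≤q = subst (_≤ p * q) (*-zeroʳ p) (*-monoˡ-≤-nonNeg p {{nonNegative 0≤p}} 0≤q)

  *-mono-≤ : ∀ {p q r s} → 0ℚ ≤ r → 0ℚ ≤ q → p ≤ q → r ≤ s → p * r ≤ q * s
  *-mono-≤ {p} {q} {r} {s} 0≤r 0≤q p≤q r≤s =
    ≤-trans (*-monoʳ-≤-nonNeg r {{nonNegative 0≤r}} p≤q) (*-monoˡ-≤-nonNeg q {{nonNegative 0≤q}} r≤s)

  0≤1 : 0ℚ ≤ 1ℚ
  0≤1 = *≤* (Data.Integer.Base.+≤+ ℕ.z≤n)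
    where import Data.Integer.Base

  0≤^ : ∀ {q} k → 0ℚ ≤ q → 0ℚ ≤ q ^ k
  0≤^ zero    _   = 0≤1
  0≤^ (suc k) 0≤q = 0≤* 0≤q (0≤^ k 0≤q)

  ^≤1 : ∀ {q} k → 0ℚ ≤ q → q ≤ 1ℚ → q ^ k ≤ 1ℚ
  ^≤1 zero    _   _   = ≤-refl
  ^≤1 (suc k) 0≤q q≤1 = ≤-trans (*-mono-≤ (0≤^ k 0≤q) 0≤1 q≤1 (^≤1 k 0≤q q≤1)) ≤-refl

  ^-antitone : ∀ {q} {k l} → 0ℚ ≤ q → q ≤ 1ℚ → k ℕ.≤ l → q ^ l ≤ q ^ k
  ^-antitone {k = zero}  {l}     0≤q q≤1 _           = ^≤1 l 0≤q q≤1
  ^-antitone {q} {suc k} {suc l} 0≤q q≤1 (ℕ.s≤s k≤l) = *-monoˡ-≤-nonNeg q {{nonNegative 0≤q}} (^-antitone 0≤q q≤1 k≤l)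

  sum : List ℚ → ℚ
  sum = foldr _+_ 0ℚ

  sum-++ : ∀ xs ys → sum (xs ++ ys) ≡ sum xs + sum ys
  sum-++ []       ys = sym (+-identityˡ (sum ys))
  sum-++ (x ∷ xs) ys = trans (cong (x +_) (sum-++ xs ys)) (sym (+-assoc x (sum xs) (sum ys)))

  sum-map-+ : ∀ {A : Set} (f g : A → ℚ) xs → sum (map (λ x → f x + g x) xs) ≡ sum (map f xs) + sum (map g xs)
  sum-map-+ f g []       = refl
  sum-map-+ f g (x ∷ xs) = trans (cong (f x + g x +_) (sum-map-+ f g xs)) (eq (f x) (g x) _ _)
    where
    open ℚSolver.+-*-Solver
    eq : ∀ a b c d → a + b + (c + d) ≡ a + c + (b + d)
    eq = solve 4 (λ a b c d → a :+ b :+ (c :+ d) := a :+ c :+ (b :+ d)) refl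

  0≤sum : ∀ {A : Set} {f : A → ℚ} (xs : List A) → (∀ x → 0ℚ ≤ f x) → 0ℚ ≤ sum (map f xs)
  0≤sum []       _   = ≤-refl
  0≤sum (x ∷ xs) 0≤f = 0≤+ (0≤f x) (0≤sum xs 0≤f)

  term≤sum : ∀ {A : Set} {f : A → ℚ} {x} {xs : List A} → (∀ x → 0ℚ ≤ f x) → x ∈ xs → f x ≤ sum (map f xs)
  term≤sum {f = f} {xs = y ∷ xs} 0≤f (here refl) = subst (_≤ f y + sum (map f xs)) (+-identityʳ (f y)) (+-monoʳ-≤ (f y) (0≤sum xs 0≤f))
  term≤sum {f = f} {xs = y ∷ xs} 0≤f (there x∈)  = subst (_≤ f y + sum (map f xs)) (+-identityˡ _) (+-mono-≤ (0≤f y) (term≤sum 0≤f x∈))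

  subset⊆ : ∀ {A : Set} (xs : List A) {E} → E ∈ subsets xs → ∀ {x} → x ∈ E → x ∈ xs
  subset⊆ [] (here refl) ()
  subset⊆ (y ∷ xs) E∈ x∈ with ∈-++⁻ (subsets xs) E∈
  ... | inj₁ E∈ˡ = there (subset⊆ xs E∈ˡ x∈)
  ... | inj₂ E∈ʳ with _ , E′∈ , refl ← ∈-map⁻ (y ∷_) E∈ʳ with x∈
  ...   | here refl = here refl
  ...   | there x∈′ = there (subset⊆ xs E′∈ x∈′)

  subset-length : ∀ {A : Set} (xs : List A) {E} → E ∈ subsets xs → length E ℕ.≤ length xs
  subset-length [] (here refl) = ℕ.z≤n
  subset-length (y ∷ xs) E∈ with ∈-++⁻ (subsets xs) E∈
  ... | inj₁ E∈ˡ = ℕₚ.m≤n⇒m≤1+n (subset-length xs E∈ˡ)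
  ... | inj₂ E∈ʳ with _ , E′∈ , refl ← ∈-map⁻ (y ∷_) E∈ʳ = ℕ.s≤s (subset-length xs E′∈)

  module Binomial {A : Set} (q : ℚ) (0≤q : 0ℚ ≤ q) (q≤1 : q ≤ 1ℚ) where

    0≤1-q : 0ℚ ≤ 1ℚ - q
    0≤1-q = subst (_≤ 1ℚ - q) (+-inverseʳ q) (+-monoˡ-≤ (- q) q≤1)

    weight : ℕ → List A → ℚ
    weight M E = q ^ length E * (1ℚ - q) ^ (M ℕ.∸ length E)

    0≤weight : ∀ M E → 0ℚ ≤ weight M E
    0≤weight M E = 0≤* (0≤^ (length E) 0≤q) (0≤^ (M ℕ.∸ length E) 0≤1-q)

    mass : ℕ → {P : List A → Set} → Decidable P → List (List A) → ℚ
    mass M P? Es = sum (map (weight M) (filter P? Es))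

    mass-++ : ∀ M {P : List A → Set} (P? : Decidable P) Es Fs → mass M P? (Es ++ Fs) ≡ mass M P? Es + mass M P? Fs
    mass-++ M P? Es Fs = trans (cong (sum ∘ map (weight M)) (filter-++ P? Es Fs))
      (trans (cong sum (map-++ (weight M) (filter P? Es) (filter P? Fs))) (sum-++ (map (weight M) (filter P? Es)) _))

    0≤mass : ∀ M {P : List A → Set} (P? : Decidable P) Es → 0ℚ ≤ mass M P? Es
    0≤mass M P? Es = 0≤sum (filter P? Es) (0≤weight M)

    mass-skip : ∀ M {P : List A → Set} (P? : Decidable P) Es → (∀ {E} → E ∈ Es → length E ℕ.≤ M) →
                mass (suc M) P? Es ≡ (1ℚ - q) * mass M P? Es
    mass-skip M P? [] _ = sym (*-zeroʳ (1ℚ - q))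
    mass-skip M P? (E ∷ Es) small with P? E
    ... | no  _ = mass-skip M P? Es (small ∘ there)
    ... | yes _ = trans (cong₂ _+_ head (mass-skip M P? Es (small ∘ there))) (sym (*-distribˡ-+ (1ℚ - q) (weight M E) _))
      where
      open ℚSolver.+-*-Solver
      eq : ∀ a b c → a * (b * c) ≡ b * (a * c)
      eq = solve 3 (λ a b c → a :* (b :* c) := b :* (a :* c)) refl
      head : weight (suc M) E ≡ (1ℚ - q) * weight M E
      head = trans (cong (λ k → q ^ length E * (1ℚ - q) ^ k) (ℕₚ.+-∸-assoc 1 (small (here refl)))) (eq (q ^ length E) (1ℚ - q) _)

    mass-take : ∀ M {P : List A → Set} (P? : Decidable P) x Es →
                mass (suc M) P? (map (x ∷_) Es) ≡ q * mass M (P? ∘ (x ∷_)) Es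
    mass-take M P? x [] = sym (*-zeroʳ q)
    mass-take M P? x (E ∷ Es) with P? (x ∷ E)
    ... | no  _ = mass-take M P? x Es
    ... | yes _ = trans (cong₂ _+_ (*-assoc q (q ^ length E) _) (mass-take M P? x Es)) (sym (*-distribˡ-+ q (weight M E) _))

    mass-none : ∀ M {P : List A → Set} (P? : Decidable P) Es → (∀ {E} → E ∈ Es → ¬ P E) → mass M P? Es ≡ 0ℚ
    mass-none M P? Es none = cong (sum ∘ map (weight M)) (filter-none P? (All.tabulate none))

    -- Elements are revealed one at a time: a required element contributes the factor q, any other
    -- one the factor (1 - q) + q.
    containment-bound : ∀ {L : List A} → Unique L → ∀ {P : List A → Set} (P? : Decidable P) {R : A → Set} (R? : Decidable R) →
      (∀ {E} → E ∈ subsets L → P E → ∀ {x} → x ∈ L → R x → x ∈ E) →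
      mass (length L) P? (subsets L) ≤ q ^ length (filter R? L)
    containment-bound [] P? R? _ with P? []
    ... | yes _ = ≤-refl
    ... | no  _ = 0≤1
    containment-bound {L = x ∷ L} (x∉ ∷ u) {P} P? {R} R? forced with R? x
    ... | yes rx = begin
      mass (suc M) P? (subsets L ++ map (x ∷_) (subsets L))                    ≡⟨ mass-++ (suc M) P? (subsets L) _ ⟩
      mass (suc M) P? (subsets L) + mass (suc M) P? (map (x ∷_) (subsets L))   ≡⟨ cong₂ _+_ (mass-none (suc M) P? (subsets L) none) (mass-take M P? x (subsets L)) ⟩
      0ℚ + q * mass M (P? ∘ (x ∷_)) (subsets L)                                ≡⟨ +-identityˡ _ ⟩
      q * mass M (P? ∘ (x ∷_)) (subsets L)                                     ≤⟨ *-monoˡ-≤-nonNeg q {{nonNegative 0≤q}} (containment-bound u (P? ∘ (x ∷_)) R? forced′) ⟩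
      q * q ^ length (filter R? L)                                             ∎
      where
      open ≤-Reasoning
      M = length L
      x∉L : x ∉ L
      x∉L x∈ = All.lookup x∉ x∈ refl
      none : ∀ {E} → E ∈ subsets L → ¬ P E
      none E∈ pE = x∉L (subset⊆ L E∈ (forced (∈-++⁺ˡ E∈) pE (here refl) rx))
      forced′ : ∀ {E} → E ∈ subsets L → P (x ∷ E) → ∀ {y} → y ∈ L → R y → y ∈ E
      forced′ E∈ pE y∈ ry with forced (∈-++⁺ʳ (subsets L) (∈-map⁺ (x ∷_) E∈)) pE (there y∈) ry
      ... | here refl = contradiction y∈ x∉L
      ... | there y∈E = y∈E
    ... | no _ = begin
      mass (suc M) P? (subsets L ++ map (x ∷_) (subsets L))                    ≡⟨ mass-++ (suc M) P? (subsets L) _ ⟩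
      mass (suc M) P? (subsets L) + mass (suc M) P? (map (x ∷_) (subsets L))   ≡⟨ cong₂ _+_ (mass-skip M P? (subsets L) (subset-length L)) (mass-take M P? x (subsets L)) ⟩
      (1ℚ - q) * mass M P? (subsets L) + q * mass M (P? ∘ (x ∷_)) (subsets L)  ≤⟨ +-mono-≤ (*-monoˡ-≤-nonNeg (1ℚ - q) {{nonNegative 0≤1-q}} (containment-bound u P? R? forcedˡ))
                                                                                            (*-monoˡ-≤-nonNeg q {{nonNegative 0≤q}} (containment-bound u (P? ∘ (x ∷_)) R? forced′)) ⟩
      (1ℚ - q) * q ^ k + q * q ^ k                                             ≡⟨ eq q (q ^ k) ⟩
      q ^ k                                                                    ∎
      where
      open ≤-Reasoning
      M = length L
      k = length (filter R? L)
      x∉L : x ∉ L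
      x∉L x∈ = All.lookup x∉ x∈ refl
      forcedˡ : ∀ {E} → E ∈ subsets L → P E → ∀ {y} → y ∈ L → R y → y ∈ E
      forcedˡ E∈ pE y∈ ry = forced (∈-++⁺ˡ E∈) pE (there y∈) ry
      forced′ : ∀ {E} → E ∈ subsets L → P (x ∷ E) → ∀ {y} → y ∈ L → R y → y ∈ E
      forced′ E∈ pE y∈ ry with forced (∈-++⁺ʳ (subsets L) (∈-map⁺ (x ∷_) E∈)) pE (there y∈) ry
      ... | here refl = contradiction y∈ x∉L
      ... | there y∈E = y∈E
      eq : ∀ q x → (1ℚ - q) * x + q * x ≡ x
      eq = solve 2 (λ q x → (con 1ℚ :- q) :* x :+ q :* x := x) refl
        where open ℚSolver.+-*-Solver

    module Union {B : Set} (M : ℕ) {P : List A → Set} (P? : Decidable P) {Q : B → List A → Set} (Q? : ∀ b → Decidable (Q b)) (bs : List B) where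

      share : List A → B → ℚ
      share E b with Q? b E
      ... | yes _ = weight M E
      ... | no  _ = 0ℚ

      0≤share : ∀ E b → 0ℚ ≤ share E b
      0≤share E b with Q? b E
      ... | yes _ = 0≤weight M E
      ... | no  _ = ≤-refl

      share-yes : ∀ E b → Q b E → share E b ≡ weight M E
      share-yes E b h with Q? b E
      ... | yes _ = refl
      ... | no ¬h = contradiction h ¬h

      mass-∷ : ∀ E Es b → mass M (Q? b) (E ∷ Es) ≡ share E b + mass M (Q? b) Es
      mass-∷ E Es b with Q? b E
      ... | yes _ = refl
      ... | no  _ = sym (+-identityˡ _)

      union-bound : ∀ Es → (∀ {E} → E ∈ Es → P E → ∃[ b ] b ∈ bs × Q b E) →
                    mass M P? Es ≤ sum (map (λ b → mass M (Q? b) Es) bs)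
      union-bound [] _ = 0≤sum bs (λ _ → ≤-refl)
      union-bound (E ∷ Es) cover = begin
        mass M P? (E ∷ Es)                                                          ≤⟨ head ⟩
        sum (map (share E) bs) + mass M P? Es                                       ≤⟨ +-monoʳ-≤ (sum (map (share E) bs)) (union-bound Es (cover ∘ there)) ⟩
        sum (map (share E) bs) + sum (map (λ b → mass M (Q? b) Es) bs)              ≡⟨ sum-map-+ (share E) _ bs ⟨
        sum (map (λ b → share E b + mass M (Q? b) Es) bs)                           ≡⟨ cong sum (Data.List.Properties.map-cong (λ b → sym (mass-∷ E Es b)) bs) ⟩
        sum (map (λ b → mass M (Q? b) (E ∷ Es)) bs)                                 ∎
        where
        import Data.List.Properties
        open ≤-Reasoning
        head : mass M P? (E ∷ Es) ≤ sum (map (share E) bs) + mass M P? Es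
        head with P? E
        ... | no  _ = subst (_≤ sum (map (share E) bs) + mass M P? Es) (+-identityˡ _) (+-monoˡ-≤ (mass M P? Es) (0≤sum bs (0≤share E)))
        ... | yes p with b , b∈ , h ← cover (here refl) p = +-monoˡ-≤ (mass M P? Es)
          (subst (_≤ sum (map (share E) bs)) (share-yes E b h) (term≤sum (0≤share E) b∈))

-- Edges that the random graph must supply for a given cycle

module ForcedEdges where

  open FiniteSums
  open Runs using (𝟙)
  open Flips using (%-injective; module Cyclic)
  open HubGraphs
  open import Data.Bool.Base using (Bool)
  open import Data.Bool.Properties using () renaming (_≟_ to _≟ᵇ_)
  open import Data.Fin.Base as Fin using (Fin; toℕ) renaming (zero to fzero; suc to fsuc)
  open import Data.Fin.Properties using (toℕ<n; toℕ-injective; toℕ-fromℕ<) renaming (_<?_ to _<ᶠ?_)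
  open import Data.List.Base using (List; _++_; length; map; filter; allFin; tabulate; cartesianProduct; upTo)
  open import Data.List.Membership.Propositional using (_∈_)
  open import Data.List.Membership.Propositional.Properties using (∈-filter⁻; ∈-filter⁺; ∈-map⁻; ∈-upTo⁺; ∈-cartesianProduct⁺; ∈-allFin)
  open import Data.List.Properties using (length-++; length-map; length-upTo; filter-++; map-tabulate)
  open import Data.List.Relation.Unary.Unique.Propositional.Properties using (map⁺; filter⁺; allFin⁺; cartesianProduct⁺)
  open import Data.Nat.Base hiding (_/_; _%_)
  open import Data.Nat.DivMod using (_%_; _mod_; m%n<n; m<n⇒m%n≡m; %-distribˡ-+; m%n%n≡m%n; [m+n]%n≡m%n)
  open import Data.Nat.Properties
  open import Data.Nat.Tactic.RingSolver using (solve-∀)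
  open import Data.Product.Base using (_×_; _,_; proj₁; proj₂)
  open import Data.Product.Properties using (,-injective)
  open import Data.Sum.Base using (_⊎_; inj₁; inj₂)
  open import Data.Vec.Base using (Vec; lookup)
  open import Defs using (Graph; Adj; adj?; power; cycle; Walk; pairs; subsets; edgeGraph; _∪_; _⊆_)
  open BinomialMass using (subset⊆)
  open import Function.Base using (_∘_; id)
  open import Function.Definitions using (Injective)
  open import Relation.Binary.PropositionalEquality
  open import Relation.Nullary.Decidable using (Dec; yes; no; ¬?; _×-dec_)
  open import Relation.Nullary.Negation using (¬_; contradiction)
  open import Relation.Unary using (Decidable)

  length-filter-tabulate : ∀ {A : Set} {P : A → Set} (P? : Decidable P) n (f : Fin n → A) g →
    (∀ i → 𝟙 (P? (f i)) ≡ g (toℕ i)) → length (filter P? (tabulate f)) ≡ ∑ n g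
  length-filter-tabulate P? zero    f g e = refl
  length-filter-tabulate P? (suc n) f g e with P? (f fzero) | e fzero
  ... | yes _ | e₀ = trans (cong suc (length-filter-tabulate P? n (f ∘ fsuc) (g ∘ suc) (e ∘ fsuc))) (cong (λ x → x + ∑ n (g ∘ suc)) e₀)
  ... | no  _ | e₀ = trans (length-filter-tabulate P? n (f ∘ fsuc) (g ∘ suc) (e ∘ fsuc)) (cong (λ x → x + ∑ n (g ∘ suc)) e₀)

  length-filter-product : ∀ {A : Set} {m} {P : A × Fin m → Set} (P? : Decidable P) n (f : Fin n → A) (g : ℕ → ℕ → ℕ) →
    (∀ i j → 𝟙 (P? (f i , j)) ≡ g (toℕ i) (toℕ j)) →
    length (filter P? (cartesianProduct (tabulate f) (allFin m))) ≡ ∑ n (λ i → ∑ m (g i))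
  length-filter-product P? zero    f g e = refl
  length-filter-product {A} {m} P? (suc n) f g e = begin
    length (filter P? (map pair (allFin m) ++ rest))                         ≡⟨ cong length (filter-++ P? (map pair (allFin m)) rest) ⟩
    length (filter P? (map pair (allFin m)) ++ filter P? rest)               ≡⟨ length-++ (filter P? (map pair (allFin m))) ⟩
    length (filter P? (map pair (allFin m))) + length (filter P? rest)       ≡⟨ cong₂ _+_ first (length-filter-product P? n (f ∘ fsuc) (λ i → g (suc i)) (e ∘ fsuc)) ⟩
    ∑ m (g 0) + ∑ n (λ i → ∑ m (g (suc i)))                                  ∎
    where
    open ≡-Reasoning
    pair : Fin m → A × Fin m
    pair j = f fzero , j
    rest : List (A × Fin m)
    rest = cartesianProduct (tabulate (f ∘ fsuc)) (allFin m)
    first : length (filter P? (map pair (allFin m))) ≡ ∑ m (g 0)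
    first = trans (cong (length ∘ filter P?) (map-tabulate id pair)) (length-filter-tabulate P? m pair (g 0) (e fzero))

  module CycleEdges (D : ℕ) (2≤D : 2 ≤ D) (m n : ℕ) (1≤m : 1 ≤ m) (2m<n : m + m < n) (σ : Vec (Fin n) n) (σ-injective : Injective _≡_ _≡_ (lookup σ)) where

    open HubGraph D 2≤D

    m<n : m < n
    m<n = ≤-<-trans (m≤m+n m m) 2m<n

    instance
      n≢0 : NonZero n
      n≢0 = >-nonZero (≤-<-trans z≤n m<n)

    open Cyclic m n m<n

    vertex : ℕ → Fin n
    vertex t = lookup σ (t mod n)

    toℕ-mod : ∀ t → toℕ (t mod n) ≡ t % n
    toℕ-mod t = toℕ-fromℕ< (m%n<n t n)

    mod-cong : ∀ {s t} → s % n ≡ t % n → s mod n ≡ t mod n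
    mod-cong {s} {t} e = toℕ-injective (trans (toℕ-mod s) (trans e (sym (toℕ-mod t))))

    vertex-cong : ∀ {s t} → s % n ≡ t % n → vertex s ≡ vertex t
    vertex-cong = cong (lookup σ) ∘ mod-cong

    vertex-injective : ∀ {s t} → vertex s ≡ vertex t → s % n ≡ t % n
    vertex-injective {s} {t} e = trans (sym (toℕ-mod s)) (trans (cong toℕ (σ-injective e)) (toℕ-mod t))

    vertex-toℕ : ∀ i → vertex (toℕ i) ≡ lookup σ i
    vertex-toℕ i = cong (lookup σ) (toℕ-injective (trans (toℕ-mod (toℕ i)) (m<n⇒m%n≡m (toℕ<n i))))

    colour : ℕ → Bool
    colour t = side (vertex t)

    colour-periodic : Periodic n colour
    colour-periodic t = cong side (vertex-cong ([m+n]%n≡m%n t n))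

    apart : ∀ t k → 0 < k → k < n → (t + k) % n ≢ t % n
    apart t k 0<k k<n e = <-irrefl (sym (%-injective t k k<n e)) 0<k

    walk-step : ∀ t → Adj (cycle σ) (vertex t) (vertex (suc t))
    walk-step t = (λ e → apart t 1 z<s (≤-<-trans 1≤m m<n) (trans (cong (_% n) (+-comm t 1)) (sym (vertex-injective e)))) ,
      inj₁ (t mod n , refl , cong (lookup σ) (mod-cong {suc (toℕ (t mod n))} {suc t} step))
      where
      step : suc (toℕ (t mod n)) % n ≡ suc t % n
      step = trans (cong (λ k → suc k % n) (toℕ-mod t)) (trans (%-distribˡ-+ 1 (t % n) n)
        (trans (cong (λ k → (1 % n + k) % n) (m%n%n≡m%n t n)) (sym (%-distribˡ-+ 1 t n))))

    walk : ∀ k t → Walk (cycle σ) k (vertex t) (vertex (t + k))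
    walk zero    t = cong vertex (sym (+-identityʳ t))
    walk (suc k) t = vertex (suc t) , walk-step t , subst (Walk (cycle σ) k (vertex (suc t)) ∘ vertex) (sym (+-suc t k)) (walk k (suc t))

    power-adj : ∀ t i → i < m → Adj (power (cycle σ) m) (vertex t) (vertex (t + suc i))
    power-adj t i i<m = (λ e → apart t (suc i) z<s (≤-<-trans i<m m<n) (sym (vertex-injective e))) , suc i , i<m , walk (suc i) t

    Good : ℕ → ℕ → Set
    Good t i = ¬ Hub (vertex t) × ¬ Hub (vertex (t + suc i)) × colour t ≡ colour (t + suc i)

    good? : ∀ t i → Dec (Good t i)
    good? t i = ¬? (hub? (vertex t)) ×-dec (¬? (hub? (vertex (t + suc i))) ×-dec (colour t ≟ᵇ colour (t + suc i)))

    Forced : Fin n × Fin n → Set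
    Forced (u , v) = Adj (power (cycle σ) m) u v × ¬ Adj (G n) u v

    forced? : Decidable Forced
    forced? (u , v) = adj? (power (cycle σ) m) u v ×-dec ¬? (adj? (G n) u v)

    good⇒forced : ∀ t i → i < m → Good t i → Forced (vertex t , vertex (t + suc i))
    good⇒forced t i i<m (¬h , ¬h′ , s) = power-adj t i i<m , λ
      { (_ , inj₁ h) → ¬h h ; (_ , inj₂ (inj₁ h)) → ¬h′ h ; (_ , inj₂ (inj₂ ¬s)) → ¬s s }

    forced-sym : ∀ {u v} → Forced (u , v) → Forced (v , u)
    forced-sym (a , ¬b) = Graph.symm (power (cycle σ) m) a , ¬b ∘ Graph.symm (G n)

    sort : Fin n → Fin n → Fin n × Fin n
    sort u v with u <ᶠ? v
    ... | yes _ = u , v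
    ... | no  _ = v , u

    sort-cases : ∀ u v → sort u v ≡ (u , v) ⊎ sort u v ≡ (v , u)
    sort-cases u v with u <ᶠ? v
    ... | yes _ = inj₁ refl
    ... | no  _ = inj₂ refl

    sort-∈-pairs : ∀ u v → u ≢ v → sort u v ∈ pairs n
    sort-∈-pairs u v u≢v with u <ᶠ? v
    ... | yes u<v = ∈-filter⁺ _ (∈-cartesianProduct⁺ (∈-allFin u) (∈-allFin v)) u<v
    ... | no  u≮v = ∈-filter⁺ _ (∈-cartesianProduct⁺ (∈-allFin v) (∈-allFin u)) (≤∧≢⇒< (≮⇒≥ u≮v) (u≢v ∘ sym ∘ toℕ-injective))

    edge : Fin n × Fin m → Fin n × Fin n
    edge (t , i) = sort (vertex (toℕ t)) (vertex (toℕ t + suc (toℕ i)))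

    same-direction : ∀ {t t′ : Fin n} {i i′ : Fin m} → vertex (toℕ t) ≡ vertex (toℕ t′) →
      vertex (toℕ t + suc (toℕ i)) ≡ vertex (toℕ t′ + suc (toℕ i′)) → (t , i) ≡ (t′ , i′)
    same-direction {t} {t′} {i} {i′} e e′ with toℕ-injective (trans (sym (m<n⇒m%n≡m (toℕ<n t))) (trans (vertex-injective e) (m<n⇒m%n≡m (toℕ<n t′))))
    ... | refl = cong (t ,_) (toℕ-injective (by-size (≤-total (toℕ i) (toℕ i′))))
      where
      close : ∀ (a b : ℕ) → a ≤ b → b < m → (toℕ t + suc b) % n ≡ (toℕ t + suc a) % n → a ≡ b
      close a b a≤b b<m e with o , refl ← m≤n⇒∃[o]m+o≡n a≤b = sym (trans (cong (λ x → a + x)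
        (%-injective (toℕ t + suc a) o (≤-<-trans (m≤n+m o a) (<-trans b<m m<n)) (trans (cong (_% n) (+-assoc (toℕ t) (suc a) o)) e))) (+-identityʳ a))
      by-size : toℕ i ≤ toℕ i′ ⊎ toℕ i′ ≤ toℕ i → toℕ i ≡ toℕ i′
      by-size (inj₁ le) = close (toℕ i) (toℕ i′) le (toℕ<n i′) (sym (vertex-injective e′))
      by-size (inj₂ le) = sym (close (toℕ i′) (toℕ i) le (toℕ<n i) (vertex-injective e′))

    -- Two forward steps of at most m each cannot lead back to the start, because 2m < n. Hence no
    -- unordered pair is counted from both of its ends.
    no-reversal : ∀ {t t′ : ℕ} {i i′ : Fin m} → vertex t ≡ vertex (t′ + suc (toℕ i′)) → vertex (t + suc (toℕ i)) ≢ vertex t′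
    no-reversal {t} {t′} {i} {i′} e e′ = apart t (suc (toℕ i) + suc (toℕ i′)) z<s
      (≤-<-trans (+-mono-≤ (toℕ<n i) (toℕ<n i′)) 2m<n) (begin
        (t + (a + b)) % n                ≡⟨ cong (_% n) (+-assoc t a b) ⟨
        (t + a + b) % n                  ≡⟨ %-distribˡ-+ (t + a) b n ⟩
        ((t + a) % n + b % n) % n        ≡⟨ cong (λ k → (k + b % n) % n) (vertex-injective e′) ⟩
        (t′ % n + b % n) % n             ≡⟨ %-distribˡ-+ t′ b n ⟨
        (t′ + b) % n                     ≡⟨ vertex-injective e ⟨
        t % n                            ∎)
      where
      open ≡-Reasoning
      a = suc (toℕ i)
      b = suc (toℕ i′)

    edge-injective : ∀ {p p′} → edge p ≡ edge p′ → p ≡ p′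
    edge-injective {t , i} {t′ , i′} e with sort-cases (vertex (toℕ t)) (vertex (toℕ t + suc (toℕ i))) | sort-cases (vertex (toℕ t′)) (vertex (toℕ t′ + suc (toℕ i′)))
    ... | inj₁ p | inj₁ q = let e₁ , e₂ = ,-injective (trans (sym p) (trans e q)) in same-direction e₁ e₂
    ... | inj₂ p | inj₂ q = let e₁ , e₂ = ,-injective (trans (sym p) (trans e q)) in same-direction e₂ e₁
    ... | inj₁ p | inj₂ q = let e₁ , e₂ = ,-injective (trans (sym p) (trans e q)) in contradiction e₂ (no-reversal {toℕ t} {toℕ t′} {i} {i′} e₁)
    ... | inj₂ p | inj₁ q = let e₁ , e₂ = ,-injective (trans (sym p) (trans e q)) in contradiction e₁ (no-reversal {toℕ t} {toℕ t′} {i} {i′} e₂)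

    forced-count : ℕ
    forced-count = length (filter forced? (pairs n))

    good-total : ℕ
    good-total = ∑ n λ t → ∑ m λ i → 𝟙 (good? t i)

    good≤forced : good-total ≤ forced-count
    good≤forced = begin
      good-total                          ≡⟨ length-filter-product {A = Fin n} {m = m} good?′ n id (λ t i → 𝟙 (good? t i)) (λ _ _ → refl) ⟨
      length (filter good?′ index)        ≡⟨ length-map edge (filter good?′ index) ⟨
      length (map edge (filter good?′ index)) ≤⟨ unique-⊆⇒length≤ (map⁺ edge-injective (filter⁺ good?′ (cartesianProduct⁺ (allFin⁺ n) (allFin⁺ m)))) sub ⟩
      forced-count                        ∎
      where
      open ≤-Reasoning
      index = cartesianProduct (allFin n) (allFin m)
      good?′ : Decidable (λ (p : Fin n × Fin m) → Good (toℕ (proj₁ p)) (toℕ (proj₂ p)))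
      good?′ (t , i) = good? (toℕ t) (toℕ i)
      sub : ∀ {p} → p ∈ map edge (filter good?′ index) → p ∈ filter forced? (pairs n)
      sub p∈ with (t , i) , ti∈ , refl ← ∈-map⁻ edge p∈ = ∈-filter⁺ forced? (sort-∈-pairs _ _ (proj₁ (proj₁ f))) (sorted (sort-cases _ _))
        where
        f = good⇒forced (toℕ t) (toℕ i) (toℕ<n i) (proj₂ (∈-filter⁻ good?′ {xs = index} ti∈))
        u = vertex (toℕ t)
        v = vertex (toℕ t + suc (toℕ i))
        sorted : sort u v ≡ (u , v) ⊎ sort u v ≡ (v , u) → Forced (sort u v)
        sorted (inj₁ e) = subst Forced (sym e) f
        sorted (inj₂ e) = subst Forced (sym e) (forced-sym f)

    hubs : ℕ → ℕ
    hubs t = 𝟙 (hub? (vertex t))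

    hubs-periodic : Periodic n hubs
    hubs-periodic t = cong (λ v → 𝟙 (hub? v)) (vertex-cong ([m+n]%n≡m%n t n))

    hubs-total : ∑ n hubs ≤ hub n
    hubs-total = begin
      ∑ n hubs                                    ≡⟨ length-filter-tabulate P? n id hubs (λ i → cong (λ v → 𝟙 (hub? v)) (sym (vertex-toℕ i))) ⟨
      length (filter P? (allFin n))               ≡⟨ length-map f (filter P? (allFin n)) ⟨
      length (map f (filter P? (allFin n)))       ≤⟨ unique-⊆⇒length≤ (map⁺ (σ-injective ∘ toℕ-injective) (filter⁺ P? (allFin⁺ n))) sub ⟩
      length (upTo (hub n))                       ≡⟨ length-upTo (hub n) ⟩
      hub n                                       ∎
      where
      open ≤-Reasoning
      f : Fin n → ℕ
      f = toℕ ∘ lookup σ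
      P? : Decidable (λ i → Hub (lookup σ i))
      P? i = hub? (lookup σ i)
      sub : ∀ {k} → k ∈ map f (filter P? (allFin n)) → k ∈ upTo (hub n)
      sub k∈ with i , i∈ , refl ← ∈-map⁻ f k∈ = ∈-upTo⁺ (proj₂ (∈-filter⁻ P? {xs = allFin n} i∈))

    same≤ : ∀ t i → same colour (suc i) t ≤ 𝟙 (good? t i) + (hubs t + hubs (t + suc i))
    same≤ t i with hub? (vertex t) | hub? (vertex (t + suc i)) | colour t ≟ᵇ colour (t + suc i)
    ... | _     | _     | no _  = z≤n
    ... | yes _ | _     | yes _ = s≤s z≤n
    ... | no _  | yes _ | yes _ = s≤s z≤n
    ... | no _  | no _  | yes _ = s≤s z≤n

    -- A monochromatic pair that is not forced has a hub as an end, and every hub lies in 2m of the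
    -- indexed pairs.
    cost≤forced : cost colour ≤ forced-count + 2 * (m * hub n)
    cost≤forced = begin
      ∑ m (λ i → ∑ n (same colour (suc i)))                                                  ≡⟨ ∑-comm n m (λ t i → same colour (suc i) t) ⟨
      ∑ n (λ t → ∑ m λ i → same colour (suc i) t)                                            ≤⟨ ∑-mono n (λ t _ → ∑-mono m λ i _ → same≤ t i) ⟩
      ∑ n (λ t → ∑ m λ i → 𝟙 (good? t i) + (hubs t + hubs (t + suc i)))                      ≡⟨ trans (∑-cong n λ t _ → ∑-distrib-+ m _ _) (∑-distrib-+ n _ _) ⟩
      good-total + ∑ n (λ t → ∑ m λ i → hubs t + hubs (t + suc i))                           ≡⟨ cong (λ x → good-total + x) (trans (∑-comm n m (λ t i → hubs t + hubs (t + suc i))) (∑-cong m λ i _ → trans (∑-distrib-+ n hubs _)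
                                                                                                (cong (λ x → ∑ n hubs + x) (trans (∑-cong n λ t _ → cong hubs (+-comm t (suc i))) (∑-shift hubs-periodic (suc i)))))) ⟩
      good-total + ∑ m (λ _ → ∑ n hubs + ∑ n hubs)                                           ≤⟨ +-mono-≤ good≤forced (∑-mono m λ _ _ → +-mono-≤ hubs-total hubs-total) ⟩
      forced-count + ∑ m (λ _ → hub n + hub n)                                               ≡⟨ cong (λ x → forced-count + x) (trans (∑-const m _) (eq m (hub n))) ⟩
      forced-count + 2 * (m * hub n)                                                         ∎
      where
      open ≤-Reasoning
      eq : ∀ m k → m * (k + k) ≡ 2 * (m * k)
      eq = solve-∀

    forced-present : ∀ {E} → E ∈ subsets (pairs n) → power (cycle σ) m ⊆ G n ∪ edgeGraph E →
      ∀ {p} → p ∈ pairs n → Forced p → p ∈ E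
    forced-present {E} E∈ sub {u , v} p∈ (a , ¬g) with sub u v a
    ... | inj₁ g = contradiction g ¬g
    ... | inj₂ (_ , inj₁ uv∈) = uv∈
    -- `E` consists of increasing pairs only, so the reversed pair cannot be the one present.
    ... | inj₂ (_ , inj₂ vu∈) = contradiction (ordered (subset⊆ (pairs n) E∈ vu∈)) (<-asym (ordered p∈))
      where
      ordered : ∀ {u v} → (u , v) ∈ pairs n → toℕ u < toℕ v
      ordered uv∈ = proj₂ (∈-filter⁻ (λ (i , j) → i <ᶠ? j) {xs = cartesianProduct (allFin n) (allFin n)} uv∈)

-- Union bound over all vertex sequences

module Embeddings where

  open CyclicColourings
  open OptimumConstants using (module Optimum)
  open HubGraphs
  open BinomialMass
  open ForcedEdges
  import Data.Fin.Properties as Finₚ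
  open import Data.Fin.Base using (Fin)
  import Data.Integer.Base as ℤ
  import Data.Integer.Properties as ℤₚ
  open import Data.List.Base using (List; []; _∷_; length; map; allFin; cartesianProductWith)
  open import Data.List.Membership.Propositional using (_∈_)
  open import Data.List.Membership.Propositional.Properties using (∈-cartesianProductWith⁺; ∈-allFin)
  open import Data.List.Properties using (length-++; length-map; length-tabulate)
  open import Data.List.Relation.Unary.Any using (here)
  open import Data.List.Relation.Unary.Unique.Propositional using (Unique)
  open import Data.List.Relation.Unary.Unique.Propositional.Properties using (filter⁺; allFin⁺; cartesianProduct⁺)
  open import Data.Nat.Base as ℕ using (ℕ; zero; suc; NonZero)
  import Data.Nat.Properties as ℕₚ
  import Data.Nat.Tactic.RingSolver as ℕSolver
  open import Data.Product.Base using (_×_; _,_)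
  open import Data.Rational.Base hiding (NonZero)
  open import Data.Rational.Properties
  open import Data.Rational.Unnormalised.Base as ℚᵘ using (mkℚᵘ)
  import Data.Rational.Unnormalised.Properties as ℚᵘₚ
  open import Data.Vec.Base using (Vec; []; _∷_; lookup)
  import Data.Sum.Base as Sum
  open import Defs using (power; cycle; pairs; subsets; edgeGraph; _∪_; _⊆_; 𝒞?; adj?)
  open import Function.Base using (id)
  open import Function.Definitions using (Injective)
  open import Relation.Binary.PropositionalEquality
  open import Relation.Nullary.Decidable using (Dec; yes; no; map′; _×-dec_; _→-dec_)
  open import Relation.Nullary.Negation using (¬_)
  open import Relation.Unary using (Decidable)

  -- Defined by recursion so that its homomorphism laws follow by induction, without normalised
  -- fractions; `ι≡/1` connects it with the division.
  ι : ℕ → ℚ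
  ι zero    = 0ℚ
  ι (suc k) = 1ℚ + ι k

  0≤ι : ∀ k → 0ℚ ≤ ι k
  0≤ι zero    = ≤-refl
  0≤ι (suc k) = 0≤+ 0≤1 (0≤ι k)

  ι-+ : ∀ a b → ι (a ℕ.+ b) ≡ ι a + ι b
  ι-+ zero    b = sym (+-identityˡ (ι b))
  ι-+ (suc a) b = trans (cong (1ℚ +_) (ι-+ a b)) (sym (+-assoc 1ℚ (ι a) (ι b)))

  ι-* : ∀ a b → ι (a ℕ.* b) ≡ ι a * ι b
  ι-* zero    b = sym (*-zeroˡ (ι b))
  ι-* (suc a) b = trans (ι-+ b (a ℕ.* b)) (trans (cong₂ _+_ (sym (*-identityˡ (ι b))) (ι-* a b)) (sym (*-distribʳ-+ (ι b) 1ℚ (ι a))))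

  ι-^ : ∀ a k → ι (a ℕ.^ k) ≡ ι a ^ k
  ι-^ a zero    = +-identityʳ 1ℚ
  ι-^ a (suc k) = trans (ι-* a (a ℕ.^ k)) (cong (ι a *_) (ι-^ a k))

  ι-mono : ∀ {a b} → a ℕ.≤ b → ι a ≤ ι b
  ι-mono {b = b} ℕ.z≤n = 0≤ι b
  ι-mono (ℕ.s≤s le)    = +-monoʳ-≤ 1ℚ (ι-mono le)

  ι-pos : ∀ {a} → 0 ℕ.< a → 0ℚ < ι a
  ι-pos {suc a} _ = <-≤-trans (*<* (ℤ.+<+ (ℕ.s≤s ℕ.z≤n))) (subst (_≤ ι (suc a)) (+-identityʳ 1ℚ) (+-monoʳ-≤ 1ℚ (0≤ι a)))

  ι≡/1 : ∀ a → ι a ≡ ℤ.+ a / 1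
  ι≡/1 zero    = refl
  ι≡/1 (suc a) = trans (cong (1ℚ +_) (ι≡/1 a)) (toℚᵘ-injective (begin
    toℚᵘ (1ℚ + ℤ.+ a / 1)                      ≈⟨ toℚᵘ-homo-+ 1ℚ (ℤ.+ a / 1) ⟩
    toℚᵘ 1ℚ ℚᵘ.+ toℚᵘ (ℤ.+ a / 1)              ≈⟨ ℚᵘₚ.+-congʳ (toℚᵘ 1ℚ) (toℚᵘ-fromℚᵘ (mkℚᵘ (ℤ.+ a) 0)) ⟩
    toℚᵘ 1ℚ ℚᵘ.+ mkℚᵘ (ℤ.+ a) 0                ≈⟨ ℚᵘ.*≡* (cong (λ x → (ℤ.+ 1 ℤ.+ x) ℤ.* ℤ.+ 1) (ℤₚ.*-identityʳ (ℤ.+ a))) ⟩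
    mkℚᵘ (ℤ.+ suc a) 0                         ≈⟨ toℚᵘ-fromℚᵘ (mkℚᵘ (ℤ.+ suc a) 0) ⟨
    toℚᵘ (ℤ.+ suc a / 1)                       ∎))
    where open import Relation.Binary.Reasoning.Setoid ℚᵘₚ.≃-setoid

  /-cancel : ∀ u k .{{_ : NonZero k}} → (ℤ.+ u / k) * ι k ≡ ι u
  /-cancel u (suc k) = trans (cong (ℤ.+ u / suc k *_) (ι≡/1 (suc k))) (trans (toℚᵘ-injective (begin
    toℚᵘ (ℤ.+ u / suc k * (ℤ.+ suc k / 1))                  ≈⟨ toℚᵘ-homo-* (ℤ.+ u / suc k) (ℤ.+ suc k / 1) ⟩
    toℚᵘ (ℤ.+ u / suc k) ℚᵘ.* toℚᵘ (ℤ.+ suc k / 1)          ≈⟨ ℚᵘₚ.*-cong (toℚᵘ-fromℚᵘ (mkℚᵘ (ℤ.+ u) k)) (toℚᵘ-fromℚᵘ (mkℚᵘ (ℤ.+ suc k) 0)) ⟩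
    mkℚᵘ (ℤ.+ u) k ℚᵘ.* mkℚᵘ (ℤ.+ suc k) 0                  ≈⟨ ℚᵘ.*≡* (trans (ℤₚ.*-identityʳ (ℤ.+ u ℤ.* ℤ.+ suc k)) (cong (λ x → ℤ.+ u ℤ.* ℤ.+ x) (sym (ℕₚ.*-identityʳ (suc k))))) ⟩
    mkℚᵘ (ℤ.+ u) 0                                          ≈⟨ toℚᵘ-fromℚᵘ (mkℚᵘ (ℤ.+ u) 0) ⟨
    toℚᵘ (ℤ.+ u / 1)                                        ∎)) (sym (ι≡/1 u)))
    where open import Relation.Binary.Reasoning.Setoid ℚᵘₚ.≃-setoid

  sum-≤ : ∀ {B : Set} {f : B → ℚ} {C} (bs : List B) → (∀ b → f b ≤ C) → sum (map f bs) ≤ ι (length bs) * C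
  sum-≤ {C = C} []       _ = ≤-reflexive (sym (*-zeroˡ C))
  sum-≤ {C = C} (b ∷ bs) h = ≤-trans (+-mono-≤ (h b) (sum-≤ bs h))
    (≤-reflexive (trans (cong (_+ ι (length bs) * C) (sym (*-identityˡ C))) (sym (*-distribʳ-+ C 1ℚ (ι (length bs))))))

  vectors : ∀ n k → List (Vec (Fin n) k)
  vectors n zero    = [] ∷ []
  vectors n (suc k) = cartesianProductWith _∷_ (allFin n) (vectors n k)

  ∈-vectors : ∀ {n k} (v : Vec (Fin n) k) → v ∈ vectors n k
  ∈-vectors []      = here refl
  ∈-vectors (i ∷ v) = ∈-cartesianProductWith⁺ _∷_ (∈-allFin i) (∈-vectors v)

  length-product : ∀ {A B C : Set} (f : A → B → C) xs ys → length (cartesianProductWith f xs ys) ≡ length xs ℕ.* length ys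
  length-product f []       ys = refl
  length-product f (x ∷ xs) ys = trans (length-++ (map (f x) ys)) (cong₂ ℕ._+_ (length-map (f x) ys) (length-product f xs ys))

  length-vectors : ∀ n k → length (vectors n k) ≡ n ℕ.^ k
  length-vectors n zero    = refl
  length-vectors n (suc k) = trans (length-product _∷_ (allFin n) (vectors n k)) (cong₂ ℕ._*_ (length-tabulate {n = n} id) (length-vectors n k))

  pairs-unique : ∀ n → Unique (pairs n)
  pairs-unique n = filter⁺ _ (cartesianProduct⁺ (allFin⁺ n) (allFin⁺ n))

  module PowerProbability (m h e : ℕ) (1≤m : 1 ℕ.≤ m) (1≤h : 1 ℕ.≤ h) (m≡ : suc m ≡ h ℕ.+ e ℕ.+ h)
    (lower : e ℕ.* e ℕ.≤ 2 ℕ.* h ℕ.* h ℕ.+ e) (upper : 2 ℕ.* h ℕ.* h ℕ.≤ e ℕ.* e ℕ.+ 3 ℕ.* e ℕ.+ 4 ℕ.* h)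
    (D : ℕ) (2≤D : 2 ℕ.≤ D) (n : ℕ) (2m<n : m ℕ.+ m ℕ.< n)
    (q : ℚ) (0≤q : 0ℚ ≤ q) (q≤1 : q ≤ 1ℚ) where

    open Optimum m h e 1≤h m≡ lower upper using (ℓ; Y)
    open HubGraph D 2≤D using (G; hub)
    open Binomial {Fin n × Fin n} q 0≤q q≤1

    Embeds : Vec (Fin n) n → List (Fin n × Fin n) → Set
    Embeds σ E = Injective _≡_ _≡_ (lookup σ) × power (cycle σ) m ⊆ G n ∪ edgeGraph E

    injective? : ∀ (σ : Vec (Fin n) n) → Dec (Injective _≡_ _≡_ (lookup σ))
    injective? σ = map′ (λ inj {i} {j} → inj i j) (λ inj i j → inj)
      (Finₚ.all? λ i → Finₚ.all? λ j → (lookup σ i Finₚ.≟ lookup σ j) →-dec (i Finₚ.≟ j))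

    embeds? : ∀ σ → Decidable (Embeds σ)
    embeds? σ E = injective? σ ×-dec
      (Finₚ.all? λ u → Finₚ.all? λ v → adj? (power (cycle σ) m) u v →-dec adj? (G n ∪ edgeGraph E) u v)

    -- The truncation k ⊓ m n keeps the exponent bounded and the constraint true.
    probability-bound : ∀ {B} → 0ℚ ≤ B →
      (∀ k → k ℕ.≤ m ℕ.* n → ℓ ℕ.* (m ℕ.* n) ℕ.≤ Y ℕ.* n ℕ.+ 2 ℕ.* (ℓ ℕ.* (k ℕ.+ 2 ℕ.* (m ℕ.* hub n))) → q ^ k ≤ B) →
      mass (length (pairs n)) (λ E → 𝒞? m n (G n ∪ edgeGraph E)) (subsets (pairs n)) ≤ ι (n ℕ.^ n) * B
    probability-bound {B} 0≤B small = begin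
      mass M (λ E → 𝒞? m n (G n ∪ edgeGraph E)) (subsets (pairs n))
        ≤⟨ union-bound (subsets (pairs n)) (λ _ (σ , inj , sub) → σ , ∈-vectors σ , inj , sub) ⟩
      sum (map (λ σ → mass M (embeds? σ) (subsets (pairs n))) (vectors n n))
        ≤⟨ sum-≤ (vectors n n) each ⟩
      ι (length (vectors n n)) * B
        ≡⟨ cong (λ k → ι k * B) (length-vectors n n) ⟩
      ι (n ℕ.^ n) * B ∎
      where
      open ≤-Reasoning
      M = length (pairs n)
      open Union M (λ E → 𝒞? m n (G n ∪ edgeGraph E)) embeds? (vectors n n)
      not-injective : ∀ σ → ¬ Injective _≡_ _≡_ (lookup σ) → mass M (embeds? σ) (subsets (pairs n)) ≤ B
      not-injective σ ¬inj = subst (_≤ B) (sym (mass-none M (embeds? σ) (subsets (pairs n)) (λ _ (inj , _) → ¬inj inj))) 0≤B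
      is-injective : ∀ σ → Injective _≡_ _≡_ (lookup σ) → mass M (embeds? σ) (subsets (pairs n)) ≤ B
      is-injective σ inj = ≤-trans (containment-bound (pairs-unique n) (embeds? σ) forced? (λ E∈ (_ , sub) {p} p∈ f → forced-present E∈ sub p∈ f))
        (≤-trans (^-antitone 0≤q q≤1 (ℕₚ.m⊓n≤m forced-count (m ℕ.* n))) (small (forced-count ℕ.⊓ (m ℕ.* n)) (ℕₚ.m⊓n≤n forced-count (m ℕ.* n)) constraint))
        where
        open CycleEdges D 2≤D m n 1≤m 2m<n σ inj
        open CyclicBound m h e 1≤m 1≤h m≡ lower upper n m<n using (cyclic-bound)
        Constraint : ℕ → Set
        Constraint k = ℓ ℕ.* (m ℕ.* n) ℕ.≤ Y ℕ.* n ℕ.+ 2 ℕ.* (ℓ ℕ.* (k ℕ.+ 2 ℕ.* (m ℕ.* hub n)))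
        trivial : Constraint (m ℕ.* n)
        trivial = ℕₚ.≤-trans (ℕₚ.m≤m+n _ _) (ℕₚ.≤-trans (ℕₚ.≤-reflexive (eq ℓ (m ℕ.* n) (2 ℕ.* (m ℕ.* hub n)))) (ℕₚ.m≤n+m _ (Y ℕ.* n)))
          where
          eq : ∀ l a b → l ℕ.* a ℕ.+ (l ℕ.* a ℕ.+ 2 ℕ.* (l ℕ.* b)) ≡ 2 ℕ.* (l ℕ.* (a ℕ.+ b))
          eq = ℕSolver.solve-∀
        actual : Constraint forced-count
        actual = ℕₚ.≤-trans (cyclic-bound colour colour-periodic) (ℕₚ.+-monoʳ-≤ (Y ℕ.* n) (ℕₚ.*-monoʳ-≤ 2 (ℕₚ.*-monoʳ-≤ ℓ cost≤forced)))
        constraint : Constraint (forced-count ℕ.⊓ (m ℕ.* n))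
        constraint = Sum.[ (λ eq → subst Constraint (sym eq) actual) , (λ eq → subst Constraint (sym eq) trivial) ]′ (ℕₚ.⊓-sel forced-count (m ℕ.* n))
      each : ∀ σ → mass M (embeds? σ) (subsets (pairs n)) ≤ B
      each σ = by-cases (injective? σ)
        where
        by-cases : Dec (Injective _≡_ _≡_ (lookup σ)) → mass M (embeds? σ) (subsets (pairs n)) ≤ B
        by-cases (yes inj) = is-injective σ inj
        by-cases (no ¬inj) = not-injective σ ¬inj

-- Powers of a rational and the decay of the expected count

module PowerLaws where

  open BinomialMass
  open Embeddings
  open import Data.Nat.Base as ℕ using (ℕ; zero; suc)
  import Data.Nat.Properties as ℕₚ
  import Data.Nat.Tactic.RingSolver as ℕSolver
  open import Data.Rational.Base hiding (NonZero)
  open import Data.Rational.Properties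
  import Data.Rational.Solver as ℚSolver
  open import Data.Sum.Base using (inj₁; inj₂)
  open import Relation.Binary.PropositionalEquality

  ^-distribˡ-+ : ∀ q a b → q ^ (a ℕ.+ b) ≡ q ^ a * q ^ b
  ^-distribˡ-+ q zero    b = sym (*-identityˡ (q ^ b))
  ^-distribˡ-+ q (suc a) b = trans (cong (q *_) (^-distribˡ-+ q a b)) (sym (*-assoc q (q ^ a) (q ^ b)))

  *-^ : ∀ p q k → (p * q) ^ k ≡ p ^ k * q ^ k
  *-^ p q zero    = refl
  *-^ p q (suc k) = trans (cong (p * q *_) (*-^ p q k)) (eq p q (p ^ k) (q ^ k))
    where
    open ℚSolver.+-*-Solver
    eq : ∀ a b c d → a * b * (c * d) ≡ a * c * (b * d)
    eq = solve 4 (λ a b c d → a :* b :* (c :* d) := a :* c :* (b :* d)) refl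

  ^-*-assoc : ∀ q a b → (q ^ a) ^ b ≡ q ^ (a ℕ.* b)
  ^-*-assoc q a zero    = cong (q ^_) (sym (ℕₚ.*-zeroʳ a))
  ^-*-assoc q a (suc b) = trans (cong (q ^ a *_) (^-*-assoc q a b)) (trans (sym (^-distribˡ-+ q a (a ℕ.* b))) (cong (q ^_) (sym (ℕₚ.*-suc a b))))

  ^-monoˡ-≤ : ∀ {p q} k → 0ℚ ≤ p → p ≤ q → p ^ k ≤ q ^ k
  ^-monoˡ-≤ zero    _   _   = ≤-refl
  ^-monoˡ-≤ (suc k) 0≤p p≤q = *-mono-≤ (0≤^ k 0≤p) (≤-trans 0≤p p≤q) p≤q (^-monoˡ-≤ k 0≤p p≤q)

  1≤^ : ∀ {q} k → 1ℚ ≤ q → 1ℚ ≤ q ^ k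
  1≤^ zero    _   = ≤-refl
  1≤^ {q} (suc k) 1≤q = subst (_≤ q * q ^ k) (*-identityˡ 1ℚ) (*-mono-≤ 0≤1 (≤-trans 0≤1 1≤q) 1≤q (1≤^ k 1≤q))

  ^-monoʳ-≤ : ∀ {q a b} → 1ℚ ≤ q → a ℕ.≤ b → q ^ a ≤ q ^ b
  ^-monoʳ-≤ {b = b} 1≤q ℕ.z≤n = 1≤^ b 1≤q
  ^-monoʳ-≤ {q} 1≤q (ℕ.s≤s le) = *-monoˡ-≤-nonNeg q {{nonNegative (≤-trans 0≤1 1≤q)}} (^-monoʳ-≤ 1≤q le)

  ^≤1⇒≤1 : ∀ {q} k → q ^ suc k ≤ 1ℚ → q ≤ 1ℚ
  ^≤1⇒≤1 {q} k le = ≮⇒≥ λ 1<q → <-irrefl refl (<-≤-trans 1<q (≤-trans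
    (subst (_≤ q ^ suc k) (*-identityʳ q) (*-monoˡ-≤-nonNeg q {{nonNegative (<⇒≤ (≤-<-trans 0≤1 1<q))}} (1≤^ k (<⇒≤ 1<q)))) le))

  module Decay (q : ℚ) (0≤q : 0ℚ ≤ q) (n d e k ℓ m : ℕ) (1≤n : 1 ℕ.≤ n) (1≤ℓ : 1 ℕ.≤ ℓ) (1≤d : 1 ℕ.≤ d)
    (k≤ : k ℕ.≤ m ℕ.* n) (q^d≤ : q ^ d * ι n ^ e ≤ ι 2 ^ d)
    (gap : 2 ℕ.* ℓ ℕ.* d ℕ.* n ℕ.+ n ℕ.≤ 2 ℕ.* ℓ ℕ.* e ℕ.* k)
    (large : 2 ℕ.^ (2 ℕ.* ℓ ℕ.* d ℕ.* suc m) ℕ.≤ n) where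

    private
      a b A : ℚ
      a = ι 2
      b = ι n
      A = q ^ k * ι (2 ℕ.* n) ^ n
      K : ℕ
      K = 2 ℕ.* ℓ ℕ.* d
      0≤b : 0ℚ ≤ b
      0≤b = 0≤ι n
      1≤a : 1ℚ ≤ a
      1≤a = ι-mono {1} {2} (ℕ.s≤s ℕ.z≤n)
      1≤b : 1ℚ ≤ b
      1≤b = ι-mono {1} 1≤n

    private
      A^K≡ : A ^ K ≡ q ^ (k ℕ.* K) * (a ^ (n ℕ.* K) * b ^ (n ℕ.* K))
      A^K≡ = begin
        (q ^ k * ι (2 ℕ.* n) ^ n) ^ K                 ≡⟨ *-^ (q ^ k) _ K ⟩
        (q ^ k) ^ K * (ι (2 ℕ.* n) ^ n) ^ K           ≡⟨ cong₂ _*_ (^-*-assoc q k K) (^-*-assoc (ι (2 ℕ.* n)) n K) ⟩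
        q ^ (k ℕ.* K) * ι (2 ℕ.* n) ^ (n ℕ.* K)       ≡⟨ cong (λ x → q ^ (k ℕ.* K) * x ^ (n ℕ.* K)) (ι-* 2 n) ⟩
        q ^ (k ℕ.* K) * (a * b) ^ (n ℕ.* K)           ≡⟨ cong (q ^ (k ℕ.* K) *_) (*-^ a b (n ℕ.* K)) ⟩
        q ^ (k ℕ.* K) * (a ^ (n ℕ.* K) * b ^ (n ℕ.* K)) ∎
        where open ≡-Reasoning

      edges : q ^ (k ℕ.* K) * b ^ (n ℕ.* K ℕ.+ n) ≤ a ^ (K ℕ.* (m ℕ.* n))
      edges = begin
        q ^ (k ℕ.* K) * b ^ (n ℕ.* K ℕ.+ n)             ≤⟨ *-monoˡ-≤-nonNeg (q ^ (k ℕ.* K)) {{nonNegative (0≤^ (k ℕ.* K) 0≤q)}} (^-monoʳ-≤ 1≤b gap′) ⟩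
        q ^ (k ℕ.* K) * b ^ (2 ℕ.* ℓ ℕ.* e ℕ.* k)       ≡⟨ cong₂ (λ i j → q ^ i * b ^ j) (eq₁ k ℓ d) (eq₂ ℓ e k) ⟩
        q ^ (d ℕ.* (2 ℕ.* ℓ ℕ.* k)) * b ^ (e ℕ.* (2 ℕ.* ℓ ℕ.* k)) ≡⟨ cong₂ _*_ (sym (^-*-assoc q d _)) (sym (^-*-assoc b e _)) ⟩
        (q ^ d) ^ (2 ℕ.* ℓ ℕ.* k) * (b ^ e) ^ (2 ℕ.* ℓ ℕ.* k)     ≡⟨ *-^ (q ^ d) (b ^ e) (2 ℕ.* ℓ ℕ.* k) ⟨
        (q ^ d * b ^ e) ^ (2 ℕ.* ℓ ℕ.* k)               ≤⟨ ^-monoˡ-≤ (2 ℕ.* ℓ ℕ.* k) (0≤* (0≤^ d 0≤q) (0≤^ e 0≤b)) q^d≤ ⟩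
        (a ^ d) ^ (2 ℕ.* ℓ ℕ.* k)                       ≡⟨ ^-*-assoc a d _ ⟩
        a ^ (d ℕ.* (2 ℕ.* ℓ ℕ.* k))                     ≤⟨ ^-monoʳ-≤ 1≤a (ℕₚ.≤-trans (ℕₚ.≤-reflexive (eq₃ d ℓ k)) (ℕₚ.*-monoʳ-≤ K k≤)) ⟩
        a ^ (K ℕ.* (m ℕ.* n))                           ∎
        where
        open ≤-Reasoning
        eq₀ : ∀ n ℓ d → 2 ℕ.* ℓ ℕ.* d ℕ.* n ℕ.+ n ≡ n ℕ.* (2 ℕ.* ℓ ℕ.* d) ℕ.+ n
        eq₀ = ℕSolver.solve-∀
        gap′ : n ℕ.* K ℕ.+ n ℕ.≤ 2 ℕ.* ℓ ℕ.* e ℕ.* k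
        gap′ = subst (ℕ._≤ 2 ℕ.* ℓ ℕ.* e ℕ.* k) (eq₀ n ℓ d) gap
        eq₁ : ∀ k ℓ d → k ℕ.* (2 ℕ.* ℓ ℕ.* d) ≡ d ℕ.* (2 ℕ.* ℓ ℕ.* k)
        eq₁ = ℕSolver.solve-∀
        eq₂ : ∀ ℓ e k → 2 ℕ.* ℓ ℕ.* e ℕ.* k ≡ e ℕ.* (2 ℕ.* ℓ ℕ.* k)
        eq₂ = ℕSolver.solve-∀
        eq₃ : ∀ d ℓ k → d ℕ.* (2 ℕ.* ℓ ℕ.* k) ≡ 2 ℕ.* ℓ ℕ.* d ℕ.* k
        eq₃ = ℕSolver.solve-∀

      A^K*b^n≤b^n : A ^ K * b ^ n ≤ 1ℚ * b ^ n
      A^K*b^n≤b^n = begin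
        A ^ K * b ^ n                                                        ≡⟨ cong (_* b ^ n) A^K≡ ⟩
        q ^ (k ℕ.* K) * (a ^ (n ℕ.* K) * b ^ (n ℕ.* K)) * b ^ n              ≡⟨ eq (q ^ (k ℕ.* K)) (a ^ (n ℕ.* K)) (b ^ (n ℕ.* K)) (b ^ n) ⟩
        q ^ (k ℕ.* K) * (b ^ (n ℕ.* K) * b ^ n) * a ^ (n ℕ.* K)              ≡⟨ cong (λ x → q ^ (k ℕ.* K) * x * a ^ (n ℕ.* K)) (^-distribˡ-+ b (n ℕ.* K) n) ⟨
        q ^ (k ℕ.* K) * b ^ (n ℕ.* K ℕ.+ n) * a ^ (n ℕ.* K)                  ≤⟨ *-monoʳ-≤-nonNeg _ {{nonNegative (0≤^ (n ℕ.* K) (0≤ι 2))}} edges ⟩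
        a ^ (K ℕ.* (m ℕ.* n)) * a ^ (n ℕ.* K)                                ≡⟨ ^-distribˡ-+ a (K ℕ.* (m ℕ.* n)) (n ℕ.* K) ⟨
        a ^ (K ℕ.* (m ℕ.* n) ℕ.+ n ℕ.* K)                                    ≡⟨ cong (a ^_) (eq′ K m n) ⟩
        a ^ (K ℕ.* suc m ℕ.* n)                                              ≡⟨ ^-*-assoc a (K ℕ.* suc m) n ⟨
        (a ^ (K ℕ.* suc m)) ^ n                                              ≤⟨ ^-monoˡ-≤ n (0≤^ (K ℕ.* suc m) (0≤ι 2)) (≤-trans (≤-reflexive (sym (ι-^ 2 (K ℕ.* suc m)))) (ι-mono large)) ⟩
        b ^ n                                                                ≡⟨ *-identityˡ (b ^ n) ⟨
        1ℚ * b ^ n                                                           ∎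
        where
        open ≤-Reasoning
        open ℚSolver.+-*-Solver
        eq : ∀ x y z w → x * (y * z) * w ≡ x * (z * w) * y
        eq = solve 4 (λ x y z w → x :* (y :* z) :* w := x :* (z :* w) :* y) refl
        eq′ : ∀ K m n → K ℕ.* (m ℕ.* n) ℕ.+ n ℕ.* K ≡ K ℕ.* suc m ℕ.* n
        eq′ = ℕSolver.solve-∀

      0<b^n : 0ℚ < b ^ n
      0<b^n = <-≤-trans (ι-pos {1} (ℕ.s≤s ℕ.z≤n)) (1≤^ n 1≤b)

      A≤1′ : ∀ K′ → A ^ K′ * b ^ n ≤ 1ℚ * b ^ n → 1 ℕ.≤ K′ → A ≤ 1ℚ
      A≤1′ (suc K′) le _ = ^≤1⇒≤1 K′ (*-cancelʳ-≤-pos (b ^ n) {{positive 0<b^n}} le)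

    decay : q ^ k * ι (2 ℕ.* n) ^ n ≤ 1ℚ
    decay = A≤1′ K A^K*b^n≤b^n (ℕₚ.*-mono-≤ (ℕₚ.*-mono-≤ (ℕ.s≤s (ℕ.z≤n {1})) 1≤ℓ) 1≤d)

  scale-root : ∀ {q v B : ℚ} d → 0ℚ ≤ q → 0ℚ ≤ B → q ≤ v + v → v ^ d * B ≤ 1ℚ → q ^ d * B ≤ ι 2 ^ d
  scale-root {q} {v} {B} d 0≤q 0≤B q≤ vB≤1 = begin
    q ^ d * B                ≤⟨ *-monoʳ-≤-nonNeg B {{nonNegative 0≤B}} (^-monoˡ-≤ d 0≤q (≤-trans q≤ (≤-reflexive (eq v)))) ⟩
    (ι 2 * v) ^ d * B        ≡⟨ trans (cong (_* B) (*-^ (ι 2) v d)) (*-assoc (ι 2 ^ d) (v ^ d) B) ⟩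
    ι 2 ^ d * (v ^ d * B)    ≤⟨ *-monoˡ-≤-nonNeg (ι 2 ^ d) {{nonNegative (0≤^ d (0≤ι 2))}} vB≤1 ⟩
    ι 2 ^ d * 1ℚ             ≡⟨ *-identityʳ (ι 2 ^ d) ⟩
    ι 2 ^ d                  ∎
    where
    open ≤-Reasoning
    eq : ∀ v → v + v ≡ ι 2 * v
    eq v = trans (cong₂ _+_ (sym (*-identityˡ v)) (sym (*-identityˡ v))) (sym (*-distribʳ-+ v 1ℚ 1ℚ))

  -- q is at most twice the larger of u and η, and either of them satisfies the required estimate.
  double-root : ∀ {q u η B : ℚ} d → 1 ℕ.≤ d → 0ℚ ≤ q → 0ℚ ≤ η → η ≤ 1ℚ → 0ℚ ≤ B → q ≤ u + η →
    u ^ d * B ≤ 1ℚ → η * B ≤ 1ℚ → q ^ d * B ≤ ι 2 ^ d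
  double-root {q} {u} {η} {B} d@(suc d′) _ 0≤q 0≤η η≤1 0≤B q≤ uB≤1 ηB≤1 with ≤-total u η
  ... | inj₁ u≤η = scale-root {v = η} d 0≤q 0≤B (≤-trans q≤ (+-monoˡ-≤ η u≤η)) (≤-trans (*-monoʳ-≤-nonNeg B {{nonNegative 0≤B}}
      (subst (η ^ d ≤_) (*-identityʳ η) (*-monoˡ-≤-nonNeg η {{nonNegative 0≤η}} (^≤1 d′ 0≤η η≤1)))) ηB≤1)
  ... | inj₂ η≤u = scale-root {v = u} d 0≤q 0≤B (≤-trans q≤ (+-monoʳ-≤ u η≤u)) uB≤1

-- From real parameters to their rational approximations

module RealPolynomials where

  open BinomialMass
  open Embeddings
  open PowerLaws
  import Defs as R
  open R using (ℝ; mkℝ; seq; cauchy)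
  open import Data.Bool.Base using (Bool; true; false; not; if_then_else_)
  import Data.Integer.Base as ℤ
  open import Data.List.Base using (List; []; _∷_; length; map)
  open import Data.Nat.Base as ℕ using (ℕ; zero; suc; NonZero; ⌊_/2⌋)
  open import Data.Nat.Coprimality using (Coprime)
  import Data.Nat.Properties as ℕₚ
  open import Data.Product.Base using (_×_; _,_; ∃; proj₁; proj₂)
  open import Data.Rational.Base hiding (NonZero)
  open import Data.Rational.Properties
  import Data.Rational.Solver as ℚSolver
  open import Data.Sum.Base using (inj₁; inj₂)
  open import Function.Base using (_∘_)
  open import Relation.Binary.PropositionalEquality
  open import Relation.Nullary.Negation using (contradiction)

  -- Two sequences with the same limit, interleaved into one real number: by
  -- construction any polynomial takes nearby values on the two.
  module Interleave (x : ℝ) (y : ℕ → ℚ) (near : ∀ ε → 0ℚ < ε → ∃ λ N → ∀ i → N ℕ.≤ i → ∣ y i - seq x i ∣ ≤ ε) where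

    odd : ℕ → Bool
    odd zero    = false
    odd (suc k) = not (odd k)

    mixed : ℕ → ℚ
    mixed k = if odd k then y ⌊ k /2⌋ else seq x ⌊ k /2⌋

    mixed-near : ∀ ε → 0ℚ < ε → ∃ λ N → ∀ k → N ℕ.≤ ⌊ k /2⌋ → ∣ mixed k - seq x ⌊ k /2⌋ ∣ ≤ ε
    mixed-near ε 0<ε with N , h ← near ε 0<ε = N , close
      where
      close : ∀ k → N ℕ.≤ ⌊ k /2⌋ → ∣ mixed k - seq x ⌊ k /2⌋ ∣ ≤ ε
      close k N≤ with odd k
      ... | true  = h ⌊ k /2⌋ N≤
      ... | false = subst (_≤ ε) (sym (cong ∣_∣ (+-inverseʳ (seq x ⌊ k /2⌋)))) (<⇒≤ 0<ε)

    half-large : ∀ {N k} → N ℕ.+ N ℕ.≤ k → N ℕ.≤ ⌊ k /2⌋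
    half-large {N} {k} le = subst (ℕ._≤ ⌊ k /2⌋) (sym (ℕₚ.n≡⌊n+n/2⌋ N)) (ℕₚ.⌊n/2⌋-mono le)

    blend : ℝ
    blend = mkℝ mixed λ ε 0<ε →
      let δ = ½ * (½ * ε)
          0<½ε = R.half-pos 0<ε
          0<δ = R.half-pos 0<½ε
          N₁ , h₁ = mixed-near δ 0<δ
          N₂ , h₂ = cauchy x (½ * ε) 0<½ε
          N = N₁ ℕ.⊔ N₂
      in N ℕ.+ N , λ j k N≤j N≤k →
        let a = ⌊ j /2⌋
            b = ⌊ k /2⌋
            N≤a = half-large N≤j
            N≤b = half-large N≤k
        in begin
          ∣ mixed j - mixed k ∣
            ≡⟨ cong ∣_∣ (eq (mixed j) (mixed k) (seq x a) (seq x b)) ⟩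
          ∣ (mixed j - seq x a) + ((seq x a - seq x b) + (seq x b - mixed k)) ∣
            ≤⟨ ≤-trans (∣p+q∣≤∣p∣+∣q∣ (mixed j - seq x a) _) (+-monoʳ-≤ ∣ mixed j - seq x a ∣ (∣p+q∣≤∣p∣+∣q∣ (seq x a - seq x b) _)) ⟩
          ∣ mixed j - seq x a ∣ + (∣ seq x a - seq x b ∣ + ∣ seq x b - mixed k ∣)
            ≤⟨ +-mono-≤ (h₁ j (ℕₚ.≤-trans (ℕₚ.m≤m⊔n N₁ N₂) N≤a)) (+-mono-≤
                 (h₂ a b (ℕₚ.≤-trans (ℕₚ.m≤n⊔m N₁ N₂) N≤a) (ℕₚ.≤-trans (ℕₚ.m≤n⊔m N₁ N₂) N≤b))
                 (subst (_≤ δ) (R.∣-∣-comm (mixed k) (seq x b)) (h₁ k (ℕₚ.≤-trans (ℕₚ.m≤m⊔n N₁ N₂) N≤b)))) ⟩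
          δ + (½ * ε + δ)
            ≡⟨ eq′ δ (½ * ε) ⟩
          (δ + δ) + ½ * ε
            ≡⟨ trans (cong (_+ ½ * ε) (R.half+half (½ * ε))) (R.half+half ε) ⟩
          ε ∎
      where
      open ≤-Reasoning
      open ℚSolver.+-*-Solver
      eq : ∀ a b c d → a - b ≡ (a - c) + ((c - d) + (d - b))
      eq = solve 4 (λ a b c d → a :- b := (a :- c) :+ ((c :- d) :+ (d :- b))) refl
      eq′ : ∀ a b → a + (b + a) ≡ (a + a) + b
      eq′ = solve 2 (λ a b → a :+ (b :+ a) := (a :+ a) :+ b) refl

    odd-double : ∀ i → odd (i ℕ.+ i) ≡ false
    odd-double zero    = refl
    odd-double (suc i) = trans (cong (not ∘ odd) (ℕₚ.+-suc i i)) (cong (not ∘ not) (odd-double i))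

    mixed-even : ∀ i → mixed (i ℕ.+ i) ≡ seq x i
    mixed-even i = trans (cong (if_then y ⌊ i ℕ.+ i /2⌋ else seq x ⌊ i ℕ.+ i /2⌋) (odd-double i)) (cong (seq x) (sym (ℕₚ.n≡⌊n+n/2⌋ i)))

    mixed-odd : ∀ i → mixed (suc (i ℕ.+ i)) ≡ y i
    mixed-odd i = trans (cong (λ b → if not b then y ⌊ suc (i ℕ.+ i) /2⌋ else seq x ⌊ suc (i ℕ.+ i) /2⌋) (odd-double i)) (cong y (sym (ℕₚ.n≡⌈n+n/2⌉ i)))

  polynomial : {A : Set} → ℕ → List (List A) → ℚ → ℚ
  polynomial M Es q = sum (map (λ E → q ^ length E * (1ℚ - q) ^ (M ℕ.∸ length E)) Es)

  -- By definition this is the sum in `ℙ[G_,_∈_]`, with `Es` the list of edge sets that belong to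
  -- the event.
  polynomialℝ : {A : Set} → ℕ → List (List A) → ℝ → ℝ
  polynomialℝ M Es p = R.sumℝ (map (λ E → p R.^ length E R.* (R.1ℝ R.- p) R.^ (M ℕ.∸ length E)) Es)

  seq-^ : ∀ x k i → seq (x R.^ k) i ≡ seq x i ^ k
  seq-^ x zero    i = refl
  seq-^ x (suc k) i = cong (seq x i *_) (seq-^ x k i)

  seq-polynomial : ∀ {A : Set} M (Es : List (List A)) p i → seq (polynomialℝ M Es p) i ≡ polynomial M Es (seq p i)
  seq-polynomial M []       p i = refl
  seq-polynomial M (E ∷ Es) p i = cong₂ _+_ (cong₂ _*_ (seq-^ p (length E) i) (seq-^ (R.1ℝ R.- p) (M ℕ.∸ length E) i)) (seq-polynomial M Es p i)

  abstract
    clamp : ℚ → ℚ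
    clamp q = 0ℚ ⊔ (q ⊓ 1ℚ)

    0≤clamp : ∀ q → 0ℚ ≤ clamp q
    0≤clamp q = p≤p⊔q 0ℚ (q ⊓ 1ℚ)

    clamp≤1 : ∀ q → clamp q ≤ 1ℚ
    clamp≤1 q = ⊔-lub 0≤1 (p⊓q≤q q 1ℚ)

    clamp≤ : ∀ {q r} → 0ℚ ≤ r → q ≤ r → clamp q ≤ r
    clamp≤ {q} 0≤r q≤r = ⊔-lub 0≤r (≤-trans (p⊓q≤p q 1ℚ) q≤r)

    clamp-near : ∀ {q ε} → 0ℚ ≤ ε → 0ℚ ≤ q + ε → q ≤ 1ℚ + ε → ∣ clamp q - q ∣ ≤ ε
    clamp-near {q} {ε} 0≤ε lo hi = R.≤⇒∣-∣-≤ {clamp q} {q} {ε} (clamp≤ lo (subst (_≤ q + ε) (+-identityʳ q) (+-monoʳ-≤ q 0≤ε))) upper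
      where
      upper : q ≤ clamp q + ε
      upper with ≤-total q 1ℚ
      ... | inj₁ q≤1 = ≤-trans (subst (_≤ clamp q) (p≤q⇒p⊓q≡p q≤1) (p≤q⊔p 0ℚ (q ⊓ 1ℚ))) (subst (_≤ clamp q + ε) (+-identityʳ (clamp q)) (+-monoʳ-≤ (clamp q) 0≤ε))
      ... | inj₂ 1≤q = ≤-trans hi (+-monoˡ-≤ ε (subst (_≤ clamp q) (p≥q⇒p⊓q≡q 1≤q) (p≤q⊔p 0ℚ (q ⊓ 1ℚ))))

  module _ {A : Set} (M : ℕ) (Es : List (List A)) (p : ℝ) (0≤p : R.0ℝ R.≤ p) (p≤1 : p R.≤ R.1ℝ) where

    clamped-near : ∀ ε → 0ℚ < ε → ∃ λ N → ∀ i → N ℕ.≤ i → ∣ clamp (seq p i) - seq p i ∣ ≤ ε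
    clamped-near ε 0<ε with N₁ , lo ← 0≤p ε 0<ε | N₂ , hi ← p≤1 ε 0<ε = N₁ ℕ.⊔ N₂ , λ i N≤i →
      clamp-near (<⇒≤ 0<ε) (lo i (ℕₚ.≤-trans (ℕₚ.m≤m⊔n N₁ N₂) N≤i)) (hi i (ℕₚ.≤-trans (ℕₚ.m≤n⊔m N₁ N₂) N≤i))

    open Interleave p (clamp ∘ seq p) clamped-near

    private
      P : ℝ
      P = polynomialℝ M Es blend

      even : ∀ i → seq P (i ℕ.+ i) ≡ polynomial M Es (seq p i)
      even i = trans (seq-polynomial M Es blend (i ℕ.+ i)) (cong (polynomial M Es) (mixed-even i))

      odd′ : ∀ i → seq P (suc (i ℕ.+ i)) ≡ polynomial M Es (clamp (seq p i))
      odd′ i = trans (seq-polynomial M Es blend (suc (i ℕ.+ i))) (cong (polynomial M Es) (mixed-odd i))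

      close : ∀ {x y x′ y′ δ} → x ≡ x′ → y ≡ y′ → ∣ x - y ∣ ≤ δ → x′ ≤ y′ + δ
      close {x} {y} refl refl h = R.∣-∣-≤⇒≤ {x} {y} h

    -- Both values are terms, at even and odd index, of the polynomial taken at the one real number
    -- `blend`; its Cauchy property replaces a continuity estimate.
    polynomial-clamp : ∀ δ → 0ℚ < δ → ∃ λ N → ∀ i → N ℕ.≤ i →
      polynomial M Es (seq p i) ≤ polynomial M Es (clamp (seq p i)) + δ ×
      polynomial M Es (clamp (seq p i)) ≤ polynomial M Es (seq p i) + δ
    polynomial-clamp δ 0<δ = proj₁ P-cauchy , λ i N≤i →
      let N≤2i = ℕₚ.≤-trans N≤i (ℕₚ.m≤m+n i i)
          N≤2i+1 = ℕₚ.m≤n⇒m≤1+n N≤2i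
      in close (even i) (odd′ i) (proj₂ P-cauchy (i ℕ.+ i) (suc (i ℕ.+ i)) N≤2i N≤2i+1) ,
         close (odd′ i) (even i) (proj₂ P-cauchy (suc (i ℕ.+ i)) (i ℕ.+ i) N≤2i+1 N≤2i)
      where
      P-cauchy : ∃ λ N → ∀ i j → N ℕ.≤ i → N ℕ.≤ j → ∣ seq P i - seq P j ∣ ≤ δ
      P-cauchy = cauchy P δ 0<δ

  ι-cancel-≤ : ∀ {a b} → ι a ≤ ι b → a ℕ.≤ b
  ι-cancel-≤ {a} {b} le = ℕₚ.≮⇒≥ λ b<a → <-irrefl refl (<-≤-trans
    (subst (_< 1ℚ + ι b) (+-identityˡ (ι b)) (+-monoˡ-< (ι b) (ι-pos {1} (ℕ.s≤s ℕ.z≤n)))) (≤-trans (ι-mono b<a) le))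

  mkℚ-cancel : ∀ u b .(c : Coprime u (suc b)) → mkℚ (ℤ.+ u) b c * ι (suc b) ≡ ι u
  mkℚ-cancel u b c = trans (cong (_* ι (suc b)) (sym (↥p/↧p≡p (mkℚ (ℤ.+ u) b c)))) (/-cancel u (suc b))

  archimedean : ∀ ε → 0ℚ < ε → ∃ λ N → 1ℚ ≤ ι N * ε
  archimedean (mkℚ (ℤ.+ zero) d _) (*<* (ℤ.+<+ ()))
  archimedean (mkℚ ℤ.-[1+ _ ] d _) (*<* ())
  archimedean (mkℚ (ℤ.+ suc a) d c) _ = suc d , subst (1ℚ ≤_) (trans (sym (mkℚ-cancel (suc a) d c)) (*-comm (mkℚ (ℤ.+ suc a) d c) (ι (suc d))))
    (subst (_≤ ι (suc a)) (+-identityʳ 1ℚ) (+-monoʳ-≤ 1ℚ (0≤ι a)))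

  negative-exponent : ∀ t E d → 1 ℕ.≤ E → ι E ≤ (- t) * ι d → R.pos (↥ t) ≡ 0 × E ℕ.* ↧ₙ t ℕ.≤ R.neg (↥ t) ℕ.* d
  negative-exponent t@(mkℚ (ℤ.+ a) b c) E d 1≤E le = contradiction (<-≤-trans (ι-pos 1≤E) (≤-trans le nonpositive)) (<-irrefl refl)
    where
    -t≤0 : - t ≤ 0ℚ
    -t≤0 = neg-antimono-≤ (nonNegative⁻¹ t)
    nonpositive : (- t) * ι d ≤ 0ℚ
    nonpositive = subst ((- t) * ι d ≤_) (*-zeroˡ (ι d)) (*-monoʳ-≤-nonNeg (ι d) {{nonNegative (0≤ι d)}} -t≤0)
  negative-exponent (mkℚ ℤ.-[1+ a ] b c) E d 1≤E le = refl , ι-cancel-≤ (begin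
    ι (E ℕ.* suc b)                              ≡⟨ ι-* E (suc b) ⟩
    ι E * ι (suc b)                              ≤⟨ *-monoʳ-≤-nonNeg (ι (suc b)) {{nonNegative (0≤ι (suc b))}} le ⟩
    mkℚ (ℤ.+ suc a) b c * ι d * ι (suc b)        ≡⟨ eq (mkℚ (ℤ.+ suc a) b c) (ι d) (ι (suc b)) ⟩
    mkℚ (ℤ.+ suc a) b c * ι (suc b) * ι d        ≡⟨ cong (_* ι d) (mkℚ-cancel (suc a) b c) ⟩
    ι (suc a) * ι d                              ≡⟨ ι-* (suc a) d ⟨
    ι (suc a ℕ.* d)                              ∎)
    where
    open ≤-Reasoning
    open ℚSolver.+-*-Solver
    eq : ∀ x y z → x * y * z ≡ x * z * y
    eq = solve 3 (λ x y z → x :* y :* z := x :* z :* y) refl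

  below-negative : ∀ n .{{_ : NonZero n}} t K U E d → 1 ℕ.≤ E → ι E ≤ (- t) * ι d → R.Below n t K U →
                   U ℕ.^ d ℕ.* n ℕ.^ E ℕ.≤ K ℕ.^ d
  below-negative n t@record{} K U E d 1≤E le below with pos≡0 , E≤ ← negative-exponent t E d 1≤E le =
    R.^-cancel-≤ b (begin
      (U ℕ.^ d ℕ.* n ℕ.^ E) ℕ.^ b              ≡⟨ R.^-of-product U d n E b ⟩
      U ℕ.^ (d ℕ.* b) ℕ.* n ℕ.^ (E ℕ.* b)      ≤⟨ ℕₚ.*-monoʳ-≤ (U ℕ.^ (d ℕ.* b)) (ℕₚ.^-monoʳ-≤ n E≤) ⟩
      U ℕ.^ (d ℕ.* b) ℕ.* n ℕ.^ (na ℕ.* d)     ≡⟨ cong (λ k → U ℕ.^ k ℕ.* n ℕ.^ (na ℕ.* d)) (ℕₚ.*-comm d b) ⟩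
      U ℕ.^ (b ℕ.* d) ℕ.* n ℕ.^ (na ℕ.* d)     ≡⟨ R.^-of-product U b n na d ⟨
      (U ℕ.^ b ℕ.* n ℕ.^ na) ℕ.^ d             ≤⟨ ℕₚ.^-monoˡ-≤ d (subst (λ k → U ℕ.^ b ℕ.* n ℕ.^ na ℕ.≤ n ℕ.^ k ℕ.* K ℕ.^ b) pos≡0 below) ⟩
      (n ℕ.^ 0 ℕ.* K ℕ.^ b) ℕ.^ d              ≡⟨ cong (ℕ._^ d) (ℕₚ.*-identityˡ (K ℕ.^ b)) ⟩
      (K ℕ.^ b) ℕ.^ d                          ≡⟨ trans (ℕₚ.^-*-assoc K b d) (trans (cong (K ℕ.^_) (ℕₚ.*-comm b d)) (sym (ℕₚ.^-*-assoc K d b))) ⟩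
      (K ℕ.^ d) ℕ.^ b                          ∎)
    where
    open ℕₚ.≤-Reasoning
    b = ↧ₙ t
    na = R.neg (↥ t)

  -- The i-th approximation of n^s never exceeds n^(s i), and s i ≤ -E/d.
  root-bound : ∀ n .{{_ : NonZero n}} (s : ℝ) i E d → 1 ℕ.≤ E → ι E ≤ (- seq s i) * ι d →
    seq (n R.^ᵣ s) i ^ d * ι n ^ E ≤ 1ℚ
  root-bound n s i E d 1≤E le = *-cancelʳ-≤-pos (ι K ^ d) {{positive (subst (0ℚ <_) (ι-^ K d) (ι-pos (ℕₚ.m^n>0 K d)))}} (begin
    u ^ d * ι n ^ E * ι K ^ d        ≡⟨ eq (u ^ d) (ι n ^ E) (ι K ^ d) ⟩
    u ^ d * ι K ^ d * ι n ^ E        ≡⟨ cong (_* ι n ^ E) (trans (sym (*-^ u (ι K) d)) (cong (_^ d) (/-cancel U K))) ⟩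
    ι U ^ d * ι n ^ E                ≡⟨ trans (ι-* (U ℕ.^ d) (n ℕ.^ E)) (cong₂ _*_ (ι-^ U d) (ι-^ n E)) ⟨
    ι (U ℕ.^ d ℕ.* n ℕ.^ E)          ≤⟨ ι-mono (below-negative n (seq s i) K U E d 1≤E le (R.root-below n (seq s i) K)) ⟩
    ι (K ℕ.^ d)                      ≡⟨ ι-^ K d ⟩
    ι K ^ d                          ≡⟨ *-identityˡ (ι K ^ d) ⟨
    1ℚ * ι K ^ d                     ∎)
    where
    open ≤-Reasoning
    K = suc i
    U = R.rootNum n (seq s i) K
    u = ℤ.+ U / K
    open ℚSolver.+-*-Solver
    eq : ∀ x y z → x * y * z ≡ x * z * y
    eq = solve 3 (λ x y z → x :* y :* z := x :* z :* y) refl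

-- Arithmetic consequences of the definition of ℓₘ

module HalfIntegers where

  open BinomialMass using (0≤*; *-mono-≤)
  open Embeddings using (ι; 0≤ι; ι-*; ι-+; ι-mono; ι-pos; ι≡/1; /-cancel)
  open RealPolynomials using (ι-cancel-≤)
  import Defs as R
  open R using (ℝ; seq)
  import Data.Integer.Base as ℤ
  open import Data.Nat.Base as ℕ using (ℕ; zero; suc; NonZero; z≤n; s≤s)
  open import Data.Nat.Combinatorics using (_C_; nC1≡n; nCk+nC[k+1]≡[n+1]C[k+1])
  import Data.Nat.Properties as ℕₚ
  import Data.Nat.Tactic.RingSolver as ℕSolver
  open import Data.Product.Base using (_,_; proj₁; proj₂)
  open import Data.Rational.Base hiding (NonZero)
  open import Data.Rational.Properties
  import Data.Rational.Solver as ℚSolver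
  open import Data.Sum.Base using (_⊎_; inj₁; inj₂)
  open import Relation.Binary.PropositionalEquality
  open import Relation.Nullary.Negation using (¬_; contradiction)

  0<¼ : 0ℚ < ½ * ½
  0<¼ = *<* (ℤ.+<+ (s≤s z≤n))

  module SquareRoot (a : ℕ) where

    n : ℕ
    n = suc a

    U : ℕ → ℕ
    U i = R.rootNum n ½ (suc i)

    u : ℕ → ℚ
    u i = ℤ.+ U i / suc i

    square-scale : ∀ v K → v ℕ.* K ℕ.* (v ℕ.* K) ≡ v ℕ.* v ℕ.* (K ℕ.* K)
    square-scale = ℕSolver.solve-∀

    ^2 : ∀ x → x ℕ.^ 2 ≡ x ℕ.* x
    ^2 x = cong (x ℕ.*_) (ℕₚ.*-identityʳ x)

    root≤ : ∀ v → n ℕ.≤ v ℕ.* v → ∀ i → u i ≤ ι v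
    root≤ v n≤v² i = *-cancelʳ-≤-pos (ι K) {{positive (ι-pos {K} (s≤s z≤n))}} (subst₂ _≤_ (sym (/-cancel (U i) K)) (ι-* v K) (ι-mono U≤vK))
      where
      K = suc i
      U≤vK : U i ℕ.≤ v ℕ.* K
      U≤vK = R.^-cancel-≤ 2 (begin
        U i ℕ.^ 2                       ≡⟨ ℕₚ.*-identityʳ _ ⟨
        U i ℕ.^ 2 ℕ.* n ℕ.^ 0           ≤⟨ R.root-below n ½ K ⟩
        n ℕ.^ 1 ℕ.* K ℕ.^ 2             ≡⟨ cong₂ ℕ._*_ (ℕₚ.*-identityʳ n) (^2 K) ⟩
        n ℕ.* (K ℕ.* K)                 ≤⟨ ℕₚ.*-monoˡ-≤ (K ℕ.* K) n≤v² ⟩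
        v ℕ.* v ℕ.* (K ℕ.* K)           ≡⟨ square-scale v K ⟨
        v ℕ.* K ℕ.* (v ℕ.* K)           ≡⟨ ^2 (v ℕ.* K) ⟨
        (v ℕ.* K) ℕ.^ 2                 ∎)
        where open ℕₚ.≤-Reasoning

    ≤root : ∀ v → v ℕ.* v ℕ.≤ n → ∀ i → ι v ≤ u i
    ≤root v v²≤n i = *-cancelʳ-≤-pos (ι K) {{positive (ι-pos {K} (s≤s z≤n))}} (subst₂ _≤_ (ι-* v K) (sym (/-cancel (U i) K)) (ι-mono vK≤U))
      where
      K = suc i
      vK≤U : v ℕ.* K ℕ.≤ U i
      vK≤U = ℕₚ.≮⇒≥ λ U<vK → R.root-above n ½ K (begin
        suc (U i) ℕ.^ 2 ℕ.* n ℕ.^ 0     ≡⟨ ℕₚ.*-identityʳ _ ⟩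
        suc (U i) ℕ.^ 2                 ≤⟨ ℕₚ.^-monoˡ-≤ 2 U<vK ⟩
        (v ℕ.* K) ℕ.^ 2                 ≡⟨ trans (^2 (v ℕ.* K)) (square-scale v K) ⟩
        v ℕ.* v ℕ.* (K ℕ.* K)           ≤⟨ ℕₚ.*-monoˡ-≤ (K ℕ.* K) v²≤n ⟩
        n ℕ.* (K ℕ.* K)                 ≡⟨ cong₂ ℕ._*_ (ℕₚ.*-identityʳ n) (^2 K) ⟨
        n ℕ.^ 1 ℕ.* K ℕ.^ 2             ∎)
        where open ℕₚ.≤-Reasoning

    half : ∀ k → ι (k ℕ.+ k) * ½ ≡ ι k
    half k = trans (cong (_* ½) (ι-+ k k)) (eq (ι k))
      where
      open ℚSolver.+-*-Solver
      eq : ∀ x → (x + x) * ½ ≡ x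
      eq = solve 1 (λ x → (x :+ x) :* con ½ := x) refl

    half-suc : ∀ k → ι (suc (k ℕ.+ k)) * ½ ≡ ι k + ½
    half-suc k = trans (*-distribʳ-+ ½ 1ℚ (ι (k ℕ.+ k))) (trans (cong (1ℚ * ½ +_) (half k)) (+-comm (1ℚ * ½) (ι k)))

    absurd-≤ : ∀ {x ε} → 0ℚ < ε → ¬ x + ε ≤ x
    absurd-≤ {x} {ε} 0<ε le = <-irrefl refl (<-≤-trans (subst (_< x + ε) (+-identityʳ x) (+-monoʳ-< x 0<ε)) le)

    λ½ : ℝ
    λ½ = (R.√ n) R.* R.fromℚ ½

    -- A real inequality holds at an approximation only up to an error, here a quarter, so λ ≥ k + 1
    -- is only used to exclude λ < k + ½. Nothing is lost for the purpose: since (2k + 1)² = 4k(k +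
    -- 1) + 1, the half-integer bound already yields 2ℓ(ℓ - 1) ≤ m(m + 1) at ℓ = k + 1.
    floor-lower : ∀ k → R.fromℕ (suc k) R.≤ λ½ → suc (k ℕ.+ k) ℕ.* suc (k ℕ.+ k) ℕ.≤ n
    floor-lower k le = ℕₚ.≮⇒≥ λ n<v² → absurd-≤ 0<¼ (begin
      ι k + (½ + ½ * ½) + ½ * ½         ≡⟨ eq (ι k) ⟩
      ι (suc k)                         ≡⟨ ι≡/1 (suc k) ⟩
      ℤ.+ suc k / 1                     ≤⟨ h i ℕₚ.≤-refl ⟩
      u i * ½ + ½ * ½                   ≤⟨ +-monoˡ-≤ (½ * ½) (*-monoʳ-≤-nonNeg ½ (root≤ (suc (k ℕ.+ k)) (ℕₚ.<⇒≤ n<v²) i)) ⟩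
      ι (suc (k ℕ.+ k)) * ½ + ½ * ½     ≡⟨ cong (_+ ½ * ½) (half-suc k) ⟩
      ι k + ½ + ½ * ½                   ≡⟨ +-assoc (ι k) ½ (½ * ½) ⟩
      ι k + (½ + ½ * ½)                 ∎)
      where
      i : ℕ
      i = proj₁ (le (½ * ½) 0<¼)
      h = proj₂ (le (½ * ½) 0<¼)
      open ≤-Reasoning
      open ℚSolver.+-*-Solver
      eq : ∀ x → x + (½ + ½ * ½) + ½ * ½ ≡ 1ℚ + x
      eq = solve 1 (λ x → x :+ (con ½ :+ con ½ :* con ½) :+ con ½ :* con ½ := con 1ℚ :+ x) refl

    floor-upper : ∀ k → λ½ R.< R.fromℕ k R.+ R.1ℝ → n ℕ.< (suc k ℕ.+ suc k) ℕ.* (suc k ℕ.+ suc k)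
    floor-upper k (ε , 0<ε , i , h) = ℕₚ.≰⇒> λ v²≤n → absurd-≤ 0<ε (begin
      ι (suc k) + ε                     ≡⟨ cong (_+ ε) (half (suc k)) ⟨
      ι (suc k ℕ.+ suc k) * ½ + ε       ≤⟨ +-monoˡ-≤ ε (*-monoʳ-≤-nonNeg ½ (≤root (suc k ℕ.+ suc k) v²≤n i)) ⟩
      u i * ½ + ε                       ≤⟨ h i ℕₚ.≤-refl ⟩
      ℤ.+ k / 1 + 1ℚ                    ≡⟨ trans (cong (_+ 1ℚ) (sym (ι≡/1 k))) (+-comm (ι k) 1ℚ) ⟩
      ι (suc k)                         ∎)
      where open ≤-Reasoning

    ceiling-lower : ∀ k → R.fromℕ (suc k) R.- R.1ℝ R.< λ½ → (k ℕ.+ k) ℕ.* (k ℕ.+ k) ℕ.< n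
    ceiling-lower k (ε , 0<ε , i , h) = ℕₚ.≰⇒> λ n≤v² → absurd-≤ 0<ε (begin
      ι k + ε                           ≡⟨ cong (_+ ε) (eq (ι k)) ⟨
      ι (suc k) - 1ℚ + ε                ≡⟨ cong (λ x → x - 1ℚ + ε) (ι≡/1 (suc k)) ⟩
      ℤ.+ suc k / 1 - 1ℚ + ε            ≤⟨ h i ℕₚ.≤-refl ⟩
      u i * ½                           ≤⟨ *-monoʳ-≤-nonNeg ½ (root≤ (k ℕ.+ k) n≤v² i) ⟩
      ι (k ℕ.+ k) * ½                   ≡⟨ half k ⟩
      ι k                               ∎)
      where
      open ≤-Reasoning
      open ℚSolver.+-*-Solver
      eq : ∀ x → 1ℚ + x - 1ℚ ≡ x
      eq = solve 1 (λ x → con 1ℚ :+ x :- con 1ℚ := x) refl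

    ceiling-upper : ∀ k → λ½ R.≤ R.fromℕ k → n ℕ.< suc (k ℕ.+ k) ℕ.* suc (k ℕ.+ k)
    ceiling-upper k le = ℕₚ.≰⇒> λ v²≤n → absurd-≤ 0<¼ (begin
      ι k + ½ * ½ + ½ * ½               ≡⟨ +-assoc (ι k) (½ * ½) (½ * ½) ⟩
      ι k + ½                           ≡⟨ half-suc k ⟨
      ι (suc (k ℕ.+ k)) * ½             ≤⟨ *-monoʳ-≤-nonNeg ½ (≤root (suc (k ℕ.+ k)) v²≤n i) ⟩
      u i * ½                           ≤⟨ h i ℕₚ.≤-refl ⟩
      ℤ.+ k / 1 + ½ * ½                 ≡⟨ cong (_+ ½ * ½) (ι≡/1 k) ⟨
      ι k + ½ * ½                       ∎)
      where
      open ≤-Reasoning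
      i : ℕ
      i = proj₁ (le (½ * ½) 0<¼)
      h = proj₂ (le (½ * ½) 0<¼)

  2*C2 : ∀ k → 2 ℕ.* (suc k C 2) ≡ suc k ℕ.* k
  2*C2 zero    = refl
  2*C2 (suc k) = trans (cong (2 ℕ.*_) (trans (sym (nCk+nC[k+1]≡[n+1]C[k+1] (suc k) 1)) (cong (ℕ._+ suc k C 2) (nC1≡n (suc k)))))
    (trans (ℕₚ.*-distribˡ-+ 2 (suc k) (suc k C 2)) (trans (cong (2 ℕ.* suc k ℕ.+_) (2*C2 k)) (eq k)))
    where
    eq : ∀ k → 2 ℕ.* suc k ℕ.+ suc k ℕ.* k ≡ suc (suc k) ℕ.* suc k
    eq = ℕSolver.solve-∀

  square-cancel-< : ∀ {a b} → a ℕ.* a ℕ.< b ℕ.* b → a ℕ.< b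
  square-cancel-< lt = ℕₚ.≰⇒> λ b≤a → ℕₚ.<⇒≱ lt (ℕₚ.*-mono-≤ b≤a b≤a)

  double-cancel-< : ∀ {a b} → a ℕ.+ a ℕ.< b ℕ.+ b → a ℕ.< b
  double-cancel-< lt = ℕₚ.≰⇒> λ b≤a → ℕₚ.<⇒≱ lt (ℕₚ.+-mono-≤ b≤a b≤a)

  /-≤⇒ : ∀ a b k l .{{_ : NonZero k}} .{{_ : NonZero l}} → ℤ.+ a / k ≤ ℤ.+ b / l → a ℕ.* l ℕ.≤ b ℕ.* k
  /-≤⇒ a b k l le = ι-cancel-≤ (begin
    ι (a ℕ.* l)                    ≡⟨ trans (ι-* a l) (cong (_* ι l) (sym (/-cancel a k))) ⟩
    ℤ.+ a / k * ι k * ι l          ≡⟨ *-assoc (ℤ.+ a / k) (ι k) (ι l) ⟩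
    ℤ.+ a / k * (ι k * ι l)        ≤⟨ *-monoʳ-≤-nonNeg (ι k * ι l) {{nonNegative (0≤* (0≤ι k) (0≤ι l))}} le ⟩
    ℤ.+ b / l * (ι k * ι l)        ≡⟨ trans (cong (ℤ.+ b / l *_) (*-comm (ι k) (ι l))) (sym (*-assoc (ℤ.+ b / l) (ι l) (ι k))) ⟩
    ℤ.+ b / l * ι l * ι k          ≡⟨ trans (cong (_* ι k) (/-cancel b l)) (sym (ι-* b k)) ⟩
    ι (b ℕ.* k)                    ∎)
    where open ≤-Reasoning

  numerator : ℕ → ℕ → ℕ
  numerator m ℓ = ℓ C 2 ℕ.+ (m ℕ.∸ ℓ ℕ.+ 1) C 2

  2*numerator : ∀ ℓ j → 2 ℕ.* numerator (suc ℓ ℕ.+ j) (suc ℓ) ≡ suc ℓ ℕ.* ℓ ℕ.+ suc j ℕ.* j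
  2*numerator ℓ j = trans (cong (λ i → 2 ℕ.* (suc ℓ C 2 ℕ.+ i C 2)) (trans (cong (ℕ._+ 1) (ℕₚ.m+n∸m≡n (suc ℓ) j)) (ℕₚ.+-comm j 1)))
    (trans (ℕₚ.*-distribˡ-+ 2 (suc ℓ C 2) (suc j C 2)) (cong₂ ℕ._+_ (2*C2 ℓ) (2*C2 j)))

  -- The last two fields express f(ℓ) ≤ f(ℓ - 1) and f(ℓ) ≤ f(ℓ + 1) for f(ℓ) = ℓ + m(m + 1)/(2ℓ) -
  -- m - 1.
  record Optimal (m ℓ : ℕ) : Set where
    field
      ℓ≤m   : ℓ ℕ.≤ m
      lower : 2 ℕ.* ℓ ℕ.* (ℓ ℕ.∸ 1) ℕ.≤ m ℕ.* suc m
      upper : m ℕ.* suc m ℕ.≤ 2 ℕ.* ℓ ℕ.* suc ℓ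

  module _ (k j : ℕ) where

    private
      m A B : ℕ
      m = suc (suc k) ℕ.+ j
      A = numerator m (suc k)
      B = numerator m (suc (suc k))

      2A : 2 ℕ.* A ≡ suc k ℕ.* k ℕ.+ suc (suc j) ℕ.* suc j
      2A = trans (cong (λ m → 2 ℕ.* numerator m (suc k)) (cong suc (sym (ℕₚ.+-suc k j)))) (2*numerator k (suc j))

      2B : 2 ℕ.* B ≡ suc (suc k) ℕ.* suc k ℕ.+ suc j ℕ.* j
      2B = 2*numerator (suc k) j

      scale : ∀ x y a b → x ℕ.* b ℕ.≤ y ℕ.* a → (2 ℕ.* x) ℕ.* b ℕ.≤ (2 ℕ.* y) ℕ.* a
      scale x y a b le = subst₂ ℕ._≤_ (sym (ℕₚ.*-assoc 2 x b)) (sym (ℕₚ.*-assoc 2 y a)) (ℕₚ.*-monoʳ-≤ 2 le)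

      X : ℕ → ℕ → ℕ
      X k j = k ℕ.* k ℕ.* k ℕ.+ 2 ℕ.* k ℕ.* k ℕ.+ suc k ℕ.* (j ℕ.* j ℕ.+ j)

      A≡ : 2 ℕ.* A ℕ.* suc (suc k) ℕ.+ suc (suc k) ≡ m ℕ.* suc m ℕ.+ X k j
      A≡ = trans (cong (λ x → x ℕ.* suc (suc k) ℕ.+ suc (suc k)) 2A) (eq k j)
        where
        eq : ∀ k j → (suc k ℕ.* k ℕ.+ suc (suc j) ℕ.* suc j) ℕ.* suc (suc k) ℕ.+ suc (suc k)
           ≡ (suc (suc k) ℕ.+ j) ℕ.* suc (suc (suc k) ℕ.+ j) ℕ.+ (k ℕ.* k ℕ.* k ℕ.+ 2 ℕ.* k ℕ.* k ℕ.+ suc k ℕ.* (j ℕ.* j ℕ.+ j))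
        eq = ℕSolver.solve-∀

      B≡ : 2 ℕ.* B ℕ.* suc k ℕ.+ suc (suc k) ≡ 2 ℕ.* suc k ℕ.* suc (suc k) ℕ.+ X k j
      B≡ = trans (cong (λ x → x ℕ.* suc k ℕ.+ suc (suc k)) 2B) (eq k j)
        where
        eq : ∀ k j → (suc (suc k) ℕ.* suc k ℕ.+ suc j ℕ.* j) ℕ.* suc k ℕ.+ suc (suc k)
           ≡ 2 ℕ.* suc k ℕ.* suc (suc k) ℕ.+ (k ℕ.* k ℕ.* k ℕ.+ 2 ℕ.* k ℕ.* k ℕ.+ suc k ℕ.* (j ℕ.* j ℕ.+ j))
        eq = ℕSolver.solve-∀

    -- With ℓ = k + 1, f(ℓ + 1) - f(ℓ) = 1 - m(m + 1)/(2ℓ(ℓ + 1)). `X` is the part that both sides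
    -- share after cross-multiplication.
    numerator-≤⇒upper : A ℕ.* suc (suc k) ℕ.≤ B ℕ.* suc k → m ℕ.* suc m ℕ.≤ 2 ℕ.* suc k ℕ.* suc (suc k)
    numerator-≤⇒upper le = ℕₚ.+-cancelʳ-≤ (X k j) _ _ (subst₂ ℕ._≤_ A≡ B≡
      (ℕₚ.+-monoˡ-≤ (suc (suc k)) (scale A B (suc k) (suc (suc k)) le)))

    numerator-≥⇒lower : B ℕ.* suc k ℕ.≤ A ℕ.* suc (suc k) → 2 ℕ.* suc k ℕ.* suc (suc k) ℕ.≤ m ℕ.* suc m
    numerator-≥⇒lower le = ℕₚ.+-cancelʳ-≤ (X k j) _ _ (subst₂ ℕ._≤_ B≡ A≡
      (ℕₚ.+-monoˡ-≤ (suc (suc k)) (scale B A (suc (suc k)) (suc k) le)))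

  -- With S = m(m+1), so that 2λₘ = √(2S): S is compared with the squares of
  -- the half-integers next to ⌊λₘ⌋ = suc k and ⌈λₘ⌉ = suc k′.
  module Candidates (m k k′ : ℕ) (1≤m : 1 ℕ.≤ m)
    (floor-lower : suc (k ℕ.+ k) ℕ.* suc (k ℕ.+ k) ℕ.≤ 2 ℕ.* (m ℕ.* suc m))
    (floor-upper : 2 ℕ.* (m ℕ.* suc m) ℕ.< (suc (suc k) ℕ.+ suc (suc k)) ℕ.* (suc (suc k) ℕ.+ suc (suc k)))
    (ceiling-lower : (k′ ℕ.+ k′) ℕ.* (k′ ℕ.+ k′) ℕ.< 2 ℕ.* (m ℕ.* suc m))
    (ceiling-upper : 2 ℕ.* (m ℕ.* suc m) ℕ.< suc (suc k′ ℕ.+ suc k′) ℕ.* suc (suc k′ ℕ.+ suc k′)) where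

    k≤k′ : k ℕ.≤ k′
    k≤k′ = ℕ.s≤s⁻¹ (double-cancel-< (ℕ.s≤s⁻¹ (square-cancel-< (ℕₚ.≤-<-trans floor-lower ceiling-upper))))

    k′≤1+k : k′ ℕ.≤ suc k
    k′≤1+k = ℕ.s≤s⁻¹ (double-cancel-< (square-cancel-< (ℕₚ.<-trans ceiling-lower floor-upper)))

    k′<m : k′ ℕ.< m
    k′<m = double-cancel-< (square-cancel-< (ℕₚ.<-≤-trans ceiling-lower (begin
      2 ℕ.* (m ℕ.* suc m)                   ≤⟨ ℕₚ.*-monoʳ-≤ 2 (ℕₚ.*-monoʳ-≤ m (ℕₚ.+-monoˡ-≤ m 1≤m)) ⟩
      2 ℕ.* (m ℕ.* (m ℕ.+ m))               ≡⟨ eq m ⟩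
      (m ℕ.+ m) ℕ.* (m ℕ.+ m)               ∎)))
      where
      open ℕₚ.≤-Reasoning
      eq : ∀ m → 2 ℕ.* (m ℕ.* (m ℕ.+ m)) ≡ (m ℕ.+ m) ℕ.* (m ℕ.+ m)
      eq = ℕSolver.solve-∀

    lower : 2 ℕ.* suc k ℕ.* k ℕ.≤ m ℕ.* suc m
    lower = ℕₚ.*-cancelˡ-≤ 2 (ℕₚ.≤-trans (ℕₚ.n≤1+n _) (subst (ℕ._≤ 2 ℕ.* (m ℕ.* suc m)) (eq k) floor-lower))
      where
      eq : ∀ k → suc (k ℕ.+ k) ℕ.* suc (k ℕ.+ k) ≡ suc (2 ℕ.* (2 ℕ.* suc k ℕ.* k))
      eq = ℕSolver.solve-∀

    upper : m ℕ.* suc m ℕ.≤ 2 ℕ.* suc k′ ℕ.* suc (suc k′)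
    upper = ℕₚ.*-cancelˡ-≤ 2 (ℕ.s≤s⁻¹ (subst (2 ℕ.* (m ℕ.* suc m) ℕ.<_) (eq k′) ceiling-upper))
      where
      eq : ∀ k → suc (suc k ℕ.+ suc k) ℕ.* suc (suc k ℕ.+ suc k) ≡ suc (2 ℕ.* (2 ℕ.* suc k ℕ.* suc (suc k)))
      eq = ℕSolver.solve-∀

    -- The floor yields the lower and the ceiling the upper inequality. If they differ they are
    -- consecutive, and the inequality that the chosen candidate lacks comes from comparing it with
    -- the other one.
    optimal : ∀ ℓ → ℓ ≡ suc k ⊎ ℓ ≡ suc k′ →
              numerator m ℓ ℕ.* suc k ℕ.≤ numerator m (suc k) ℕ.* ℓ →
              numerator m ℓ ℕ.* suc k′ ℕ.≤ numerator m (suc k′) ℕ.* ℓ → Optimal m ℓ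
    optimal ℓ candidate ≤k ≤k′ with ℕₚ.m≤n⇒m<n∨m≡n k≤k′
    optimal ℓ (inj₁ refl) ≤k ≤k′ | inj₂ refl = record { ℓ≤m = k′<m ; lower = lower ; upper = upper }
    optimal ℓ (inj₂ refl) ≤k ≤k′ | inj₂ refl = record { ℓ≤m = k′<m ; lower = lower ; upper = upper }
    optimal ℓ candidate ≤k ≤k′ | inj₁ k<k′ with ℕₚ.≤-antisym k′≤1+k k<k′ | ℕₚ.m≤n⇒∃[o]m+o≡n k′<m
    optimal ℓ (inj₁ refl) ≤k ≤k′ | inj₁ k<k′ | refl | j , refl = record
      { ℓ≤m = ℕₚ.≤-trans (ℕₚ.n≤1+n _) k′<m ; lower = lower ; upper = numerator-≤⇒upper k j ≤k′ }
    optimal ℓ (inj₂ refl) ≤k ≤k′ | inj₁ k<k′ | refl | j , refl = record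
      { ℓ≤m = k′<m ; lower = subst (ℕ._≤ m ℕ.* suc m) (eq k) (numerator-≥⇒lower k j ≤k) ; upper = upper }
      where
      eq : ∀ k → 2 ℕ.* suc k ℕ.* suc (suc k) ≡ 2 ℕ.* suc (suc k) ℕ.* suc k
      eq = ℕSolver.solve-∀

  root⇒optimal : ∀ r .{{_ : NonZero r}} m k k′ ℓ → r ≡ 2 ℕ.* (m ℕ.* suc m) → 1 ℕ.≤ m →
    R.IsFloor ((R.√ r) R.* R.fromℚ ½) (suc k) → R.IsCeiling ((R.√ r) R.* R.fromℚ ½) (suc k′) →
    ℓ ≡ suc k ⊎ ℓ ≡ suc k′ →
    numerator m ℓ ℕ.* suc k ℕ.≤ numerator m (suc k) ℕ.* ℓ →
    numerator m ℓ ℕ.* suc k′ ℕ.≤ numerator m (suc k′) ℕ.* ℓ → Optimal m ℓ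
  root⇒optimal (suc a) m k k′ ℓ r≡ 1≤m (floor₁ , floor₂) (ceiling₁ , ceiling₂) = Candidates.optimal m k k′ 1≤m
    (subst (suc (k ℕ.+ k) ℕ.* suc (k ℕ.+ k) ℕ.≤_) r≡ (floor-lower k floor₁))
    (subst (ℕ._< (suc (suc k) ℕ.+ suc (suc k)) ℕ.* (suc (suc k) ℕ.+ suc (suc k))) r≡ (floor-upper (suc k) floor₂))
    (subst ((k′ ℕ.+ k′) ℕ.* (k′ ℕ.+ k′) ℕ.<_) r≡ (ceiling-lower k′ ceiling₁))
    (subst (ℕ._< suc (suc k′ ℕ.+ suc k′) ℕ.* suc (suc k′ ℕ.+ suc k′)) r≡ (ceiling-upper (suc k′) ceiling₂)) ℓ
    where open SquareRoot a

  isℓₘ⇒optimal : ∀ m ℓ .{{_ : NonZero ℓ}} → 1 ℕ.≤ m → R.Isℓₘ m ℓ → Optimal m ℓ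
  isℓₘ⇒optimal m ℓ 1≤m isℓ = by-cases ⌊λ⌋ ⌈λ⌉ isFloor isCeiling candidate
    (minimum ⌊λ⌋ (subst (_≤ R.f m ⌊λ⌋) (sym minimises) (p⊓q≤p (R.f m ⌊λ⌋) (R.f m ⌈λ⌉))))
    (minimum ⌈λ⌉ (subst (_≤ R.f m ⌈λ⌉) (sym minimises) (p⊓q≤q (R.f m ⌊λ⌋) (R.f m ⌈λ⌉))))
    where
    open R.Isℓₘ isℓ
    minimum : ∀ k .{{_ : NonZero k}} → R.f m ℓ ≤ R.f m k → numerator m ℓ ℕ.* k ℕ.≤ numerator m k ℕ.* ℓ
    minimum k = /-≤⇒ (numerator m ℓ) (numerator m k) ℓ k
    radicand≡ : ∀ m → 2 ℕ.* (m ℕ.* (m ℕ.* 1)) ℕ.+ 2 ℕ.* m ≡ 2 ℕ.* (m ℕ.* suc m)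
    radicand≡ = ℕSolver.solve-∀
    1≤radicand : 1 ℕ.≤ 2 ℕ.* m ℕ.^ 2 ℕ.+ 2 ℕ.* m
    1≤radicand = ℕₚ.≤-trans (ℕₚ.≤-trans 1≤m (ℕₚ.m≤m+n m _)) (ℕₚ.m≤n+m (2 ℕ.* m) (2 ℕ.* m ℕ.^ 2))
    by-cases : ∀ a b .{{_ : NonZero a}} .{{_ : NonZero b}} → R.IsFloor (R.λₘ m) a → R.IsCeiling (R.λₘ m) b → ℓ ≡ a ⊎ ℓ ≡ b →
      numerator m ℓ ℕ.* a ℕ.≤ numerator m a ℕ.* ℓ → numerator m ℓ ℕ.* b ℕ.≤ numerator m b ℕ.* ℓ → Optimal m ℓ
    by-cases (suc k) (suc k′) isFloor′ isCeiling′ cand =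
      root⇒optimal (2 ℕ.* m ℕ.^ 2 ℕ.+ 2 ℕ.* m) {{ℕ.>-nonZero 1≤radicand}} m k k′ ℓ (radicand≡ m) 1≤m isFloor′ isCeiling′ cand

  -- h is the m − ℓ + 1 of the second binomial coefficient in f m ℓ.
  record Parameters (m ℓ : ℕ) : Set where
    field
      h e   : ℕ
      1≤h   : 1 ℕ.≤ h
      ℓ≡    : ℓ ≡ h ℕ.+ e
      m≡    : suc m ≡ h ℕ.+ e ℕ.+ h
      lower : e ℕ.* e ℕ.≤ 2 ℕ.* h ℕ.* h ℕ.+ e
      upper : 2 ℕ.* h ℕ.* h ℕ.≤ e ℕ.* e ℕ.+ 3 ℕ.* e ℕ.+ 4 ℕ.* h

  optimal⇒parameters : ∀ {m ℓ} → 1 ℕ.≤ ℓ → Optimal m ℓ → Parameters m ℓ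
  optimal⇒parameters {m} {ℓ} 1≤ℓ opt with j , refl ← ℕₚ.m≤n⇒∃[o]m+o≡n (Optimal.ℓ≤m opt) = result
    where
    open Optimal opt renaming (lower to lo; upper to hi)
    -- If m ≥ 2ℓ, then m(m + 1) ≥ 2ℓ(2ℓ + 1) > 2ℓ(ℓ + 1), against `hi`. So e = ℓ - j - 1 makes
    -- sense.
    j<ℓ : j ℕ.< ℓ
    j<ℓ = ℕₚ.≰⇒> λ ℓ≤j → ℕₚ.<⇒≱ (strict ℓ≤j) hi
      where
      strict : ℓ ℕ.≤ j → 2 ℕ.* ℓ ℕ.* suc ℓ ℕ.< (ℓ ℕ.+ j) ℕ.* suc (ℓ ℕ.+ j)
      strict ℓ≤j = begin-strict
        2 ℕ.* ℓ ℕ.* suc ℓ                               <⟨ ℕₚ.m<m+n _ (ℕₚ.*-mono-≤ 1≤ℓ (ℕₚ.≤-trans 1≤ℓ (ℕₚ.m≤m+n ℓ ℓ))) ⟩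
        2 ℕ.* ℓ ℕ.* suc ℓ ℕ.+ ℓ ℕ.* (ℓ ℕ.+ ℓ)          ≡⟨ eq ℓ ⟩
        (ℓ ℕ.+ ℓ) ℕ.* suc (ℓ ℕ.+ ℓ)                     ≤⟨ ℕₚ.*-mono-≤ (ℕₚ.+-monoʳ-≤ ℓ ℓ≤j) (s≤s (ℕₚ.+-monoʳ-≤ ℓ ℓ≤j)) ⟩
        (ℓ ℕ.+ j) ℕ.* suc (ℓ ℕ.+ j)                     ∎
        where
        open ℕₚ.≤-Reasoning
        eq : ∀ l → 2 ℕ.* l ℕ.* suc l ℕ.+ l ℕ.* (l ℕ.+ l) ≡ (l ℕ.+ l) ℕ.* suc (l ℕ.+ l)
        eq = ℕSolver.solve-∀
    result : Parameters (ℓ ℕ.+ j) ℓ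
    result with e , refl ← ℕₚ.m≤n⇒∃[o]m+o≡n j<ℓ = record
      { h = suc j ; e = e ; 1≤h = s≤s z≤n ; ℓ≡ = refl
      ; m≡ = cong suc (trans (sym (ℕₚ.+-suc (j ℕ.+ e) j)) refl)
      ; lower = ℕₚ.+-cancelʳ-≤ (2 ℕ.* j ℕ.* j ℕ.+ 4 ℕ.* j ℕ.* e ℕ.+ e ℕ.* e ℕ.+ 2 ℕ.* j ℕ.+ 2 ℕ.* e) _ _
          (subst₂ ℕ._≤_ (eq₁ j e) (eq₂ j e) lo)
      ; upper = ℕₚ.+-cancelʳ-≤ (2 ℕ.* j ℕ.* j ℕ.+ 2 ℕ.* j ℕ.+ 4 ℕ.* j ℕ.* e ℕ.+ 3 ℕ.* e ℕ.+ e ℕ.* e) _ _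
          (subst₂ ℕ._≤_ (eq₃ j e) (eq₄ j e) hi) }
      where
      eq₁ : ∀ j e → 2 ℕ.* (suc j ℕ.+ e) ℕ.* (j ℕ.+ e) ≡ e ℕ.* e ℕ.+ (2 ℕ.* j ℕ.* j ℕ.+ 4 ℕ.* j ℕ.* e ℕ.+ e ℕ.* e ℕ.+ 2 ℕ.* j ℕ.+ 2 ℕ.* e)
      eq₁ = ℕSolver.solve-∀
      eq₂ : ∀ j e → (suc j ℕ.+ e ℕ.+ j) ℕ.* suc (suc j ℕ.+ e ℕ.+ j) ≡ 2 ℕ.* suc j ℕ.* suc j ℕ.+ e ℕ.+ (2 ℕ.* j ℕ.* j ℕ.+ 4 ℕ.* j ℕ.* e ℕ.+ e ℕ.* e ℕ.+ 2 ℕ.* j ℕ.+ 2 ℕ.* e)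
      eq₂ = ℕSolver.solve-∀
      eq₃ : ∀ j e → (suc j ℕ.+ e ℕ.+ j) ℕ.* suc (suc j ℕ.+ e ℕ.+ j) ≡ 2 ℕ.* suc j ℕ.* suc j ℕ.+ (2 ℕ.* j ℕ.* j ℕ.+ 2 ℕ.* j ℕ.+ 4 ℕ.* j ℕ.* e ℕ.+ 3 ℕ.* e ℕ.+ e ℕ.* e)
      eq₃ = ℕSolver.solve-∀
      eq₄ : ∀ j e → 2 ℕ.* (suc j ℕ.+ e) ℕ.* suc (suc j ℕ.+ e) ≡ e ℕ.* e ℕ.+ 3 ℕ.* e ℕ.+ 4 ℕ.* suc j ℕ.+ (2 ℕ.* j ℕ.* j ℕ.+ 2 ℕ.* j ℕ.+ 4 ℕ.* j ℕ.* e ℕ.+ 3 ℕ.* e ℕ.+ e ℕ.* e)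
      eq₄ = ℕSolver.solve-∀

-- Choice of the constants and the limit

module Asymptotics where

  open OptimumConstants using (module Optimum)
  open HubGraphs using (module HubGraph)
  open BinomialMass
  open Embeddings
  open PowerLaws
  open RealPolynomials
  open HalfIntegers
  import Defs as R
  open R using (ℝ; seq; Graph; _∪_; pairs; subsets; edgeGraph; 𝒞?)
  import Data.Integer.Base as ℤ
  open import Data.Fin.Base using (Fin)
  open import Data.List.Base using (List; length; filter)
  open import Data.Nat.Base as ℕ using (ℕ; zero; suc; NonZero; z≤n; s≤s)
  import Data.Nat.Properties as ℕₚ
  import Data.Nat.Tactic.RingSolver as ℕSolver
  open import Data.Product.Base using (_×_; _,_; ∃; proj₁; proj₂)
  open import Data.Rational.Base renaming (NonZero to NonZeroℚ)
  open import Data.Rational.Properties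
  import Data.Rational.Solver as ℚSolver
  open import Relation.Binary.PropositionalEquality

  0≤/ : ∀ a k .{{_ : NonZero k}} → 0ℚ ≤ ℤ.+ a / k
  0≤/ a k = nonNegative⁻¹ (ℤ.+ a / k) {{normalize-nonNeg a k}}

  1/≤1 : ∀ k .{{_ : NonZero k}} → ℤ.+ 1 / k ≤ 1ℚ
  1/≤1 k = *-cancelʳ-≤-pos (ι k) {{positive (ι-pos (ℕ.>-nonZero⁻¹ k))}} (begin
    ℤ.+ 1 / k * ι k      ≡⟨ /-cancel 1 k ⟩
    ι 1                  ≤⟨ ι-mono (ℕ.>-nonZero⁻¹ k) ⟩
    ι k                  ≡⟨ *-identityˡ (ι k) ⟨
    1ℚ * ι k             ∎)
    where open ≤-Reasoning

  -- A rational ε₀ > 0 lies eventually below ε; one half of it bounds the terms, the other half is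
  -- the margin of the strict inequalities.
  ⟶0 : (a : ℕ → ℝ) →
       (∀ δ → 0ℚ < δ → ∃ λ N → ∀ n → N ℕ.≤ n → ∃ λ I → ∀ i → I ℕ.≤ i → 0ℚ ≤ seq (a n) i + δ × seq (a n) i ≤ δ) →
       a R.⟶ R.0ℝ
  ⟶0 a close ε (ε₀ , 0<ε₀ , I₀ , ε₀≤) with N , h ← close (½ * ε₀) (R.half-pos 0<ε₀) = N , λ n N≤n →
    let I , c = h n N≤n in
    (δ , 0<δ , I₀ ℕ.⊔ I , λ i ≤i → lower (ε₀≤ i (ℕₚ.≤-trans (ℕₚ.m≤m⊔n I₀ I) ≤i)) (proj₁ (c i (ℕₚ.≤-trans (ℕₚ.m≤n⊔m I₀ I) ≤i)))) ,
    (δ , 0<δ , I₀ ℕ.⊔ I , λ i ≤i → upper (ε₀≤ i (ℕₚ.≤-trans (ℕₚ.m≤m⊔n I₀ I) ≤i)) (proj₂ (c i (ℕₚ.≤-trans (ℕₚ.m≤n⊔m I₀ I) ≤i))))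
    where
    open ≤-Reasoning
    open ℚSolver.+-*-Solver
    δ = ½ * ε₀
    0<δ : 0ℚ < δ
    0<δ = R.half-pos 0<ε₀
    lower : ∀ {x y} → 0ℚ + ε₀ ≤ y → 0ℚ ≤ x + δ → 0ℚ + (- y) + δ ≤ x
    lower {x} {y} ε₀≤y 0≤x+δ = begin
      0ℚ + (- y) + δ              ≤⟨ +-monoˡ-≤ δ (+-monoʳ-≤ 0ℚ (neg-antimono-≤ ε₀≤y)) ⟩
      0ℚ + (- (0ℚ + ε₀)) + δ      ≡⟨ eq ε₀ ⟩
      0ℚ - δ                      ≤⟨ +-monoˡ-≤ (- δ) 0≤x+δ ⟩
      x + δ - δ                   ≡⟨ eq′ x δ ⟩
      x                           ∎
      where
      eq : ∀ z → 0ℚ + (- (0ℚ + z)) + ½ * z ≡ 0ℚ - ½ * z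
      eq = solve 1 (λ z → con 0ℚ :+ (:- (con 0ℚ :+ z)) :+ con ½ :* z := con 0ℚ :- con ½ :* z) refl
      eq′ : ∀ x z → x + z - z ≡ x
      eq′ = solve 2 (λ x z → x :+ z :- z := x) refl
    upper : ∀ {x y} → 0ℚ + ε₀ ≤ y → x ≤ δ → x + δ ≤ 0ℚ + y
    upper {x} {y} ε₀≤y x≤δ = begin
      x + δ      ≤⟨ +-monoˡ-≤ δ x≤δ ⟩
      δ + δ      ≡⟨ R.half+half ε₀ ⟩
      ε₀         ≡⟨ +-identityˡ ε₀ ⟨
      0ℚ + ε₀    ≤⟨ ε₀≤y ⟩
      y          ≡⟨ +-identityˡ y ⟨
      0ℚ + y     ∎

  module _ {A : Set} (M : ℕ) (Es : List (List A)) (p : ℝ) (0≤p : R.0ℝ R.≤ p) (p≤1 : p R.≤ R.1ℝ) where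

    polynomialℝ-small : ∀ δ → 0ℚ < δ → ∀ {n} → 1 ℕ.≤ n → 1ℚ ≤ ι n * (½ * δ) →
      (∀ q → 0ℚ ≤ q → q ≤ 1ℚ → 0ℚ ≤ polynomial M Es q) →
      (∃ λ I → ∀ i → I ℕ.≤ i → ι n * polynomial M Es (clamp (seq p i)) ≤ 1ℚ) →
      ∃ λ I → ∀ i → I ℕ.≤ i → 0ℚ ≤ seq (polynomialℝ M Es p) i + δ × seq (polynomialℝ M Es p) i ≤ δ
    polynomialℝ-small δ 0<δ {n} 1≤n 1≤nδ nonneg (I₂ , bound) = I₁ ℕ.⊔ I₂ , λ i ≤i →
      subst (λ x → 0ℚ ≤ x + δ × x ≤ δ) (sym (seq-polynomial M Es p i))
        (combine (seq p i) (near i (ℕₚ.≤-trans (ℕₚ.m≤m⊔n I₁ I₂) ≤i)) (bound i (ℕₚ.≤-trans (ℕₚ.m≤n⊔m I₁ I₂) ≤i)))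
      where
      clamped : ∃ λ I → ∀ i → I ℕ.≤ i →
        polynomial M Es (seq p i) ≤ polynomial M Es (clamp (seq p i)) + ½ * δ ×
        polynomial M Es (clamp (seq p i)) ≤ polynomial M Es (seq p i) + ½ * δ
      clamped = polynomial-clamp M Es p 0≤p p≤1 (½ * δ) (R.half-pos 0<δ)
      I₁ = proj₁ clamped
      near = proj₂ clamped
      ½δ≤δ : ½ * δ ≤ δ
      ½δ≤δ = subst₂ _≤_ (+-identityʳ (½ * δ)) (R.half+half δ) (+-monoʳ-≤ (½ * δ) (<⇒≤ (R.half-pos 0<δ)))
      combine : ∀ x → polynomial M Es x ≤ polynomial M Es (clamp x) + ½ * δ × polynomial M Es (clamp x) ≤ polynomial M Es x + ½ * δ →
        ι n * polynomial M Es (clamp x) ≤ 1ℚ → 0ℚ ≤ polynomial M Es x + δ × polynomial M Es x ≤ δ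
      combine x (P≤ , Q≤) nQ≤1 =
        ≤-trans (nonneg (clamp x) (0≤clamp x) (clamp≤1 x)) (≤-trans Q≤ (+-monoʳ-≤ (polynomial M Es x) ½δ≤δ)) ,
        ≤-trans P≤ (≤-trans (+-monoˡ-≤ (½ * δ) (*-cancelˡ-≤-pos (ι n) {{positive (ι-pos 1≤n)}} (≤-trans nQ≤1 1≤nδ))) (≤-reflexive (R.half+half δ)))

  n≤2^n : ∀ n → n ℕ.≤ 2 ℕ.^ n
  n≤2^n zero    = z≤n
  n≤2^n (suc n) = ℕₚ.≤-trans (ℕₚ.+-mono-≤ (ℕₚ.m^n>0 2 n) (n≤2^n n)) (ℕₚ.+-monoʳ-≤ (2 ℕ.^ n) (ℕₚ.m≤m+n (2 ℕ.^ n) 0))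

  -- With v = ℓ/F and z ≥ ε ≥ 1/κ, the sum v + z is at least (ℓκ + F)/(Fκ).
  exponent-bound : ∀ {v z : ℚ} F ℓ κ {ε} → v * ι F ≡ ι ℓ → 1ℚ ≤ ι κ * ε → 0ℚ + ε ≤ z → ι (ℓ ℕ.* κ ℕ.+ F) ≤ (- ((- v) + (- z))) * ι (F ℕ.* κ)
  exponent-bound {v} {z} F ℓ κ {ε} vF 1≤κε ε≤z = begin
    ι (ℓ ℕ.* κ ℕ.+ F)                   ≡⟨ trans (ι-+ (ℓ ℕ.* κ) F) (cong₂ _+_ (trans (ι-* ℓ κ) (cong (_* ι κ) (sym vF))) (sym (*-identityʳ (ι F)))) ⟩
    v * ι F * ι κ + ι F * 1ℚ            ≤⟨ +-monoʳ-≤ (v * ι F * ι κ) (*-monoˡ-≤-nonNeg (ι F) {{nonNegative (0≤ι F)}}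
                                             (≤-trans 1≤κε (*-monoˡ-≤-nonNeg (ι κ) {{nonNegative (0≤ι κ)}} (subst (_≤ z) (+-identityˡ ε) ε≤z)))) ⟩
    v * ι F * ι κ + ι F * (ι κ * z)     ≡⟨ eq v z (ι F) (ι κ) ⟩
    (- ((- v) + (- z))) * (ι F * ι κ)   ≡⟨ cong ((- ((- v) + (- z))) *_) (ι-* F κ) ⟨
    (- ((- v) + (- z))) * ι (F ℕ.* κ)   ∎
    where
    open ≤-Reasoning
    open ℚSolver.+-*-Solver
    eq : ∀ v z F κ → v * F * κ + F * (κ * z) ≡ (- ((- v) + (- z))) * (F * κ)
    eq = solve 4 (λ v z F κ → v :* F :* κ :+ F :* (κ :* z) := (:- ((:- v) :+ (:- z))) :* (F :* κ)) refl

  -- κ ≥ 1/μ is what remains of the slack μ in the exponent: q ≤ 2 n^(-E/d) with E/d = ℓ/F + 1/κ.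
  module Threshold (m h e : ℕ) (2≤m : 2 ℕ.≤ m) (1≤h : 1 ℕ.≤ h) (m≡ : suc m ≡ h ℕ.+ e ℕ.+ h)
    (lower : e ℕ.* e ℕ.≤ 2 ℕ.* h ℕ.* h ℕ.+ e) (upper : 2 ℕ.* h ℕ.* h ℕ.≤ e ℕ.* e ℕ.+ 3 ℕ.* e ℕ.+ 4 ℕ.* h)
    (κ : ℕ) (1≤κ : 1 ℕ.≤ κ) where

    open Optimum m h e 1≤h m≡ lower upper using (ℓ; Y)

    F : ℕ
    F = numerator m ℓ

    1≤ℓ : 1 ℕ.≤ ℓ
    1≤ℓ = ℕₚ.≤-trans 1≤h (ℕₚ.m≤m+n h e)

    2F+Y≡ : 2 ℕ.* F ℕ.+ Y ≡ ℓ ℕ.* m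
    2F+Y≡ = by-cases h m 1≤h m≡
      where
      by-cases : ∀ h m → 1 ℕ.≤ h → suc m ≡ h ℕ.+ e ℕ.+ h → 2 ℕ.* numerator m (h ℕ.+ e) ℕ.+ h ℕ.* suc e ≡ (h ℕ.+ e) ℕ.* m
      by-cases (suc j) m _ eq with refl ← trans (ℕₚ.suc-injective eq) (ℕₚ.+-suc (j ℕ.+ e) j) =
        trans (cong (ℕ._+ suc j ℕ.* suc e) (2*numerator (j ℕ.+ e) j)) (eq′ j e)
        where
        eq′ : ∀ j e → suc (j ℕ.+ e) ℕ.* (j ℕ.+ e) ℕ.+ suc j ℕ.* j ℕ.+ suc j ℕ.* suc e ≡ (suc j ℕ.+ e) ℕ.* (suc (j ℕ.+ e) ℕ.+ j)
        eq′ = ℕSolver.solve-∀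

    1≤F : 1 ℕ.≤ F
    1≤F = by-cases h e m 1≤h m≡ 2≤m
      where
      by-cases : ∀ h e m → 1 ℕ.≤ h → suc m ≡ h ℕ.+ e ℕ.+ h → 2 ℕ.≤ m → 1 ℕ.≤ numerator m (h ℕ.+ e)
      by-cases (suc j) e m _ eq 2≤m with refl ← trans (ℕₚ.suc-injective eq) (ℕₚ.+-suc (j ℕ.+ e) j) =
        ℕₚ.n≢0⇒n>0 λ F≡0 → nonzero j e 2≤m (trans (sym (2*numerator (j ℕ.+ e) j)) (cong (2 ℕ.*_) F≡0))
        where
        nonzero : ∀ j e → 2 ℕ.≤ suc (j ℕ.+ e) ℕ.+ j → suc (j ℕ.+ e) ℕ.* (j ℕ.+ e) ℕ.+ suc j ℕ.* j ≢ 0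
        nonzero zero    zero    (s≤s ())
        nonzero zero    (suc e) _ ()
        nonzero (suc j) e       _ ()

    -- `D` makes the loss caused by the hubs, 2E · ℓ · 2m · `hub n`, equal to `hub n` · D, hence at
    -- most n.
    d E D : ℕ
    d = F ℕ.* κ
    E = ℓ ℕ.* κ ℕ.+ F
    D = 4 ℕ.* E ℕ.* ℓ ℕ.* m

    1≤d : 1 ℕ.≤ d
    1≤d = ℕₚ.*-mono-≤ 1≤F 1≤κ

    1≤E : 1 ℕ.≤ E
    1≤E = ℕₚ.≤-trans 1≤F (ℕₚ.m≤n+m F (ℓ ℕ.* κ))

    2≤D : 2 ℕ.≤ D
    2≤D = ℕₚ.*-mono-≤ {1} {4 ℕ.* E ℕ.* ℓ} {2} {m} (ℕₚ.*-mono-≤ {1} {4 ℕ.* E} {1} {ℓ} (ℕₚ.*-mono-≤ {1} {4} {1} {E} (s≤s z≤n) 1≤E) 1≤ℓ) 2≤m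

    open HubGraph D 2≤D public using (G; hub; hub≤; min-degree-bound; D≢0)

    -- The summands take care of the incomplete case of the hub graph, of 2m < n, and of the
    -- constants in `decay`.
    N₀ : ℕ
    N₀ = 4 ℕ.* D ℕ.+ (m ℕ.+ m ℕ.+ 1) ℕ.+ 2 ℕ.^ (2 ℕ.* ℓ ℕ.* d ℕ.* suc m)

    -- E F = ℓd + F² exceeds ℓd by at least 1, and this is the slack 1/κ in the exponent. After
    -- doubling it is worth 2n: one n compensates the hubs, the other one remains as the gap.
    forced-large : ∀ n k → hub n ℕ.* D ℕ.≤ n →
      ℓ ℕ.* (m ℕ.* n) ℕ.≤ Y ℕ.* n ℕ.+ 2 ℕ.* (ℓ ℕ.* (k ℕ.+ 2 ℕ.* (m ℕ.* hub n))) →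
      2 ℕ.* ℓ ℕ.* d ℕ.* n ℕ.+ n ℕ.≤ 2 ℕ.* ℓ ℕ.* E ℕ.* k
    forced-large n k hub≤n/D constraint = ℕₚ.+-cancelʳ-≤ n _ _ (begin
      2 ℕ.* ℓ ℕ.* d ℕ.* n ℕ.+ n ℕ.+ n
        ≡⟨ eq₁ ℓ d n ⟩
      2 ℕ.* (ℓ ℕ.* d ℕ.* n ℕ.+ 1 ℕ.* n)
        ≤⟨ ℕₚ.*-monoʳ-≤ 2 (ℕₚ.+-monoʳ-≤ (ℓ ℕ.* d ℕ.* n) (ℕₚ.*-monoˡ-≤ n (ℕₚ.*-mono-≤ 1≤F 1≤F))) ⟩
      2 ℕ.* (ℓ ℕ.* d ℕ.* n ℕ.+ F ℕ.* F ℕ.* n)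
        ≡⟨ eq₂ ℓ F κ n ⟩
      2 ℕ.* E ℕ.* (F ℕ.* n)
        ≤⟨ ℕₚ.*-monoʳ-≤ (2 ℕ.* E) Fn≤ ⟩
      2 ℕ.* E ℕ.* (ℓ ℕ.* (k ℕ.+ 2 ℕ.* (m ℕ.* hub n)))
        ≡⟨ eq₃ ℓ E m k (hub n) ⟩
      2 ℕ.* ℓ ℕ.* E ℕ.* k ℕ.+ hub n ℕ.* D
        ≤⟨ ℕₚ.+-monoʳ-≤ (2 ℕ.* ℓ ℕ.* E ℕ.* k) hub≤n/D ⟩
      2 ℕ.* ℓ ℕ.* E ℕ.* k ℕ.+ n ∎)
      where
      open ℕₚ.≤-Reasoning
      eq₁ : ∀ l d n → 2 ℕ.* l ℕ.* d ℕ.* n ℕ.+ n ℕ.+ n ≡ 2 ℕ.* (l ℕ.* d ℕ.* n ℕ.+ 1 ℕ.* n)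
      eq₁ = ℕSolver.solve-∀
      eq₂ : ∀ l F κ n → 2 ℕ.* (l ℕ.* (F ℕ.* κ) ℕ.* n ℕ.+ F ℕ.* F ℕ.* n) ≡ 2 ℕ.* (l ℕ.* κ ℕ.+ F) ℕ.* (F ℕ.* n)
      eq₂ = ℕSolver.solve-∀
      eq₃ : ∀ l E m k s → 2 ℕ.* E ℕ.* (l ℕ.* (k ℕ.+ 2 ℕ.* (m ℕ.* s))) ≡ 2 ℕ.* l ℕ.* E ℕ.* k ℕ.+ s ℕ.* (4 ℕ.* E ℕ.* l ℕ.* m)
      eq₃ = ℕSolver.solve-∀
      eq₄ : ∀ F Y n → (2 ℕ.* F ℕ.+ Y) ℕ.* n ≡ Y ℕ.* n ℕ.+ 2 ℕ.* (F ℕ.* n)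
      eq₄ = ℕSolver.solve-∀
      Fn≤ : F ℕ.* n ℕ.≤ ℓ ℕ.* (k ℕ.+ 2 ℕ.* (m ℕ.* hub n))
      Fn≤ = ℕₚ.*-cancelˡ-≤ 2 (ℕₚ.+-cancelˡ-≤ (Y ℕ.* n) _ _ (subst (ℕ._≤ Y ℕ.* n ℕ.+ 2 ℕ.* (ℓ ℕ.* (k ℕ.+ 2 ℕ.* (m ℕ.* hub n))))
        (trans (sym (ℕₚ.*-assoc ℓ m n)) (trans (cong (ℕ._* n) (sym 2F+Y≡)) (eq₄ F Y n))) constraint))

    event : ∀ n → List (List (Fin n × Fin n))
    event n = filter (λ E → 𝒞? m n (G n ∪ edgeGraph E)) (subsets (pairs n))

    module _ (n : ℕ) (N₀≤n : N₀ ℕ.≤ n) where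

      4D≤n : 4 ℕ.* D ℕ.≤ n
      4D≤n = ℕₚ.≤-trans (ℕₚ.m≤m+n (4 ℕ.* D) (m ℕ.+ m ℕ.+ 1)) (ℕₚ.≤-trans (ℕₚ.m≤m+n _ _) N₀≤n)

      2m<n : m ℕ.+ m ℕ.< n
      2m<n = ℕₚ.≤-trans (ℕₚ.≤-reflexive (ℕₚ.+-comm 1 (m ℕ.+ m))) (ℕₚ.≤-trans (ℕₚ.m≤n+m (m ℕ.+ m ℕ.+ 1) (4 ℕ.* D)) (ℕₚ.≤-trans (ℕₚ.m≤m+n _ _) N₀≤n))

      large : 2 ℕ.^ (2 ℕ.* ℓ ℕ.* d ℕ.* suc m) ℕ.≤ n
      large = ℕₚ.≤-trans (ℕₚ.m≤n+m _ _) N₀≤n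

      1≤n : 1 ℕ.≤ n
      1≤n = ℕₚ.≤-trans (s≤s z≤n) 2m<n

      instance
        n≢0 : NonZero n
        n≢0 = ℕ.>-nonZero 1≤n

      m+2≤n : m ℕ.+ 2 ℕ.≤ n
      m+2≤n = ℕₚ.≤-trans (ℕₚ.+-monoʳ-≤ m 2≤m) (ℕₚ.<⇒≤ 2m<n)

      -- Each of the nⁿ sequences contributes at most (2n)⁻ⁿ, so the probability is at most 2⁻ⁿ,
      -- which is at most 1/n.
      rare : ∀ q → 0ℚ ≤ q → q ≤ 1ℚ → q ^ d * ι n ^ E ≤ ι 2 ^ d → ι n * polynomial (length (pairs n)) (event n) q ≤ 1ℚ
      rare q 0≤q q≤1 q^d≤ = begin
        ι n * P                              ≤⟨ *-monoʳ-≤-nonNeg P {{nonNegative 0≤P}} (ι-mono (n≤2^n n)) ⟩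
        ι (2 ℕ.^ n) * P                      ≤⟨ *-monoˡ-≤-nonNeg (ι (2 ℕ.^ n)) {{nonNegative (0≤ι (2 ℕ.^ n))}} P≤ ⟩
        ι (2 ℕ.^ n) * (ι (n ℕ.^ n) * B)      ≡⟨ *-assoc (ι (2 ℕ.^ n)) (ι (n ℕ.^ n)) B ⟨
        ι (2 ℕ.^ n) * ι (n ℕ.^ n) * B        ≡⟨ cong (_* B) (trans (sym (ι-* (2 ℕ.^ n) (n ℕ.^ n))) (cong ι (sym (R.^-distribʳ-* n 2 n)))) ⟩
        ι K * B                              ≡⟨ trans (*-comm (ι K) B) (/-cancel 1 K) ⟩
        1ℚ                                   ∎
        where
        open ≤-Reasoning
        P = polynomial (length (pairs n)) (event n) q
        K = (2 ℕ.* n) ℕ.^ n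
        instance
          K≢0 : NonZero K
          K≢0 = ℕ.>-nonZero (ℕₚ.m^n>0 (2 ℕ.* n) {{ℕ.>-nonZero (ℕₚ.*-mono-≤ {1} {2} (s≤s z≤n) 1≤n)}} n)
        B = ℤ.+ 1 / K
        open Binomial {Fin n × Fin n} q 0≤q q≤1 using (0≤mass)
        0≤P : 0ℚ ≤ P
        0≤P = 0≤mass (length (pairs n)) (λ E → 𝒞? m n (G n ∪ edgeGraph E)) (subsets (pairs n))
        small : ∀ k → k ℕ.≤ m ℕ.* n → ℓ ℕ.* (m ℕ.* n) ℕ.≤ Y ℕ.* n ℕ.+ 2 ℕ.* (ℓ ℕ.* (k ℕ.+ 2 ℕ.* (m ℕ.* hub n))) → q ^ k ≤ B
        small k k≤ constraint = *-cancelʳ-≤-pos (ι K) {{positive (ι-pos (ℕ.>-nonZero⁻¹ K))}} (begin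
          q ^ k * ι K              ≡⟨ cong (q ^ k *_) (ι-^ (2 ℕ.* n) n) ⟩
          q ^ k * ι (2 ℕ.* n) ^ n  ≤⟨ decay ⟩
          1ℚ                       ≡⟨ /-cancel 1 K ⟨
          B * ι K                  ∎)
          where open Decay q 0≤q n d E k ℓ m 1≤n 1≤ℓ 1≤d k≤ q^d≤ (forced-large n k (hub≤ n 4D≤n) constraint) large
        P≤ : P ≤ ι (n ℕ.^ n) * B
        P≤ = PowerProbability.probability-bound m h e (ℕₚ.<⇒≤ 2≤m) 1≤h m≡ lower upper D 2≤D n 2m<n q 0≤q q≤1 (0≤/ 1 K) small

    minimum-degree : ∀ n → m ℕ.+ 2 ℕ.≤ n →
      (R.fromℚ ½ R.+ R.fromℚ ((ℤ.+ 1 / (4 ℕ.* D)) {{ℕₚ.m*n≢0 4 D}})) R.* R.fromℕ n R.≤ R.fromℕ (R.δ (G n))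
    minimum-degree n m+2≤n ε 0<ε = 0 , λ _ _ → begin
      (½ + η) * (ℤ.+ n / 1)      ≡⟨ cong ((½ + η) *_) (ι≡/1 n) ⟨
      (½ + η) * ι n              ≤⟨ *-cancelʳ-≤-pos (ι K) {{positive (ι-pos (ℕ.>-nonZero⁻¹ K))}} scaled ⟩
      ι (R.δ (G n))              ≡⟨ trans (ι≡/1 (R.δ (G n))) (sym (+-identityʳ _)) ⟩
      ℤ.+ R.δ (G n) / 1 + 0ℚ     ≤⟨ +-monoʳ-≤ (ℤ.+ R.δ (G n) / 1) (<⇒≤ 0<ε) ⟩
      ℤ.+ R.δ (G n) / 1 + ε      ∎
      where
      open ≤-Reasoning
      K = 4 ℕ.* D
      instance
        K≢0 : NonZero K
        K≢0 = ℕₚ.m*n≢0 4 D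
      η = ℤ.+ 1 / K
      open ℚSolver.+-*-Solver
      eq : ∀ x y z → (½ + x) * y * z ≡ (½ * z + x * z) * y
      eq = solve 3 (λ x y z → (con ½ :+ x) :* y :* z := (con ½ :* z :+ x :* z) :* y) refl
      half : ½ * ι K ≡ ι (2 ℕ.* D)
      half = trans (cong (½ *_) (trans (cong ι (ℕₚ.*-assoc 2 2 D)) (ι-* 2 (2 ℕ.* D)))) (trans (sym (*-assoc ½ (ι 2) (ι (2 ℕ.* D)))) (*-identityˡ (ι (2 ℕ.* D))))
      scaled : (½ + η) * ι n * ι K ≤ ι (R.δ (G n)) * ι K
      scaled = begin
        (½ + η) * ι n * ι K                ≡⟨ eq η (ι n) (ι K) ⟩
        (½ * ι K + η * ι K) * ι n          ≡⟨ cong (_* ι n) (cong₂ _+_ half (/-cancel 1 K)) ⟩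
        (ι (2 ℕ.* D) + ι 1) * ι n          ≡⟨ cong (_* ι n) (ι-+ (2 ℕ.* D) 1) ⟨
        ι (2 ℕ.* D ℕ.+ 1) * ι n            ≡⟨ ι-* (2 ℕ.* D ℕ.+ 1) n ⟨
        ι ((2 ℕ.* D ℕ.+ 1) ℕ.* n)          ≤⟨ ι-mono (min-degree-bound n (ℕₚ.≤-trans (ℕₚ.+-monoˡ-≤ 2 2≤m) m+2≤n)) ⟩
        ι (4 ℕ.* D ℕ.* R.δ (G n))          ≡⟨ trans (cong ι (ℕₚ.*-comm K (R.δ (G n)))) (ι-* (R.δ (G n)) K) ⟩
        ι (R.δ (G n)) * ι K                ∎

    module _ (s : ℝ) (I₀ : ℕ) (exponent : ∀ i → I₀ ℕ.≤ i → ι E ≤ (- seq s i) * ι d) where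

      module _ (n : ℕ) (N₀≤n : N₀ ℕ.≤ n) (p : ℝ) (p≤ : p R.≤ R._^ᵣ_ n {{n≢0 n N₀≤n}} s) where

        clamped-rare : ∃ λ I → ∀ i → I ℕ.≤ i → ι n * polynomial (length (pairs n)) (event n) (clamp (seq p i)) ≤ 1ℚ
        clamped-rare = I₀ ℕ.⊔ I₁ , λ i ≤i →
          rare n N₀≤n (clamp (seq p i)) (0≤clamp (seq p i)) (clamp≤1 (seq p i))
            (double-root d 1≤d (0≤clamp (seq p i)) 0≤η (1/≤1 (n ℕ.^ E)) 0≤B
              (clamp≤ (+-mono-≤ (0≤/ (R.rootNum n (seq s i) (suc i)) (suc i)) 0≤η) (proj₂ eventually i (ℕₚ.≤-trans (ℕₚ.m≤n⊔m I₀ I₁) ≤i)))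
              (root-bound n s i E d 1≤E (exponent i (ℕₚ.≤-trans (ℕₚ.m≤m⊔n I₀ I₁) ≤i)))
              (≤-reflexive (trans (cong (η *_) (sym (ι-^ n E))) (/-cancel 1 (n ℕ.^ E)))))
          where
          instance
            _ = n≢0 n N₀≤n
            n^E≢0 : NonZero (n ℕ.^ E)
            n^E≢0 = ℕₚ.m^n≢0 n E
          -- The tolerance in p ≤ n^s is chosen as n^(-E), small enough to meet the same estimate as
          -- the power itself in `double-root`.
          η = ℤ.+ 1 / (n ℕ.^ E)
          eventually : ∃ λ I → ∀ i → I ℕ.≤ i → seq p i ≤ seq (n R.^ᵣ s) i + η
          eventually = p≤ η (positive⁻¹ η {{normalize-pos 1 (n ℕ.^ E)}})
          I₁ = proj₁ eventually
          0≤η : 0ℚ ≤ η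
          0≤η = 0≤/ 1 (n ℕ.^ E)
          0≤B : 0ℚ ≤ ι n ^ E
          0≤B = subst (0ℚ ≤_) (ι-^ n E) (0≤ι (n ℕ.^ E))

      probability⟶0 : (p : ℕ → ℝ) →
        (∀ n .{{_ : NonZero n}} → m ℕ.+ 2 ℕ.≤ n → R.0ℝ R.≤ p n × p n R.≤ R.1ℝ × p n R.≤ n R.^ᵣ s) →
        (λ n → R.ℙ[G n , p n ∈ (λ H → 𝒞? m n (G n ∪ H)) ]) R.⟶ R.0ℝ
      probability⟶0 p p-bounds = ⟶0 (λ n → polynomialℝ (length (pairs n)) (event n) (p n)) λ δ 0<δ →
        let N₁ , 1≤N₁δ = archimedean (½ * δ) (R.half-pos 0<δ)
        in N₀ ℕ.⊔ N₁ , λ n ≤n → at δ 0<δ n (ℕₚ.≤-trans (ℕₚ.m≤m⊔n N₀ N₁) ≤n)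
             (≤-trans 1≤N₁δ (*-monoʳ-≤-nonNeg (½ * δ) {{nonNegative (<⇒≤ (R.half-pos 0<δ))}} (ι-mono (ℕₚ.≤-trans (ℕₚ.m≤n⊔m N₀ N₁) ≤n))))
        where
        at : ∀ δ → 0ℚ < δ → ∀ n → N₀ ℕ.≤ n → 1ℚ ≤ ι n * (½ * δ) → ∃ λ I → ∀ i → I ℕ.≤ i →
          0ℚ ≤ seq (polynomialℝ (length (pairs n)) (event n) (p n)) i + δ × seq (polynomialℝ (length (pairs n)) (event n) (p n)) i ≤ δ
        at δ 0<δ n N₀≤n 1≤nδ =
          polynomialℝ-small (length (pairs n)) (event n) (p n) (proj₁ bounds) (proj₁ (proj₂ bounds)) δ 0<δ (1≤n n N₀≤n) 1≤nδ
            (λ q 0≤q q≤1 → Binomial.0≤mass q 0≤q q≤1 (length (pairs n)) (λ E → 𝒞? m n (G n ∪ edgeGraph E)) (subsets (pairs n)))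
            (clamped-rare n N₀≤n (p n) (proj₂ (proj₂ bounds)))
          where bounds = p-bounds n {{n≢0 n N₀≤n}} (m+2≤n n N₀≤n)

    probability⟶0-at : ∀ v → v * ι F ≡ ι ℓ → ∀ μ ε → 1ℚ ≤ ι κ * ε → (∃ λ I → ∀ i → I ℕ.≤ i → 0ℚ + ε ≤ seq μ i) →
      (p : ℕ → ℝ) →
      (∀ n .{{_ : NonZero n}} → m ℕ.+ 2 ℕ.≤ n → R.0ℝ R.≤ p n × p n R.≤ R.1ℝ × p n R.≤ n R.^ᵣ (R.- R.fromℚ v R.- μ)) →
      (λ n → R.ℙ[G n , p n ∈ (λ H → 𝒞? m n (G n ∪ H)) ]) R.⟶ R.0ℝ
    probability⟶0-at v vF μ ε 1≤κε (I₀ , ε≤μ) = probability⟶0 (R.- R.fromℚ v R.- μ) I₀ λ i I₀≤i →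
      exponent-bound {v} {seq μ i} F ℓ κ {ε} vF 1≤κε (ε≤μ i I₀≤i)

  reciprocal-f : ∀ m ℓ .{{_ : NonZero ℓ}} .{{f≢0 : NonZeroℚ (R.f m ℓ)}} → (1/ R.f m ℓ) * ι (numerator m ℓ) ≡ ι ℓ
  reciprocal-f m ℓ = begin
    v * ι (numerator m ℓ)       ≡⟨ cong (v *_) (/-cancel (numerator m ℓ) ℓ) ⟨
    v * (R.f m ℓ * ι ℓ)         ≡⟨ *-assoc v (R.f m ℓ) (ι ℓ) ⟨
    v * R.f m ℓ * ι ℓ           ≡⟨ cong (_* ι ℓ) (*-inverseˡ (R.f m ℓ)) ⟩
    1ℚ * ι ℓ                    ≡⟨ *-identityˡ (ι ℓ) ⟩
    ι ℓ                         ∎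
    where
    open ≡-Reasoning
    v = 1/ R.f m ℓ

-- Assembly

open Embeddings using (ι)
open RealPolynomials using (archimedean)
open Asymptotics
open HalfIntegers
import Data.Integer.Base as ℤ
import Data.Nat.Properties as ℕₚ
open import Data.Product.Base using (_,_; proj₁; proj₂)
import Data.Rational.Base as ℚ
import Data.Rational.Properties as ℚₚ
open import Relation.Binary.PropositionalEquality
open import Relation.Nullary.Negation using (contradiction)
open import Data.Nat.Base as ℕ using (ℕ; NonZero; zero; suc; z≤n; s≤s)
open import Data.Product.Base using (Σ-syntax; _×_)
open import Data.Rational.Base using (½; 1/_)
open import Defs

multiplier-positive : ∀ κ {ε} → ℚ.1ℚ ℚ.≤ ι κ ℚ.* ε → 1 ℕ.≤ κ
multiplier-positive zero {ε} 1≤0 = contradiction (ℚₚ.<-≤-trans (ℚ.*<* (ℤ.+<+ (s≤s z≤n))) (subst (ℚ.1ℚ ℚ.≤_) (ℚₚ.*-zeroˡ ε) 1≤0)) (ℚₚ.<-irrefl refl)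
multiplier-positive (suc κ) _ = s≤s z≤n

Conclusion : ∀ m → 2 ℕ.≤ m → ∀ ℓ .{{_ : NonZero ℓ}} → ℝ → Set₁
Conclusion m 2≤m ℓ μ =
  Σ[ ε ∈ ℝ ] 0ℝ < ε × (Σ[ G ∈ (∀ n → Graph n) ]
    (∀ n → m ℕ.+ 2 ℕ.≤ n → (fromℚ ½ + ε) * fromℕ n ≤ fromℕ (δ (G n))) ×
    (∀ (p : ℕ → ℝ) →
      (∀ n .{{_ : NonZero n}} → m ℕ.+ 2 ℕ.≤ n →
        0ℝ ≤ p n × p n ≤ 1ℝ × p n ≤ n ^ᵣ (- fromℚ ((1/ f m ℓ) {{f-nonZero 2≤m ℓ}}) - μ)) →
      (λ n → ℙ[G n , p n ∈ (λ H → 𝒞? m n (G n ∪ H)) ]) ⟶ 0ℝ))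

module _ (m : ℕ) (2≤m : 2 ℕ.≤ m) (h e : ℕ) (1≤h : 1 ℕ.≤ h) (m≡ : suc m ≡ h ℕ.+ e ℕ.+ h)
  (lower : e ℕ.* e ℕ.≤ 2 ℕ.* h ℕ.* h ℕ.+ e) (upper : 2 ℕ.* h ℕ.* h ℕ.≤ e ℕ.* e ℕ.+ 3 ℕ.* e ℕ.+ 4 ℕ.* h)
  .{{_ : NonZero (h ℕ.+ e)}} (μ : ℝ) (0<μ : 0ℝ < μ) where

  private
    ε₀ = proj₁ 0<μ
    κ : ℕ
    κ = proj₁ (archimedean ε₀ (proj₁ (proj₂ 0<μ)))
    1≤κε₀ : ℚ.1ℚ ℚ.≤ ι κ ℚ.* ε₀
    1≤κε₀ = proj₂ (archimedean ε₀ (proj₁ (proj₂ 0<μ)))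

  open Threshold m h e 2≤m 1≤h m≡ lower upper κ (multiplier-positive κ 1≤κε₀)

  private
    instance
      4D≢0 : NonZero (4 ℕ.* D)
      4D≢0 = ℕₚ.m*n≢0 4 D
    ε : ℚ.ℚ
    ε = ℤ.+ 1 ℚ./ (4 ℕ.* D)
    0<ε : ℚ.0ℚ ℚ.< ε
    0<ε = ℚₚ.positive⁻¹ ε {{ℚₚ.normalize-pos 1 (4 ℕ.* D)}}

  conclusion : Conclusion m 2≤m (h ℕ.+ e) μ
  conclusion =
    -- The degree ratio (2D + 1)/(4D) is ½ + 1/(4D), which gives ε = 1/(4D).
    fromℚ ε , (ε , 0<ε , 0 , λ _ _ → ℚₚ.≤-reflexive (ℚₚ.+-identityˡ ε)) , G , minimum-degree ,
    probability⟶0-at ((1/ f m (h ℕ.+ e)) {{f-nonZero 2≤m (h ℕ.+ e)}}) reciprocal μ ε₀ 1≤κε₀ (proj₂ (proj₂ 0<μ))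
    where
    reciprocal : ((1/ f m (h ℕ.+ e)) {{f-nonZero 2≤m (h ℕ.+ e)}}) ℚ.* ι F ≡ ι (h ℕ.+ e)
    reciprocal = reciprocal-f m (h ℕ.+ e) {{f≢0 = f-nonZero 2≤m (h ℕ.+ e)}}

parameters⇒conclusion : ∀ m (2≤m : 2 ℕ.≤ m) ℓ .{{_ : NonZero ℓ}} → Parameters m ℓ → ∀ μ → 0ℝ < μ → Conclusion m 2≤m ℓ μ
parameters⇒conclusion m 2≤m _ record { h = h ; e = e ; 1≤h = 1≤h ; ℓ≡ = refl ; m≡ = m≡ ; lower = lower ; upper = upper } =
  conclusion m 2≤m h e 1≤h m≡ lower upper

theorem1p1 : ∀ (m : ℕ) (2≤m : 2 ℕ.≤ m) (ℓ : ℕ) .{{_ : NonZero ℓ}} → Isℓₘ m ℓ →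
    ∀ (μ : ℝ) → 0ℝ < μ →
    Σ[ ε ∈ ℝ ] 0ℝ < ε × (Σ[ G ∈ (∀ n → Graph n) ]
      (∀ n → m ℕ.+ 2 ℕ.≤ n → (fromℚ ½ + ε) * fromℕ n ≤ fromℕ (δ (G n))) ×
      (∀ (p : ℕ → ℝ) →
        (∀ n .{{_ : NonZero n}} → m ℕ.+ 2 ℕ.≤ n →
          0ℝ ≤ p n × p n ≤ 1ℝ × p n ≤ n ^ᵣ (- fromℚ ((1/ f m ℓ) {{f-nonZero 2≤m ℓ}}) - μ)) →
        (λ n → ℙ[G n , p n ∈ (λ H → 𝒞? m n (G n ∪ H)) ]) ⟶ 0ℝ))
theorem1p1 m 2≤m ℓ isℓ = parameters⇒conclusion m 2≤m ℓ (optimal⇒parameters (ℕ.>-nonZero⁻¹ ℓ) (isℓₘ⇒optimal m ℓ (ℕₚ.<⇒≤ 2≤m) isℓ))
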